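{- There exists an absolute constant $\gamma_4>0$ such that for every primitive coherent configuration $\mathfrak{X}$ of rank $4$ on $n$ vertices, either $\mathrm{motion}(\mathfrak{X})\geq \gamma_4 n$, or $\mathfrak{X}$ is a Johnson scheme, or $\mathfrak{X}$ is a Hamming scheme.
   Context: A configuration of rank $r$ on a finite set $V$ is a map $c:V\times V\to\{0,1,\dots,r-1\}$ (all $r$ colors occurring) such that (i) $c(v,v)\neq c(u,w)$ for all $v,u,w\in V$ with $u\neq w$; (ii) for every color $i$ there is a color $i^*$ such that $c(u,v)=i$ implies $c(v,u)=i^*$. It is coherent if for all colors $i,j,t$ there is an integer $p^t_{i,j}$ such that whenever $c(u,v)=t$ there are exactly $p^t_{i,j}$ vertices $w$ with $c(u,w)=i$ and $c(w,v)=j$. It is homogeneous if $c(u,u)$ is the same color for all $u\in V$. A homogeneous coherent configuration is primitive if for every color $i$ other than the diagonal color, the digraph $X_i=(V,\{(u,v):c(u,v)=i\})$ is strongly connected. An automorphism of $\mathfrak{X}=(V,c)$ is a permutation $\sigma$ of $V$ with $c(\sigma(u),\sigma(v))=c(u,v)$ for all $u,v$. The minimal degree of a permutation group $G$ on $\Omega$ is the minimum number of points moved by a non-identity element of $G$ (defined to be $|\Omega|$ if $G$ is trivial); $\mathrm{motion}(\mathfrak{X})$ is the minimal degree of the automorphism group of $\mathfrak{X}$. The Johnson scheme $\mathfrak{J}(m,d)$ ($d\ge2$, $m\ge 2d$) has as vertices the $d$-subsets of an $m$-set, with $c(U_1,U_2)=|U_1\setminus U_2|$. The Hamming scheme $\mathfrak{H}(d,m)$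 ($m\ge2$) has vertex set $\Omega^d$ with $|\Omega|=m$, and $c(x,y)$ equal to the number of coordinates in which $x,y$ differ. "$\mathfrak{X}$ is a Johnson (resp. Hamming) scheme" means $\mathfrak{X}$ is isomorphic, up to a bijection of vertex sets and renaming of colors, to some $\mathfrak{J}(m,d)$ (resp. $\mathfrak{H}(d,m)$). -}

module Defs where

open import Data.Nat using (ℕ; zero; suc; _+_; _*_; _≤_)
open import Data.Bool using (Bool; true; false; not; _∧_; if_then_else_)
open import Data.Fin using (Fin; _≟_)
import Data.Fin as F
open import Data.Fin.Subset using (Subset; ∣_∣; _∩_; ∁)
open import Data.Fin.Permutation using (Permutation′; _⟨$⟩ʳ_)
open import Data.Vec using (Vec; []; _∷_)
open import Data.Product using (Σ; ∃; ∃-syntax; _×_; _,_)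
open import Data.Sum using (_⊎_)
open import Relation.Nullary using (¬_; Dec; yes; no)
open import Relation.Nullary.Decidable using (⌊_⌋)
open import Relation.Binary.PropositionalEquality using (_≡_)
open import Relation.Binary.Construct.Closure.ReflexiveTransitive using (Star)
open import Function.Bundles using (_⤖_; Bijection)
open import Function.Definitions using (Injective)

count : ∀ {n} → (Fin n → Bool) → ℕ
count {zero} P = 0
count {suc n} P = (if P F.zero then 1 else 0) + count (λ i → P (F.suc i))

record Configuration (n r : ℕ) : Set where
  field
    c        : Fin n → Fin n → Fin r
    surj     : ∀ (i : Fin r) → ∃[ u ] ∃[ v ] c u v ≡ i
    diagSep  : ∀ v u w → ¬ (u ≡ w) → ¬ (c v v ≡ c u w)
    converse : ∀ (i : Fin r) → ∃[ i* ] (∀ u v → c u v ≡ i → c v u ≡ i*)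

module _ {n r : ℕ} (X : Configuration n r) where
  open Configuration X

  IsCoherent : Set
  IsCoherent = Σ (Fin r → Fin r → Fin r → ℕ) λ p → (∀ (i j : Fin r) (u v : Fin n) →
    count (λ w → ⌊ c u w ≟ i ⌋ ∧ ⌊ c w v ≟ j ⌋) ≡ p i j (c u v))

  IsHomogeneous : Set
  IsHomogeneous = ∀ u v → c u u ≡ c v v

  StronglyConnected : Fin r → Set
  StronglyConnected i = ∀ u v → Star (λ x y → c x y ≡ i) u v

  IsPrimitive : Set
  IsPrimitive = IsCoherent × IsHomogeneous ×
    (∀ (i : Fin r) → (∀ u → ¬ (c u u ≡ i)) → StronglyConnected i)

  IsAutomorphism : Permutation′ n → Set
  IsAutomorphism σ = ∀ u v → c (σ ⟨$⟩ʳ u) (σ ⟨$⟩ʳ v) ≡ c u v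

  moved : Permutation′ n → ℕ
  moved σ = count (λ u → not ⌊ σ ⟨$⟩ʳ u ≟ u ⌋)

  NonIdentity : Permutation′ n → Set
  NonIdentity σ = ∃[ u ] ¬ (σ ⟨$⟩ʳ u ≡ u)

  IsMotion : ℕ → Set
  IsMotion m =
    ((∀ σ → IsAutomorphism σ → ¬ NonIdentity σ) × m ≡ n)
    ⊎ ((∃[ σ ] (IsAutomorphism σ × NonIdentity σ × moved σ ≡ m))
       × (∀ σ → IsAutomorphism σ → NonIdentity σ → m ≤ moved σ))

JVertex : ℕ → ℕ → Set
JVertex m d = Σ (Subset m) (λ U → ∣ U ∣ ≡ d)

johnsonColour : ∀ {m d} → JVertex m d → JVertex m d → ℕ
johnsonColour (U₁ , _) (U₂ , _) = ∣ U₁ ∩ ∁ U₂ ∣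

hammingDist : ∀ {d m} → Vec (Fin m) d → Vec (Fin m) d → ℕ
hammingDist [] [] = 0
hammingDist (x ∷ xs) (y ∷ ys) = (if ⌊ x ≟ y ⌋ then 0 else 1) + hammingDist xs ys

-- isomorphism up to renaming of colours: a vertex bijection f and an
-- injective colour renaming g with colour(f u, f v) = g (c u v)
IsJohnson : ∀ {n r} → Configuration n r → Set
IsJohnson {n} {r} X = ∃[ m ] ∃[ d ] (2 ≤ d × 2 * d ≤ m ×
  Σ (Fin n ⤖ JVertex m d) λ f → Σ (Fin r → ℕ) λ g → (Injective _≡_ _≡_ g ×
    (∀ u v → johnsonColour (Bijection.to f u) (Bijection.to f v)
               ≡ g (Configuration.c X u v))))

IsHamming : ∀ {n r} → Configuration n r → Set
IsHamming {n} {r} X = ∃[ d ] ∃[ m ] (2 ≤ m ×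
  Σ (Fin n ⤖ Vec (Fin m) d) λ f → Σ (Fin r → ℕ) λ g → (Injective _≡_ _≡_ g ×
    (∀ u v → hammingDist (Bijection.to f u) (Bijection.to f v)
               ≡ g (Configuration.c X u v))))

{-# OPTIONS --safe #-}
-- Suppose a non-identity automorphism f moves only s vertices, N s < n with N huge.  Counting the
-- vertices that distinguish u from f u, and using that every colour is connected with four colours in
-- all, one colour D has valency n - O(s).  Let Γ be the graph of the two other ("light") colours A and
-- B, of valency K = o(n); two vertices of colour D have only o(K) common Γ-neighbours.  A vertex u of
-- the support S has all its fixed neighbours in common with f u, so S has large inner degree, while
-- counting two-step walks in S bounds this degree by the number of common neighbours of light pairs.
--
-- If A and B are converse to each other, the fixed neighbours create too many transitive triangles.
-- If A and B are symmetric of comparable valency, light pairs have about K/2 common neighbours, so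
-- pairs of colour D have at most four; a moved vertex u and a moved neighbour u' with
-- c(u,u') = c(u,f u) = c(u',f u') then contradict the intersection numbers of D.  If A is much sparser
-- than B, light pairs of colour B have about K/2 common neighbours, which is excluded similarly, or
-- about K/3.  In the last case each neighbourhood is essentially a union of three cliques, and these
-- extend to "planes": every vertex lies on three planes, and the colour of a pair is determined by the
-- number of common planes.  The vertices thus form a 3-uniform hypergraph on the planes, in whose links
-- any two disjoint edges are joined by the same number of edges; hence all links are complete (Johnson
-- scheme) or all are complete bipartite (Hamming scheme).
module Submission where

open import Defs
open import Data.Nat
open import Data.Nat.Properties
open import Data.Bool using (Bool; true; false; if_then_else_; T; _∧_; _∨_; not)
open import Data.Bool.Properties using (∧-comm; ∧-idem; ∧-inverseʳ)
open import Data.Fin using (Fin; zero; suc)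
import Data.Fin as F
import Data.Fin.Properties as FP
open import Data.Fin.Permutation using (_⟨$⟩ʳ_)
open import Data.Fin.Subset using (Subset; ∣_∣; _∩_; ∁)
open import Data.Vec using (Vec; []; _∷_; lookup; tabulate; zipWith; replicate)
open import Data.Vec.Properties using (lookup∘tabulate; tabulate∘lookup; tabulate-cong)
open import Data.List using (List; []; _∷_; length)
open import Data.List.Relation.Unary.All using (All; []; _∷_)
open import Data.List.Relation.Unary.AllPairs using (AllPairs; []; _∷_)
open import Data.Product using (_×_; _,_; ∃-syntax; proj₁; proj₂; Σ)
open import Data.Sum using (_⊎_; inj₁; inj₂)
open import Data.Unit using (tt)
open import Data.Empty using (⊥; ⊥-elim)
open import Function using (_∘_)
open import Function.Bundles using (_⤖_; Bijection; mk⤖)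
open import Function.Definitions using (Injective; Surjective)
open import Relation.Nullary using (¬_; yes; no; Dec)
open import Relation.Nullary.Decidable using (⌊_⌋; _×-dec_; ¬?)
open import Relation.Binary.PropositionalEquality
open import Relation.Binary.Construct.Closure.ReflexiveTransitive as Star using (Star; ε; _◅_)

-- Counting

-- Having only four colours is the source of the factor 3 in the estimates: a colour-determined
-- distance with the triangle inequality is, on any pair, at most three times its value on any
-- non-diagonal pair. For the number of neighbours that u has and v lacks, which is nearly K on
-- colour D, this limits light pairs to about 2K/3 common neighbours; two equal steps joining a pair
-- of colour D improve the limit to K/2. The obstacle is that the degree argument can balance
-- exactly. A moved vertex has inner degree at least K minus the largest number of common
-- neighbours, while the walk count bounds some such degree by a weighted mean of these numbers.
-- When the light colours are comparable both sides are about K/2, so estimates alone do not decide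
-- and exact intersection numbers are needed. With 2K/3 for A and K/3 for B they balance too, and
-- this is the shape of the genuine examples, the Johnson and Hamming schemes with d = 3. Margins of
-- parts in a few thousand decide; relative errors of 10^-8 leave room and cost the constant 10^-17.

⟪_⟫ : Bool → ℕ
⟪ b ⟫ = if b then 1 else 0

∑ : ∀ {n} → (Fin n → ℕ) → ℕ
∑ {zero}  f = 0
∑ {suc n} f = f zero + ∑ (f ∘ suc)

# : ∀ {n} → (Fin n → Bool) → ℕ
# P = ∑ (λ i → ⟪ P i ⟫)

count≡# : ∀ {n} (P : Fin n → Bool) → count P ≡ # P
count≡# {zero}  P = refl
count≡# {suc n} P = cong (⟪ P zero ⟫ +_) (count≡# (P ∘ suc))

∑-cong : ∀ {n} {f g : Fin n → ℕ} → (∀ i → f i ≡ g i) → ∑ f ≡ ∑ g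
∑-cong {zero}  e = refl
∑-cong {suc n} e = cong₂ _+_ (e zero) (∑-cong (e ∘ suc))

∑-mono : ∀ {n} {f g : Fin n → ℕ} → (∀ i → f i ≤ g i) → ∑ f ≤ ∑ g
∑-mono {zero}  h = z≤n
∑-mono {suc n} h = +-mono-≤ (h zero) (∑-mono (h ∘ suc))

+-interchange : ∀ a b c d → (a + b) + (c + d) ≡ (a + c) + (b + d)
+-interchange a b c d = trans (+-assoc a b (c + d)) (trans (cong (a +_)
  (trans (sym (+-assoc b c d)) (trans (cong (_+ d) (+-comm b c)) (+-assoc c b d)))) (sym (+-assoc a c (b + d))))

∑-+ : ∀ {n} (f g : Fin n → ℕ) → ∑ (λ i → f i + g i) ≡ ∑ f + ∑ g
∑-+ {zero}  f g = refl
∑-+ {suc n} f g = trans (cong (f zero + g zero +_) (∑-+ (f ∘ suc) (g ∘ suc)))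
  (+-interchange (f zero) (g zero) _ _)

∑-*ˡ : ∀ {n} c (f : Fin n → ℕ) → ∑ (λ i → c * f i) ≡ c * ∑ f
∑-*ˡ {zero}  c f = sym (*-zeroʳ c)
∑-*ˡ {suc n} c f = trans (cong (c * f zero +_) (∑-*ˡ c (f ∘ suc))) (sym (*-distribˡ-+ c (f zero) _))

∑-*ʳ : ∀ {n} c (f : Fin n → ℕ) → ∑ (λ i → f i * c) ≡ ∑ f * c
∑-*ʳ c f = trans (∑-cong (λ i → *-comm (f i) c)) (trans (∑-*ˡ c f) (*-comm c _))

∑-const : ∀ n c → ∑ {n} (λ _ → c) ≡ n * c
∑-const zero    c = refl
∑-const (suc n) c = cong (c +_) (∑-const n c)

∑-zero : ∀ n → ∑ {n} (λ _ → 0) ≡ 0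
∑-zero n = trans (∑-const n 0) (*-zeroʳ n)

∑-swap : ∀ {m n} (f : Fin m → Fin n → ℕ) → ∑ (λ i → ∑ (f i)) ≡ ∑ (λ j → ∑ (λ i → f i j))
∑-swap {zero}  {n} f = sym (∑-zero n)
∑-swap {suc m} {n} f = trans (cong (∑ (f zero) +_) (∑-swap (f ∘ suc)))
  (sym (∑-+ (f zero) (λ j → ∑ (λ i → f (suc i) j))))

-- Averaging: were `f i` larger than `g i` at every selected index, the first sum would exceed the
-- second. Later it selects one moved vertex from an inequality summed over the support.
∑-pick : ∀ {n} (P : Fin n → Bool) (f g : Fin n → ℕ) → ∃[ i ] P i ≡ true →
  ∑ (λ i → ⟪ P i ⟫ * f i) ≤ ∑ (λ i → ⟪ P i ⟫ * g i) → ∃[ i ] (P i ≡ true × f i ≤ g i)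
∑-pick {n} P f g (i₀ , Pi₀) le with FP.any? (λ i → dec i)
  where
  dec : ∀ i → Dec (P i ≡ true × f i ≤ g i)
  dec i with P i | f i ≤? g i
  ... | true  | yes p = yes (refl , p)
  ... | true  | no ¬p = no (¬p ∘ proj₂)
  ... | false | _     = no λ ()
... | yes r = r
... | no ¬r = ⊥-elim (<⇒≱ (strict P f g i₀ Pi₀ (λ i Pi → ≰⇒> (λ le → ¬r (i , Pi , le)))) le)
  where
  weak : ∀ {n} (P : Fin n → Bool) (f g : Fin n → ℕ) → (∀ i → P i ≡ true → g i < f i) →
    ∀ i → ⟪ P i ⟫ * g i ≤ ⟪ P i ⟫ * f i
  weak P f g h i with P i | h i
  ... | true  | h′ = +-monoˡ-≤ 0 (<⇒≤ (h′ refl))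
  ... | false | _  = z≤n
  strict : ∀ {n} (P : Fin n → Bool) (f g : Fin n → ℕ) i → P i ≡ true → (∀ i → P i ≡ true → g i < f i) →
    ∑ (λ i → ⟪ P i ⟫ * g i) < ∑ (λ i → ⟪ P i ⟫ * f i)
  strict P f g zero Pi h rewrite Pi =
    +-mono-<-≤ (+-monoˡ-< 0 (h zero Pi)) (∑-mono (weak (P ∘ suc) (f ∘ suc) (g ∘ suc) (h ∘ suc)))
  strict P f g (suc i) Pi h =
    +-mono-≤-< (weak P f g h zero) (strict (P ∘ suc) (f ∘ suc) (g ∘ suc) i Pi (h ∘ suc))

#-cong : ∀ {n} {P Q : Fin n → Bool} → (∀ i → P i ≡ Q i) → # P ≡ # Q
#-cong e = ∑-cong (λ i → cong ⟪_⟫ (e i))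

⟪⟫-mono : ∀ {a b} → (a ≡ true → b ≡ true) → ⟪ a ⟫ ≤ ⟪ b ⟫
⟪⟫-mono {false} h = z≤n
⟪⟫-mono {true}  h rewrite h refl = ≤-refl

#-mono : ∀ {n} {P Q : Fin n → Bool} → (∀ i → P i ≡ true → Q i ≡ true) → # P ≤ # Q
#-mono h = ∑-mono (λ i → ⟪⟫-mono (h i))

#≡0 : ∀ {n} {P : Fin n → Bool} → (∀ i → P i ≡ false) → # P ≡ 0
#≡0 {n} h = trans (∑-cong (λ i → cong ⟪_⟫ (h i))) (∑-zero n)

⟪∧⟫ : ∀ a b → ⟪ a ∧ b ⟫ ≡ ⟪ a ⟫ * ⟪ b ⟫
⟪∧⟫ true  b = sym (+-identityʳ _)
⟪∧⟫ false b = refl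

⟪⟫≤1 : ∀ b → ⟪ b ⟫ ≤ 1
⟪⟫≤1 true  = ≤-refl
⟪⟫≤1 false = z≤n

#-split : ∀ {n} (P Q : Fin n → Bool) → # P ≡ # (λ i → P i ∧ Q i) + # (λ i → P i ∧ not (Q i))
#-split P Q = trans (∑-cong (λ i → lem (P i) (Q i))) (∑-+ (λ i → ⟪ P i ∧ Q i ⟫) _)
  where
  lem : ∀ a b → ⟪ a ⟫ ≡ ⟪ a ∧ b ⟫ + ⟪ a ∧ not b ⟫
  lem true  true  = refl
  lem true  false = refl
  lem false _     = refl

#-∃ : ∀ {n} (P : Fin n → Bool) → 0 < # P → ∃[ i ] P i ≡ true
#-∃ {suc n} P lt with P zero in eq
... | true  = zero , eq
... | false with #-∃ (P ∘ suc) lt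
...   | i , e = suc i , e

∃-# : ∀ {n} (P : Fin n → Bool) i → P i ≡ true → 0 < # P
∃-# P zero    eq rewrite eq = s≤s z≤n
∃-# P (suc i) eq = ≤-trans (∃-# (P ∘ suc) i eq) (m≤n+m _ _)

infix 4 _==_
_==_ : ∀ {n} → Fin n → Fin n → Bool
zero  == zero  = true
zero  == suc _ = false
suc _ == zero  = false
suc i == suc j = i == j

==⇒≡ : ∀ {n} (i j : Fin n) → (i == j) ≡ true → i ≡ j
==⇒≡ zero    zero    _ = refl
==⇒≡ (suc i) (suc j) e = cong suc (==⇒≡ i j e)

==-refl : ∀ {n} (i : Fin n) → (i == i) ≡ true
==-refl zero    = refl
==-refl (suc i) = ==-refl i

==-sym : ∀ {n} (i j : Fin n) → (i == j) ≡ (j == i)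
==-sym zero    zero    = refl
==-sym zero    (suc j) = refl
==-sym (suc i) zero    = refl
==-sym (suc i) (suc j) = ==-sym i j

≢⇒== : ∀ {n} (i j : Fin n) → ¬ i ≡ j → (i == j) ≡ false
≢⇒== i j h with i == j in eq
... | true  = ⊥-elim (h (==⇒≡ i j eq))
... | false = refl

==⇒≢ : ∀ {n} (i j : Fin n) → (i == j) ≡ false → ¬ i ≡ j
==⇒≢ i .i e refl with () ← trans (sym e) (==-refl i)

∑-point : ∀ {n} (i : Fin n) (f : Fin n → ℕ) → ∑ (λ j → ⟪ j == i ⟫ * f j) ≡ f i
∑-point {suc n} zero    f = trans (cong (f zero + 0 +_) (∑-zero n)) (trans (+-identityʳ _) (+-identityʳ _))
∑-point {suc n} (suc i) f = ∑-point i (f ∘ suc)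

#-point : ∀ {n} (i : Fin n) → # (λ j → j == i) ≡ 1
#-point i = trans (∑-cong (λ j → sym (*-identityʳ ⟪ j == i ⟫))) (∑-point i (λ _ → 1))

#≤1 : ∀ {n} (P : Fin n → Bool) → (∀ i j → P i ≡ true → P j ≡ true → i ≡ j) → # P ≤ 1
#≤1 P uniq with 0 <? # P
... | no ¬p = ≤-trans (≮⇒≥ ¬p) z≤n
... | yes p with #-∃ P p
...   | i , Pi = ≤-trans (#-mono {Q = λ j → j == i}
        (λ j Pj → subst (λ k → (j == k) ≡ true) (uniq j i Pj Pi) (==-refl j))) (≤-reflexive (#-point i))

#-classes : ∀ {n k} (P : Fin n → Bool) (κ : Fin n → Fin k) →
  (∀ i j → P i ≡ true → P j ≡ true → κ i ≡ κ j → i ≡ j) → # P ≤ k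
#-classes {n} {k} P κ inj = begin
  # P                                             ≡⟨ ∑-cong (λ i → trans (sym (*-identityʳ _)) (sym (∑-point (κ i) (λ _ → ⟪ P i ⟫ * 1)))) ⟩
  ∑ (λ i → ∑ (λ q → ⟪ q == κ i ⟫ * (⟪ P i ⟫ * 1))) ≡⟨ ∑-swap (λ i q → ⟪ q == κ i ⟫ * (⟪ P i ⟫ * 1)) ⟩
  ∑ (λ q → ∑ (λ i → ⟪ q == κ i ⟫ * (⟪ P i ⟫ * 1))) ≡⟨ ∑-cong (λ q → ∑-cong (λ i → trans (cong (⟪ q == κ i ⟫ *_) (*-identityʳ _)) (sym (⟪∧⟫ (q == κ i) (P i))))) ⟩
  ∑ (λ q → # (λ i → (q == κ i) ∧ P i))             ≤⟨ ∑-mono (λ q → #≤1 _ (uniq q)) ⟩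
  ∑ {k} (λ q → 1)                                  ≡⟨ ∑-const k 1 ⟩
  k * 1                                            ≡⟨ *-identityʳ k ⟩
  k ∎
  where
  open ≤-Reasoning
  uniq : ∀ q i j → ((q == κ i) ∧ P i) ≡ true → ((q == κ j) ∧ P j) ≡ true → i ≡ j
  uniq q i j e e′ with q == κ i in a | q == κ j in b | P i in c | P j in d
  ... | true | true | true | true = inj i j c d (trans (sym (==⇒≡ q _ a)) (==⇒≡ q _ b))

#-preimage : ∀ {n} (f : Fin n → Fin n) → (∀ i j → f i ≡ f j → i ≡ j) → (P : Fin n → Bool) →
  # (P ∘ f) ≤ # P
#-preimage {n} f inj P = begin
  ∑ (λ i → ⟪ P (f i) ⟫)                        ≡⟨ ∑-cong (λ i → sym (∑-point (f i) (λ j → ⟪ P j ⟫))) ⟩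
  ∑ (λ i → ∑ (λ j → ⟪ j == f i ⟫ * ⟪ P j ⟫))    ≡⟨ ∑-swap (λ i j → ⟪ j == f i ⟫ * ⟪ P j ⟫) ⟩
  ∑ (λ j → ∑ (λ i → ⟪ j == f i ⟫ * ⟪ P j ⟫))    ≡⟨ ∑-cong (λ j → ∑-*ʳ ⟪ P j ⟫ (λ i → ⟪ j == f i ⟫)) ⟩
  ∑ (λ j → # (λ i → j == f i) * ⟪ P j ⟫)        ≤⟨ ∑-mono (λ j → *-monoˡ-≤ ⟪ P j ⟫ (#≤1 _ (λ i i′ e e′ → inj i i′ (trans (sym (==⇒≡ j _ e)) (==⇒≡ j _ e′))))) ⟩
  ∑ (λ j → 1 * ⟪ P j ⟫)                         ≡⟨ ∑-cong (λ j → *-identityˡ ⟪ P j ⟫) ⟩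
  # P ∎
  where open ≤-Reasoning

-- Certified linear arithmetic: a weighted sum of the hypotheses is compared coefficientwise.

infixl 7 _:+_
infixl 8 _:*_
data Expr (k : ℕ) : Set where
  var       : Fin k → Expr k
  con       : ℕ → Expr k
  _:+_ _:*_ : Expr k → Expr k → Expr k

⟦_⟧ : ∀ {k} → Expr k → Vec ℕ k → ℕ
⟦ var i ⟧ ρ  = lookup ρ i
⟦ con c ⟧ ρ  = c
⟦ a :+ b ⟧ ρ = ⟦ a ⟧ ρ + ⟦ b ⟧ ρ
⟦ a :* b ⟧ ρ = ⟦ a ⟧ ρ * ⟦ b ⟧ ρ

Mono : ℕ → Set
Mono k = Vec ℕ k

Poly : ℕ → Set
Poly k = List (ℕ × Mono k)

evalM : ∀ {k} → Mono k → Vec ℕ k → ℕ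
evalM []      []      = 1
evalM (e ∷ m) (x ∷ ρ) = x ^ e * evalM m ρ

evalP : ∀ {k} → Poly k → Vec ℕ k → ℕ
evalP []            ρ = 0
evalP ((c , m) ∷ p) ρ = c * evalM m ρ + evalP p ρ

sameM : ∀ {k} → Mono k → Mono k → Bool
sameM []      []      = true
sameM (e ∷ m) (f ∷ n) = if e ≡ᵇ f then sameM m n else false

sameM-sound : ∀ {k} (m n : Mono k) → sameM m n ≡ true → m ≡ n
sameM-sound []      []      _  = refl
sameM-sound (e ∷ m) (f ∷ n) eq with e ≡ᵇ f in e≡f
... | true = cong₂ _∷_ (≡ᵇ⇒≡ e f (subst T (sym e≡f) tt)) (sameM-sound m n eq)

insertP : ∀ {k} → ℕ → Mono k → Poly k → Poly k
insertP c m []            = (c , m) ∷ []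
insertP c m ((d , n) ∷ p) = if sameM m n then (c + d , n) ∷ p else (d , n) ∷ insertP c m p

insertP-sound : ∀ {k} c (m : Mono k) p ρ → evalP (insertP c m p) ρ ≡ c * evalM m ρ + evalP p ρ
insertP-sound c m []            ρ = refl
insertP-sound c m ((d , n) ∷ p) ρ with sameM m n in eq
... | true rewrite sameM-sound m n eq | *-distribʳ-+ (evalM n ρ) c d =
  +-assoc (c * evalM n ρ) _ _
... | false rewrite insertP-sound c m p ρ =
  x∙yz≈y∙xz (d * evalM n ρ) (c * evalM m ρ) (evalP p ρ)
  where
  x∙yz≈y∙xz : ∀ x y z → x + (y + z) ≡ y + (x + z)
  x∙yz≈y∙xz x y z = trans (sym (+-assoc x y z)) (trans (cong (_+ z) (+-comm x y)) (+-assoc y x z))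

addP : ∀ {k} → Poly k → Poly k → Poly k
addP []            q = q
addP ((c , m) ∷ p) q = insertP c m (addP p q)

addP-sound : ∀ {k} (p q : Poly k) ρ → evalP (addP p q) ρ ≡ evalP p ρ + evalP q ρ
addP-sound []            q ρ = refl
addP-sound ((c , m) ∷ p) q ρ
  rewrite insertP-sound c m (addP p q) ρ | addP-sound p q ρ = sym (+-assoc (c * evalM m ρ) _ _)

mulM-sound : ∀ {k} (m n : Mono k) ρ → evalM (zipWith _+_ m n) ρ ≡ evalM m ρ * evalM n ρ
mulM-sound []      []      []      = refl
mulM-sound (e ∷ m) (f ∷ n) (x ∷ ρ)
  rewrite ^-distribˡ-+-* x e f | mulM-sound m n ρ = [m*n]*[o*p]≡[m*o]*[n*p] (x ^ e) (x ^ f) (evalM m ρ) _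

scaleP : ∀ {k} → ℕ → Mono k → Poly k → Poly k
scaleP c m []            = []
scaleP c m ((d , n) ∷ p) = (c * d , zipWith _+_ m n) ∷ scaleP c m p

scaleP-sound : ∀ {k} c (m : Mono k) p ρ → evalP (scaleP c m p) ρ ≡ (c * evalM m ρ) * evalP p ρ
scaleP-sound c m []            ρ = sym (*-zeroʳ (c * evalM m ρ))
scaleP-sound c m ((d , n) ∷ p) ρ
  rewrite scaleP-sound c m p ρ | mulM-sound m n ρ | *-distribˡ-+ (c * evalM m ρ) (d * evalM n ρ) (evalP p ρ) =
  cong (_+ (c * evalM m ρ) * evalP p ρ) ([m*n]*[o*p]≡[m*o]*[n*p] c d (evalM m ρ) (evalM n ρ))

mulP : ∀ {k} → Poly k → Poly k → Poly k
mulP []            q = []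
mulP ((c , m) ∷ p) q = addP (scaleP c m q) (mulP p q)

mulP-sound : ∀ {k} (p q : Poly k) ρ → evalP (mulP p q) ρ ≡ evalP p ρ * evalP q ρ
mulP-sound []            q ρ = refl
mulP-sound ((c , m) ∷ p) q ρ
  rewrite addP-sound (scaleP c m q) (mulP p q) ρ | scaleP-sound c m q ρ | mulP-sound p q ρ =
  sym (*-distribʳ-+ (evalP q ρ) (c * evalM m ρ) (evalP p ρ))

unitM : ∀ {k} → Mono k
unitM = replicate _ 0

unitM-sound : ∀ {k} (ρ : Vec ℕ k) → evalM unitM ρ ≡ 1
unitM-sound []      = refl
unitM-sound (x ∷ ρ) = trans (+-identityʳ _) (unitM-sound ρ)

varM : ∀ {k} → Fin k → Mono k
varM zero    = 1 ∷ unitM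
varM (suc i) = 0 ∷ varM i

varM-sound : ∀ {k} (i : Fin k) ρ → evalM (varM i) ρ ≡ lookup ρ i
varM-sound zero    (x ∷ ρ) rewrite unitM-sound ρ = trans (*-identityʳ _) (*-identityʳ x)
varM-sound (suc i) (x ∷ ρ) = trans (+-identityʳ _) (varM-sound i ρ)

norm : ∀ {k} → Expr k → Poly k
norm (var i)  = (1 , varM i) ∷ []
norm (con c)  = (c , unitM) ∷ []
norm (a :+ b) = addP (norm a) (norm b)
norm (a :* b) = mulP (norm a) (norm b)

norm-sound : ∀ {k} (e : Expr k) ρ → evalP (norm e) ρ ≡ ⟦ e ⟧ ρ
norm-sound (var i)  ρ rewrite varM-sound i ρ = trans (+-identityʳ _) (+-identityʳ _)
norm-sound (con c)  ρ rewrite unitM-sound ρ = trans (+-identityʳ _) (*-identityʳ c)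
norm-sound (a :+ b) ρ = trans (addP-sound (norm a) _ ρ) (cong₂ _+_ (norm-sound a ρ) (norm-sound b ρ))
norm-sound (a :* b) ρ = trans (mulP-sound (norm a) _ ρ) (cong₂ _*_ (norm-sound a ρ) (norm-sound b ρ))

coversTerm : ∀ {k} → ℕ → Mono k → Poly k → Bool
coversTerm zero    m p             = true
coversTerm (suc c) m []            = false
coversTerm (suc c) m ((d , n) ∷ p) = if sameM m n then c <ᵇ d else coversTerm (suc c) m p

removeTerm : ∀ {k} → ℕ → Mono k → Poly k → Poly k
removeTerm c m []            = []
removeTerm c m ((d , n) ∷ p) = if sameM m n then (d ∸ c , n) ∷ p else (d , n) ∷ removeTerm c m p

removeTerm-sound : ∀ {k} c (m : Mono k) p ρ → coversTerm c m p ≡ true →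
  c * evalM m ρ + evalP (removeTerm c m p) ρ ≤ evalP p ρ
removeTerm-sound zero m [] ρ _ = z≤n
removeTerm-sound zero m ((d , n) ∷ p) ρ _ with sameM m n
... | true  = ≤-refl
... | false = +-monoʳ-≤ (d * evalM n ρ) (removeTerm-sound zero m p ρ refl)
removeTerm-sound (suc c) m ((d , n) ∷ p) ρ eq with sameM m n in same
... | true rewrite sameM-sound m n same = ≤-reflexive (trans (sym (+-assoc (suc c * evalM n ρ) _ _))
    (cong (_+ evalP p ρ) (trans (sym (*-distribʳ-+ (evalM n ρ) (suc c) (d ∸ suc c)))
      (cong (_* evalM n ρ) (m+[n∸m]≡n (<ᵇ⇒< c d (subst T (sym eq) tt)))))))
... | false = subst (_≤ d * evalM n ρ + evalP p ρ) (x∙yz≈y∙xz (d * evalM n ρ) (suc c * evalM m ρ) _)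
    (+-monoʳ-≤ (d * evalM n ρ) (removeTerm-sound (suc c) m p ρ eq))
  where
  x∙yz≈y∙xz : ∀ x y z → x + (y + z) ≡ y + (x + z)
  x∙yz≈y∙xz x y z = trans (sym (+-assoc x y z)) (trans (cong (_+ z) (+-comm x y)) (+-assoc y x z))

dominated : ∀ {k} → Poly k → Poly k → Bool
dominated []            q = true
dominated ((c , m) ∷ p) q = if coversTerm c m q then dominated p (removeTerm c m q) else false

dominated-sound : ∀ {k} (p q : Poly k) ρ → dominated p q ≡ true → evalP p ρ ≤ evalP q ρ
dominated-sound []            q ρ _  = z≤n
dominated-sound ((c , m) ∷ p) q ρ eq with coversTerm c m q in cov
... | true = ≤-trans (+-monoʳ-≤ (c * evalM m ρ) (dominated-sound p _ ρ eq)) (removeTerm-sound c m q ρ cov)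

infix 6 _:≤_[_]
-- The bracketed expression is the multiplier of the inequality. Polynomial multipliers are allowed,
-- so that quadratic consequences also have certificates; over the natural numbers a multiplier is
-- never negative and no side condition arises.
data Ineq (k : ℕ) : Set where
  _:≤_[_] : Expr k → Expr k → Expr k → Ineq k

Holds : ∀ {k} → Vec ℕ k → Ineq k → Set
Holds ρ (a :≤ b [ _ ]) = ⟦ a ⟧ ρ ≤ ⟦ b ⟧ ρ

lhsSum rhsSum : ∀ {k} → List (Ineq k) → Poly k
lhsSum []                  = []
lhsSum (a :≤ b [ w ] ∷ hs) = addP (mulP (norm w) (norm a)) (lhsSum hs)
rhsSum []                  = []
rhsSum (a :≤ b [ w ] ∷ hs) = addP (mulP (norm w) (norm b)) (rhsSum hs)

sums-sound : ∀ {k} (ρ : Vec ℕ k) hs → All (Holds ρ) hs → evalP (lhsSum hs) ρ ≤ evalP (rhsSum hs) ρ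
sums-sound ρ []                  []       = z≤n
sums-sound ρ (a :≤ b [ w ] ∷ hs) (p ∷ ps)
  rewrite addP-sound (mulP (norm w) (norm a)) (lhsSum hs) ρ
        | addP-sound (mulP (norm w) (norm b)) (rhsSum hs) ρ
        | mulP-sound (norm w) (norm a) ρ | mulP-sound (norm w) (norm b) ρ
        | norm-sound a ρ | norm-sound b ρ
  = +-mono-≤ (*-monoʳ-≤ (evalP (norm w) ρ) p) (sums-sound ρ hs ps)

-- If the summed left sides dominate one plus the summed right sides coefficient by coefficient,
-- they are strictly larger at all natural values, whereas the hypotheses add up to the opposite
-- inequality.
refutes : ∀ {k} → List (Ineq k) → Bool
refutes hs = dominated (addP (norm (con 1)) (rhsSum hs)) (lhsSum hs)

vars : ∀ {k} → Vec (Expr k) k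
vars = tabulate var

opaque
  refute : ∀ {k} (ρ : Vec ℕ k) (hs : Vec (Expr k) k → List (Ineq k)) →
    refutes (hs vars) ≡ true → All (Holds ρ) (hs vars) → ⊥
  refute ρ hs eq ps = <⇒≱ lt (sums-sound ρ (hs vars) ps)
    where
    lt : evalP (rhsSum (hs vars)) ρ < evalP (lhsSum (hs vars)) ρ
    lt = subst (_≤ evalP (lhsSum (hs vars)) ρ)
           (trans (addP-sound (norm (con 1)) (rhsSum (hs vars)) ρ) (cong (_+ evalP (rhsSum (hs vars)) ρ) (norm-sound (con 1) ρ)))
           (dominated-sound (addP (norm (con 1)) (rhsSum (hs vars))) (lhsSum (hs vars)) ρ eq)

negated : ∀ {k} → Ineq k → Ineq k
negated (a :≤ b [ w ]) = con 1 :+ b :≤ a [ w ]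

opaque
  -- By contradiction: the negated goal joins the hypotheses, so the bracket written on a goal is
  -- the multiplier of its negation.
  prove : ∀ {k} (ρ : Vec ℕ k) (hs : Vec (Expr k) k → List (Ineq k)) (goal : Vec (Expr k) k → Ineq k) →
    refutes (negated (goal vars) ∷ hs vars) ≡ true → All (Holds ρ) (hs vars) → Holds ρ (goal vars)
  prove ρ hs goal eq ps with goal vars
  ... | a :≤ b [ w ] with ⟦ a ⟧ ρ ≤? ⟦ b ⟧ ρ
  ...   | yes a≤b = a≤b
  ...   | no  a≰b = ⊥-elim (refute ρ (λ vs → negated (a :≤ b [ w ]) ∷ hs vs) eq (≰⇒> a≰b ∷ ps))

-- Colourings with intersection numbers

-- p i j counts the vertices w seen from both ends, i.e. with c u w ≡ i and c v w ≡ j.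
record Scheme (n : ℕ) : Set where
  field
    c    : Fin n → Fin n → Fin 4
    o    : Fin 4
    st   : Fin 4 → Fin 4
    p    : Fin 4 → Fin 4 → Fin 4 → ℕ
    occ  : ∀ i → ∃[ u ] ∃[ v ] c u v ≡ i
    loop : ∀ u → c u u ≡ o
    diag : ∀ u v → c u v ≡ o → u ≡ v
    conv : ∀ u v → c v u ≡ st (c u v)
    coh  : ∀ i j u v → # (λ w → (c u w == i) ∧ (c v w == j)) ≡ p i j (c u v)
    conn : ∀ i → ¬ i ≡ o → ∀ u v → Star (λ x y → c x y ≡ i) u v

no-5-chain : (F : Fin 4 → ℕ) (e : Vec (Fin 4) 5) → let h = λ i → F (lookup e i) in
  h (F.# 0) < h (F.# 1) → h (F.# 1) < h (F.# 2) → h (F.# 2) < h (F.# 3) → h (F.# 3) < h (F.# 4) → ⊥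
no-5-chain F e a b d g with FP.pigeonhole {4} {5} ≤-refl (lookup e)
... | i , j , i<j , eq = clash i j i<j eq
  where
  no-eq : ∀ {x y} → F x < F y → x ≡ y → ⊥
  no-eq lt refl = <-irrefl refl lt
  clash : (x y : Fin 5) → x F.< y → lookup e x ≡ lookup e y → ⊥
  clash zero (suc zero) _ = no-eq a
  clash zero (suc (suc zero)) _ = no-eq (<-trans a b)
  clash zero (suc (suc (suc zero))) _ = no-eq (<-trans a (<-trans b d))
  clash zero (suc (suc (suc (suc zero)))) _ = no-eq (<-trans a (<-trans b (<-trans d g)))
  clash (suc zero) (suc (suc zero)) _ = no-eq b
  clash (suc zero) (suc (suc (suc zero))) _ = no-eq (<-trans b d)
  clash (suc zero) (suc (suc (suc (suc zero)))) _ = no-eq (<-trans b (<-trans d g))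
  clash (suc (suc zero)) (suc (suc (suc zero))) _ = no-eq d
  clash (suc (suc zero)) (suc (suc (suc (suc zero)))) _ = no-eq (<-trans d g)
  clash (suc (suc (suc zero))) (suc (suc (suc (suc zero)))) _ = no-eq g
  clash (suc zero) (suc zero) (s≤s ())
  clash (suc (suc _)) (suc zero) (s≤s ())
  clash (suc (suc zero)) (suc (suc zero)) (s≤s (s≤s ()))
  clash (suc (suc (suc _))) (suc (suc zero)) (s≤s (s≤s ()))
  clash (suc (suc (suc zero))) (suc (suc (suc zero))) (s≤s (s≤s (s≤s ())))
  clash (suc (suc (suc (suc zero)))) (suc (suc (suc zero))) (s≤s (s≤s (s≤s ())))
  clash (suc (suc (suc (suc zero)))) (suc (suc (suc (suc zero)))) (s≤s (s≤s (s≤s (s≤s ()))))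

module Basic {n : ℕ} (X : Scheme n) where
  open Scheme X public

  V : Set
  V = Fin n

  -- The five values separated by the intermediate bounds would be five colours.
  module ThreeSteps (φ : Fin n → Fin n → ℕ) (F : Fin 4 → ℕ) (φF : ∀ u v → φ u v ≡ F (c u v))
    (φ-refl : ∀ u → φ u u ≡ 0) (φ-trans : ∀ u v w → φ u w ≤ φ u v + φ v w) where

    F-step : ∀ {u x y} → F (c u y) ≤ F (c u x) + F (c x y)
    F-step {u} {x} {y} = subst₂ _≤_ (φF u y) (cong₂ _+_ (φF u x) (φF x y)) (φ-trans u x y)

    F-o : F o ≡ 0
    F-o with occ o
    ... | u , _ = trans (cong F (sym (loop u))) (trans (sym (φF u u)) (φ-refl u))

    -- Along a path of colour `i` the value seen from `u` grows by at most `F i` in each step; the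
    -- step that first crosses the level `b` ends at a colour whose value lies just above `b`.
    exit : ∀ i u b {x v} → Star (λ x y → c x y ≡ i) x v → F (c u x) ≤ b → b < F (c u v) →
      ∃[ e ] (b < F e × F e ≤ b + F i)
    exit i u b ε le lt = ⊥-elim (<⇒≱ lt le)
    exit i u b {x} (_◅_ {j = y} xy path) le lt with F (c u y) ≤? b
    ... | yes le′ = exit i u b path le′ lt
    ... | no  ≰b = c u y , ≰⇒> ≰b , ≤-trans F-step (+-mono-≤ le (≤-reflexive (cong F xy)))

    exit′ : ∀ i → ¬ i ≡ o → ∀ b k → b < F k → ∃[ e ] (b < F e × F e ≤ b + F i)
    exit′ i i≢o b k lt with occ k
    ... | u , v , refl = exit i u b (conn i i≢o u v)
      (subst (_≤ b) (sym (trans (cong F (loop u)) F-o)) z≤n) lt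

    -- Otherwise paths of colour `i` would cross the levels 0, `F i` and `2 * F i` and produce three
    -- colours with values in consecutive disjoint intervals. Together with `o` at 0 and `k` on top
    -- these are five colours.
    bounded : ∀ i → ¬ i ≡ o → ∀ k → F k ≤ 3 * F i
    bounded i i≢o k with F k ≤? 3 * F i
    ... | yes le = le
    ... | no ≰ with exit′ i i≢o 0 k (≤-trans (s≤s z≤n) k>) | exit′ i i≢o (F i) k (≤-trans (s≤s (m≤m+n _ _)) k>)
                  | exit′ i i≢o (F i + F i) k (≤-trans (s≤s (+-monoʳ-≤ (F i) (m≤m+n _ _))) k>)
      where
      k> : 3 * F i < F k
      k> = ≰⇒> ≰
    ... | e₀ , l₀ , h₀ | e₁ , l₁ , h₁ | e₂ , l₂ , h₂ =
      ⊥-elim (no-5-chain F (o ∷ e₀ ∷ e₁ ∷ e₂ ∷ k ∷ []) (subst (_< F e₀) (sym F-o) l₀)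
        (≤-<-trans h₀ l₁) (≤-<-trans h₁ l₂) (≤-<-trans h₂ (subst (_< F k) (sym F3) (≰⇒> ≰))))
      where
      F3 : F i + F i + F i ≡ 3 * F i
      F3 = trans (+-assoc (F i) (F i) (F i)) (cong (λ z → F i + (F i + z)) (sym (+-identityʳ (F i))))

  cnt : (Fin 4 → Fin 4 → Bool) → V → V → ℕ
  cnt g u v = # (λ w → g (c u w) (c v w))

  opaque
    G : (Fin 4 → Fin 4 → Bool) → Fin 4 → ℕ
    G g t = ∑ (λ i → ∑ (λ j → ⟪ g i j ⟫ * p i j t))

    -- Splitting a count according to the two colours under which `w` is seen reduces it to
    -- intersection numbers, so any such count depends only on the colour of the pair.
    cnt-G : ∀ g u v → cnt g u v ≡ G g (c u v)
    cnt-G g u v = begin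
      ∑ (λ w → ⟪ g (c u w) (c v w) ⟫)
        ≡⟨ ∑-cong (λ w → trans (sym (∑-point (c u w) (λ i → ⟪ g i (c v w) ⟫)))
             (∑-cong (λ i → trans (cong (⟪ i == c u w ⟫ *_) (sym (∑-point (c v w) (λ j → ⟪ g i j ⟫))))
                                  (sym (∑-*ˡ ⟪ i == c u w ⟫ (λ j → ⟪ j == c v w ⟫ * ⟪ g i j ⟫)))))) ⟩
      ∑ (λ w → ∑ (λ i → ∑ (λ j → ⟪ i == c u w ⟫ * (⟪ j == c v w ⟫ * ⟪ g i j ⟫))))
        ≡⟨ ∑-swap (λ w i → ∑ (λ j → ⟪ i == c u w ⟫ * (⟪ j == c v w ⟫ * ⟪ g i j ⟫))) ⟩
      ∑ (λ i → ∑ (λ w → ∑ (λ j → ⟪ i == c u w ⟫ * (⟪ j == c v w ⟫ * ⟪ g i j ⟫))))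
        ≡⟨ ∑-cong (λ i → ∑-swap (λ w j → ⟪ i == c u w ⟫ * (⟪ j == c v w ⟫ * ⟪ g i j ⟫))) ⟩
      ∑ (λ i → ∑ (λ j → ∑ (λ w → ⟪ i == c u w ⟫ * (⟪ j == c v w ⟫ * ⟪ g i j ⟫))))
        ≡⟨ ∑-cong (λ i → ∑-cong (λ j → inner i j)) ⟩
      ∑ (λ i → ∑ (λ j → ⟪ g i j ⟫ * p i j (c u v))) ∎
      where
      open ≡-Reasoning
      inner : ∀ i j → ∑ (λ w → ⟪ i == c u w ⟫ * (⟪ j == c v w ⟫ * ⟪ g i j ⟫)) ≡ ⟪ g i j ⟫ * p i j (c u v)
      inner i j = trans (∑-cong (λ w → trans (sym (*-assoc ⟪ i == c u w ⟫ ⟪ j == c v w ⟫ ⟪ g i j ⟫))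
          (cong (_* ⟪ g i j ⟫) (trans (sym (⟪∧⟫ (i == c u w) (j == c v w)))
            (cong ⟪_⟫ (cong₂ _∧_ (==-sym i (c u w)) (==-sym j (c v w))))))))
        (trans (∑-*ʳ ⟪ g i j ⟫ (λ w → ⟪ (c u w == i) ∧ (c v w == j) ⟫))
          (trans (*-comm _ ⟪ g i j ⟫) (cong (⟪ g i j ⟫ *_) (coh i j u v))))

  val : (Fin 4 → Bool) → ℕ
  val g = G (λ i _ → g i) o

  val-# : ∀ g u → # (λ w → g (c u w)) ≡ val g
  val-# g u = trans (cnt-G (λ i _ → g i) u u) (cong (G (λ i _ → g i)) (loop u))

  k : Fin 4 → ℕ
  k i = val (_== i)

  k-# : ∀ i u → # (λ w → c u w == i) ≡ k i
  k-# i = val-# (_== i)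

  st-st : ∀ i → st (st i) ≡ i
  st-st i with occ i
  ... | u , v , refl = trans (cong st (sym (conv u v))) (sym (conv v u))

  st-o : st o ≡ o
  st-o with occ o
  ... | u , _ = trans (cong st (sym (loop u))) (trans (sym (conv u u)) (loop u))

  ==-conv : ∀ v w j → (c v w == j) ≡ (c w v == st j)
  ==-conv v w j with c v w == j in e | c w v == st j in e′
  ... | true  | true  = refl
  ... | false | false = refl
  ... | true  | false = ⊥-elim (==⇒≢ _ _ e′ (trans (conv v w) (cong st (==⇒≡ _ _ e))))
  ... | false | true  = ⊥-elim (==⇒≢ _ _ e (trans (conv w v) (trans (cong st (==⇒≡ _ _ e′)) (st-st j))))

  k-in : ∀ i w → # (λ u → c u w == i) ≡ k (st i)
  k-in i w = trans (#-cong (λ u → ==-conv u w i)) (k-# (st i) w)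

  n>0 : 0 < n
  n>0 with occ o
  ... | u , _ = ≤-trans (s≤s z≤n) (FP.toℕ<n u)

  n-cancel : ∀ {a b} → n * a ≡ n * b → a ≡ b
  n-cancel {a} {b} e = *-cancelˡ-≡ a b n {{>-nonZero n>0}} e

  k-st : ∀ i → k (st i) ≡ k i
  k-st i = n-cancel (begin
    n * k (st i)                              ≡⟨ sym (∑-const n (k (st i))) ⟩
    ∑ {n} (λ w → k (st i))                    ≡⟨ ∑-cong (λ w → sym (k-in i w)) ⟩
    ∑ (λ w → ∑ (λ u → ⟪ c u w == i ⟫))         ≡⟨ ∑-swap (λ w u → ⟪ c u w == i ⟫) ⟩
    ∑ (λ u → ∑ (λ w → ⟪ c u w == i ⟫))         ≡⟨ ∑-cong (λ u → k-# i u) ⟩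
    ∑ {n} (λ u → k i)                         ≡⟨ ∑-const n (k i) ⟩
    n * k i                                   ∎)
    where open ≡-Reasoning

  k-o : k o ≡ 1
  k-o with occ o
  ... | u , _ = trans (sym (k-# o u)) (trans (#-cong h) (#-point u))
    where
    h : ∀ w → (c u w == o) ≡ (w == u)
    h w with w == u in e
    ... | true  rewrite ==⇒≡ w u e | loop u = ==-refl o
    ... | false = ≢⇒== _ _ (λ e′ → ==⇒≢ w u e (sym (diag u w e′)))

  k-sum : ∑ k ≡ n
  k-sum with occ o
  ... | u , _ = begin
    ∑ k                                     ≡⟨ ∑-cong (λ i → sym (k-# i u)) ⟩
    ∑ (λ i → ∑ (λ w → ⟪ c u w == i ⟫))       ≡⟨ ∑-swap (λ i w → ⟪ c u w == i ⟫) ⟩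
    ∑ (λ w → ∑ (λ i → ⟪ c u w == i ⟫))       ≡⟨ ∑-cong (λ w → trans (∑-cong (λ i → cong ⟪_⟫ (==-sym (c u w) i))) (#-point (c u w))) ⟩
    ∑ {n} (λ w → 1)                         ≡⟨ trans (∑-const n 1) (*-identityʳ n) ⟩
    n                                       ∎
    where open ≡-Reasoning

  k>0 : ∀ i → 0 < k i
  k>0 i with occ i
  ... | u , v , e = subst (0 <_) (k-# i u) (∃-# (λ w → c u w == i) v (trans (cong (_== i) e) (==-refl i)))

  p-swap : ∀ i j t → p i j t ≡ p j i (st t)
  p-swap i j t with occ t
  ... | u , v , refl = trans (sym (coh i j u v)) (trans (#-cong (λ w → ∧-comm (c u w == i) _))
    (trans (coh j i v u) (cong (p j i) (conv u v))))
    where open import Data.Bool.Properties using (∧-comm)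

  private
    tri-sum : ∀ i j t → ∑ (λ u → ∑ (λ v → ∑ (λ w → ⟪ c u v == t ⟫ * ⟪ (c u w == i) ∧ (c v w == j) ⟫))) ≡ n * (k t * p i j t)
    tri-sum i j t = trans (∑-cong (λ u → trans (∑-cong (λ v → trans
        (∑-*ˡ ⟪ c u v == t ⟫ (λ w → ⟪ (c u w == i) ∧ (c v w == j) ⟫)) (fix u v)))
        (trans (∑-*ʳ (p i j t) (λ v → ⟪ c u v == t ⟫)) (cong (_* p i j t) (k-# t u)))))
      (∑-const n (k t * p i j t))
      where
      fix : ∀ u v → ⟪ c u v == t ⟫ * # (λ w → (c u w == i) ∧ (c v w == j)) ≡ ⟪ c u v == t ⟫ * p i j t
      fix u v with c u v == t in e
      ... | false = refl
      ... | true  = cong (1 *_) (trans (coh i j u v) (cong (p i j) (==⇒≡ _ _ e)))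

  -- Triples `u`, `v`, `w` with prescribed colours are counted once over the pair `u`, `v` and once
  -- over `u`, `w`. The converse of `j` enters because the third side is then read from `w`.
  triangle : ∀ i j t → k t * p i j t ≡ k i * p t (st j) i
  triangle i j t = n-cancel (trans (sym (tri-sum i j t)) (trans (∑-cong (λ u →
    trans (∑-swap (λ v w → ⟪ c u v == t ⟫ * ⟪ (c u w == i) ∧ (c v w == j) ⟫))
      (∑-cong (λ w → ∑-cong (λ v → shuffle (c u v == t) (c u w == i) (c v w == j) (c w v == st j) (==-conv v w j))))))
    (tri-sum t (st j) i)))
    where
    shuffle : ∀ a b d d′ → d ≡ d′ → ⟪ a ⟫ * ⟪ b ∧ d ⟫ ≡ ⟪ b ⟫ * ⟪ a ∧ d′ ⟫
    shuffle true  true  d d′ refl = refl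
    shuffle true  false d d′ refl = refl
    shuffle false true  d d′ refl = refl
    shuffle false false d d′ refl = refl

  miss : (Fin 4 → Bool) → V → V → ℕ
  miss g u v = # (λ w → g (c u w) ∧ not (g (c v w)))

  both : (Fin 4 → Bool) → V → V → ℕ
  both g u v = # (λ w → g (c u w) ∧ g (c v w))

  bothC : (Fin 4 → Bool) → Fin 4 → ℕ
  bothC g = G (λ i j → g i ∧ g j)

  both-C : ∀ g u v → both g u v ≡ bothC g (c u v)
  both-C g u v = cnt-G (λ i j → g i ∧ g j) u v

  both+miss : ∀ g u v → val g ≡ both g u v + miss g u v
  both+miss g u v = trans (sym (val-# g u)) (#-split (λ w → g (c u w)) (λ w → g (c v w)))

  miss-trans : ∀ g u v w → miss g u w ≤ miss g u v + miss g v w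
  miss-trans g u v w = ≤-trans (∑-mono (λ x → lem (g (c u x)) (g (c v x)) (g (c w x))))
    (≤-reflexive (∑-+ (λ x → ⟪ g (c u x) ∧ not (g (c v x)) ⟫) _))
    where
    lem : ∀ a b d → ⟪ a ∧ not d ⟫ ≤ ⟪ a ∧ not b ⟫ + ⟪ b ∧ not d ⟫
    lem true  true  d     = ≤-refl
    lem true  false true  = z≤n
    lem true  false false = s≤s z≤n
    lem false _     _     = z≤n

  miss-refl : ∀ g u → miss g u u ≡ 0
  miss-refl g u = #≡0 (λ w → lem (g (c u w)))
    where
    lem : ∀ a → a ∧ not a ≡ false
    lem true  = refl
    lem false = refl

  -- `miss g` is determined by the colour and obeys the triangle inequality, so the three-step bound
  -- applies. Taken at a moved pair it bounds `miss` everywhere from above; compared with colour `D`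
  -- it bounds light pairs from below.
  miss≤3 : ∀ g u v u′ v′ → ¬ c u′ v′ ≡ o → miss g u v ≤ 3 * miss g u′ v′
  miss≤3 g u v u′ v′ ne = subst₂ _≤_ (sym (cnt-G (λ i j → g i ∧ not (g j)) u v))
    (cong (3 *_) (sym (cnt-G (λ i j → g i ∧ not (g j)) u′ v′)))
    (bounded (c u′ v′) ne (c u v))
    where open ThreeSteps (miss g) (G (λ i j → g i ∧ not (g j))) (cnt-G (λ i j → g i ∧ not (g j))) (miss-refl g) (miss-trans g)

-- A heavy colour

#-not : ∀ {n} (P : Fin n → Bool) → # P + # (not ∘ P) ≡ n
#-not {n} P = trans (sym (#-split (λ _ → true) P)) (trans (∑-const n 1) (*-identityʳ n))

half-light : ∀ x y n s →
  x + y ≤ n →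
  x * y ≤ n * (3 * s) →
  n ≤ 2 * x →
  y ≤ 6 * s
half-light x y n s h1 h2 h3 = prove (x ∷ y ∷ n ∷ s ∷ []) (λ { (x ∷ y ∷ n ∷ s ∷ []) →
    x :+ y :≤ n [ con 2 ] ∷
    x :* y :≤ n :* (con 3 :* s) [ con 2 ] ∷
    n :≤ con 2 :* x [ con 1 :+ y ] ∷
    [] })
  (λ { (x ∷ y ∷ n ∷ s ∷ []) → y :≤ con 6 :* s [ con 2 :+ n ] })
  refl (h1 ∷ h2 ∷ h3 ∷ [])

some-half : ∀ x y n →
  n ≤ x + y →
  2 * x + 1 ≤ n →
  n ≤ 2 * y
some-half x y n h1 h2 = prove (x ∷ y ∷ n ∷ []) (λ { (x ∷ y ∷ n ∷ []) →
    n :≤ x :+ y [ con 2 ] ∷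
    con 2 :* x :+ con 1 :≤ n [ con 1 ] ∷
    [] })
  (λ { (x ∷ y ∷ n ∷ []) → n :≤ con 2 :* y [ con 1 ] })
  refl (h1 ∷ h2 ∷ [])

not-all-light : ∀ a b d e n s N →
  n ≤ a + (b + (d + (e + 0))) →
  a ≤ 6 * s →
  b ≤ 6 * s →
  d ≤ 6 * s →
  e ≤ 6 * s →
  N * s + 1 ≤ n →
  100000000000000000 ≤ N →
  ⊥
not-all-light a b d e n s N h1 h2 h3 h4 h5 h6 h7 = refute (a ∷ b ∷ d ∷ e ∷ n ∷ s ∷ N ∷ []) (λ { (a ∷ b ∷ d ∷ e ∷ n ∷ s ∷ N ∷ []) →
    n :≤ a :+ (b :+ (d :+ (e :+ con 0))) [ con 12500000000000000 ] ∷
    a :≤ con 6 :* s [ con 12500000000000000 ] ∷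
    b :≤ con 6 :* s [ con 12500000000000000 ] ∷
    d :≤ con 6 :* s [ con 12500000000000000 ] ∷
    e :≤ con 6 :* s [ con 12500000000000000 ] ∷
    N :* s :+ con 1 :≤ n [ con 12500000000000000 ] ∷
    con 100000000000000000 :≤ N [ con 3 :* s ] ∷
    [] })
  refl (h1 ∷ h2 ∷ h3 ∷ h4 ∷ h5 ∷ h6 ∷ h7 ∷ [])

not-one-heavy : ∀ n s N →
  n ≤ 1 + 6 * s →
  1 ≤ s →
  N * s + 1 ≤ n →
  100000000000000000 ≤ N →
  ⊥
not-one-heavy n s N h1 h2 h3 h4 = refute (n ∷ s ∷ N ∷ []) (λ { (n ∷ s ∷ N ∷ []) →
    n :≤ con 1 :+ con 6 :* s [ con 1 ] ∷
    con 1 :≤ s [ con 99999999999999994 ] ∷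
    N :* s :+ con 1 :≤ n [ con 1 ] ∷
    con 100000000000000000 :≤ N [ s ] ∷
    [] })
  refl (h1 ∷ h2 ∷ h3 ∷ h4 ∷ [])

module Moving {n : ℕ} (X : Scheme n) (f : Fin n → Fin n)
  (f-col : ∀ u v → Scheme.c X (f u) (f v) ≡ Scheme.c X u v) where
  open Basic X

  S : V → Bool
  S u = not (f u == u)

  s : ℕ
  s = # S

  fixed : ∀ w → S w ≡ false → f w ≡ w
  fixed w e with f w == w in e′
  ... | true = ==⇒≡ (f w) w e′

  moves : ∀ w → S w ≡ true → ¬ f w ≡ w
  moves w e with f w == w in e′
  ... | false = ==⇒≢ (f w) w e′

  c-fixed : ∀ u w → S w ≡ false → c (f u) w ≡ c u w
  c-fixed u w e = trans (cong (c (f u)) (sym (fixed w e))) (f-col u w)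

  f-inj : ∀ u v → f u ≡ f v → u ≡ v
  f-inj u v e = diag u v (trans (sym (f-col u v)) (trans (cong (c (f u)) (sym e)) (loop (f u))))

  -- A vertex fixed by `f` sees `u` and `f u` in the same colour, so only moved vertices can tell
  -- them apart.
  miss-f : ∀ g u → miss g u (f u) ≤ s
  miss-f g u = #-mono h
    where
    h : ∀ w → (g (c u w) ∧ not (g (c (f u) w))) ≡ true → S w ≡ true
    h w e with S w in e′
    ... | true = refl
    ... | false rewrite c-fixed u w e′ with g (c u w)
    h w () | false | true
    h w () | false | false

  module Few (u₀ : Fin n) (u₀-moved : ¬ f u₀ ≡ u₀) (N : ℕ) (N-big : 100000000000000000 ≤ N)
    (few : N * s + 1 ≤ n) where

    Su₀ : S u₀ ≡ true
    Su₀ rewrite ≢⇒== (f u₀) u₀ u₀-moved = refl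

    s>0 : 0 < s
    s>0 = ∃-# S u₀ Su₀

    miss≤3s : ∀ g u v → miss g u v ≤ 3 * s
    miss≤3s g u v = ≤-trans (miss≤3 g u v u₀ (f u₀) (λ e → u₀-moved (sym (diag _ _ e))))
      (*-monoʳ-≤ 3 (miss-f g u₀))

    -- Double counting of the pairs `w`, `v` such that `w` has colour `j` from `u₀` but not from
    -- `v`: each of the `k j` choices of `w` has `n ∸ k j` partners, each `v` at most `3 * s`. A
    -- valency is therefore close to 0 or to `n`.
    unbalanced : ∀ j → k j * (n ∸ k j) ≤ n * (3 * s)
    unbalanced j = begin
      k j * (n ∸ k j)                                              ≡⟨ cong (_* (n ∸ k j)) (sym (k-# j u₀)) ⟩
      # (λ w → c u₀ w == j) * (n ∸ k j)                            ≡⟨ sym (∑-*ʳ (n ∸ k j) (λ w → ⟪ c u₀ w == j ⟫)) ⟩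
      ∑ (λ w → ⟪ c u₀ w == j ⟫ * (n ∸ k j))                         ≡⟨ ∑-cong (λ w → trans (cong (⟪ c u₀ w == j ⟫ *_) (sym (others w)))
                                                                        (trans (sym (∑-*ˡ ⟪ c u₀ w == j ⟫ (λ v → ⟪ not (c v w == j) ⟫)))
                                                                               (∑-cong (λ v → sym (⟪∧⟫ (c u₀ w == j) (not (c v w == j))))))) ⟩
      ∑ (λ w → ∑ (λ v → ⟪ (c u₀ w == j) ∧ not (c v w == j) ⟫))      ≡⟨ ∑-swap (λ w v → ⟪ (c u₀ w == j) ∧ not (c v w == j) ⟫) ⟩
      ∑ (λ v → miss (_== j) u₀ v)                                   ≤⟨ ∑-mono (λ v → miss≤3s (_== j) u₀ v) ⟩
      ∑ {n} (λ v → 3 * s)                                           ≡⟨ ∑-const n (3 * s) ⟩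
      n * (3 * s) ∎
      where
      open ≤-Reasoning
      others : ∀ w → # (λ v → not (c v w == j)) ≡ n ∸ k j
      others w = trans (sym (m+n∸m≡n (k j) _)) (cong (_∸ k j)
        (trans (cong (_+ # (λ v → not (c v w == j))) (sym (trans (k-in j w) (k-st j)))) (#-not (λ v → c v w == j))))

    k≤n : ∀ j → k j ≤ n
    k≤n j = subst (_≤ n) (k-# j u₀) (subst (# (λ w → c u₀ w == j) ≤_) (#-not (λ w → c u₀ w == j)) (m≤m+n _ _))

    light-or-heavy : ∀ j → k j ≤ 6 * s ⊎ n ≤ k j + 6 * s
    light-or-heavy j with n ≤? 2 * k j
    ... | yes h = inj₂ (subst (_≤ k j + 6 * s) (m+[n∸m]≡n (k≤n j)) (+-monoʳ-≤ (k j)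
      (half-light (k j) (n ∸ k j) n s (≤-reflexive (m+[n∸m]≡n (k≤n j))) (unbalanced j) h)))
    ... | no ¬h = inj₁ (half-light (n ∸ k j) (k j) n s (≤-reflexive (m∸n+n≡m (k≤n j)))
      (subst (_≤ n * (3 * s)) (*-comm (k j) _) (unbalanced j))
      (some-half (k j) (n ∸ k j) n (≤-reflexive (sym (m+[n∸m]≡n (k≤n j)))) (subst (_≤ n) (+-comm 1 _) (≰⇒> ¬h))))

    -- Four valencies of at most `6 * s` cannot add up to `n`. The diagonal, of valency 1, is too
    -- small to be the exception.
    heavy : ∃[ d ] (¬ d ≡ o × n ≤ k d + 6 * s)
    heavy with FP.any? (λ d → n ≤? k d + 6 * s)
    ... | yes (d , h) = d , (λ { refl → not-one-heavy n s N (subst (λ z → n ≤ z + 6 * s) k-o h) s>0 few N-big }) , h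
    ... | no ¬h = ⊥-elim (not-all-light _ _ _ _ n s N (≤-reflexive (sym k-sum)) (l zero) (l (suc zero)) (l (suc (suc zero))) (l (suc (suc (suc zero)))) few N-big)
      where
      l : ∀ j → k j ≤ 6 * s
      l j with light-or-heavy j
      ... | inj₁ h = h
      ... | inj₂ h = ⊥-elim (¬h (j , h))

-- The graph of light colours

two-heavy : ∀ a b d n s N →
  d ≤ a →
  1 + (a + (b + (d + 0))) ≤ n →
  n ≤ d + 6 * s →
  N * s + 1 ≤ n →
  100000000000000000 ≤ N →
  ⊥
two-heavy a b d n s N h1 h2 h3 h4 h5 = refute (a ∷ b ∷ d ∷ n ∷ s ∷ N ∷ []) (λ { (a ∷ b ∷ d ∷ n ∷ s ∷ N ∷ []) →
    d :≤ a [ con 3 ] ∷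
    con 1 :+ (a :+ (b :+ (d :+ con 0))) :≤ n [ con 49999999999999997 ] ∷
    n :≤ d :+ con 6 :* s [ con 50000000000000000 ] ∷
    N :* s :+ con 1 :≤ n [ con 3 ] ∷
    con 100000000000000000 :≤ N [ con 3 :* s ] ∷
    [] })
  refl (h1 ∷ h2 ∷ h3 ∷ h4 ∷ h5 ∷ [])

K-light : ∀ a b d n s K →
  1 + (a + (b + (d + 0))) ≤ n →
  n ≤ d + 6 * s →
  K ≤ a + b →
  K + 1 ≤ 6 * s
K-light a b d n s K h1 h2 h3 = prove (a ∷ b ∷ d ∷ n ∷ s ∷ K ∷ []) (λ { (a ∷ b ∷ d ∷ n ∷ s ∷ K ∷ []) →
    con 1 :+ (a :+ (b :+ (d :+ con 0))) :≤ n [ con 1 ] ∷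
    n :≤ d :+ con 6 :* s [ con 1 ] ∷
    K :≤ a :+ b [ con 1 ] ∷
    [] })
  (λ { (a ∷ b ∷ d ∷ n ∷ s ∷ K ∷ []) → K :+ con 1 :≤ con 6 :* s [ con 1 ] })
  refl (h1 ∷ h2 ∷ h3 ∷ [])

half-heavy : ∀ d n s N →
  n ≤ d + 6 * s →
  N * s + 1 ≤ n →
  100000000000000000 ≤ N →
  n ≤ 2 * d
half-heavy d n s N h1 h2 h3 = prove (d ∷ n ∷ s ∷ N ∷ []) (λ { (d ∷ n ∷ s ∷ N ∷ []) →
    n :≤ d :+ con 6 :* s [ con 50000000000000000 ] ∷
    N :* s :+ con 1 :≤ n [ con 3 ] ∷
    con 100000000000000000 :≤ N [ con 3 :* s ] ∷
    [] })
  (λ { (d ∷ n ∷ s ∷ N ∷ []) → n :≤ con 2 :* d [ con 49999999999999997 ] })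
  refl (h1 ∷ h2 ∷ h3 ∷ [])

n-le : ∀ a b d n K →
  n ≤ 1 + (a + (b + (d + 0))) →
  a + b ≤ K →
  n ≤ d + K + 1
n-le a b d n K h1 h2 = prove (a ∷ b ∷ d ∷ n ∷ K ∷ []) (λ { (a ∷ b ∷ d ∷ n ∷ K ∷ []) →
    n :≤ con 1 :+ (a :+ (b :+ (d :+ con 0))) [ con 1 ] ∷
    a :+ b :≤ K [ con 1 ] ∷
    [] })
  (λ { (a ∷ b ∷ d ∷ n ∷ K ∷ []) → n :≤ d :+ K :+ con 1 [ con 1 ] })
  refl (h1 ∷ h2 ∷ [])

K-large : ∀ d n s N M K →
  n ≤ d + K + 1 →
  d * M ≤ K * K →
  1 ≤ M →
  1 ≤ s →
  N * s + 1 ≤ n →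
  100000000000000000 ≤ N →
  K ≤ 200000000 →
  ⊥
K-large d n s N M K h1 h2 h3 h4 h5 h6 h7 = refute (d ∷ n ∷ s ∷ N ∷ M ∷ K ∷ []) (λ { (d ∷ n ∷ s ∷ N ∷ M ∷ K ∷ []) →
    n :≤ d :+ K :+ con 1 [ con 100000000000000000 ] ∷
    d :* M :≤ K :* K [ con 100000000000000000 ] ∷
    con 1 :≤ M [ con 100000000000000000 :* d ] ∷
    con 1 :≤ s [ con 100000000000000000 :* N ] ∷
    N :* s :+ con 1 :≤ n [ con 100000000000000000 ] ∷
    con 100000000000000000 :≤ N [ con 59999999800000000 :+ con 200000001 :* K ] ∷
    K :≤ con 200000000 [ con 100000000000000000 :* K :+ con 200000001 :* N ] ∷
    [] })
  refl (h1 ∷ h2 ∷ h3 ∷ h4 ∷ h5 ∷ h6 ∷ h7 ∷ [])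

M-small′ : ∀ d n s N M K →
  d * M ≤ K * K →
  K + 1 ≤ 6 * s →
  N * s + 1 ≤ n →
  n ≤ 2 * d →
  d * (N * M) ≤ d * (12 * K)
M-small′ d n s N M K h1 h2 h3 h4 = prove (d ∷ n ∷ s ∷ N ∷ M ∷ K ∷ []) (λ { (d ∷ n ∷ s ∷ N ∷ M ∷ K ∷ []) →
    d :* M :≤ K :* K [ N ] ∷
    K :+ con 1 :≤ con 6 :* s [ K :* N ] ∷
    N :* s :+ con 1 :≤ n [ con 6 :* K ] ∷
    n :≤ con 2 :* d [ con 6 :* K ] ∷
    [] })
  (λ { (d ∷ n ∷ s ∷ N ∷ M ∷ K ∷ []) → d :* (N :* M) :≤ d :* (con 12 :* K) [ con 1 ] })
  refl (h1 ∷ h2 ∷ h3 ∷ h4 ∷ [])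

M-small : ∀ N M K →
  N * M ≤ 12 * K →
  100000000000000000 ≤ N →
  100000000 * M ≤ K
M-small N M K h1 h2 = prove (N ∷ M ∷ K ∷ []) (λ { (N ∷ M ∷ K ∷ []) →
    N :* M :≤ con 12 :* K [ con 1 ] ∷
    con 100000000000000000 :≤ N [ M ] ∷
    [] })
  (λ { (N ∷ M ∷ K ∷ []) → con 100000000 :* M :≤ K [ con 1000000000 ] })
  refl (h1 ∷ h2 ∷ [])

sM-small : ∀ d n s N M K →
  d * M ≤ K * K →
  N * s + 1 ≤ n →
  n ≤ 2 * d →
  N * (s * M) ≤ 2 * (K * K)
sM-small d n s N M K h1 h2 h3 = prove (d ∷ n ∷ s ∷ N ∷ M ∷ K ∷ []) (λ { (d ∷ n ∷ s ∷ N ∷ M ∷ K ∷ []) →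
    d :* M :≤ K :* K [ con 2 ] ∷
    N :* s :+ con 1 :≤ n [ M ] ∷
    n :≤ con 2 :* d [ M ] ∷
    [] })
  (λ { (d ∷ n ∷ s ∷ N ∷ M ∷ K ∷ []) → N :* (s :* M) :≤ con 2 :* (K :* K) [ con 1 ] })
  refl (h1 ∷ h2 ∷ h3 ∷ [])

error-small : ∀ s N M K e →
  N * (s * M) ≤ 2 * (K * K) →
  100000000000000000 ≤ N →
  200000000 ≤ K →
  e ≤ K + s * M →
  100000000 * e ≤ K * K
error-small s N M K e h1 h2 h3 h4 = prove (s ∷ N ∷ M ∷ K ∷ e ∷ []) (λ { (s ∷ N ∷ M ∷ K ∷ e ∷ []) →
    N :* (s :* M) :≤ con 2 :* (K :* K) [ con 1 ] ∷
    con 100000000000000000 :≤ N [ M :* s ] ∷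
    con 200000000 :≤ K [ con 99999999600000000 :+ con 999999998 :* K ] ∷
    e :≤ K :+ s :* M [ con 100000000000000000 ] ∷
    [] })
  (λ { (s ∷ N ∷ M ∷ K ∷ e ∷ []) → con 100000000 :* e :≤ K :* K [ con 1000000000 ] })
  refl (h1 ∷ h2 ∷ h3 ∷ h4 ∷ [])

two-thirds : ∀ K M t x y →
  K ≤ M + x →
  x ≤ 3 * y →
  t + y ≤ K →
  3 * t ≤ 2 * K + M
two-thirds K M t x y h1 h2 h3 = prove (K ∷ M ∷ t ∷ x ∷ y ∷ []) (λ { (K ∷ M ∷ t ∷ x ∷ y ∷ []) →
    K :≤ M :+ x [ con 1 ] ∷
    x :≤ con 3 :* y [ con 1 ] ∷
    t :+ y :≤ K [ con 3 ] ∷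
    [] })
  (λ { (K ∷ M ∷ t ∷ x ∷ y ∷ []) → con 3 :* t :≤ con 2 :* K :+ M [ con 1 ] })
  refl (h1 ∷ h2 ∷ h3 ∷ [])

one-half : ∀ K M t x y →
  K ≤ M + x →
  x ≤ y + y →
  t + y ≤ K →
  2 * t ≤ K + M
one-half K M t x y h1 h2 h3 = prove (K ∷ M ∷ t ∷ x ∷ y ∷ []) (λ { (K ∷ M ∷ t ∷ x ∷ y ∷ []) →
    K :≤ M :+ x [ con 1 ] ∷
    x :≤ y :+ y [ con 1 ] ∷
    t :+ y :≤ K [ con 2 ] ∷
    [] })
  (λ { (K ∷ M ∷ t ∷ x ∷ y ∷ []) → con 2 :* t :≤ K :+ M [ con 1 ] })
  refl (h1 ∷ h2 ∷ h3 ∷ [])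

pattern O = zero
pattern A = suc zero
pattern B = suc (suc zero)
pattern D = suc (suc (suc zero))

light : Fin 4 → Bool
light O = false
light A = true
light B = true
light D = false

A≢O : ¬ _≡_ {A = Fin 4} A O
A≢O ()

∧-true : ∀ {a b} → a ≡ true → b ≡ true → a ∧ b ≡ true
∧-true refl refl = refl

∧-left : ∀ {a b} → a ∧ b ≡ true → a ≡ true
∧-left {true} _ = refl

∧-right : ∀ {a b} → a ∧ b ≡ true → b ≡ true
∧-right {true} e = e

-- 10^17 exceeds 4 R² for R = 10^8, the relative precision of the estimates M-tiny and error-tiny below.
record Setting (n : ℕ) : Set where
  field
    X        : Scheme n
    o≡O      : Scheme.o X ≡ O
    f        : Fin n → Fin n
    f-col    : ∀ u v → Scheme.c X (f u) (f v) ≡ Scheme.c X u v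
    u₀       : Fin n
    u₀-moved : ¬ f u₀ ≡ u₀
    N        : ℕ
    N-big    : 100000000000000000 ≤ N
    few      : N * Moving.s X f f-col + 1 ≤ n
    heavy-D  : n ≤ Basic.k X D + 6 * Moving.s X f f-col

module Sparse {n : ℕ} (E : Setting n) where
  open Setting E public using (X; o≡O; f; f-col; u₀; u₀-moved; N; N-big; few; heavy-D)
  open Basic X public
  open Moving X f f-col public
  open Few u₀ u₀-moved N N-big few public using (Su₀; s>0)

  loop′ : ∀ u → c u u ≡ O
  loop′ u = trans (loop u) o≡O

  diag′ : ∀ u v → c u v ≡ O → u ≡ v
  diag′ u v e = diag u v (trans e (sym o≡O))

  k-total : 1 + (k A + (k B + (k D + 0))) ≡ n
  k-total = trans (cong (_+ (k A + (k B + (k D + 0)))) (trans (sym k-o) (cong k o≡O))) k-sum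

  st-O : st O ≡ O
  st-O = subst (λ i → st i ≡ i) o≡O st-o

  -- A light converse would have the valency of `D`, and two heavy colours do not fit into `n`.
  st-D : st D ≡ D
  st-D with st D in e
  ... | D = refl
  ... | O with () ← trans (sym (st-st D)) (trans (cong st e) st-O)
  ... | A = ⊥-elim (two-heavy (k A) (k B) (k D) n s N
      (≤-reflexive (trans (sym (k-st D)) (cong k e))) (≤-reflexive k-total) heavy-D few N-big)
  ... | B = ⊥-elim (two-heavy (k B) (k A) (k D) n s N
      (≤-reflexive (trans (sym (k-st D)) (cong k e)))
      (≤-reflexive (trans (cong suc (swap (k B) (k A) (k D + 0))) k-total)) heavy-D few N-big)
    where
    swap : ∀ x y z → x + (y + z) ≡ y + (x + z)
    swap x y z = trans (sym (+-assoc x y z)) (trans (cong (_+ z) (+-comm x y)) (+-assoc y x z))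

  light-st : ∀ i → light (st i) ≡ light i
  light-st O = cong light st-O
  light-st D = cong light st-D
  light-st A with st A in e
  ... | A = refl
  ... | B = refl
  ... | O with () ← trans (sym (st-st A)) (trans (cong st e) st-O)
  ... | D with () ← trans (sym (st-st A)) (trans (cong st e) st-D)
  light-st B with st B in e
  ... | A = refl
  ... | B = refl
  light-st B | O with () ← trans (sym (st-st B)) (trans (cong st e) st-O)
  light-st B | D with () ← trans (sym (st-st B)) (trans (cong st e) st-D)

  adj : V → V → Bool
  adj u v = light (c u v)

  adj-sym : ∀ u v → adj u v ≡ adj v u
  adj-sym u v = sym (trans (cong light (conv u v)) (light-st (c u v)))

  far : ∀ u v → ¬ u ≡ v → adj u v ≡ false → c u v ≡ D
  far u v ne e with c u v in e′
  ... | O = ⊥-elim (ne (diag′ u v e′))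
  ... | D = refl

  K : ℕ
  K = val light

  comm : V → V → ℕ
  comm = both light

  cc : Fin 4 → ℕ
  cc = bothC light

  M : ℕ
  M = cc D

  comm-cc : ∀ {u v t} → c u v ≡ t → comm u v ≡ cc t
  comm-cc {u} {v} e = trans (both-C light u v) (cong cc e)

  K≡ : K ≡ k A + k B
  K≡ = begin
    K                                               ≡⟨ sym (val-# light u₀) ⟩
    # (λ w → light (c u₀ w))                        ≡⟨ ∑-cong (λ w → h (c u₀ w)) ⟩
    ∑ (λ w → ⟪ c u₀ w == A ⟫ + ⟪ c u₀ w == B ⟫)     ≡⟨ ∑-+ (λ w → ⟪ c u₀ w == A ⟫) _ ⟩
    # (λ w → c u₀ w == A) + # (λ w → c u₀ w == B)   ≡⟨ cong₂ _+_ (k-# A u₀) (k-# B u₀) ⟩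
    k A + k B                                       ∎
    where
    open ≡-Reasoning
    h : ∀ i → ⟪ light i ⟫ ≡ ⟪ i == A ⟫ + ⟪ i == B ⟫
    h O = refl
    h A = refl
    h B = refl
    h D = refl

  -- Counts the two-step light walks from `u₀`: there are `K * K`, and `M` of them end at each
  -- vertex of colour `D`.
  DM≤KK : k D * M ≤ K * K
  DM≤KK = begin
    k D * M                                             ≡⟨ cong (_* M) (sym (k-# D u₀)) ⟩
    # (λ v → c u₀ v == D) * M                           ≡⟨ sym (∑-*ʳ M (λ v → ⟪ c u₀ v == D ⟫)) ⟩
    ∑ (λ v → ⟪ c u₀ v == D ⟫ * M)                       ≤⟨ ∑-mono h ⟩
    ∑ (λ v → comm u₀ v)                                 ≡⟨ ∑-swap (λ v w → ⟪ adj u₀ w ∧ adj v w ⟫) ⟩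
    ∑ (λ w → ∑ (λ v → ⟪ adj u₀ w ∧ adj v w ⟫))          ≡⟨ ∑-cong (λ w → trans (∑-cong (λ v → trans (⟪∧⟫ (adj u₀ w) (adj v w))
                                                             (cong (λ b → ⟪ adj u₀ w ⟫ * ⟪ b ⟫) (adj-sym v w))))
                                                             (trans (∑-*ˡ ⟪ adj u₀ w ⟫ (λ v → ⟪ adj w v ⟫)) (cong (⟪ adj u₀ w ⟫ *_) (val-# light w)))) ⟩
    ∑ (λ w → ⟪ adj u₀ w ⟫ * K)                          ≡⟨ ∑-*ʳ K (λ w → ⟪ adj u₀ w ⟫) ⟩
    # (λ w → adj u₀ w) * K                              ≡⟨ cong (_* K) (val-# light u₀) ⟩
    K * K                                               ∎
    where
    open ≤-Reasoning
    h : ∀ v → ⟪ c u₀ v == D ⟫ * M ≤ comm u₀ v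
    h v with c u₀ v == D in e
    ... | false = z≤n
    ... | true  = ≤-reflexive (trans (+-identityʳ M) (sym (comm-cc (==⇒≡ _ _ e))))

  -- The last light step of an A-path reaching colour D.
  two-step : ∃[ u ] ∃[ w ] ∃[ v ] (c u v ≡ D × adj u w ≡ true × c w v ≡ A)
  two-step with occ D
  ... | u , v , uv = walk (conn A (λ e → A≢O (trans e o≡O)) u v) (inj₁ refl)
    where
    walk : ∀ {x} → Star (λ x y → c x y ≡ A) x v → u ≡ x ⊎ adj u x ≡ true →
      ∃[ u ] ∃[ w ] ∃[ v ] (c u v ≡ D × adj u w ≡ true × c w v ≡ A)
    walk ε (inj₁ refl) with () ← trans (sym uv) (loop′ u)
    walk ε (inj₂ e) with () ← trans (sym (cong light uv)) e
    walk (_◅_ {j = y} xy p) (inj₁ refl) = walk p (inj₂ (cong light xy))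
    walk {x} (_◅_ {j = y} xy p) (inj₂ e) with c u y in uy
    ... | D = u , x , y , uy , e , xy
    ... | O = walk p (inj₁ (diag′ u y uy))
    ... | A = walk p (inj₂ (cong light uy))
    ... | B = walk p (inj₂ (cong light uy))

  M>0 : 1 ≤ M
  M>0 with two-step
  ... | u , w , v , uv , uw , wv = subst (1 ≤_) (comm-cc uv)
    (∃-# (λ x → adj u x ∧ adj v x) w (∧-true uw (trans (adj-sym v w) (cong light wv))))

  private
    n≤2D : n ≤ 2 * k D
    n≤2D = half-heavy (k D) n s N heavy-D few N-big

  opaque
    -- As `M` is positive, `DM≤KK` gives `k D ≤ K * K`, so `n` is at most about the square of `K`,
    -- while `n` exceeds 10^17.
    K-big : 200000000 ≤ K
    K-big with 200000000 ≤? K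
    ... | yes h = h
    ... | no ¬h = ⊥-elim (K-large (k D) n s N M K
        (n-le (k A) (k B) (k D) n K (≤-reflexive (sym k-total)) (≤-reflexive (sym K≡))) DM≤KK M>0 s>0 few N-big (<⇒≤ (≰⇒> ¬h)))

  opaque
    -- `DM≤KK` with `K` below `6 * s` and `k D` at least half of `n`, which exceeds `N * s`, gives
    -- `N * M ≤ 12 * K`.
    M-tiny : 100000000 * M ≤ K
    M-tiny = M-small N M K (*-cancelˡ-≤ (k D) {{>-nonZero (k>0 D)}}
      (M-small′ (k D) n s N M K DM≤KK
        (K-light (k A) (k B) (k D) n s K (≤-reflexive k-total) heavy-D (≤-reflexive K≡)) few n≤2D)) N-big

  -- The two-step walks from `u` that do not end at a light neighbour: `K` closed ones, and at most
  -- `M` for each of the `s` possible ends of colour `D`.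
  err : ℕ
  err = K + s * M

  opaque
    error-tiny : 100000000 * err ≤ K * K
    error-tiny = error-small s N M K err (sM-small (k D) n s N M K DM≤KK few n≤2D) N-big K-big ≤-refl

  -- Of two vertices of colour `D`, one has at least `K - M` neighbours that the other lacks; by the
  -- three-step bound a pair of colour `t` differs by at least a third of that.
  comm≤⅔ : ∀ t → ¬ t ≡ O → 3 * cc t ≤ 2 * K + M
  comm≤⅔ t t≢O with occ t | occ D
  ... | u , v , uv | x , y , xy = two-thirds K M (cc t) (miss light x y) (miss light u v)
    (≤-reflexive (trans (both+miss light x y) (cong (_+ miss light x y) (comm-cc xy))))
    (miss≤3 light x y u v (λ e → t≢O (trans (sym uv) (trans e o≡O))))
    (≤-reflexive (trans (cong (_+ miss light u v) (sym (comm-cc uv))) (sym (both+miss light u v))))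

  degS : V → ℕ
  degS u = # (λ w → S w ∧ adj u w)

  degSC : Fin 4 → V → ℕ
  degSC i u = # (λ w → S w ∧ (c u w == i))

  degS≡ : ∀ u → degS u ≡ degSC A u + degSC B u
  degS≡ u = trans (∑-cong (λ w → h (S w) (c u w))) (∑-+ (λ w → ⟪ S w ∧ (c u w == A) ⟫) _)
    where
    h : ∀ b i → ⟪ b ∧ light i ⟫ ≡ ⟪ b ∧ (i == A) ⟫ + ⟪ b ∧ (i == B) ⟫
    h false i = refl
    h true  O = refl
    h true  A = refl
    h true  B = refl
    h true  D = refl

  -- A fixed `g`-neighbour of `u` is a `g`-neighbour of `f u` as well, and the remaining ones are
  -- moved.
  deg-lower : ∀ g u → val g ≤ # (λ w → S w ∧ g (c u w)) + both g u (f u)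
  deg-lower g u = subst₂ _≤_ (val-# g u) (∑-+ (λ w → ⟪ S w ∧ g (c u w) ⟫) _) (∑-mono h)
    where
    h : ∀ w → ⟪ g (c u w) ⟫ ≤ ⟪ S w ∧ g (c u w) ⟫ + ⟪ g (c u w) ∧ g (c (f u) w) ⟫
    h w with S w in e
    ... | true = m≤m+n _ _
    ... | false rewrite c-fixed u w e with g (c u w)
    ...   | true  = ≤-refl
    ...   | false = z≤n

  comm-sum : ∀ u → ∑ (λ w → ⟪ S w ⟫ * comm u w) ≤ err + degSC A u * cc A + degSC B u * cc B
  comm-sum u = begin
    ∑ (λ w → ⟪ S w ⟫ * comm u w)
      ≤⟨ ∑-mono h ⟩
    ∑ (λ w → ⟪ w == u ⟫ * K + ⟪ S w ⟫ * M + ⟪ S w ∧ (c u w == A) ⟫ * cc A + ⟪ S w ∧ (c u w == B) ⟫ * cc B)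
      ≡⟨ ∑-+ (λ w → ⟪ w == u ⟫ * K + ⟪ S w ⟫ * M + ⟪ S w ∧ (c u w == A) ⟫ * cc A) _ ⟩
    ∑ (λ w → ⟪ w == u ⟫ * K + ⟪ S w ⟫ * M + ⟪ S w ∧ (c u w == A) ⟫ * cc A) + ∑ (λ w → ⟪ S w ∧ (c u w == B) ⟫ * cc B)
      ≡⟨ cong₂ _+_ (∑-+ (λ w → ⟪ w == u ⟫ * K + ⟪ S w ⟫ * M) _) (∑-*ʳ (cc B) (λ w → ⟪ S w ∧ (c u w == B) ⟫)) ⟩
    ∑ (λ w → ⟪ w == u ⟫ * K + ⟪ S w ⟫ * M) + ∑ (λ w → ⟪ S w ∧ (c u w == A) ⟫ * cc A) + degSC B u * cc B
      ≡⟨ cong (_+ degSC B u * cc B) (cong₂ _+_ (trans (∑-+ (λ w → ⟪ w == u ⟫ * K) _)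
           (cong₂ _+_ (∑-point u (λ _ → K)) (∑-*ʳ M (λ w → ⟪ S w ⟫)))) (∑-*ʳ (cc A) (λ w → ⟪ S w ∧ (c u w == A) ⟫))) ⟩
    err + degSC A u * cc A + degSC B u * cc B ∎
    where
    open ≤-Reasoning
    h : ∀ w → ⟪ S w ⟫ * comm u w ≤
      ⟪ w == u ⟫ * K + ⟪ S w ⟫ * M + ⟪ S w ∧ (c u w == A) ⟫ * cc A + ⟪ S w ∧ (c u w == B) ⟫ * cc B
    h w with S w
    ... | false = z≤n
    ... | true with c u w in e
    ...   | O rewrite sym (diag′ u w e) | ==-refl u | both-C light u u | loop′ u = ≤-trans (≤-reflexive (cong (_+ 0)
              (trans (trans (cong cc (sym (loop′ u))) (sym (both-C light u u)))
              (trans (#-cong (λ x → ∧-idem (adj u x))) (val-# light u)))))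
            (≤-trans (m≤m+n (K + 0) (M + 0)) (≤-trans (m≤m+n _ 0) (m≤m+n _ 0)))
      where open import Data.Bool.Properties using (∧-idem)
    ...   | A rewrite both-C light u w | e = ≤-trans (m≤n+m (cc A + 0) (⟪ w == u ⟫ * K + (M + 0))) (m≤m+n _ 0)
    ...   | B rewrite both-C light u w | e = m≤n+m (cc B + 0) (⟪ w == u ⟫ * K + (M + 0) + 0)
    ...   | D rewrite both-C light u w | e = ≤-trans (m≤n+m (M + 0) (⟪ w == u ⟫ * K)) (≤-trans (m≤m+n _ 0) (m≤m+n _ 0))

  square-sum : ∑ (λ v → degS v * degS v) ≡ ∑ (λ u → ⟪ S u ⟫ * ∑ (λ w → ⟪ S w ⟫ * comm u w))
  square-sum = begin
    ∑ (λ v → degS v * degS v)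
      ≡⟨ ∑-cong (λ v → trans (sym (∑-*ʳ (degS v) (λ u → ⟪ S u ∧ adj v u ⟫)))
           (∑-cong (λ u → sym (∑-*ˡ ⟪ S u ∧ adj v u ⟫ (λ w → ⟪ S w ∧ adj v w ⟫))))) ⟩
    ∑ (λ v → ∑ (λ u → ∑ (λ w → ⟪ S u ∧ adj v u ⟫ * ⟪ S w ∧ adj v w ⟫)))
      ≡⟨ ∑-swap (λ v u → ∑ (λ w → ⟪ S u ∧ adj v u ⟫ * ⟪ S w ∧ adj v w ⟫)) ⟩
    ∑ (λ u → ∑ (λ v → ∑ (λ w → ⟪ S u ∧ adj v u ⟫ * ⟪ S w ∧ adj v w ⟫)))
      ≡⟨ ∑-cong (λ u → ∑-swap (λ v w → ⟪ S u ∧ adj v u ⟫ * ⟪ S w ∧ adj v w ⟫)) ⟩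
    ∑ (λ u → ∑ (λ w → ∑ (λ v → ⟪ S u ∧ adj v u ⟫ * ⟪ S w ∧ adj v w ⟫)))
      ≡⟨ ∑-cong (λ u → trans (∑-cong (λ w → inner u w)) (∑-*ˡ ⟪ S u ⟫ (λ w → ⟪ S w ⟫ * comm u w))) ⟩
    ∑ (λ u → ⟪ S u ⟫ * ∑ (λ w → ⟪ S w ⟫ * comm u w)) ∎
    where
    open ≡-Reasoning
    bits : ∀ a b x y → ⟪ a ∧ x ⟫ * ⟪ b ∧ y ⟫ ≡ ⟪ a ⟫ * (⟪ b ⟫ * ⟪ x ∧ y ⟫)
    bits false b x y = refl
    bits true false true  y = refl
    bits true false false y = refl
    bits true true  true  y = sym (+-identityʳ _)
    bits true true  false y = refl
    inner : ∀ u w → ∑ (λ v → ⟪ S u ∧ adj v u ⟫ * ⟪ S w ∧ adj v w ⟫) ≡ ⟪ S u ⟫ * (⟪ S w ⟫ * comm u w)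
    inner u w = trans (∑-cong (λ v → trans (bits (S u) (S w) (adj v u) (adj v w))
        (cong₂ (λ x y → ⟪ S u ⟫ * (⟪ S w ⟫ * ⟪ x ∧ y ⟫)) (adj-sym v u) (adj-sym v w))))
      (trans (∑-*ˡ ⟪ S u ⟫ (λ v → ⟪ S w ⟫ * ⟪ adj u v ∧ adj w v ⟫))
        (cong (⟪ S u ⟫ *_) (∑-*ˡ ⟪ S w ⟫ (λ v → ⟪ adj u v ∧ adj w v ⟫))))

  -- Two-step walks inside S: counted by their middle vertex on the left, by their ends on the right.
  walks : ∑ (λ u → ⟪ S u ⟫ * (degS u * degS u)) ≤
          ∑ (λ u → ⟪ S u ⟫ * (err + degSC A u * cc A + degSC B u * cc B))
  walks = ≤-trans (∑-mono h) (≤-trans (≤-reflexive square-sum) (∑-mono (λ u → *-monoʳ-≤ ⟪ S u ⟫ (comm-sum u))))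
    where
    h : ∀ u → ⟪ S u ⟫ * (degS u * degS u) ≤ degS u * degS u
    h u = ≤-trans (*-monoˡ-≤ _ (⟪⟫≤1 (S u))) (≤-reflexive (+-identityʳ _))

  -- The vertex on which most of the case analysis rests: `deg-lower` makes its degree large, while
  -- here, up to `err`, the degree is at most a weighted mean of `cc A` and `cc B`.
  pick : ∃[ u ] (S u ≡ true × degS u * degS u ≤ err + degSC A u * cc A + degSC B u * cc B)
  pick = ∑-pick S (λ u → degS u * degS u) _ (u₀ , Su₀) walks

-- Directed light colours

directed-end : ∀ K M c F d e →
  3 * F ≤ K + M →
  2 * c ≤ K + M →
  K ≤ d + F →
  d * d ≤ e + d * c →
  100000000 * e ≤ K * K →
  100000000 * M ≤ K →
  1 ≤ K →
  ⊥
directed-end K M c F d e h1 h2 h3 h4 h5 h6 h7 = refute (K ∷ M ∷ c ∷ F ∷ d ∷ e ∷ []) (λ { (K ∷ M ∷ c ∷ F ∷ d ∷ e ∷ []) →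
    con 3 :* F :≤ K :+ M [ con 1999999900000000 :* K :+ con 12000000000000000 :* d ] ∷
    con 2 :* c :≤ K :+ M [ con 18000000000000000 :* d ] ∷
    K :≤ d :+ F [ con 5999999700000000 :* K :+ con 36000000000000000 :* d ] ∷
    d :* d :≤ e :+ d :* c [ con 36000000000000000 ] ∷
    con 100000000 :* e :≤ K :* K [ con 360000000 ] ∷
    con 100000000 :* M :≤ K [ con 19999999 :* K :+ con 300000000 :* d ] ∷
    con 1 :≤ K [ con 3999999420000001 :+ con 3999999420000001 :* K ] ∷
    [] })
  refl (h1 ∷ h2 ∷ h3 ∷ h4 ∷ h5 ∷ h6 ∷ h7 ∷ [])

directed-F : ∀ K M c F a →
  F ≤ a + a →
  a + a + a ≤ c →
  2 * c ≤ K + M →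
  3 * F ≤ K + M
directed-F K M c F a h1 h2 h3 = prove (K ∷ M ∷ c ∷ F ∷ a ∷ []) (λ { (K ∷ M ∷ c ∷ F ∷ a ∷ []) →
    F :≤ a :+ a [ con 3 ] ∷
    a :+ a :+ a :≤ c [ con 2 ] ∷
    con 2 :* c :≤ K :+ M [ con 1 ] ∷
    [] })
  (λ { (K ∷ M ∷ c ∷ F ∷ a ∷ []) → con 3 :* F :≤ K :+ M [ con 1 ] })
  refl (h1 ∷ h2 ∷ h3 ∷ [])

directed-FD : ∀ K M F →
  F ≤ M →
  100000000 * M ≤ K →
  3 * F ≤ K + M
directed-FD K M F h1 h2 = prove (K ∷ M ∷ F ∷ []) (λ { (K ∷ M ∷ F ∷ []) →
    F :≤ M [ con 150000000 ] ∷
    con 100000000 :* M :≤ K [ con 1 ] ∷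
    [] })
  (λ { (K ∷ M ∷ F ∷ []) → con 3 :* F :≤ K :+ M [ con 50000000 ] })
  refl (h1 ∷ h2 ∷ [])

module Directed {n : ℕ} (E : Setting n) (stA : Scheme.st (Setting.X E) A ≡ B) where
  open Sparse E

  stB : st B ≡ A
  stB = trans (cong st (sym stA)) (st-st A)

  ccA≡ccB : cc A ≡ cc B
  ccA≡ccB with occ A
  ... | u , v , uv = trans (sym (comm-cc uv)) (trans (#-cong (λ w → ∧-comm (adj u w) (adj v w)))
    (comm-cc (trans (conv u v) (trans (cong st uv) stA))))

  cc-light : ∀ {i} → light i ≡ true → cc i ≡ cc A
  cc-light {A} _ = refl
  cc-light {B} _ = sym ccA≡ccB
  cc-light {D} ()

  miss-light : ∀ {u v} → adj u v ≡ true → K ≡ cc A + miss light u v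
  miss-light {u} {v} e = trans (both+miss light u v) (cong (_+ miss light u v) (trans (both-C light u v) (cc-light e)))

  -- `miss light` has the same value on all light pairs, and the two light steps from `u` over `w`
  -- to `v` must together account for the `K - M` neighbours lost on a pair of colour `D`.
  2c≤K+M : 2 * cc A ≤ K + M
  2c≤K+M with two-step
  ... | u , w , v , uv , uw , wv = one-half K M (cc A) (miss light u v) (miss light u w)
    (≤-reflexive (trans (both+miss light u v) (cong (_+ miss light u v) (comm-cc uv))))
    (≤-trans (miss-trans light u w v) (+-monoʳ-≤ _ (≤-reflexive (+-cancelˡ-≡ (cc A) _ _
      (trans (sym (miss-light (cong light wv))) (miss-light uw))))))
    (≤-reflexive (sym (miss-light uw)))

  pAB pBB : ℕ
  pAB = p A B A
  pBB = p B B A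

  -- Here `A` orients the light graph. `p A A A`, `pAB` and `pBB` count the transitive triangles on
  -- an arc according to which of the three arcs of the triangle it is; every transitive triangle
  -- has one arc of each kind, so the numbers agree.
  pAA≡pAB : p A A A ≡ pAB
  pAA≡pAB = *-cancelˡ-≡ _ _ (k A) {{>-nonZero (k>0 A)}} (trans (triangle A A A) (cong (λ i → k A * p A i A) stA))

  pBB≡pAB : pBB ≡ pAB
  pBB≡pAB = trans (p-swap B B A) (trans (cong (p B B) stA) (trans
    (*-cancelˡ-≡ _ _ (k B) {{>-nonZero (k>0 B)}} (trans (triangle B B B) (cong (λ i → k B * p B i B) stB)))
    (trans (p-swap B A B) (cong (p A B) stB))))

  -- The three transitive kinds are disjoint among the common neighbours; the fourth kind, the
  -- cyclic triangles, is dropped.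
  3p≤c : pAB + pAB + pAB ≤ cc A
  3p≤c with occ A
  ... | u , v , uv = begin
    pAB + pAB + pAB
      ≡⟨ cong₂ (λ x y → x + y + pAB) (sym pAA≡pAB) (sym pBB≡pAB) ⟩
    p A A A + p B B A + p A B A
      ≡⟨ cong₂ _+_ (cong₂ _+_ (q A A) (q B B)) (q A B) ⟩
    # (h A A) + # (h B B) + # (h A B)
      ≡⟨ sym (trans (∑-+ (λ w → ⟪ h A A w ⟫ + ⟪ h B B w ⟫) (λ w → ⟪ h A B w ⟫))
           (cong (_+ # (h A B)) (∑-+ (λ w → ⟪ h A A w ⟫) (λ w → ⟪ h B B w ⟫)))) ⟩
    ∑ (λ w → ⟪ h A A w ⟫ + ⟪ h B B w ⟫ + ⟪ h A B w ⟫)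
      ≤⟨ ∑-mono (λ w → bound (c u w) (c v w)) ⟩
    comm u v
      ≡⟨ comm-cc uv ⟩
    cc A ∎
    where
    open ≤-Reasoning
    h : Fin 4 → Fin 4 → V → Bool
    h i j w = (c u w == i) ∧ (c v w == j)
    q : ∀ i j → p i j A ≡ # (h i j)
    q i j = trans (cong (p i j) (sym uv)) (sym (coh i j u v))
    bound : ∀ x y → ⟪ (x == A) ∧ (y == A) ⟫ + ⟪ (x == B) ∧ (y == B) ⟫ + ⟪ (x == A) ∧ (y == B) ⟫ ≤ ⟪ light x ∧ light y ⟫
    bound O _ = z≤n
    bound D _ = z≤n
    bound A O = z≤n
    bound A A = ≤-refl
    bound A B = ≤-refl
    bound A D = z≤n
    bound B O = z≤n
    bound B A = z≤n
    bound B B = ≤-refl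
    bound B D = z≤n

  F : V → ℕ
  F u = # (λ w → not (S w) ∧ adj u w)

  K≤degS+F : ∀ u → K ≤ degS u + F u
  K≤degS+F u = ≤-trans (≤-reflexive (sym (val-# light u))) (≤-trans
    (≤-reflexive (#-split (adj u) S)) (≤-reflexive (cong₂ _+_ (#-cong (λ w → ∧-comm (adj u w) (S w)))
      (#-cong (λ w → ∧-comm (adj u w) (not (S w)))))))

  F≤ : ∀ u → F u ≤ p A A (c u (f u)) + p B B (c u (f u))
  F≤ u = begin
    F u                                            ≤⟨ ∑-mono h ⟩
    ∑ (λ w → ⟪ (c u w == A) ∧ (c (f u) w == A) ⟫ + ⟪ (c u w == B) ∧ (c (f u) w == B) ⟫)
      ≡⟨ ∑-+ (λ w → ⟪ (c u w == A) ∧ (c (f u) w == A) ⟫) _ ⟩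
    # (λ w → (c u w == A) ∧ (c (f u) w == A)) + # (λ w → (c u w == B) ∧ (c (f u) w == B))
      ≡⟨ cong₂ _+_ (coh A A u (f u)) (coh B B u (f u)) ⟩
    p A A (c u (f u)) + p B B (c u (f u)) ∎
    where
    open ≤-Reasoning
    h : ∀ w → ⟪ not (S w) ∧ adj u w ⟫ ≤ ⟪ (c u w == A) ∧ (c (f u) w == A) ⟫ + ⟪ (c u w == B) ∧ (c (f u) w == B) ⟫
    h w with S w in e
    ... | true = z≤n
    ... | false rewrite c-fixed u w e with c u w
    ...   | O = z≤n
    ...   | A = ≤-refl
    ...   | B = ≤-refl
    ...   | D = z≤n

  F≤comm : ∀ u → F u ≤ comm u (f u)
  F≤comm u = #-mono h
    where
    h : ∀ w → not (S w) ∧ adj u w ≡ true → adj u w ∧ adj (f u) w ≡ true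
    h w e with S w in e′
    ... | false rewrite c-fixed u w e′ = ∧-true e e

  -- A fixed neighbour has the same colour from `u` and from `f u`, so when these form a light pair
  -- it is counted by two of the three equal transitive numbers: at most two thirds of `cc A`, which
  -- is itself about `K / 2` at most. When they have colour `D`, there are at most `M` such
  -- neighbours.
  3F≤K+M : ∀ u → S u ≡ true → 3 * F u ≤ K + M
  3F≤K+M u Su with c u (f u) in e | F≤ u | F≤comm u
  ... | O | _ | _ = ⊥-elim (moves u Su (sym (diag′ u (f u) e)))
  ... | A | h | _ = directed-F K M (cc A) (F u) pAB (subst (F u ≤_) (cong₂ _+_ pAA≡pAB pBB≡pAB) h) 3p≤c 2c≤K+M
  ... | B | h | _ = directed-F K M (cc A) (F u) pAB (subst (F u ≤_) (cong₂ _+_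
        (trans (trans (p-swap A A B) (cong (p A A) stB)) pAA≡pAB)
        (trans (trans (p-swap B B B) (cong (p B B) stB)) pBB≡pAB)) h) 3p≤c 2c≤K+M
  ... | D | _ | h = directed-FD K M (F u) (subst (F u ≤_) (comm-cc e) h) M-tiny

  -- By `3F≤K+M` the picked vertex has at least about `2 K / 3` moved neighbours, but its degree
  -- should not exceed `cc A` by more than the error, hence not much more than `K / 2`.
  impossible : ⊥
  impossible with pick
  ... | u , Su , h = directed-end K M (cc A) (F u) (degS u) err (3F≤K+M u Su) 2c≤K+M (K≤degS+F u)
    (≤-trans h (≤-reflexive (trans (+-assoc err _ _) (cong (err +_) (trans
      (cong (λ z → degSC A u * cc A + degSC B u * z) (sym ccA≡ccB))
      (trans (sym (*-distribʳ-+ (cc A) (degSC A u) (degSC B u))) (cong (_* cc A) (sym (degS≡ u)))))))))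
    error-tiny M-tiny (≤-trans (s≤s z≤n) K-big)

-- Symmetric light colours

new-nbr : ∀ Kg T q a b h t →
  Kg + T ≤ q + a + b + 1 + 1 →
  a ≤ h →
  b ≤ h →
  2 * h + 2 ≤ Kg + t →
  t + 1 ≤ T →
  1 ≤ q
new-nbr Kg T q a b h t h1 h2 h3 h4 h5 = prove (Kg ∷ T ∷ q ∷ a ∷ b ∷ h ∷ t ∷ []) (λ { (Kg ∷ T ∷ q ∷ a ∷ b ∷ h ∷ t ∷ []) →
    Kg :+ T :≤ q :+ a :+ b :+ con 1 :+ con 1 [ con 1 ] ∷
    a :≤ h [ con 1 ] ∷
    b :≤ h [ con 1 ] ∷
    con 2 :* h :+ con 2 :≤ Kg :+ t [ con 1 ] ∷
    t :+ con 1 :≤ T [ con 1 ] ∷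
    [] })
  (λ { (Kg ∷ T ∷ q ∷ a ∷ b ∷ h ∷ t ∷ []) → con 1 :≤ q [ con 1 ] })
  refl (h1 ∷ h2 ∷ h3 ∷ h4 ∷ h5 ∷ [])

big-T : ∀ K M T a b d l be →
  a + b + d ≤ K + T + M + M →
  l ≤ a →
  l ≤ b →
  l ≤ d →
  be + K + 2 * M ≤ 3 * l →
  be ≤ T
big-T K M T a b d l be h1 h2 h3 h4 h5 = prove (K ∷ M ∷ T ∷ a ∷ b ∷ d ∷ l ∷ be ∷ []) (λ { (K ∷ M ∷ T ∷ a ∷ b ∷ d ∷ l ∷ be ∷ []) →
    a :+ b :+ d :≤ K :+ T :+ M :+ M [ con 1 ] ∷
    l :≤ a [ con 1 ] ∷
    l :≤ b [ con 1 ] ∷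
    l :≤ d [ con 1 ] ∷
    be :+ K :+ con 2 :* M :≤ con 3 :* l [ con 1 ] ∷
    [] })
  (λ { (K ∷ M ∷ T ∷ a ∷ b ∷ d ∷ l ∷ be ∷ []) → be :≤ T [ con 1 ] })
  refl (h1 ∷ h2 ∷ h3 ∷ h4 ∷ h5 ∷ [])

third-T : ∀ K T T1 T2 a b d l t →
  a + b + d ≤ K + T1 + T2 + T →
  l ≤ a →
  l ≤ b →
  l ≤ d →
  K + 3 * t + 1 ≤ 3 * l →
  T1 ≤ t →
  T2 ≤ t →
  t + 1 ≤ T
third-T K T T1 T2 a b d l t h1 h2 h3 h4 h5 h6 h7 = prove (K ∷ T ∷ T1 ∷ T2 ∷ a ∷ b ∷ d ∷ l ∷ t ∷ []) (λ { (K ∷ T ∷ T1 ∷ T2 ∷ a ∷ b ∷ d ∷ l ∷ t ∷ []) →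
    a :+ b :+ d :≤ K :+ T1 :+ T2 :+ T [ con 1 ] ∷
    l :≤ a [ con 1 ] ∷
    l :≤ b [ con 1 ] ∷
    l :≤ d [ con 1 ] ∷
    K :+ con 3 :* t :+ con 1 :≤ con 3 :* l [ con 1 ] ∷
    T1 :≤ t [ con 1 ] ∷
    T2 :≤ t [ con 1 ] ∷
    [] })
  (λ { (K ∷ T ∷ T1 ∷ T2 ∷ a ∷ b ∷ d ∷ l ∷ t ∷ []) → t :+ con 1 :≤ T [ con 1 ] })
  refl (h1 ∷ h2 ∷ h3 ∷ h4 ∷ h5 ∷ h6 ∷ h7 ∷ [])

trans-T : ∀ T T1 T2 a h be t →
  T1 + T2 ≤ a + T →
  a ≤ h →
  be ≤ T1 →
  be ≤ T2 →
  h + t + 1 ≤ 2 * be →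
  t + 1 ≤ T
trans-T T T1 T2 a h be t h1 h2 h3 h4 h5 = prove (T ∷ T1 ∷ T2 ∷ a ∷ h ∷ be ∷ t ∷ []) (λ { (T ∷ T1 ∷ T2 ∷ a ∷ h ∷ be ∷ t ∷ []) →
    T1 :+ T2 :≤ a :+ T [ con 1 ] ∷
    a :≤ h [ con 1 ] ∷
    be :≤ T1 [ con 1 ] ∷
    be :≤ T2 [ con 1 ] ∷
    h :+ t :+ con 1 :≤ con 2 :* be [ con 1 ] ∷
    [] })
  (λ { (T ∷ T1 ∷ T2 ∷ a ∷ h ∷ be ∷ t ∷ []) → t :+ con 1 :≤ T [ con 1 ] })
  refl (h1 ∷ h2 ∷ h3 ∷ h4 ∷ h5 ∷ [])

four-end : ∀ T1 T2 x M H be →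
  T1 + T2 ≤ x + M →
  x ≤ H →
  be ≤ T1 →
  be ≤ T2 →
  H + M + 1 ≤ 2 * be →
  ⊥
four-end T1 T2 x M H be h1 h2 h3 h4 h5 = refute (T1 ∷ T2 ∷ x ∷ M ∷ H ∷ be ∷ []) (λ { (T1 ∷ T2 ∷ x ∷ M ∷ H ∷ be ∷ []) →
    T1 :+ T2 :≤ x :+ M [ con 1 ] ∷
    x :≤ H [ con 1 ] ∷
    be :≤ T1 [ con 1 ] ∷
    be :≤ T2 [ con 1 ] ∷
    H :+ M :+ con 1 :≤ con 2 :* be [ con 1 ] ∷
    [] })
  refl (h1 ∷ h2 ∷ h3 ∷ h4 ∷ h5 ∷ [])

-- Inequalities between sums of indicators, checked on all truth assignments

taut : ∀ k → (Vec Bool k → Bool) → Bool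
taut zero    g = g []
taut (suc k) g = taut k (g ∘ (true ∷_)) ∧ taut k (g ∘ (false ∷_))

taut-sound : ∀ {k} (g : Vec Bool k → Bool) → taut k g ≡ true → ∀ v → g v ≡ true
taut-sound g e []          = e
taut-sound g e (true ∷ v)  = taut-sound (g ∘ (true ∷_)) (∧-left e) v
taut-sound g e (false ∷ v) = taut-sound (g ∘ (false ∷_)) (∧-right {taut _ (g ∘ (true ∷_))} e) v

bits≤ : ∀ {k} (l r : Vec Bool k → ℕ) → taut k (λ v → l v ≤ᵇ r v) ≡ true → ∀ v → l v ≤ r v
bits≤ l r e v = ≤ᵇ⇒≤ (l v) (r v) (subst T (sym (taut-sound (λ v → l v ≤ᵇ r v) e v)) tt)

-- Under `∑-mono` this turns estimates of inclusion and exclusion type into a finite check at each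
-- vertex; `h` carries the known implications and incompatibilities between the memberships.
bits≤-if : ∀ {k} (h : Vec Bool k → Bool) (l r : Vec Bool k → ℕ) →
  taut k (λ v → not (h v) ∨ (l v ≤ᵇ r v)) ≡ true → ∀ v → h v ≡ true → l v ≤ r v
bits≤-if h l r e v hv with h v | taut-sound (λ v → not (h v) ∨ (l v ≤ᵇ r v)) e v
... | true | le = ≤ᵇ⇒≤ (l v) (r v) (subst T (sym le) tt)

implies : ∀ {a b} → (a ≡ true → b ≡ true) → not a ∨ b ≡ true
implies {true}  h = h refl
implies {false} h = refl

∑-+₃ : ∀ {n} (f g h : Fin n → ℕ) → ∑ (λ i → f i + g i + h i) ≡ ∑ f + ∑ g + ∑ h
∑-+₃ f g h = trans (∑-+ (λ i → f i + g i) h) (cong (_+ ∑ h) (∑-+ f g))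

∑-+₄ : ∀ {n} (f g h i : Fin n → ℕ) → ∑ (λ x → f x + g x + h x + i x) ≡ ∑ f + ∑ g + ∑ h + ∑ i
∑-+₄ f g h i = trans (∑-+ (λ x → f x + g x + h x) i) (cong (_+ ∑ i) (∑-+₃ f g h))

∑-+₅ : ∀ {n} (f g h i j : Fin n → ℕ) → ∑ (λ x → f x + g x + h x + i x + j x) ≡ ∑ f + ∑ g + ∑ h + ∑ i + ∑ j
∑-+₅ f g h i j = trans (∑-+ (λ x → f x + g x + h x + i x) j) (cong (_+ ∑ j) (∑-+₄ f g h i))

∨-cases : ∀ {a b} → a ∨ b ≡ true → a ≡ true ⊎ b ≡ true
∨-cases {true}  e = inj₁ refl
∨-cases {false} e = inj₂ e

not-true : ∀ {a} → not a ≡ true → a ≡ false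
not-true {false} _ = refl

false⇒not : ∀ {a} → a ≡ false → not a ≡ true
false⇒not refl = refl

<ᵇ-true : ∀ {a b} → (a <ᵇ b) ≡ true → a < b
<ᵇ-true {a} {b} e = <ᵇ⇒< a b (subst T (sym e) tt)

<ᵇ-false : ∀ {a b} → (a <ᵇ b) ≡ false → b ≤ a
<ᵇ-false {a} {b} e = ≮⇒≥ (λ lt → subst T e (<⇒<ᵇ lt))

code : Bool → Bool → Fin 4
code false false = O
code false true  = A
code true  false = B
code true  true  = D

code-inj : ∀ a b a′ b′ → code a b ≡ code a′ b′ → a ≡ a′ × b ≡ b′
code-inj false false false false _ = refl , refl
code-inj false true  false true  _ = refl , refl
code-inj true  false true  false _ = refl , refl
code-inj true  true  true  true  _ = refl , refl
code-inj false false false true  ()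
code-inj false false true  true  ()
code-inj false true  false false ()
code-inj false true  true  false ()
code-inj true  false false true  ()
code-inj true  false true  true  ()
code-inj true  true  false false ()
code-inj true  true  true  false ()

module Symmetric {n : ℕ} (E : Setting n) (st-id : ∀ i → Scheme.st (Setting.X E) i ≡ i) where
  open Sparse E public

  c-sym : ∀ u v → c u v ≡ c v u
  c-sym u v = sym (trans (conv u v) (st-id (c u v)))

  p-sym : ∀ i j t → p i j t ≡ p j i t
  p-sym i j t = trans (p-swap i j t) (cong (p j i) (st-id t))

  triangle′ : ∀ i j t → k t * p i j t ≡ k i * p t j i
  triangle′ i j t = trans (triangle i j t) (cong (λ x → k i * p t x i) (st-id j))

  p-O : ∀ i t → p i O t ≡ ⟪ t == i ⟫
  p-O i t with occ t
  ... | u , v , refl = trans (sym (coh i O u v)) (trans (∑-cong h) (∑-point v (λ w → ⟪ c u w == i ⟫)))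
    where
    h : ∀ w → ⟪ (c u w == i) ∧ (c v w == O) ⟫ ≡ ⟪ w == v ⟫ * ⟪ c u w == i ⟫
    h w with w == v in e
    ... | true rewrite ==⇒≡ w v e | loop′ v = trans (⟪∧⟫ (c u v == i) true) (*-comm ⟪ c u v == i ⟫ 1)
    ... | false rewrite ≢⇒== (c v w) O (λ e′ → ==⇒≢ w v e (sym (diag′ v w e′))) = trans (⟪∧⟫ (c u w == i) false) (*-zeroʳ ⟪ c u w == i ⟫)

  k-split : ∀ i t → k i ≡ ⟪ t == i ⟫ + p i A t + p i B t + p i D t
  k-split i t with occ t
  ... | u , v , uv = trans (sym (k-# i u)) (trans (∑-cong (λ w → h (c u w == i) (c v w)))
    (trans (∑-+₄ (λ w → ⟪ (c u w == i) ∧ (c v w == O) ⟫) (λ w → ⟪ (c u w == i) ∧ (c v w == A) ⟫)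
                 (λ w → ⟪ (c u w == i) ∧ (c v w == B) ⟫) (λ w → ⟪ (c u w == i) ∧ (c v w == D) ⟫))
      (cong₂ _+_ (cong₂ _+_ (cong₂ _+_ (trans (q O) (p-O i t)) (q A)) (q B)) (q D))))
    where
    q : ∀ j → # (λ w → (c u w == i) ∧ (c v w == j)) ≡ p i j t
    q j = trans (coh i j u v) (cong (p i j) uv)
    h : ∀ b x → ⟪ b ⟫ ≡ ⟪ b ∧ (x == O) ⟫ + ⟪ b ∧ (x == A) ⟫ + ⟪ b ∧ (x == B) ⟫ + ⟪ b ∧ (x == D) ⟫
    h false x = refl
    h true  O = refl
    h true  A = refl
    h true  B = refl
    h true  D = refl

  cc-split : ∀ t → cc t ≡ p A A t + p A B t + p B A t + p B B t
  cc-split t with occ t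
  ... | u , v , uv = trans (sym (comm-cc uv)) (trans (∑-cong (λ w → h (c u w) (c v w)))
    (trans (∑-+₄ (λ w → ⟪ (c u w == A) ∧ (c v w == A) ⟫) (λ w → ⟪ (c u w == A) ∧ (c v w == B) ⟫)
                 (λ w → ⟪ (c u w == B) ∧ (c v w == A) ⟫) (λ w → ⟪ (c u w == B) ∧ (c v w == B) ⟫))
      (cong₂ _+_ (cong₂ _+_ (cong₂ _+_ (q A A) (q A B)) (q B A)) (q B B))))
    where
    q : ∀ i j → # (λ w → (c u w == i) ∧ (c v w == j)) ≡ p i j t
    q i j = trans (coh i j u v) (cong (p i j) uv)
    h : ∀ x y → ⟪ light x ∧ light y ⟫ ≡
      ⟪ (x == A) ∧ (y == A) ⟫ + ⟪ (x == A) ∧ (y == B) ⟫ + ⟪ (x == B) ∧ (y == A) ⟫ + ⟪ (x == B) ∧ (y == B) ⟫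
    h O y = refl
    h D y = refl
    h A O = refl
    h A A = refl
    h A B = refl
    h A D = refl
    h B O = refl
    h B A = refl
    h B B = refl
    h B D = refl

  -- If light pairs have about K/2 common neighbours, then the neighbourhood of a vertex falls
  -- into two parts according to triple intersections, and two vertices lying in the same part
  -- as seen from both u and w would have about K common neighbours.
  module Four (g : Fin 4 → Bool) (g⇒light : ∀ i → g i ≡ true → light i ≡ true) (ℓ h τ β H : ℕ)
    (lo : ∀ i → g i ≡ true → ℓ ≤ cc i) (hi : ∀ i → g i ≡ true → cc i ≤ h) (cc≤H : ∀ i → ¬ i ≡ O → cc i ≤ H)
    (n₁ : 2 * h + 2 ≤ val g + τ) (n₂ : β + K + 2 * M ≤ 3 * ℓ) (n₃ : K + 3 * τ + 1 ≤ 3 * ℓ)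
    (n₄ : h + τ + 1 ≤ 2 * β) (n₅ : H + M + 1 ≤ 2 * β) where

    gd : V → V → Bool
    gd u z = g (c u z)

    lo′ : ∀ {u z} → gd u z ≡ true → ℓ ≤ comm u z
    lo′ {u} {z} e = subst (ℓ ≤_) (sym (both-C light u z)) (lo _ e)

    hi′ : ∀ {u z} → gd u z ≡ true → comm u z ≤ h
    hi′ {u} {z} e = subst (_≤ h) (sym (both-C light u z)) (hi _ e)

    T₃ : V → V → V → ℕ
    T₃ u z z′ = # (λ y → adj u y ∧ (adj z y ∧ adj z′ y))

    T₃-sym : ∀ u z z′ → T₃ u z z′ ≡ T₃ u z′ z
    T₃-sym u z z′ = #-cong (λ y → cong (adj u y ∧_) (∧-comm (adj z y) (adj z′ y)))

    -- A triple overlap above `τ` leaves some `g`-neighbour `y` of `u` that is far from both `z` and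
    -- `z′`. The neighbourhoods of `y`, `z`, `z′` have at least `ℓ` elements each inside that of
    -- `u`, and that of `y` meets the other two in at most `M`; so the overlap of those two is at
    -- least `3 * ℓ - K - 2 * M`, which is at least `β`.
    dichotomy : ∀ u z z′ → gd u z ≡ true → gd u z′ ≡ true → τ < T₃ u z z′ → β ≤ T₃ u z z′
    dichotomy u z z′ uz uz′ lt with #-∃ new (new-nbr (val g) (T₃ u z z′) (# new) (comm u z) (comm u z′) h τ
        total (hi′ uz) (hi′ uz′) n₁ (subst (_≤ T₃ u z z′) (+-comm 1 τ) lt))
      where
      new : V → Bool
      new y = gd u y ∧ (not (adj z y) ∧ (not (adj z′ y) ∧ (not (y == z) ∧ not (y == z′))))
      total : val g + T₃ u z z′ ≤ # new + comm u z + comm u z′ + 1 + 1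
      total = begin
        val g + T₃ u z z′
          ≡⟨ cong (_+ T₃ u z z′) (sym (val-# g u)) ⟩
        # (gd u) + T₃ u z z′
          ≡⟨ sym (∑-+ (λ y → ⟪ gd u y ⟫) _) ⟩
        ∑ (λ y → ⟪ gd u y ⟫ + ⟪ adj u y ∧ (adj z y ∧ adj z′ y) ⟫)
          ≤⟨ ∑-mono (λ y → bits≤-if {6} (λ { (a ∷ b ∷ _) → not a ∨ b })
               (λ { (a ∷ b ∷ x ∷ x′ ∷ _) → ⟪ a ⟫ + ⟪ b ∧ (x ∧ x′) ⟫ })
               (λ { (a ∷ b ∷ x ∷ x′ ∷ e ∷ e′ ∷ []) → ⟪ a ∧ (not x ∧ (not x′ ∧ (not e ∧ not e′))) ⟫ + ⟪ b ∧ x ⟫ + ⟪ b ∧ x′ ⟫ + ⟪ e ⟫ + ⟪ e′ ⟫ })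
               refl (gd u y ∷ adj u y ∷ adj z y ∷ adj z′ y ∷ (y == z) ∷ (y == z′) ∷ []) (implies (g⇒light _))) ⟩
        ∑ (λ y → ⟪ new y ⟫ + ⟪ adj u y ∧ adj z y ⟫ + ⟪ adj u y ∧ adj z′ y ⟫ + ⟪ y == z ⟫ + ⟪ y == z′ ⟫)
          ≡⟨ ∑-+₅ (λ y → ⟪ new y ⟫) _ _ _ _ ⟩
        # new + comm u z + comm u z′ + # (_== z) + # (_== z′)
          ≡⟨ cong₂ (λ a b → # new + comm u z + comm u z′ + a + b) (#-point z) (#-point z′) ⟩
        # new + comm u z + comm u z′ + 1 + 1 ∎
        where open ≤-Reasoning
    ... | y , ny = big-T K M (T₃ u z z′) (comm u z) (comm u z′) (comm u y) ℓ β sum (lo′ uz) (lo′ uz′) (lo′ (∧-left ny)) n₂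
      where
      r₁ = ∧-right {gd u y} ny
      r₂ = ∧-right {not (adj z y)} r₁
      r₃ = ∧-right {not (adj z′ y)} r₂
      zy : c z y ≡ D
      zy = far z y (λ e → ==⇒≢ y z (not-true (∧-left r₃)) (sym e)) (not-true (∧-left r₁))
      z′y : c z′ y ≡ D
      z′y = far z′ y (λ e → ==⇒≢ y z′ (not-true (∧-right {not (y == z)} r₃)) (sym e)) (not-true (∧-left r₂))
      sum : comm u z + comm u z′ + comm u y ≤ K + T₃ u z z′ + M + M
      sum = begin
        comm u z + comm u z′ + comm u y
          ≡⟨ sym (∑-+₃ (λ x → ⟪ adj u x ∧ adj z x ⟫) _ _) ⟩
        ∑ (λ x → ⟪ adj u x ∧ adj z x ⟫ + ⟪ adj u x ∧ adj z′ x ⟫ + ⟪ adj u x ∧ adj y x ⟫)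
          ≤⟨ ∑-mono (λ x → bits≤ {4} (λ { (a ∷ b ∷ d ∷ e ∷ []) → ⟪ a ∧ b ⟫ + ⟪ a ∧ d ⟫ + ⟪ a ∧ e ⟫ })
               (λ { (a ∷ b ∷ d ∷ e ∷ []) → ⟪ a ⟫ + ⟪ a ∧ (b ∧ d) ⟫ + ⟪ b ∧ e ⟫ + ⟪ d ∧ e ⟫ }) refl
               (adj u x ∷ adj z x ∷ adj z′ x ∷ adj y x ∷ [])) ⟩
        ∑ (λ x → ⟪ adj u x ⟫ + ⟪ adj u x ∧ (adj z x ∧ adj z′ x) ⟫ + ⟪ adj z x ∧ adj y x ⟫ + ⟪ adj z′ x ∧ adj y x ⟫)
          ≡⟨ ∑-+₄ (λ x → ⟪ adj u x ⟫) _ _ _ ⟩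
        # (adj u) + T₃ u z z′ + comm z y + comm z′ y
          ≡⟨ cong₂ _+_ (cong₂ _+_ (cong (_+ T₃ u z z′) (val-# light u)) (comm-cc zy)) (comm-cc z′y) ⟩
        K + T₃ u z z′ + M + M ∎
        where open ≤-Reasoning

    near : V → V → V → Bool
    near u z₀ z = (z == z₀) ∨ (τ <ᵇ T₃ u z₀ z)

    -- Three sets of size at least `ℓ` inside a neighbourhood of size `K` cannot all overlap
    -- pairwise in at most `τ`. Hence there are only two parts.
    third : ∀ u z₀ z z′ → gd u z₀ ≡ true → gd u z ≡ true → gd u z′ ≡ true →
      T₃ u z₀ z ≤ τ → T₃ u z₀ z′ ≤ τ → τ < T₃ u z z′
    third u z₀ z z′ a b d l l′ = subst (_≤ T₃ u z z′) (+-comm τ 1)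
      (third-T K (T₃ u z z′) (T₃ u z₀ z) (T₃ u z₀ z′) (comm u z₀) (comm u z) (comm u z′) ℓ τ sum (lo′ a) (lo′ b) (lo′ d) n₃ l l′)
      where
      sum : comm u z₀ + comm u z + comm u z′ ≤ K + T₃ u z₀ z + T₃ u z₀ z′ + T₃ u z z′
      sum = begin
        comm u z₀ + comm u z + comm u z′
          ≡⟨ sym (∑-+₃ (λ x → ⟪ adj u x ∧ adj z₀ x ⟫) _ _) ⟩
        ∑ (λ x → ⟪ adj u x ∧ adj z₀ x ⟫ + ⟪ adj u x ∧ adj z x ⟫ + ⟪ adj u x ∧ adj z′ x ⟫)
          ≤⟨ ∑-mono (λ x → bits≤ {4} (λ { (a ∷ b ∷ d ∷ e ∷ []) → ⟪ a ∧ b ⟫ + ⟪ a ∧ d ⟫ + ⟪ a ∧ e ⟫ })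
               (λ { (a ∷ b ∷ d ∷ e ∷ []) → ⟪ a ⟫ + ⟪ a ∧ (b ∧ d) ⟫ + ⟪ a ∧ (b ∧ e) ⟫ + ⟪ a ∧ (d ∧ e) ⟫ }) refl
               (adj u x ∷ adj z₀ x ∷ adj z x ∷ adj z′ x ∷ [])) ⟩
        ∑ (λ x → ⟪ adj u x ⟫ + ⟪ adj u x ∧ (adj z₀ x ∧ adj z x) ⟫ + ⟪ adj u x ∧ (adj z₀ x ∧ adj z′ x) ⟫ + ⟪ adj u x ∧ (adj z x ∧ adj z′ x) ⟫)
          ≡⟨ ∑-+₄ (λ x → ⟪ adj u x ⟫) _ _ _ ⟩
        # (adj u) + T₃ u z₀ z + T₃ u z₀ z′ + T₃ u z z′
          ≡⟨ cong (λ a → a + T₃ u z₀ z + T₃ u z₀ z′ + T₃ u z z′) (val-# light u) ⟩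
        K + T₃ u z₀ z + T₃ u z₀ z′ + T₃ u z z′ ∎
        where open ≤-Reasoning

    -- By `dichotomy` two subsets of size at least `β` lie among the at most `h` common neighbours
    -- of `u` and `z₀`, so they overlap in more than `τ`.
    chain : ∀ u z₀ z z′ → gd u z₀ ≡ true → gd u z ≡ true → gd u z′ ≡ true →
      τ < T₃ u z₀ z → τ < T₃ u z₀ z′ → τ < T₃ u z z′
    chain u z₀ z z′ a b d l l′ = subst (_≤ T₃ u z z′) (+-comm τ 1)
      (trans-T (T₃ u z z′) (T₃ u z₀ z) (T₃ u z₀ z′) (comm u z₀) h β τ sum (hi′ a)
        (dichotomy u z₀ z a b l) (dichotomy u z₀ z′ a d l′) n₄)
      where
      sum : T₃ u z₀ z + T₃ u z₀ z′ ≤ comm u z₀ + T₃ u z z′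
      sum = subst₂ _≤_ (∑-+ (λ x → ⟪ adj u x ∧ (adj z₀ x ∧ adj z x) ⟫) _) (∑-+ (λ x → ⟪ adj u x ∧ adj z₀ x ⟫) _)
        (∑-mono (λ x → bits≤ {4} (λ { (a ∷ b ∷ d ∷ e ∷ []) → ⟪ a ∧ (b ∧ d) ⟫ + ⟪ a ∧ (b ∧ e) ⟫ })
          (λ { (a ∷ b ∷ d ∷ e ∷ []) → ⟪ a ∧ b ⟫ + ⟪ a ∧ (d ∧ e) ⟫ }) refl
          (adj u x ∷ adj z₀ x ∷ adj z x ∷ adj z′ x ∷ [])))

    same-part : ∀ u z₀ z z′ → gd u z₀ ≡ true → gd u z ≡ true → gd u z′ ≡ true → ¬ z ≡ z′ →
      near u z₀ z ≡ near u z₀ z′ → β ≤ T₃ u z z′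
    same-part u z₀ z z′ a b d ne e = dichotomy u z z′ b d (by-cases e)
      where
      by-cases : near u z₀ z ≡ near u z₀ z′ → τ < T₃ u z z′
      by-cases e with z == z₀ in e₁ | z′ == z₀ in e₂ | τ <ᵇ T₃ u z₀ z in e₃ | τ <ᵇ T₃ u z₀ z′ in e₄
      ... | true  | true  | _ | _ = ⊥-elim (ne (trans (==⇒≡ _ _ e₁) (sym (==⇒≡ _ _ e₂))))
      ... | true  | false | _ | true = subst (λ x → τ < T₃ u x z′) (sym (==⇒≡ _ _ e₁)) (<ᵇ-true e₄)
      ... | false | true  | true | _ = subst (λ x → τ < T₃ u z x) (sym (==⇒≡ _ _ e₂)) (subst (τ <_) (T₃-sym u z₀ z) (<ᵇ-true e₃))
      ... | false | false | true | true = chain u z₀ z z′ a b d (<ᵇ-true e₃) (<ᵇ-true e₄)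
      ... | false | false | false | false = third u z₀ z z′ a b d (<ᵇ-false e₃) (<ᵇ-false e₄)

    -- Each common neighbour is coded by its part as seen from `u` and as seen from `w`. Equal codes
    -- give two overlaps of size `β` among the at most `H` common neighbours of `z` and `z′`; these
    -- are nearly disjoint, because `u` and `w` share only `M` neighbours.
    common≤4 : ∀ u w → c u w ≡ D → # (λ z → gd u z ∧ gd w z) ≤ 4
    common≤4 u w uw with 0 <? # (λ z → gd u z ∧ gd w z)
    ... | no ¬p = ≤-trans (≮⇒≥ ¬p) z≤n
    ... | yes p with #-∃ _ p
    ...   | z₀ , e₀ = #-classes (λ z → gd u z ∧ gd w z) (λ z → code (near u z₀ z) (near w z₀ z)) inj
      where
      inj : ∀ z z′ → gd u z ∧ gd w z ≡ true → gd u z′ ∧ gd w z′ ≡ true →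
        code (near u z₀ z) (near w z₀ z) ≡ code (near u z₀ z′) (near w z₀ z′) → z ≡ z′
      inj z z′ e e′ eq with z F.≟ z′
      ... | yes q = q
      ... | no ne with code-inj _ _ _ _ eq
      ...   | equ , eqw = ⊥-elim (four-end (T₃ u z z′) (T₃ w z z′) (comm z z′) M H β sum
          (subst (_≤ H) (sym (both-C light z z′)) (cc≤H _ (λ zz → ne (diag′ z z′ zz))))
          (same-part u z₀ z z′ (∧-left e₀) (∧-left e) (∧-left e′) ne equ)
          (same-part w z₀ z z′ (∧-right {gd u z₀} e₀) (∧-right {gd u z} e) (∧-right {gd u z′} e′) ne eqw) n₅)
        where
        sum : T₃ u z z′ + T₃ w z z′ ≤ comm z z′ + M
        sum = subst₂ _≤_ (∑-+ (λ x → ⟪ adj u x ∧ (adj z x ∧ adj z′ x) ⟫) _)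
          (trans (∑-+ (λ x → ⟪ adj z x ∧ adj z′ x ⟫) _) (cong (comm z z′ +_) (comm-cc uw)))
          (∑-mono (λ x → bits≤ {4} (λ { (a ∷ b ∷ d ∷ e ∷ []) → ⟪ a ∧ (d ∧ e) ⟫ + ⟪ b ∧ (d ∧ e) ⟫ })
            (λ { (a ∷ b ∷ d ∷ e ∷ []) → ⟪ d ∧ e ⟫ + ⟪ a ∧ b ⟫ }) refl
            (adj u x ∷ adj w x ∷ adj z x ∷ adj z′ x ∷ [])))

-- Light colours of comparable valency

alpha-num : ∀ ki kj K M x y q →
  ki ≤ 1 + x + y →
  x ≤ M + 2 →
  ki * y ≤ kj * q →
  q ≤ M + 2 →
  kj ≤ K →
  K + 1 ≤ 200 * ki →
  100000000 * M ≤ K →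
  200000000 ≤ K →
  ⊥
alpha-num ki kj K M x y q h1 h2 h3 h4 h5 h6 h7 h8 = refute (ki ∷ kj ∷ K ∷ M ∷ x ∷ y ∷ q ∷ []) (λ { (ki ∷ kj ∷ K ∷ M ∷ x ∷ y ∷ q ∷ []) →
    ki :≤ con 1 :+ x :+ y [ con 8000000000000 :* ki ] ∷
    x :≤ M :+ con 2 [ con 8000000000000 :* ki ] ∷
    ki :* y :≤ kj :* q [ con 8000000000000 ] ∷
    q :≤ M :+ con 2 [ con 8000000000000 :* kj ] ∷
    kj :≤ K [ con 160000 :* K ] ∷
    K :+ con 1 :≤ con 200 :* ki [ con 40000000000 :* ki :+ con 199999001 :* K ] ∷
    con 100000000 :* M :≤ K [ con 80000 :* ki :+ con 80000 :* kj ] ∷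
    con 200000000 :≤ K [ con 39967800399999001 :+ con 119800 :* ki :+ con 199839001 :* K :+ con 80000 :* kj ] ∷
    [] })
  refl (h1 ∷ h2 ∷ h3 ∷ h4 ∷ h5 ∷ h6 ∷ h7 ∷ h8 ∷ [])

share-low : ∀ ki M b x y d →
  ki ≤ M + x →
  x ≤ 3 * y →
  b + y ≤ ki →
  ki ≤ d + b →
  ki ≤ M + 3 * d
share-low ki M b x y d h1 h2 h3 h4 = prove (ki ∷ M ∷ b ∷ x ∷ y ∷ d ∷ []) (λ { (ki ∷ M ∷ b ∷ x ∷ y ∷ d ∷ []) →
    ki :≤ M :+ x [ con 1 ] ∷
    x :≤ con 3 :* y [ con 1 ] ∷
    b :+ y :≤ ki [ con 3 ] ∷
    ki :≤ d :+ b [ con 3 ] ∷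
    [] })
  (λ { (ki ∷ M ∷ b ∷ x ∷ y ∷ d ∷ []) → ki :≤ M :+ con 3 :* d [ con 1 ] })
  refl (h1 ∷ h2 ∷ h3 ∷ h4 ∷ [])

half-deg : ∀ K M d x →
  K ≤ d + x →
  2 * x ≤ K + M →
  K ≤ 2 * d + M
half-deg K M d x h1 h2 = prove (K ∷ M ∷ d ∷ x ∷ []) (λ { (K ∷ M ∷ d ∷ x ∷ []) →
    K :≤ d :+ x [ con 2 ] ∷
    con 2 :* x :≤ K :+ M [ con 1 ] ∷
    [] })
  (λ { (K ∷ M ∷ d ∷ x ∷ []) → K :≤ con 2 :* d :+ M [ con 1 ] })
  refl (h1 ∷ h2 ∷ [])

M-half : ∀ K M →
  100000000 * M ≤ K →
  2 * M ≤ K + M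
M-half K M h1 = prove (K ∷ M ∷ []) (λ { (K ∷ M ∷ []) →
    con 100000000 :* M :≤ K [ con 1 ] ∷
    [] })
  (λ { (K ∷ M ∷ []) → con 2 :* M :≤ K :+ M [ con 100000000 ] })
  refl (h1 ∷ [])

close : ∀ K M d x y a b e ka →
  d * d ≤ e + x * a + y * b →
  x + y ≤ d →
  2 * b ≤ K + M →
  K ≤ 2 * d + M →
  ka ≤ M + 3 * x →
  K + 1 ≤ 200 * ka →
  d ≤ K →
  100000000 * e ≤ K * K →
  100000000 * M ≤ K →
  200000000 ≤ K →
  1000 * K ≤ 2002 * a
close K M d x y a b e ka h1 h2 h3 h4 h5 h6 h7 h8 h9 h10 = prove (K ∷ M ∷ d ∷ x ∷ y ∷ a ∷ b ∷ e ∷ ka ∷ []) (λ { (K ∷ M ∷ d ∷ x ∷ y ∷ a ∷ b ∷ e ∷ ka ∷ []) →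
    d :* d :≤ e :+ x :* a :+ y :* b [ con 20020000000000000000 ] ∷
    x :+ y :≤ d [ con 10010000100100000000 :* K ] ∷
    con 2 :* b :≤ K :+ M [ con 10010000000000000000 :* y ] ∷
    K :≤ con 2 :* d :+ M [ con 10010000000000000000 :* d ] ∷
    ka :≤ M :+ con 3 :* x [ con 3333366700000000 :* K ] ∷
    K :+ con 1 :≤ con 200 :* ka [ con 16666833500000 :* K ] ∷
    d :≤ K [ con 200200000000 :* K ] ∷
    con 100000000 :* e :≤ K :* K [ con 200200000000 ] ∷
    con 100000000 :* M :≤ K [ con 33333667 :* K :+ con 100100000000 :* d :+ con 100100000000 :* y ] ∷
    con 200000000 :≤ K [ con 3253280049933433500000 :+ con 16266400166333 :* K ] ∷
    [] })
  (λ { (K ∷ M ∷ d ∷ x ∷ y ∷ a ∷ b ∷ e ∷ ka ∷ []) → con 1000 :* K :≤ con 2002 :* a [ con 10000000000000000 :* x ] })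
  refl (h1 ∷ h2 ∷ h3 ∷ h4 ∷ h5 ∷ h6 ∷ h7 ∷ h8 ∷ h9 ∷ h10 ∷ [])

four-n₁ : ∀ K M h →
  2 * h ≤ K + M →
  2 * h + 2 ≤ K + (M + 2)
four-n₁ K M h h1 = prove (K ∷ M ∷ h ∷ []) (λ { (K ∷ M ∷ h ∷ []) →
    con 2 :* h :≤ K :+ M [ con 1 ] ∷
    [] })
  (λ { (K ∷ M ∷ h ∷ []) → con 2 :* h :+ con 2 :≤ K :+ (M :+ con 2) [ con 1 ] })
  refl (h1 ∷ [])

four-n₂ : ∀ K M l →
  1000 * K ≤ 2002 * l →
  100000000 * M ≤ K →
  200000000 ≤ K →
  K + 2 * M ≤ 3 * l
four-n₂ K M l h1 h2 h3 = prove (K ∷ M ∷ l ∷ []) (λ { (K ∷ M ∷ l ∷ []) →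
    con 1000 :* K :≤ con 2002 :* l [ con 75000000 ] ∷
    con 100000000 :* M :≤ K [ con 1001 ] ∷
    con 200000000 :≤ K [ con 24949998999 ] ∷
    [] })
  (λ { (K ∷ M ∷ l ∷ []) → K :+ con 2 :* M :≤ con 3 :* l [ con 50050000000 ] })
  refl (h1 ∷ h2 ∷ h3 ∷ [])

four-n₃ : ∀ K M l →
  1000 * K ≤ 2002 * l →
  100000000 * M ≤ K →
  200000000 ≤ K →
  K + 3 * (M + 2) + 1 ≤ 3 * l
four-n₃ K M l h1 h2 h3 = prove (K ∷ M ∷ l ∷ []) (λ { (K ∷ M ∷ l ∷ []) →
    con 1000 :* K :≤ con 2002 :* l [ con 150000000 ] ∷
    con 100000000 :* M :≤ K [ con 3003 ] ∷
    con 200000000 :≤ K [ con 49899996997 ] ∷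
    [] })
  (λ { (K ∷ M ∷ l ∷ []) → K :+ con 3 :* (M :+ con 2) :+ con 1 :≤ con 3 :* l [ con 100100000000 ] })
  refl (h1 ∷ h2 ∷ h3 ∷ [])

four-n₄ : ∀ K M l h b →
  1000 * K ≤ 2002 * l →
  2 * h ≤ K + M →
  3 * l ≤ b + K + 2 * M →
  100000000 * M ≤ K →
  200000000 ≤ K →
  h + (M + 2) + 1 ≤ 2 * b
four-n₄ K M l h b h1 h2 h3 h4 h5 = prove (K ∷ M ∷ l ∷ h ∷ b ∷ []) (λ { (K ∷ M ∷ l ∷ h ∷ b ∷ []) →
    con 1000 :* K :≤ con 2002 :* l [ con 600000000 ] ∷
    con 2 :* h :≤ K :+ M [ con 100100000000 ] ∷
    con 3 :* l :≤ b :+ K :+ con 2 :* M [ con 400400000000 ] ∷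
    con 100000000 :* M :≤ K [ con 11011 ] ∷
    con 200000000 :≤ K [ con 99499988989 ] ∷
    [] })
  (λ { (K ∷ M ∷ l ∷ h ∷ b ∷ []) → h :+ (M :+ con 2) :+ con 1 :≤ con 2 :* b [ con 200200000000 ] })
  refl (h1 ∷ h2 ∷ h3 ∷ h4 ∷ h5 ∷ [])

four-n₅ : ∀ K M l h b →
  1000 * K ≤ 2002 * l →
  2 * h ≤ K + M →
  3 * l ≤ b + K + 2 * M →
  100000000 * M ≤ K →
  200000000 ≤ K →
  h + M + 1 ≤ 2 * b
four-n₅ K M l h b h1 h2 h3 h4 h5 = prove (K ∷ M ∷ l ∷ h ∷ b ∷ []) (λ { (K ∷ M ∷ l ∷ h ∷ b ∷ []) →
    con 1000 :* K :≤ con 2002 :* l [ con 600000000 ] ∷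
    con 2 :* h :≤ K :+ M [ con 100100000000 ] ∷
    con 3 :* l :≤ b :+ K :+ con 2 :* M [ con 400400000000 ] ∷
    con 100000000 :* M :≤ K [ con 11011 ] ∷
    con 200000000 :≤ K [ con 99499988989 ] ∷
    [] })
  (λ { (K ∷ M ∷ l ∷ h ∷ b ∷ []) → h :+ M :+ con 1 :≤ con 2 :* b [ con 200200000000 ] })
  refl (h1 ∷ h2 ∷ h3 ∷ h4 ∷ h5 ∷ [])

four-n₆ : ∀ K M l h →
  1000 * K ≤ 2002 * l →
  l ≤ h →
  100000000 * M ≤ K →
  200000000 ≤ K →
  M ≤ h
four-n₆ K M l h h1 h2 h3 h4 = prove (K ∷ M ∷ l ∷ h ∷ []) (λ { (K ∷ M ∷ l ∷ h ∷ []) →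
    con 1000 :* K :≤ con 2002 :* l [ con 50000000 ] ∷
    l :≤ h [ con 100100000000 ] ∷
    con 100000000 :* M :≤ K [ con 1001 ] ∷
    con 200000000 :≤ K [ con 49999998999 ] ∷
    [] })
  (λ { (K ∷ M ∷ l ∷ h ∷ []) → M :≤ h [ con 100100000000 ] })
  refl (h1 ∷ h2 ∷ h3 ∷ h4 ∷ [])

pAB-zero : ∀ K M ka kb x y z a b →
  K ≤ ka + kb →
  kb ≤ x + y →
  x + kb ≤ a →
  z + ka ≤ b →
  2 * a ≤ K + M →
  2 * b ≤ K + M →
  ka * y ≤ kb * z →
  100000000 * M ≤ K →
  200000000 ≤ K →
  ⊥
pAB-zero K M ka kb x y z a b h1 h2 h3 h4 h5 h6 h7 h8 h9 = refute (K ∷ M ∷ ka ∷ kb ∷ x ∷ y ∷ z ∷ a ∷ b ∷ []) (λ { (K ∷ M ∷ ka ∷ kb ∷ x ∷ y ∷ z ∷ a ∷ b ∷ []) →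
    K :≤ ka :+ kb [ con 40000000000000000 :* kb :+ con 40000000000000000 :* y :+ con 59999999400000000 :* K ] ∷
    kb :≤ x :+ y [ con 40000000000000000 :* x :+ con 19999999800000000 :* K ] ∷
    x :+ kb :≤ a [ con 40000000000000000 :* kb :+ con 40000000000000000 :* x :+ con 40000000000000000 :* y :+ con 40000000000000000 :* K ] ∷
    z :+ ka :≤ b [ con 40000000000000000 :* kb :+ con 59999999400000000 :* K ] ∷
    con 2 :* a :≤ K :+ M [ con 20000000000000000 :* kb :+ con 20000000000000000 :* x :+ con 20000000000000000 :* y :+ con 20000000000000000 :* K ] ∷
    con 2 :* b :≤ K :+ M [ con 20000000000000000 :* kb :+ con 29999999700000000 :* K ] ∷
    ka :* y :≤ kb :* z [ con 40000000000000000 ] ∷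
    con 100000000 :* M :≤ K [ con 400000000 :* kb :+ con 200000000 :* x :+ con 200000000 :* y :+ con 499999997 :* K ] ∷
    con 200000000 :≤ K [ con 1999999840000000600000000 :+ con 9999999200000003 :* K ] ∷
    [] })
  refl (h1 ∷ h2 ∷ h3 ∷ h4 ∷ h5 ∷ h6 ∷ h7 ∷ h8 ∷ h9 ∷ [])

all-ones : ∀ M a b d →
  1 ≤ b →
  1 ≤ d →
  M ≤ 4 →
  a + b + b + d ≤ M →
  a ≤ 1
all-ones M a b d h1 h2 h3 h4 = prove (M ∷ a ∷ b ∷ d ∷ []) (λ { (M ∷ a ∷ b ∷ d ∷ []) →
    con 1 :≤ b [ con 2 ] ∷
    con 1 :≤ d [ con 1 ] ∷
    M :≤ con 4 [ con 1 ] ∷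
    a :+ b :+ b :+ d :≤ M [ con 1 ] ∷
    [] })
  (λ { (M ∷ a ∷ b ∷ d ∷ []) → a :≤ con 1 [ con 1 ] })
  refl (h1 ∷ h2 ∷ h3 ∷ h4 ∷ [])

bad-num : ∀ K M d x y a b e q Y →
  8000 ≤ Y →
  Y * (d * d) + K * q ≤ Y * (e + x * a + y * b) + K * (1 * d) →
  x + y ≤ d →
  2 * a ≤ K + M →
  2 * b ≤ K + M →
  2001 * K + 1 ≤ 4000 * d →
  100000000 * e ≤ K * K →
  100000000 * M ≤ K →
  200000000 ≤ K →
  ⊥
bad-num K M d x y a b e q Y h1 h2 h3 h4 h5 h6 h7 h8 h9 = refute (K ∷ M ∷ d ∷ x ∷ y ∷ a ∷ b ∷ e ∷ q ∷ Y ∷ []) (λ { (K ∷ M ∷ d ∷ x ∷ y ∷ a ∷ b ∷ e ∷ q ∷ Y ∷ []) →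
    con 8000 :≤ Y [ con 50014999 :* K :* K :+ con 100000000 :* K :* d ] ∷
    Y :* (d :* d) :+ K :* q :≤ Y :* (e :+ x :* a :+ y :* b) :+ K :* (con 1 :* d) [ con 800000000000 ] ∷
    x :+ y :≤ d [ con 400000004000 :* K :* Y ] ∷
    con 2 :* a :≤ K :+ M [ con 400000000000 :* Y :* x ] ∷
    con 2 :* b :≤ K :+ M [ con 400000000000 :* Y :* y ] ∷
    con 2001 :* K :+ con 1 :≤ con 4000 :* d [ con 24999 :* K :* Y :+ con 200000000 :* Y :* d ] ∷
    con 100000000 :* e :≤ K :* K [ con 8000 :* Y ] ∷
    con 100000000 :* M :≤ K [ con 4000 :* Y :* x :+ con 4000 :* Y :* y ] ∷
    con 200000000 :≤ K [ con 80023998400000000000 :+ con 400119992000 :* K ] ∷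
    [] })
  refl (h1 ∷ h2 ∷ h3 ∷ h4 ∷ h5 ∷ h6 ∷ h7 ∷ h8 ∷ h9 ∷ [])

few-bad : ∀ K M d x y a b e q Y →
  Y ≤ 8000 →
  Y * (d * d) + K * q ≤ Y * (e + x * a + y * b) + K * (0 * d) →
  x + y ≤ d →
  2 * a ≤ K + M →
  2 * b ≤ K + M →
  K ≤ 2 * d + M →
  d ≤ K →
  100000000 * e ≤ K * K →
  100000000 * M ≤ K →
  200000000 ≤ K →
  1000 * q ≤ K
few-bad K M d x y a b e q Y h1 h2 h3 h4 h5 h6 h7 h8 h9 h10 = prove (K ∷ M ∷ d ∷ x ∷ y ∷ a ∷ b ∷ e ∷ q ∷ Y ∷ []) (λ { (K ∷ M ∷ d ∷ x ∷ y ∷ a ∷ b ∷ e ∷ q ∷ Y ∷ []) →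
    Y :≤ con 8000 [ con 4 :* K :* K ] ∷
    Y :* (d :* d) :+ K :* q :≤ Y :* (e :+ x :* a :+ y :* b) :+ K :* (con 0 :* d) [ con 200000000 ] ∷
    x :+ y :≤ d [ con 100000001 :* K :* Y ] ∷
    con 2 :* a :≤ K :+ M [ con 100000000 :* Y :* x ] ∷
    con 2 :* b :≤ K :+ M [ con 100000000 :* Y :* y ] ∷
    K :≤ con 2 :* d :+ M [ con 100000000 :* Y :* d ] ∷
    d :≤ K [ con 2 :* K :* Y ] ∷
    con 100000000 :* e :≤ K :* K [ con 2 :* Y ] ∷
    con 100000000 :* M :≤ K [ Y :* d :+ Y :* x :+ Y :* y ] ∷
    con 200000000 :≤ K [ con 33600000200000 :+ con 168000 :* K ] ∷
    [] })
  (λ { (K ∷ M ∷ d ∷ x ∷ y ∷ a ∷ b ∷ e ∷ q ∷ Y ∷ []) → con 1000 :* q :≤ K [ con 200000 :* K ] })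
  refl (h1 ∷ h2 ∷ h3 ∷ h4 ∷ h5 ∷ h6 ∷ h7 ∷ h8 ∷ h9 ∷ h10 ∷ [])

good-num : ∀ K M d m t →
  m + K ≤ t + d →
  2 * t ≤ K + M →
  4000 * d ≤ 2001 * K →
  4000 * m ≤ K + 2000 * M
good-num K M d m t h1 h2 h3 = prove (K ∷ M ∷ d ∷ m ∷ t ∷ []) (λ { (K ∷ M ∷ d ∷ m ∷ t ∷ []) →
    m :+ K :≤ t :+ d [ con 4000 ] ∷
    con 2 :* t :≤ K :+ M [ con 2000 ] ∷
    con 4000 :* d :≤ con 2001 :* K [ con 1 ] ∷
    [] })
  (λ { (K ∷ M ∷ d ∷ m ∷ t ∷ []) → con 4000 :* m :≤ K :+ con 2000 :* M [ con 1 ] })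
  refl (h1 ∷ h2 ∷ h3 ∷ [])

good-not-D : ∀ K M d →
  K ≤ d + M →
  4000 * d ≤ 2001 * K →
  100000000 * M ≤ K →
  200000000 ≤ K →
  ⊥
good-not-D K M d h1 h2 h3 h4 = refute (K ∷ M ∷ d ∷ []) (λ { (K ∷ M ∷ d ∷ []) →
    K :≤ d :+ M [ con 100000000 ] ∷
    con 4000 :* d :≤ con 2001 :* K [ con 25000 ] ∷
    con 100000000 :* M :≤ K [ con 1 ] ∷
    con 200000000 :≤ K [ con 49974999 ] ∷
    [] })
  refl (h1 ∷ h2 ∷ h3 ∷ h4 ∷ [])

final-num : ∀ K M kt W b m →
  kt ≤ M + 3 * W →
  W ≤ b + m + 1 + 1 →
  4000 * m ≤ K + 2000 * M →
  1000 * b ≤ K →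
  K + 1 ≤ 200 * kt →
  100000000 * M ≤ K →
  200000000 ≤ K →
  ⊥
final-num K M kt W b m h1 h2 h3 h4 h5 h6 h7 = refute (K ∷ M ∷ kt ∷ W ∷ b ∷ m ∷ []) (λ { (K ∷ M ∷ kt ∷ W ∷ b ∷ m ∷ []) →
    kt :≤ M :+ con 3 :* W [ con 40000000 ] ∷
    W :≤ b :+ m :+ con 1 :+ con 1 [ con 120000000 ] ∷
    con 4000 :* m :≤ K :+ con 2000 :* M [ con 30000 ] ∷
    con 1000 :* b :≤ K [ con 120000 ] ∷
    K :+ con 1 :≤ con 200 :* kt [ con 200000 ] ∷
    con 100000000 :* M :≤ K [ con 1 ] ∷
    con 200000000 :≤ K [ con 49999 ] ∷
    [] })
  refl (h1 ∷ h2 ∷ h3 ∷ h4 ∷ h5 ∷ h6 ∷ h7 ∷ [])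

h-upper : ∀ K ka kb aa ab bb h cA →
  ka + kb ≤ K →
  1 + aa + ab + h ≤ ka →
  ab + bb + h ≤ kb →
  cA ≤ aa + ab + ab + bb →
  1000 * K ≤ 2002 * cA →
  4000 * h ≤ 1003 * K
h-upper K ka kb aa ab bb h cA h1 h2 h3 h4 h5 = prove (K ∷ ka ∷ kb ∷ aa ∷ ab ∷ bb ∷ h ∷ cA ∷ []) (λ { (K ∷ ka ∷ kb ∷ aa ∷ ab ∷ bb ∷ h ∷ cA ∷ []) →
    ka :+ kb :≤ K [ con 2002000 ] ∷
    con 1 :+ aa :+ ab :+ h :≤ ka [ con 2002000 ] ∷
    ab :+ bb :+ h :≤ kb [ con 2002000 ] ∷
    cA :≤ aa :+ ab :+ ab :+ bb [ con 2002000 ] ∷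
    con 1000 :* K :≤ con 2002 :* cA [ con 1000 ] ∷
    [] })
  (λ { (K ∷ ka ∷ kb ∷ aa ∷ ab ∷ bb ∷ h ∷ cA ∷ []) → con 4000 :* h :≤ con 1003 :* K [ con 1001 ] })
  refl (h1 ∷ h2 ∷ h3 ∷ h4 ∷ h5 ∷ [])

h-lower : ∀ K M ka kb aa ab bb h cA →
  K ≤ ka + kb →
  ka ≤ 1 + aa + ab + h →
  kb ≤ ab + bb + h →
  aa + ab + ab + bb ≤ cA →
  2 * cA ≤ K + M →
  100000000 * M ≤ K →
  200000000 ≤ K →
  999 * K ≤ 4000 * h
h-lower K M ka kb aa ab bb h cA h1 h2 h3 h4 h5 h6 h7 = prove (K ∷ M ∷ ka ∷ kb ∷ aa ∷ ab ∷ bb ∷ h ∷ cA ∷ []) (λ { (K ∷ M ∷ ka ∷ kb ∷ aa ∷ ab ∷ bb ∷ h ∷ cA ∷ []) →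
    K :≤ ka :+ kb [ con 200000000 ] ∷
    ka :≤ con 1 :+ aa :+ ab :+ h [ con 200000000 ] ∷
    kb :≤ ab :+ bb :+ h [ con 200000000 ] ∷
    aa :+ ab :+ ab :+ bb :≤ cA [ con 200000000 ] ∷
    con 2 :* cA :≤ K :+ M [ con 100000000 ] ∷
    con 100000000 :* M :≤ K [ con 1 ] ∷
    con 200000000 :≤ K [ con 99999 ] ∷
    [] })
  (λ { (K ∷ M ∷ ka ∷ kb ∷ aa ∷ ab ∷ bb ∷ h ∷ cA ∷ []) → con 999 :* K :≤ con 4000 :* h [ con 100000 ] })
  refl (h1 ∷ h2 ∷ h3 ∷ h4 ∷ h5 ∷ h6 ∷ h7 ∷ [])

ratio : ∀ K ka kb ha hb →
  kb * hb ≤ ka * ha →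
  4000 * ha ≤ 1003 * K →
  999 * K ≤ 4000 * hb →
  1 ≤ K →
  kb ≤ 2 * ka
ratio K ka kb ha hb h1 h2 h3 h4 = prove (K ∷ ka ∷ kb ∷ ha ∷ hb ∷ []) (λ { (K ∷ ka ∷ kb ∷ ha ∷ hb ∷ []) →
    kb :* hb :≤ ka :* ha [ con 4000 ] ∷
    con 4000 :* ha :≤ con 1003 :* K [ ka ] ∷
    con 999 :* K :≤ con 4000 :* hb [ kb ] ∷
    con 1 :≤ K [ con 999 ] ∷
    [] })
  (λ { (K ∷ ka ∷ kb ∷ ha ∷ hb ∷ []) → kb :≤ con 2 :* ka [ con 999 :* K ] })
  refl (h1 ∷ h2 ∷ h3 ∷ h4 ∷ [])

twin-p : ∀ ka kb bb z m →
  ka * bb ≤ kb * z →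
  z ≤ m →
  kb ≤ 2 * ka →
  1 ≤ ka →
  bb ≤ 2 * m
twin-p ka kb bb z m h1 h2 h3 h4 = prove (ka ∷ kb ∷ bb ∷ z ∷ m ∷ []) (λ { (ka ∷ kb ∷ bb ∷ z ∷ m ∷ []) →
    ka :* bb :≤ kb :* z [ con 1 ] ∷
    z :≤ m [ kb ] ∷
    kb :≤ con 2 :* ka [ m ] ∷
    con 1 :≤ ka [ con 1 ] ∷
    [] })
  (λ { (ka ∷ kb ∷ bb ∷ z ∷ m ∷ []) → bb :≤ con 2 :* m [ ka ] })
  refl (h1 ∷ h2 ∷ h3 ∷ h4 ∷ [])

twin-end : ∀ K M ka kb x y z w ha hb m →
  K ≤ ka + kb →
  kb ≤ x + y + ha →
  ka ≤ z + w + hb →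
  x ≤ m →
  w ≤ m →
  y ≤ 2 * m →
  z ≤ 2 * m →
  4000 * ha ≤ 1003 * K →
  4000 * hb ≤ 1003 * K →
  4000 * m ≤ K + 2000 * M →
  100000000 * M ≤ K →
  1 ≤ K →
  ⊥
twin-end K M ka kb x y z w ha hb m h1 h2 h3 h4 h5 h6 h7 h8 h9 h10 h11 h12 = refute (K ∷ M ∷ ka ∷ kb ∷ x ∷ y ∷ z ∷ w ∷ ha ∷ hb ∷ m ∷ []) (λ { (K ∷ M ∷ ka ∷ kb ∷ x ∷ y ∷ z ∷ w ∷ ha ∷ hb ∷ m ∷ []) →
    K :≤ ka :+ kb [ con 100000000 ] ∷
    kb :≤ x :+ y :+ ha [ con 100000000 ] ∷
    ka :≤ z :+ w :+ hb [ con 100000000 ] ∷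
    x :≤ m [ con 100000000 ] ∷
    w :≤ m [ con 100000000 ] ∷
    y :≤ con 2 :* m [ con 100000000 ] ∷
    z :≤ con 2 :* m [ con 100000000 ] ∷
    con 4000 :* ha :≤ con 1003 :* K [ con 25000 ] ∷
    con 4000 :* hb :≤ con 1003 :* K [ con 25000 ] ∷
    con 4000 :* m :≤ K :+ con 2000 :* M [ con 150000 ] ∷
    con 100000000 :* M :≤ K [ con 3 ] ∷
    con 1 :≤ K [ con 49699997 ] ∷
    [] })
  refl (h1 ∷ h2 ∷ h3 ∷ h4 ∷ h5 ∷ h6 ∷ h7 ∷ h8 ∷ h9 ∷ h10 ∷ h11 ∷ h12 ∷ [])

all-ones′ : ∀ M a b d →
  1 ≤ a →
  1 ≤ d →
  M ≤ 4 →
  a + b + b + d ≤ M →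
  b ≤ 1
all-ones′ M a b d h1 h2 h3 h4 = prove (M ∷ a ∷ b ∷ d ∷ []) (λ { (M ∷ a ∷ b ∷ d ∷ []) →
    con 1 :≤ a [ con 1 ] ∷
    con 1 :≤ d [ con 1 ] ∷
    M :≤ con 4 [ con 1 ] ∷
    a :+ b :+ b :+ d :≤ M [ con 1 ] ∷
    [] })
  (λ { (M ∷ a ∷ b ∷ d ∷ []) → b :≤ con 1 [ con 2 ] })
  refl (h1 ∷ h2 ∷ h3 ∷ h4 ∷ [])

#≥2 : ∀ {n} (P : Fin n → Bool) i j → ¬ i ≡ j → P i ≡ true → P j ≡ true → 2 ≤ # P
#≥2 P i j ne Pi Pj = subst (_≤ # P) (trans (∑-+ (λ w → ⟪ w == i ⟫) _) (cong₂ _+_ (#-point i) (#-point j)))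
  (∑-mono h)
  where
  h : ∀ w → ⟪ w == i ⟫ + ⟪ w == j ⟫ ≤ ⟪ P w ⟫
  h w with w == i in e | w == j in e′
  ... | true  | true  = ⊥-elim (ne (trans (sym (==⇒≡ w i e)) (==⇒≡ w j e′)))
  ... | true  | false rewrite ==⇒≡ w i e | Pi = ≤-refl
  ... | false | true  rewrite ==⇒≡ w j e′ | Pj = ≤-refl
  ... | false | false = z≤n

O≢D : ¬ _≡_ {A = Fin 4} O D
O≢D ()

data Partner : Fin 4 → Fin 4 → Set where
  AB : Partner A B
  BA : Partner B A

partner-sym : ∀ {i j} → Partner i j → Partner j i
partner-sym AB = BA
partner-sym BA = AB

partner≢O : ∀ {i j} → Partner i j → ¬ i ≡ O
partner≢O AB ()
partner≢O BA ()

partner-light : ∀ {i j} → Partner i j → light i ≡ true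
partner-light AB = refl
partner-light BA = refl

module Balanced {n : ℕ} (E : Setting n) (st-id : ∀ i → Scheme.st (Setting.X E) i ≡ i)
  (A-large : Sparse.K E + 1 ≤ 200 * Basic.k (Setting.X E) A)
  (B-large : Sparse.K E + 1 ≤ 200 * Basic.k (Setting.X E) B) where
  open Symmetric E st-id

  large : ∀ {i j} → Partner i j → K + 1 ≤ 200 * k i
  large AB = A-large
  large BA = B-large

  K≡′ : ∀ {i j} → Partner i j → K ≡ k i + k j
  K≡′ AB = K≡
  K≡′ BA = trans K≡ (+-comm (k A) (k B))

  k-split′ : ∀ {i j} → Partner i j → ∀ x t → k x ≡ ⟪ t == x ⟫ + p x i t + p x j t + p x D t
  k-split′ AB x t = k-split x t
  k-split′ BA x t = trans (k-split x t) (cong (_+ p x D t)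
    (trans (+-assoc ⟪ t == x ⟫ _ _) (trans (cong (⟪ t == x ⟫ +_) (+-comm (p x A t) _)) (sym (+-assoc ⟪ t == x ⟫ _ _)))))

  cc-split′ : ∀ {i j} → Partner i j → ∀ t → cc t ≡ p i i t + p i j t + p i j t + p j j t
  cc-split′ AB t = trans (cc-split t) (cong (λ z → p A A t + p A B t + z + p B B t) (p-sym B A t))
  cc-split′ BA t = trans (cc-split t) (trans (cong (λ z → p A A t + z + p B A t + p B B t) (p-sym A B t))
    (rev (p A A t) (p B A t) (p B B t)))
    where
    rev : ∀ a b d → a + b + b + d ≡ d + b + b + a
    rev a b d = trans (+-comm (a + b + b) d) (trans (cong (d +_) (trans (+-assoc a b b) (+-comm a (b + b))))
      (trans (sym (+-assoc d (b + b) a)) (cong (_+ a) (sym (+-assoc d b b)))))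

  is-col : ∀ {u v} i → c u v ≡ i → (c u v == i) ≡ true
  is-col i e = trans (cong (_== i) e) (==-refl i)

  k≤K : ∀ {i j} → Partner i j → k i ≤ K
  k≤K {i} {j} ij = subst (k i ≤_) (sym (K≡′ ij)) (m≤m+n _ _)

  -- If p i i D vanished, the i-neighbourhoods would be cliques overlapping along a connected colour,
  -- and the whole graph would be complete.
  module _ {i j} (ij : Partner i j) (p≡0 : p i i D ≡ 0) where

    nbr-clique : ∀ v u u′ → c v u ≡ i → c v u′ ≡ i → ¬ u ≡ u′ → adj u u′ ≡ true
    nbr-clique v u u′ e e′ ne with adj u u′ in a
    ... | true = refl
    ... | false = ⊥-elim (<⇒≱ (∃-# (λ w → (c u w == i) ∧ (c u′ w == i)) v
        (∧-true (is-col i (trans (c-sym u v) e)) (is-col i (trans (c-sym u′ v) e′))))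
        (≤-reflexive (trans (coh i i u u′) (trans (cong (p i i) (far u u′ ne a)) p≡0))))

    -- Adjacency of `z` to all `i`-neighbours passes from `v` to `x`: the common `i`-neighbours of
    -- `v` and `x` are adjacent to `z` by hypothesis and to any `i`-neighbour `y` of `x` by
    -- `nbr-clique`. After removing `z` and `y` more than `M` of them remain, so `z` and `y` do not
    -- have colour `D`.
    spread : ∀ t → M + 3 ≤ p i i t → ∀ z {v w} → Star (λ x y → c x y ≡ t) v w →
      (∀ y → c v y ≡ i → ¬ z ≡ y → adj z y ≡ true) → (∀ y → c w y ≡ i → ¬ z ≡ y → adj z y ≡ true)
    spread t big z ε h = h
    spread t big z (_◅_ {i = v} {j = x} vx path) h = spread t big z path step
      where
      step : ∀ y → c x y ≡ i → ¬ z ≡ y → adj z y ≡ true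
      step y xy ne with adj z y in e
      ... | true = refl
      ... | false = ⊥-elim (<⇒≱ (begin-strict
          p i i t                                       ≡⟨ trans (cong (p i i) (sym vx)) (sym (coh i i v x)) ⟩
          # (λ w → (c v w == i) ∧ (c x w == i))         ≤⟨ ∑-mono pt ⟩
          ∑ (λ w → ⟪ adj z w ∧ adj y w ⟫ + ⟪ w == z ⟫ + ⟪ w == y ⟫) ≡⟨ ∑-+₃ (λ w → ⟪ adj z w ∧ adj y w ⟫) _ _ ⟩
          comm z y + # (_== z) + # (_== y)              ≡⟨ cong₂ _+_ (cong₂ _+_ (comm-cc (far z y ne e)) (#-point z)) (#-point y) ⟩
          M + 1 + 1                                     ≡⟨ +-assoc M 1 1 ⟩
          M + 2                                         <⟨ +-monoʳ-< M ≤-refl ⟩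
          M + 3 ∎) big)
        where
        open ≤-Reasoning
        pt : ∀ w → ⟪ (c v w == i) ∧ (c x w == i) ⟫ ≤ ⟪ adj z w ∧ adj y w ⟫ + ⟪ w == z ⟫ + ⟪ w == y ⟫
        pt w with c v w == i in a | c x w == i in b
        ... | false | _     = z≤n
        ... | true  | false = z≤n
        ... | true  | true with w == z in d
        ...   | true  = ≤-trans (m≤n+m 1 ⟪ adj z w ∧ adj y w ⟫) (m≤m+n _ ⟪ w == y ⟫)
        ...   | false with w == y in d′
        ...     | true  = m≤n+m 1 (⟪ adj z w ∧ adj y w ⟫ + 0)
        ...     | false rewrite h w (==⇒≡ _ _ a) (λ q → ==⇒≢ w z d (sym q))
                              | nbr-clique x y w xy (==⇒≡ _ _ b) (λ q → ==⇒≢ w y d′ (sym q)) = ≤-refl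

    complete : ∀ t → ¬ t ≡ O → M + 3 ≤ p i i t → ⊥
    complete t t≢O big with occ D
    ... | z , y , zy with #-∃ (λ v → c z v == i) (subst (0 <_) (sym (k-# i z)) (k>0 i))
                        | #-∃ (λ w → c y w == i) (subst (0 <_) (sym (k-# i y)) (k>0 i))
    ...   | v , zv | w , yw with () ← trans (sym (cong light zy)) (spread t big z
              (conn t (λ e → t≢O (trans e o≡O)) v w)
              (λ x vx ne → nbr-clique v z x (trans (c-sym v z) (==⇒≡ _ _ zv)) vx ne)
              y (trans (c-sym w y) (==⇒≡ _ _ yw)) (λ { refl → O≢D (trans (sym (loop′ z)) zy) }))

    -- If neither colour allows spreading, then `k i = 1 + p i i i + p i j i` with
    -- `k i * p i j i = k j * p i i j` makes `k i` of the order of the geometric mean of `K` and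
    -- `M`, too small for the valency bound.
    p>0-contra : ⊥
    p>0-contra with M + 3 ≤? p i i i | M + 3 ≤? p i i j
    ... | yes h | _     = complete i (partner≢O ij) h
    ... | no _  | yes h = complete j (partner≢O (partner-sym ij)) h
    ... | no a  | no b  = alpha-num (k i) (k j) K M (p i i i) (p i j i) (p i i j)
        (≤-reflexive (trans (k-split′ ij i i) (trans (cong₂ _+_ (cong (λ q → ⟪ q ⟫ + p i i i + p i j i) (==-refl i)) pD≡0) (+-identityʳ _))))
        (below a) (≤-reflexive (sym (trans (triangle′ i i j) (cong (k i *_) (p-sym j i i)))))
        (below b) (k≤K (partner-sym ij)) (large ij) M-tiny K-big
      where
      below : ∀ {x} → ¬ M + 3 ≤ x → x ≤ M + 2
      below {x} h = s≤s⁻¹ (subst (suc x ≤_) (+-suc M 2) (≰⇒> h))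
      pD≡0 : p i D i ≡ 0
      pD≡0 = trans (p-sym i D i) (*-cancelˡ-≡ _ _ (k i) {{>-nonZero (k>0 i)}}
        (trans (sym (triangle′ i i D)) (trans (cong (k D *_) p≡0) (trans (*-zeroʳ (k D)) (sym (*-zeroʳ (k i)))))))

  p>0 : ∀ {i j} → Partner i j → 1 ≤ p i i D
  p>0 {i} ij with p i i D in e
  ... | zero  = ⊥-elim (p>0-contra ij e)
  ... | suc _ = s≤s z≤n

  -- As `p i i D` is positive, a pair of colour `D` is joined by two steps of colour `i`, each of
  -- which loses `K - cc i` neighbours.
  half : ∀ {i j} → Partner i j → 2 * cc i ≤ K + M
  half {i} ij with occ D
  ... | u , v , uv with #-∃ (λ w → (c u w == i) ∧ (c v w == i)) (subst (0 <_) (sym (trans (coh i i u v) (cong (p i i) uv))) (p>0 ij))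
  ...   | w , e = one-half K M (cc i) (miss light u v) (miss light u w)
      (≤-reflexive (trans (both+miss light u v) (cong (_+ miss light u v) (comm-cc uv))))
      (≤-trans (miss-trans light u w v) (+-monoʳ-≤ _ (≤-reflexive (+-cancelˡ-≡ (cc i) _ _ (trans (sym (q wv)) (q uw))))))
      (≤-reflexive (sym (q uw)))
    where
    uw : c u w ≡ i
    uw = ==⇒≡ _ _ (∧-left e)
    wv : c w v ≡ i
    wv = trans (c-sym w v) (==⇒≡ _ _ (∧-right {c u w == i} e))
    q : ∀ {x y} → c x y ≡ i → K ≡ cc i + miss light x y
    q {x} {y} xy = trans (both+miss light x y) (cong (_+ miss light x y) (comm-cc xy))

  half′ : ∀ t → ¬ t ≡ O → 2 * cc t ≤ K + M
  half′ O h = ⊥-elim (h refl)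
  half′ A _ = half AB
  half′ B _ = half BA
  half′ D _ = M-half K M M-tiny

  moved-colour : ∀ {u} → S u ≡ true → ¬ c u (f u) ≡ O
  moved-colour {u} Su e = moves u Su (sym (diag′ u (f u) e))

  deg≥ : ∀ {u} → S u ≡ true → K ≤ 2 * degS u + M
  deg≥ {u} Su = half-deg K M (degS u) (comm u (f u)) (deg-lower light u)
    (subst (λ z → 2 * z ≤ K + M) (sym (both-C light u (f u))) (half′ _ (moved-colour Su)))

  deg≤K : ∀ u → degS u ≤ K
  deg≤K u = ≤-trans (#-mono (λ w → ∧-right {S w})) (≤-reflexive (val-# light u))

  -- The three-step bound for `i`-neighbourhoods: a pair of colour `D` has at most `M` common ones,
  -- so `u` has at least a third of `k i - M` that `f u` lacks, and all of these are moved.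
  share : ∀ {i j} → Partner i j → ∀ {u} → S u ≡ true → k i ≤ M + 3 * degSC i u
  share {i} ij {u} Su with occ D
  ... | x , y , xy = share-low (k i) M (both (_== i) u (f u)) (miss (_== i) x y) (miss (_== i) u (f u)) (degSC i u)
      (≤-trans (≤-reflexive (both+miss (_== i) x y)) (+-monoˡ-≤ _ (≤-trans (#-mono lit) (≤-reflexive (comm-cc xy)))))
      (miss≤3 (_== i) x y u (f u) (λ e → moved-colour Su (trans e o≡O)))
      (≤-reflexive (sym (both+miss (_== i) u (f u))))
      (deg-lower (_== i) u)
    where
    is : ∀ {a b} → (c a b == i) ≡ true → adj a b ≡ true
    is e = trans (cong light (==⇒≡ _ _ e)) (partner-light ij)
    lit : ∀ w → (c x w == i) ∧ (c y w == i) ≡ true → adj x w ∧ adj y w ≡ true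
    lit w e = ∧-true (is (∧-left e)) (is (∧-right {c x w == i} e))

  -- The picked degree is at least about `K / 2`, while its square is at most about
  -- `degSC A * cc A + degSC B * cc B` with both `cc` at most about `K / 2`. The balance leaves no
  -- slack, and by `share` colour `i` has a definite part of the degree, so `cc i` cannot lag
  -- behind.
  close′ : ∀ {i j} → Partner i j → 1000 * K ≤ 2002 * cc i
  close′ ij with pick
  close′ AB | u , Su , h = close K M (degS u) (degSC A u) (degSC B u) (cc A) (cc B) err (k A) h
    (≤-reflexive (sym (degS≡ u))) (half BA) (deg≥ Su) (share AB Su) (large AB) (deg≤K u) error-tiny M-tiny K-big
  close′ BA | u , Su , h = close K M (degS u) (degSC B u) (degSC A u) (cc B) (cc A) err (k B)
    (subst (degS u * degS u ≤_) (trans (+-assoc err _ _) (trans (cong (err +_) (+-comm (degSC A u * cc A) _)) (sym (+-assoc err _ _)))) h)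
    (≤-reflexive (trans (+-comm (degSC B u) _) (sym (degS≡ u)))) (half AB) (deg≥ Su) (share BA Su) (large BA) (deg≤K u) error-tiny M-tiny K-big

  ℓ h₀ β : ℕ
  ℓ  = cc A ⊓ cc B
  h₀ = cc A ⊔ cc B
  β  = 3 * ℓ ∸ (K + 2 * M)

  ℓ-close : 1000 * K ≤ 2002 * ℓ
  ℓ-close with ⊓-sel (cc A) (cc B)
  ... | inj₁ e = subst (λ z → 1000 * K ≤ 2002 * z) (sym e) (close′ AB)
  ... | inj₂ e = subst (λ z → 1000 * K ≤ 2002 * z) (sym e) (close′ BA)

  h₀-half : 2 * h₀ ≤ K + M
  h₀-half with ⊔-sel (cc A) (cc B)
  ... | inj₁ e = subst (λ z → 2 * z ≤ K + M) (sym e) (half AB)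
  ... | inj₂ e = subst (λ z → 2 * z ≤ K + M) (sym e) (half BA)

  β≡ : β + K + 2 * M ≡ 3 * ℓ
  β≡ = trans (+-assoc β K (2 * M)) (m∸n+n≡m (four-n₂ K M ℓ ℓ-close M-tiny K-big))

  M≤4 : M ≤ 4
  M≤4 with occ D
  ... | u , v , uv = subst (_≤ 4) (comm-cc uv) (common≤4 u v uv)
    where
    lo : ∀ i → light i ≡ true → ℓ ≤ cc i
    lo A _ = m⊓n≤m (cc A) (cc B)
    lo B _ = m⊓n≤n (cc A) (cc B)
    lo D ()
    hi : ∀ i → light i ≡ true → cc i ≤ h₀
    hi A _ = m≤m⊔n (cc A) (cc B)
    hi B _ = m≤n⊔m (cc A) (cc B)
    hi D ()
    up : ∀ i → ¬ i ≡ O → cc i ≤ h₀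
    up O ne = ⊥-elim (ne refl)
    up A _  = m≤m⊔n (cc A) (cc B)
    up B _  = m≤n⊔m (cc A) (cc B)
    up D _  = four-n₆ K M ℓ h₀ ℓ-close (≤-trans (m⊓n≤m (cc A) (cc B)) (m≤m⊔n (cc A) (cc B))) M-tiny K-big
    open Four light (λ _ e → e) ℓ h₀ (M + 2) β h₀ lo hi up (four-n₁ K M h₀ h₀-half) (≤-reflexive β≡)
      (four-n₃ K M ℓ ℓ-close M-tiny K-big)
      (four-n₄ K M ℓ h₀ β ℓ-close h₀-half (≤-reflexive (sym β≡)) M-tiny K-big)
      (four-n₅ K M ℓ h₀ β ℓ-close h₀-half (≤-reflexive (sym β≡)) M-tiny K-big)

  -- Otherwise the `D` terms vanish from `k-split`, giving `cc A ≥ p A B A + k B` and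
  -- `cc B ≥ p A B B + k A`. Since `cc A + cc B` is at most `K + M`, both `p A B A` and `p A B B`
  -- are at most `M`. Then `k A * p B B A = k B * p A B B` makes `k B = p A B A + p B B A` tiny,
  -- although the two valencies are about `K / 2`.
  pAB>0 : 1 ≤ p A B D
  pAB>0 with p A B D in e
  ... | suc _ = s≤s z≤n
  ... | zero  = ⊥-elim (pAB-zero K M (k A) (k B) (p A B A) (p B B A) (p A B B) (cc A) (cc B) (≤-reflexive K≡)
      (≤-reflexive kB) (≤-trans (+-monoʳ-≤ (p A B A) (≤-reflexive kB)) (≤-trans (≤-trans (≤-reflexive (sym (+-assoc (p A B A) _ _)))
        (+-monoˡ-≤ (p B B A) (m≤n+m (p A B A + p A B A) (p A A A)))) (≤-reflexive (sym (trans (cc-split′ AB A) (cong (_+ p B B A) (+-assoc (p A A A) _ _)))))))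
      (≤-trans (+-monoʳ-≤ (p A B B) (≤-reflexive kA)) (≤-trans (≤-trans (≤-reflexive (x+[y+x] (p A B B) (p A A B))) (m≤m+n _ (p B B B))) (≤-reflexive (sym (cc-split′ AB B)))))
      (half AB) (half BA) (≤-reflexive (triangle′ B B A)) M-tiny K-big)
    where
    x+[y+x] : ∀ x y → x + (y + x) ≡ y + x + x
    x+[y+x] x y = +-comm x (y + x)
    zero-D : ∀ i j → p i j D ≡ 0 → p j D i ≡ 0
    zero-D i j z = trans (p-sym j D i) (*-cancelˡ-≡ _ _ (k i) {{>-nonZero (k>0 i)}}
        (trans (sym (triangle′ i j D)) (trans (cong (k D *_) z) (trans (*-zeroʳ (k D)) (sym (*-zeroʳ (k i)))))))
    kB : k B ≡ p A B A + p B B A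
    kB = trans (k-split B A) (trans (cong (p B A A + p B B A +_) (zero-D A B e)) (trans (+-identityʳ _) (cong (_+ p B B A) (p-sym B A A))))
    kA : k A ≡ p A A B + p A B B
    kA = trans (k-split A B) (trans (cong (p A A B + p A B B +_) (zero-D B A (trans (p-sym B A D) e))) (+-identityʳ _))

  -- `M ≤ 4` is the sum of four intersection numbers of colour `D` that are all positive.
  p≤1 : ∀ {i j} → Partner i j → p i i D ≤ 1
  p≤1 {i} {j} ij = all-ones M (p i i D) (p i j D) (p j j D) (pij ij) (p>0 (partner-sym ij)) M≤4
    (≤-reflexive (sym (cc-split′ ij D)))
    where
    pij : ∀ {i j} → Partner i j → 1 ≤ p i j D
    pij AB = pAB>0
    pij BA = subst (1 ≤_) (p-sym A B D) pAB>0

  pAB≤1 : p A B D ≤ 1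
  pAB≤1 = all-ones′ M (p A A D) (p A B D) (p B B D) (p>0 AB) (p>0 BA) M≤4 (≤-reflexive (sym (cc-split′ AB D)))

  kD-ones : ∀ {i j} → Partner i j → k D ≡ k i * p i D i × p j D i ≡ p i D i
  kD-ones {i} {j} ij = one , *-cancelˡ-≡ _ _ (k i) {{>-nonZero (k>0 i)}} (trans (sym two) one)
    where
    ones : ∀ {i j} → Partner i j → p i j D ≡ 1
    ones AB = ≤-antisym pAB≤1 pAB>0
    ones BA = trans (p-sym B A D) (≤-antisym pAB≤1 pAB>0)
    one : k D ≡ k i * p i D i
    one = trans (sym (*-identityʳ (k D))) (trans (cong (k D *_) (sym (≤-antisym (p≤1 ij) (p>0 ij))))
      (trans (triangle′ i i D) (cong (k i *_) (p-sym D i i))))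
    two : k D ≡ k i * p j D i
    two = trans (sym (*-identityʳ (k D))) (trans (cong (k D *_) (sym (ones ij)))
      (trans (triangle′ i j D) (cong (k i *_) (p-sym D j i))))

  kᵢ : ∀ {i j} → Partner i j → k i ≡ 1 + p i i i + p i j i + p i D i
  kᵢ {i} {j} ij = trans (k-split′ ij i i) (cong (λ b → ⟪ b ⟫ + p i i i + p i j i + p i D i) (==-refl i))

  kⱼ : ∀ {i j} → Partner i j → k j ≡ p i j i + p j j i + p i D i
  kⱼ {i} {j} ij = trans (k-split′ ij j i) (cong₂ _+_ (cong (_+ p j j i)
    (trans (cong (λ b → ⟪ b ⟫ + p j i i) (i≠j ij)) (p-sym j i i))) (proj₂ (kD-ones ij)))
    where
    i≠j : ∀ {i j} → Partner i j → (i == j) ≡ false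
    i≠j AB = refl
    i≠j BA = refl

  -- Adding `kᵢ` and `kⱼ` gives `K = 1 + cc i + 2 * p i D i`; as `cc i` is about `K / 2`, the last
  -- number is about `K / 4`.
  D-upper : ∀ {i j} → Partner i j → 4000 * p i D i ≤ 1003 * K
  D-upper {i} {j} ij = h-upper K (k i) (k j) (p i i i) (p i j i) (p j j i) (p i D i) (cc i)
    (≤-reflexive (sym (K≡′ ij))) (≤-reflexive (sym (kᵢ ij))) (≤-reflexive (sym (kⱼ ij))) (≤-reflexive (cc-split′ ij i)) (close′ ij)

  D-lower : ∀ {i j} → Partner i j → 999 * K ≤ 4000 * p i D i
  D-lower {i} {j} ij = h-lower K M (k i) (k j) (p i i i) (p i j i) (p j j i) (p i D i) (cc i)
    (≤-reflexive (K≡′ ij)) (≤-reflexive (kᵢ ij)) (≤-reflexive (kⱼ ij)) (≤-reflexive (sym (cc-split′ ij i))) (half ij) M-tiny K-big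

  -- `k D = k A * p A D A = k B * p B D B` makes the two valencies comparable, so `triangle′` bounds
  -- `p B B A` and `p A A B` by `2 * m` too. Then `k A` and `k B` hardly exceed `K / 4` each and
  -- cannot add up to `K`.
  not-both-twins : ∀ m → p A B A ≤ m → p A B B ≤ m → 4000 * m ≤ K + 2000 * M → ⊥
  not-both-twins m x≤m w≤m m-small = twin-end K M (k A) (k B) (p A B A) (p B B A) (p A A B) (p A B B) (p A D A) (p B D B) m
      (≤-reflexive K≡) (≤-reflexive (kⱼ AB))
      (≤-reflexive (trans (kⱼ BA) (cong (_+ p B D B) (trans (+-comm (p B A B) (p A A B)) (cong (p A A B +_) (p-sym B A B))))))
      x≤m w≤m
      (twin-p (k A) (k B) (p B B A) (p A B B) m (≤-reflexive (triangle′ B B A)) w≤m (rat AB) (k>0 A))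
      (twin-p (k B) (k A) (p A A B) (p A B A) m (≤-reflexive (trans (triangle′ A A B) (cong (k A *_) (p-sym B A A)))) x≤m (rat BA) (k>0 B))
      (D-upper AB) (D-upper BA) m-small M-tiny (≤-trans (s≤s z≤n) K-big)
    where
    rat : ∀ {i j} → Partner i j → k j ≤ 2 * k i
    rat {i} {j} ij = ratio K (k i) (k j) (p i D i) (p j D j)
      (≤-reflexive (trans (sym (proj₁ (kD-ones (partner-sym ij)))) (proj₁ (kD-ones ij))))
      (D-upper ij) (D-lower (partner-sym ij)) (≤-trans (s≤s z≤n) K-big)

  opaque
    -- Weight in the averaging of `pick-good`: large enough for a degree excess of `K / 4000` to
    -- outweigh the bad-neighbour term, small enough for the errors to leave a good vertex at most
    -- `K / 1000` bad neighbours.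
    Y : ℕ
    Y = 8000

    8000≤Y : 8000 ≤ Y
    8000≤Y = ≤-refl

    Y≤8000 : Y ≤ 8000
    Y≤8000 = ≤-refl

    bad : V → Bool
    bad u = 2001 * K <ᵇ 4000 * degS u

    bad-true : ∀ u → bad u ≡ true → 2001 * K + 1 ≤ 4000 * degS u
    bad-true u e = subst (_≤ 4000 * degS u) (+-comm 1 (2001 * K)) (<ᵇ-true e)

    bad-false : ∀ u → bad u ≡ false → 4000 * degS u ≤ 2001 * K
    bad-false u e = <ᵇ-false e

  bad-nbrs : V → ℕ
  bad-nbrs u = # (λ w → (S w ∧ bad w) ∧ adj u w)

  bad-sum : ∑ (λ u → ⟪ S u ⟫ * bad-nbrs u) ≡ ∑ (λ w → ⟪ S w ⟫ * (⟪ bad w ⟫ * degS w))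
  bad-sum = begin
    ∑ (λ u → ⟪ S u ⟫ * bad-nbrs u)
      ≡⟨ ∑-cong (λ u → sym (∑-*ˡ ⟪ S u ⟫ (λ w → ⟪ (S w ∧ bad w) ∧ adj u w ⟫))) ⟩
    ∑ (λ u → ∑ (λ w → ⟪ S u ⟫ * ⟪ (S w ∧ bad w) ∧ adj u w ⟫))
      ≡⟨ ∑-swap (λ u w → ⟪ S u ⟫ * ⟪ (S w ∧ bad w) ∧ adj u w ⟫) ⟩
    ∑ (λ w → ∑ (λ u → ⟪ S u ⟫ * ⟪ (S w ∧ bad w) ∧ adj u w ⟫))
      ≡⟨ ∑-cong (λ w → trans (∑-cong (λ u → trans (bits (S u) (S w) (bad w) (adj u w))
           (cong (λ a → ⟪ S w ⟫ * (⟪ bad w ⟫ * ⟪ S u ∧ a ⟫)) (adj-sym u w))))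
           (trans (∑-*ˡ ⟪ S w ⟫ (λ u → ⟪ bad w ⟫ * ⟪ S u ∧ adj w u ⟫))
             (cong (⟪ S w ⟫ *_) (∑-*ˡ ⟪ bad w ⟫ (λ u → ⟪ S u ∧ adj w u ⟫))))) ⟩
    ∑ (λ w → ⟪ S w ⟫ * (⟪ bad w ⟫ * degS w)) ∎
    where
    open ≡-Reasoning
    bits : ∀ a b d e → ⟪ a ⟫ * ⟪ (b ∧ d) ∧ e ⟫ ≡ ⟪ b ⟫ * (⟪ d ⟫ * ⟪ a ∧ e ⟫)
    bits true  true  true  e = sym (+-identityʳ _)
    bits true  true  false e = refl
    bits true  false d     e = refl
    bits false true  true  e = refl
    bits false true  false e = refl
    bits false false d     e = refl

  -- By `bad-sum` the bad neighbours can be averaged together with the walks, so one vertex serves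
  -- both purposes: were it bad it would violate the combined inequality, and being good it has few
  -- bad neighbours.
  pick-good : ∃[ u ] (S u ≡ true × Y * (degS u * degS u) + K * bad-nbrs u ≤
    Y * (err + degSC A u * cc A + degSC B u * cc B) + K * (⟪ bad u ⟫ * degS u))
  pick-good = ∑-pick S _ _ (u₀ , Su₀) (subst₂ _≤_
      (sym (combine (λ u → degS u * degS u) bad-nbrs))
      (sym (combine (λ u → err + degSC A u * cc A + degSC B u * cc B) (λ u → ⟪ bad u ⟫ * degS u)))
      (+-mono-≤ (*-monoʳ-≤ Y walks) (*-monoʳ-≤ K (≤-reflexive bad-sum))))
    where
    combine : ∀ (x y : V → ℕ) → ∑ (λ u → ⟪ S u ⟫ * (Y * x u + K * y u)) ≡
      Y * ∑ (λ u → ⟪ S u ⟫ * x u) + K * ∑ (λ u → ⟪ S u ⟫ * y u)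
    combine x y = trans (∑-cong (λ u → trans (*-distribˡ-+ ⟪ S u ⟫ (Y * x u) (K * y u))
        (cong₂ _+_ (pull Y ⟪ S u ⟫ (x u)) (pull K ⟪ S u ⟫ (y u)))))
      (trans (∑-+ (λ u → Y * (⟪ S u ⟫ * x u)) _) (cong₂ _+_ (∑-*ˡ Y (λ u → ⟪ S u ⟫ * x u)) (∑-*ˡ K (λ u → ⟪ S u ⟫ * y u))))
      where
      pull : ∀ a b d → b * (a * d) ≡ a * (b * d)
      pull a b d = trans (sym (*-assoc b a d)) (trans (cong (_* d) (*-comm b a)) (*-assoc a b d))

  common-moved : V → V → Bool
  common-moved u w = S w ∧ (adj u w ∧ adj (f u) w)

  -- The common neighbours of `u` and `f u` include all `K - degS u` fixed neighbours of `u`;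
  -- `common-moved` counts the others.
  common-moved-bound : ∀ u → # (common-moved u) + K ≤ comm u (f u) + degS u
  common-moved-bound u = begin
    # (common-moved u) + K                 ≡⟨ cong (# (common-moved u) +_) (sym (val-# light u)) ⟩
    # (common-moved u) + # (adj u)         ≡⟨ sym (∑-+ (λ w → ⟪ common-moved u w ⟫) _) ⟩
    ∑ (λ w → ⟪ common-moved u w ⟫ + ⟪ adj u w ⟫) ≤⟨ ∑-mono h ⟩
    ∑ (λ w → ⟪ adj u w ∧ adj (f u) w ⟫ + ⟪ S w ∧ adj u w ⟫) ≡⟨ ∑-+ (λ w → ⟪ adj u w ∧ adj (f u) w ⟫) _ ⟩
    comm u (f u) + degS u ∎
    where
    open ≤-Reasoning
    h : ∀ w → ⟪ common-moved u w ⟫ + ⟪ adj u w ⟫ ≤ ⟪ adj u w ∧ adj (f u) w ⟫ + ⟪ S w ∧ adj u w ⟫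
    h w with S w in e
    ... | true = ≤-refl
    ... | false rewrite c-fixed u w e with adj u w
    ...   | true  = ≤-refl
    ...   | false = z≤n

  Good : V → Set
  Good u = S u ≡ true × bad u ≡ false

  m : V → ℕ
  m u = # (common-moved u)

  not-D : ∀ {u} → Good u → ¬ c u (f u) ≡ D
  not-D {u} (Su , e) q = good-not-D K M (degS u) (subst (λ z → K ≤ degS u + z) (comm-cc q) (deg-lower light u))
    (bad-false u e) M-tiny K-big

  t-light : ∀ {u} → Good u → adj u (f u) ≡ true
  t-light {u} g = by-cases (c u (f u)) refl
    where
    by-cases : ∀ t → c u (f u) ≡ t → light t ≡ true
    by-cases O e = ⊥-elim (moved-colour (proj₁ g) e)
    by-cases A e = refl
    by-cases B e = refl
    by-cases D e = ⊥-elim (not-D g e)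

  m-small : ∀ {u} → Good u → 4000 * m u ≤ K + 2000 * M
  m-small {u} (Su , e) = good-num K M (degS u) (m u) (comm u (f u)) (common-moved-bound u)
    (subst (λ z → 2 * z ≤ K + M) (sym (both-C light u (f u))) (half′ _ (moved-colour Su))) (bad-false u e)

  -- A vertex seen in different colours from `u` and `f u` cannot be fixed.
  twin : ∀ u → p A B (c u (f u)) ≤ m u
  twin u = ≤-trans (≤-reflexive (sym (coh A B u (f u)))) (#-mono h)
    where
    h : ∀ w → (c u w == A) ∧ (c (f u) w == B) ≡ true → common-moved u w ≡ true
    h w e with S w in e′
    ... | true = ∧-true (cong light (==⇒≡ (c u w) A (∧-left e))) (cong light (==⇒≡ (c (f u) w) B (∧-right {c u w == A} e)))
    ... | false rewrite c-fixed u w e′ with () ← trans (sym (==⇒≡ (c u w) A (∧-left e))) (==⇒≡ (c u w) B (∧-right {c u w == A} e))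

  same-colour : ∀ {u u′} → Good u → Good u′ → c u (f u) ≡ c u′ (f u′)
  same-colour {u} {u′} gu gu′ = by-cases (c u (f u)) (c u′ (f u′)) refl refl (t-light gu) (t-light gu′)
    where
    m′ : ℕ
    m′ = m u ⊔ m u′
    m′-small : 4000 * m′ ≤ K + 2000 * M
    m′-small = either (⊔-sel (m u) (m u′))
      where
      either : m′ ≡ m u ⊎ m′ ≡ m u′ → 4000 * m′ ≤ K + 2000 * M
      either (inj₁ e) = subst (λ z → 4000 * z ≤ K + 2000 * M) (sym e) (m-small gu)
      either (inj₂ e) = subst (λ z → 4000 * z ≤ K + 2000 * M) (sym e) (m-small gu′)
    by-cases : ∀ x y → c u (f u) ≡ x → c u′ (f u′) ≡ y → light x ≡ true → light y ≡ true → x ≡ y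
    by-cases A A _ _ _ _ = refl
    by-cases B B _ _ _ _ = refl
    by-cases A B a b _ _ = ⊥-elim (not-both-twins m′
      (≤-trans (subst (λ t → p A B t ≤ m u) a (twin u)) (m≤m⊔n _ _))
      (≤-trans (subst (λ t → p A B t ≤ m u′) b (twin u′)) (m≤n⊔m _ _)) m′-small)
    by-cases B A a b _ _ = ⊥-elim (not-both-twins m′
      (≤-trans (subst (λ t → p A B t ≤ m u′) b (twin u′)) (m≤n⊔m _ _))
      (≤-trans (subst (λ t → p A B t ≤ m u) a (twin u)) (m≤m⊔n _ _)) m′-small)
    by-cases D _ _ _ () _
    by-cases _ D _ _ _ ()

  -- For good u and u′ of the colour t ≡ c u (f u), both f u and u′ would join u to f u′ by two steps of colour t.
  clash : ∀ {i j} → Partner i j → ∀ u u′ → c u (f u) ≡ i → c u′ (f u′) ≡ i → c u u′ ≡ i →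
    c u (f u′) ≡ D → ¬ f u ≡ u′ → ⊥
  clash {i} ij u u′ a b d e ne = <⇒≱ (#≥2 (λ w → (c u w == i) ∧ (c (f u′) w == i)) (f u) u′ ne
      (∧-true (is-col i a) (is-col i (trans (f-col u′ u) (trans (c-sym u′ u) d))))
      (∧-true (is-col i d) (is-col i (trans (c-sym (f u′) u′) b))))
    (≤-trans (≤-reflexive (trans (coh i i u (f u′)) (cong (p i i) e))) (p≤1 ij))

  S-f : ∀ w → S w ≡ true → S (f w) ≡ true
  S-f w Sw rewrite ≢⇒== (f (f w)) (f w) (λ q → moves w Sw (f-inj (f w) w q)) = refl

  -- For a good moved `i`-neighbour `w`, the image `f w` is adjacent to `f u`. Either it is also
  -- adjacent to `u`, hence a moved common neighbour, or `c u (f w)` is `D` and `clash` applies. The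
  -- two units pay for `w = f u` and `f w = u`.
  nbr-bound : ∀ {i j} → Partner i j → ∀ u → (g : Good u) → c u (f u) ≡ i →
    degSC i u ≤ bad-nbrs u + m u + 1 + 1
  nbr-bound {i} ij u g ufu = begin
    degSC i u
      ≤⟨ ∑-mono h ⟩
    ∑ (λ w → ⟪ (S w ∧ bad w) ∧ adj u w ⟫ + ⟪ common-moved u (f w) ⟫ + ⟪ w == f u ⟫ + ⟪ u == f w ⟫)
      ≡⟨ ∑-+₄ (λ w → ⟪ (S w ∧ bad w) ∧ adj u w ⟫) _ _ _ ⟩
    bad-nbrs u + # (common-moved u ∘ f) + # (_== f u) + # (λ w → u == f w)
      ≤⟨ +-mono-≤ (+-mono-≤ (+-monoʳ-≤ (bad-nbrs u) (#-preimage f f-inj (common-moved u))) (≤-reflexive (#-point (f u))))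
           (#≤1 _ (λ w w′ e e′ → f-inj w w′ (trans (sym (==⇒≡ u (f w) e)) (==⇒≡ u (f w′) e′)))) ⟩
    bad-nbrs u + # (common-moved u) + 1 + 1 ∎
    where
    open ≤-Reasoning
    h : ∀ w → ⟪ S w ∧ (c u w == i) ⟫ ≤ ⟪ (S w ∧ bad w) ∧ adj u w ⟫ + ⟪ common-moved u (f w) ⟫ + ⟪ w == f u ⟫ + ⟪ u == f w ⟫
    h w with S w in Sw | c u w == i in uw
    ... | false | _ = z≤n
    ... | true | false = z≤n
    ... | true | true with bad w in bw
    ...   | true rewrite ==⇒≡ (c u w) i uw | partner-light ij = s≤s z≤n
    ...   | false with w == f u in wfu
    ...     | true  = ≤-trans (m≤n+m 1 (0 + ⟪ common-moved u (f w) ⟫)) (m≤m+n _ ⟪ u == f w ⟫)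
    ...     | false with u == f w in ufw
    ...       | true  = m≤n+m 1 (0 + ⟪ common-moved u (f w) ⟫ + 0)
    ...       | false with adj u (f w) in a
    ...         | true rewrite S-f w Sw = ≤-reflexive (sym (cong (λ b → ⟪ b ⟫ + 0 + 0) (trans (cong light (f-col u w)) (trans (cong light (==⇒≡ (c u w) i uw)) (partner-light ij)))))
    ...         | false = ⊥-elim (clash ij u w ufu (trans (sym (same-colour g (Sw , bw))) ufu) (==⇒≡ (c u w) i uw)
                    (far u (f w) (==⇒≢ u (f w) ufw) a) (λ q → ==⇒≢ w (f u) wfu (sym q)))

  impossible : ⊥
  impossible = branch pick-good
    where
    branch : ∃[ u ] (S u ≡ true × Y * (degS u * degS u) + K * bad-nbrs u ≤
      Y * (err + degSC A u * cc A + degSC B u * cc B) + K * (⟪ bad u ⟫ * degS u)) → ⊥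
    branch (u , Su , h) = split (bad u) refl
      where
      h′ : ∀ b → bad u ≡ b → Y * (degS u * degS u) + K * bad-nbrs u ≤
        Y * (err + degSC A u * cc A + degSC B u * cc B) + K * (⟪ b ⟫ * degS u)
      h′ b e = subst (λ z → Y * (degS u * degS u) + K * bad-nbrs u ≤
        Y * (err + degSC A u * cc A + degSC B u * cc B) + K * (⟪ z ⟫ * degS u)) e h
      finish : Good u → ∀ t → c u (f u) ≡ t → light t ≡ true → ⊥
      finish g t e lt = last t e lt
        where
        b-small : 1000 * bad-nbrs u ≤ K
        b-small = few-bad K M (degS u) (degSC A u) (degSC B u) (cc A) (cc B) err (bad-nbrs u) Y Y≤8000 (h′ false (proj₂ g))
          (≤-reflexive (sym (degS≡ u))) (half AB) (half BA) (deg≥ Su) (deg≤K u) error-tiny M-tiny K-big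
        end : ∀ {i j} → Partner i j → c u (f u) ≡ i → ⊥
        -- `share` and the valency bound `K / 200` yield about `K / 600` moved `i`-neighbours, more
        -- than the `K / 1000` bad and roughly `K / 4000` common ones together.
        end {i} ij ufu = final-num K M (k i) (degSC i u) (bad-nbrs u) (m u) (share ij Su) (nbr-bound ij u g ufu)
          (m-small g) b-small (large ij) M-tiny K-big
        last : ∀ t → c u (f u) ≡ t → light t ≡ true → ⊥
        last A e _ = end AB e
        last B e _ = end BA e
        last D _ ()
      split : ∀ b → bad u ≡ b → ⊥
      split true  e = bad-num K M (degS u) (degSC A u) (degSC B u) (cc A) (cc B) err (bad-nbrs u) Y 8000≤Y (h′ true e)
        (≤-reflexive (sym (degS≡ u))) (half AB) (half BA) (bad-true u e) error-tiny M-tiny K-big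
      split false e = finish (Su , e) (c u (f u)) refl (t-light (Su , e))

-- One light colour much sparser than the other

thin-pick : ∀ K M d x y a b e ka m →
  d * d ≤ e + x * a + y * b →
  x + y ≤ d →
  x ≤ ka →
  200 * ka ≤ K →
  a ≤ K →
  K ≤ d + m →
  3 * m ≤ 2 * K + M →
  100000000 * e ≤ K * K →
  100000000 * M ≤ K →
  200000000 ≤ K →
  98 * K ≤ 100 * m + 100 * b
thin-pick K M d x y a b e ka m h1 h2 h3 h4 h5 h6 h7 h8 h9 h10 = prove (K ∷ M ∷ d ∷ x ∷ y ∷ a ∷ b ∷ e ∷ ka ∷ m ∷ []) (λ { (K ∷ M ∷ d ∷ x ∷ y ∷ a ∷ b ∷ e ∷ ka ∷ m ∷ []) →
    d :* d :≤ e :+ x :* a :+ y :* b [ con 15000000000 ] ∷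
    x :+ y :≤ d [ con 15000000000 :* b ] ∷
    x :≤ ka [ con 15000000000 :* a ] ∷
    con 200 :* ka :≤ K [ con 75000000 :* a ] ∷
    a :≤ K [ con 75000000 :* K ] ∷
    K :≤ d :+ m [ con 300000000 :* K :+ con 15000000000 :* d ] ∷
    con 3 :* m :≤ con 2 :* K :+ M [ con 100000000 :* K ] ∷
    con 100000000 :* e :≤ K :* K [ con 150 ] ∷
    con 100000000 :* M :≤ K [ K ] ∷
    con 200000000 :≤ K [ con 4999969800000000 :+ con 24999849 :* K ] ∷
    [] })
  (λ { (K ∷ M ∷ d ∷ x ∷ y ∷ a ∷ b ∷ e ∷ ka ∷ m ∷ []) → con 98 :* K :≤ con 100 :* m :+ con 100 :* b [ con 150000000 :* d ] })
  refl (h1 ∷ h2 ∷ h3 ∷ h4 ∷ h5 ∷ h6 ∷ h7 ∷ h8 ∷ h9 ∷ h10 ∷ [])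

esc-one : ∀ K M ka kb b z →
  K ≤ ka + kb →
  200 * ka ≤ K →
  3 * b ≤ 2 * K + M →
  z ≤ b + 1 →
  100000000 * M ≤ K →
  200000000 ≤ K →
  z + 1 ≤ kb
esc-one K M ka kb b z h1 h2 h3 h4 h5 h6 = prove (K ∷ M ∷ ka ∷ kb ∷ b ∷ z ∷ []) (λ { (K ∷ M ∷ ka ∷ kb ∷ b ∷ z ∷ []) →
    K :≤ ka :+ kb [ con 300000000 ] ∷
    con 200 :* ka :≤ K [ con 1500000 ] ∷
    con 3 :* b :≤ con 2 :* K :+ M [ con 100000000 ] ∷
    z :≤ b :+ con 1 [ con 300000000 ] ∷
    con 100000000 :* M :≤ K [ con 1 ] ∷
    con 200000000 :≤ K [ con 98499999 ] ∷
    [] })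
  (λ { (K ∷ M ∷ ka ∷ kb ∷ b ∷ z ∷ []) → z :+ con 1 :≤ kb [ con 300000000 ] })
  refl (h1 ∷ h2 ∷ h3 ∷ h4 ∷ h5 ∷ h6 ∷ [])

no-three : ∀ K M b →
  3 * b ≤ K + M + M + M →
  2 * K + 1 ≤ 5 * b →
  100000000 * M ≤ K →
  200000000 ≤ K →
  ⊥
no-three K M b h1 h2 h3 h4 = refute (K ∷ M ∷ b ∷ []) (λ { (K ∷ M ∷ b ∷ []) →
    con 3 :* b :≤ K :+ M :+ M :+ M [ con 100000000 ] ∷
    con 2 :* K :+ con 1 :≤ con 5 :* b [ con 60000000 ] ∷
    con 100000000 :* M :≤ K [ con 3 ] ∷
    con 200000000 :≤ K [ con 19999997 ] ∷
    [] })
  refl (h1 ∷ h2 ∷ h3 ∷ h4 ∷ [])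

thin-n₁ : ∀ K M ka kb b →
  K ≤ ka + kb →
  2 * b ≤ K + M →
  2 * b + 2 ≤ kb + (M + ka + 2)
thin-n₁ K M ka kb b h1 h2 = prove (K ∷ M ∷ ka ∷ kb ∷ b ∷ []) (λ { (K ∷ M ∷ ka ∷ kb ∷ b ∷ []) →
    K :≤ ka :+ kb [ con 1 ] ∷
    con 2 :* b :≤ K :+ M [ con 1 ] ∷
    [] })
  (λ { (K ∷ M ∷ ka ∷ kb ∷ b ∷ []) → con 2 :* b :+ con 2 :≤ kb :+ (M :+ ka :+ con 2) [ con 1 ] })
  refl (h1 ∷ h2 ∷ [])

thin-n₂ : ∀ K M ka kb b →
  K ≤ ka + kb →
  kb ≤ b + b + 2 →
  200 * ka ≤ K →
  100000000 * M ≤ K →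
  200000000 ≤ K →
  K + 2 * M ≤ 3 * b
thin-n₂ K M ka kb b h1 h2 h3 h4 h5 = prove (K ∷ M ∷ ka ∷ kb ∷ b ∷ []) (λ { (K ∷ M ∷ ka ∷ kb ∷ b ∷ []) →
    K :≤ ka :+ kb [ con 75000000 ] ∷
    kb :≤ b :+ b :+ con 2 [ con 75000000 ] ∷
    con 200 :* ka :≤ K [ con 375000 ] ∷
    con 100000000 :* M :≤ K [ con 1 ] ∷
    con 200000000 :≤ K [ con 24624999 ] ∷
    [] })
  (λ { (K ∷ M ∷ ka ∷ kb ∷ b ∷ []) → K :+ con 2 :* M :≤ con 3 :* b [ con 50000000 ] })
  refl (h1 ∷ h2 ∷ h3 ∷ h4 ∷ h5 ∷ [])

thin-n₃ : ∀ K M ka kb b →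
  K ≤ ka + kb →
  kb ≤ b + b + 2 →
  200 * ka ≤ K →
  100000000 * M ≤ K →
  200000000 ≤ K →
  K + 3 * (M + ka + 2) + 1 ≤ 3 * b
thin-n₃ K M ka kb b h1 h2 h3 h4 h5 = prove (K ∷ M ∷ ka ∷ kb ∷ b ∷ []) (λ { (K ∷ M ∷ ka ∷ kb ∷ b ∷ []) →
    K :≤ ka :+ kb [ con 150000000 ] ∷
    kb :≤ b :+ b :+ con 2 [ con 150000000 ] ∷
    con 200 :* ka :≤ K [ con 2250000 ] ∷
    con 100000000 :* M :≤ K [ con 3 ] ∷
    con 200000000 :≤ K [ con 47749997 ] ∷
    [] })
  (λ { (K ∷ M ∷ ka ∷ kb ∷ b ∷ []) → K :+ con 3 :* (M :+ ka :+ con 2) :+ con 1 :≤ con 3 :* b [ con 100000000 ] })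
  refl (h1 ∷ h2 ∷ h3 ∷ h4 ∷ h5 ∷ [])

thin-n₄ : ∀ K M ka kb b be →
  K ≤ ka + kb →
  kb ≤ b + b + 2 →
  200 * ka ≤ K →
  3 * b ≤ be + K + 2 * M →
  100000000 * M ≤ K →
  200000000 ≤ K →
  b + (M + ka + 2) + 1 ≤ 2 * be
thin-n₄ K M ka kb b be h1 h2 h3 h4 h5 h6 = prove (K ∷ M ∷ ka ∷ kb ∷ b ∷ be ∷ []) (λ { (K ∷ M ∷ ka ∷ kb ∷ b ∷ be ∷ []) →
    K :≤ ka :+ kb [ con 50000000 ] ∷
    kb :≤ b :+ b :+ con 2 [ con 50000000 ] ∷
    con 200 :* ka :≤ K [ con 350000 ] ∷
    con 3 :* b :≤ be :+ K :+ con 2 :* M [ con 40000000 ] ∷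
    con 100000000 :* M :≤ K [ con 1 ] ∷
    con 200000000 :≤ K [ con 9649999 ] ∷
    [] })
  (λ { (K ∷ M ∷ ka ∷ kb ∷ b ∷ be ∷ []) → b :+ (M :+ ka :+ con 2) :+ con 1 :≤ con 2 :* be [ con 20000000 ] })
  refl (h1 ∷ h2 ∷ h3 ∷ h4 ∷ h5 ∷ h6 ∷ [])

thin-n₅ : ∀ K M ka kb b be m →
  K ≤ ka + kb →
  kb ≤ b + b + 2 →
  200 * ka ≤ K →
  3 * b ≤ be + K + 2 * M →
  3 * m ≤ 2 * K + M →
  100000000 * M ≤ K →
  200000000 ≤ K →
  m + M + 1 ≤ 2 * be
thin-n₅ K M ka kb b be m h1 h2 h3 h4 h5 h6 h7 = prove (K ∷ M ∷ ka ∷ kb ∷ b ∷ be ∷ m ∷ []) (λ { (K ∷ M ∷ ka ∷ kb ∷ b ∷ be ∷ m ∷ []) →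
    K :≤ ka :+ kb [ con 56250000 ] ∷
    kb :≤ b :+ b :+ con 2 [ con 56250000 ] ∷
    con 200 :* ka :≤ K [ con 281250 ] ∷
    con 3 :* b :≤ be :+ K :+ con 2 :* M [ con 37500000 ] ∷
    con 3 :* m :≤ con 2 :* K :+ M [ con 6250000 ] ∷
    con 100000000 :* M :≤ K [ con 1 ] ∷
    con 200000000 :≤ K [ con 5968749 ] ∷
    [] })
  (λ { (K ∷ M ∷ ka ∷ kb ∷ b ∷ be ∷ m ∷ []) → m :+ M :+ con 1 :≤ con 2 :* be [ con 18750000 ] })
  refl (h1 ∷ h2 ∷ h3 ∷ h4 ∷ h5 ∷ h6 ∷ h7 ∷ [])

thin-end-1 : ∀ K M ka kb b kd q r →
  K ≤ ka + kb →
  200 * ka ≤ K →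
  2 * b ≤ K + M →
  kb ≤ 1 + b + r →
  kb * r ≤ kd * q →
  q ≤ 4 →
  kd ≤ ka * kb →
  100000000 * M ≤ K →
  200000000 ≤ K →
  ⊥
thin-end-1 K M ka kb b kd q r h1 h2 h3 h4 h5 h6 h7 h8 h9 = refute (K ∷ M ∷ ka ∷ kb ∷ b ∷ kd ∷ q ∷ r ∷ []) (λ { (K ∷ M ∷ ka ∷ kb ∷ b ∷ kd ∷ q ∷ r ∷ []) →
    K :≤ ka :+ kb [ con 20000000000 :* kb :+ con 9499999800 :* K ] ∷
    con 200 :* ka :≤ K [ con 500000000 :* kb :+ con 47499999 :* K ] ∷
    con 2 :* b :≤ K :+ M [ con 10000000000 :* kb ] ∷
    kb :≤ con 1 :+ b :+ r [ con 20000000000 :* kb ] ∷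
    kb :* r :≤ kd :* q [ con 20000000000 ] ∷
    q :≤ con 4 [ con 20000000000 :* kd ] ∷
    kd :≤ ka :* kb [ con 80000000000 ] ∷
    con 100000000 :* M :≤ K [ con 100 :* kb ] ∷
    con 200000000 :≤ K [ con 1890499960200000000 :+ con 100 :* kb :+ con 9452499801 :* K ] ∷
    [] })
  refl (h1 ∷ h2 ∷ h3 ∷ h4 ∷ h5 ∷ h6 ∷ h7 ∷ h8 ∷ h9 ∷ [])

thin-end-2 : ∀ K M ka kb a →
  K ≤ ka + kb →
  200 * ka ≤ K →
  kb ≤ a →
  3 * a ≤ 2 * K + M →
  100000000 * M ≤ K →
  200000000 ≤ K →
  ⊥
thin-end-2 K M ka kb a h1 h2 h3 h4 h5 h6 = refute (K ∷ M ∷ ka ∷ kb ∷ a ∷ []) (λ { (K ∷ M ∷ ka ∷ kb ∷ a ∷ []) →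
    K :≤ ka :+ kb [ con 300000000 ] ∷
    con 200 :* ka :≤ K [ con 1500000 ] ∷
    kb :≤ a [ con 300000000 ] ∷
    con 3 :* a :≤ con 2 :* K :+ M [ con 100000000 ] ∷
    con 100000000 :* M :≤ K [ con 1 ] ∷
    con 200000000 :≤ K [ con 98499999 ] ∷
    [] })
  refl (h1 ∷ h2 ∷ h3 ∷ h4 ∷ h5 ∷ h6 ∷ [])

max-is-A : ∀ K b →
  98 * K ≤ 100 * b + 100 * b →
  5 * b ≤ 2 * K →
  200000000 ≤ K →
  ⊥
max-is-A K b h1 h2 h3 = refute (K ∷ b ∷ []) (λ { (K ∷ b ∷ []) →
    con 98 :* K :≤ con 100 :* b :+ con 100 :* b [ con 1 ] ∷
    con 5 :* b :≤ con 2 :* K [ con 40 ] ∷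
    con 200000000 :≤ K [ con 18 ] ∷
    [] })
  refl (h1 ∷ h2 ∷ h3 ∷ [])

max-not-D : ∀ K M b →
  98 * K ≤ 100 * M + 100 * b →
  5 * b ≤ 2 * K →
  100000000 * M ≤ K →
  200000000 ≤ K →
  ⊥
max-not-D K M b h1 h2 h3 h4 = refute (K ∷ M ∷ b ∷ []) (λ { (K ∷ M ∷ b ∷ []) →
    con 98 :* K :≤ con 100 :* M :+ con 100 :* b [ con 1000000 ] ∷
    con 5 :* b :≤ con 2 :* K [ con 20000000 ] ∷
    con 100000000 :* M :≤ K [ con 1 ] ∷
    con 200000000 :≤ K [ con 57999999 ] ∷
    [] })
  refl (h1 ∷ h2 ∷ h3 ∷ h4 ∷ [])

no-four : ∀ K M a b →
  98 * K ≤ 100 * a + 100 * b →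
  3 * a ≤ 2 * K + M →
  4 * b ≤ K + M + M + M + M + M + M →
  100000000 * M ≤ K →
  200000000 ≤ K →
  ⊥
no-four K M a b h1 h2 h3 h4 h5 = refute (K ∷ M ∷ a ∷ b ∷ []) (λ { (K ∷ M ∷ a ∷ b ∷ []) →
    con 98 :* K :≤ con 100 :* a :+ con 100 :* b [ con 6000000 ] ∷
    con 3 :* a :≤ con 2 :* K :+ M [ con 200000000 ] ∷
    con 4 :* b :≤ K :+ M :+ M :+ M :+ M :+ M :+ M [ con 150000000 ] ∷
    con 100000000 :* M :≤ K [ con 11 ] ∷
    con 200000000 :≤ K [ con 37999989 ] ∷
    [] })
  refl (h1 ∷ h2 ∷ h3 ∷ h4 ∷ h5 ∷ [])

esc-two : ∀ K ka kb b z →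
  K ≤ ka + kb →
  200 * ka ≤ K →
  5 * b ≤ 2 * K →
  z ≤ b + 1 + (b + 1) →
  200000000 ≤ K →
  z + 1 ≤ kb
esc-two K ka kb b z h1 h2 h3 h4 h5 = prove (K ∷ ka ∷ kb ∷ b ∷ z ∷ []) (λ { (K ∷ ka ∷ kb ∷ b ∷ z ∷ []) →
    K :≤ ka :+ kb [ con 200 ] ∷
    con 200 :* ka :≤ K [ con 1 ] ∷
    con 5 :* b :≤ con 2 :* K [ con 80 ] ∷
    z :≤ b :+ con 1 :+ (b :+ con 1) [ con 200 ] ∷
    con 200000000 :≤ K [ con 39 ] ∷
    [] })
  (λ { (K ∷ ka ∷ kb ∷ b ∷ z ∷ []) → z :+ con 1 :≤ kb [ con 200 ] })
  refl (h1 ∷ h2 ∷ h3 ∷ h4 ∷ h5 ∷ [])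

esc-one′ : ∀ K ka kb b z →
  K ≤ ka + kb →
  200 * ka ≤ K →
  5 * b ≤ 2 * K →
  z ≤ b + 1 →
  200000000 ≤ K →
  z + 1 ≤ kb
esc-one′ K ka kb b z h1 h2 h3 h4 h5 = prove (K ∷ ka ∷ kb ∷ b ∷ z ∷ []) (λ { (K ∷ ka ∷ kb ∷ b ∷ z ∷ []) →
    K :≤ ka :+ kb [ con 200 ] ∷
    con 200 :* ka :≤ K [ con 1 ] ∷
    con 5 :* b :≤ con 2 :* K [ con 40 ] ∷
    z :≤ b :+ con 1 [ con 200 ] ∷
    con 200000000 :≤ K [ con 119 ] ∷
    [] })
  (λ { (K ∷ ka ∷ kb ∷ b ∷ z ∷ []) → z :+ con 1 :≤ kb [ con 200 ] })
  refl (h1 ∷ h2 ∷ h3 ∷ h4 ∷ h5 ∷ [])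

module Thin {n : ℕ} (E : Setting n) (st-id : ∀ i → Scheme.st (Setting.X E) i ≡ i)
  (thin : 200 * Basic.k (Setting.X E) A ≤ Sparse.K E) where
  open Symmetric E st-id public

  isB : V → V → Bool
  isB u y = c u y == B

  isB⇒ : ∀ {u y} → isB u y ≡ true → c u y ≡ B
  isB⇒ {u} {y} e = ==⇒≡ (c u y) B e

  K≤ : K ≤ k A + k B
  K≤ = ≤-reflexive K≡

  top : ℕ
  top = cc A ⊔ (cc B ⊔ M)

  cc≤top : ∀ t → ¬ t ≡ O → cc t ≤ top
  cc≤top O h = ⊥-elim (h refl)
  cc≤top A _ = m≤m⊔n (cc A) _
  cc≤top B _ = ≤-trans (m≤m⊔n (cc B) M) (m≤n⊔m (cc A) _)
  cc≤top D _ = ≤-trans (m≤n⊔m (cc B) M) (m≤n⊔m (cc A) _)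

  top-cases : top ≡ cc A ⊎ (top ≡ cc B ⊎ top ≡ M)
  top-cases with ⊔-sel (cc A) (cc B ⊔ M) | ⊔-sel (cc B) M
  ... | inj₁ e | _      = inj₁ e
  ... | inj₂ e | inj₁ g = inj₂ (inj₁ (trans e g))
  ... | inj₂ e | inj₂ g = inj₂ (inj₂ (trans e g))

  top≤⅔ : 3 * top ≤ 2 * K + M
  top≤⅔ with top-cases
  ... | inj₁ e        = subst (λ z → 3 * z ≤ 2 * K + M) (sym e) (comm≤⅔ A λ ())
  ... | inj₂ (inj₁ e) = subst (λ z → 3 * z ≤ 2 * K + M) (sym e) (comm≤⅔ B λ ())
  ... | inj₂ (inj₂ e) = subst (λ z → 3 * z ≤ 2 * K + M) (sym e) (comm≤⅔ D λ ())

  -- The picked vertex has degree at least `K - top`. At most `K / 200` of its neighbours have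
  -- colour `A`, so the degree is also nearly at most `cc B`; the missing two hundredths absorb
  -- colour `A` and the error.
  balance : 98 * K ≤ 100 * top + 100 * cc B
  balance with pick
  ... | u , Su , h = thin-pick K M (degS u) (degSC A u) (degSC B u) (cc A) (cc B) err (k A) top h
      (≤-reflexive (sym (degS≡ u)))
      (≤-trans (#-mono (λ w → ∧-right {S w})) (≤-reflexive (k-# A u))) thin
      ccA≤K
      (≤-trans (deg-lower light u) (+-monoʳ-≤ (degS u)
        (subst (_≤ top) (sym (both-C light u (f u))) (cc≤top _ (λ e → moves u Su (sym (diag′ u (f u) e)))))))
      top≤⅔ error-tiny M-tiny K-big
    where
    ccA≤K : cc A ≤ K
    ccA≤K with occ A
    ... | x , y , xy = subst₂ _≤_ (comm-cc xy) (val-# light x) (#-mono (λ w → ∧-left {adj x w}))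

  escape : ∀ u (Z : V → Bool) → # (λ y → isB u y ∧ Z y) + 1 ≤ k B → ∃[ y ] (c u y ≡ B × Z y ≡ false)
  escape u Z lt with #-∃ (λ y → isB u y ∧ not (Z y)) (+-cancelˡ-≤ (# (λ y → isB u y ∧ Z y)) 1 _
      (≤-trans lt (≤-reflexive (trans (sym (k-# B u)) (#-split (isB u) Z)))))
  ... | y , e = y , isB⇒ (∧-left e) , not-true (∧-right {isB u y} e)

  nearby : V → V → Bool
  nearby x y = (y == x) ∨ adj x y

  nearby-false : ∀ {x y} → nearby x y ≡ false → c x y ≡ D
  nearby-false {x} {y} e with y == x in e′ | adj x y in a
  ... | false | false = far x y (λ q → ==⇒≢ y x e′ (sym q)) a

  nearby-# : ∀ {u x} → c u x ≡ B → # (λ y → isB u y ∧ nearby x y) ≤ cc B + 1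
  nearby-# {u} {x} ux = begin
    # (λ y → isB u y ∧ nearby x y)                 ≤⟨ ∑-mono (λ y → bits≤-if {4} (λ { (a ∷ b ∷ _) → not a ∨ b })
                                                       (λ { (a ∷ b ∷ e ∷ d ∷ []) → ⟪ a ∧ (e ∨ d) ⟫ })
                                                       (λ { (a ∷ b ∷ e ∷ d ∷ []) → ⟪ b ∧ d ⟫ + ⟪ e ⟫ }) refl
                                                       (isB u y ∷ adj u y ∷ (y == x) ∷ adj x y ∷ []) (implies (λ e → cong light (isB⇒ e)))) ⟩
    ∑ (λ y → ⟪ adj u y ∧ adj x y ⟫ + ⟪ y == x ⟫)   ≡⟨ ∑-+ (λ y → ⟪ adj u y ∧ adj x y ⟫) _ ⟩
    comm u x + # (_== x)                           ≡⟨ cong₂ _+_ (comm-cc ux) (#-point x) ⟩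
    cc B + 1 ∎
    where open ≤-Reasoning

  indep₂ : ∀ {u x y} → c u x ≡ B → c u y ≡ B → c x y ≡ D → cc B + cc B ≤ K + M
  indep₂ {u} {x} {y} ux uy xy = subst₂ _≤_
    (trans (∑-+ (λ w → ⟪ adj u w ∧ adj x w ⟫) _) (cong₂ _+_ (comm-cc ux) (comm-cc uy)))
    (trans (∑-+ (λ w → ⟪ adj u w ⟫) _) (cong₂ _+_ (val-# light u) (comm-cc xy)))
    (∑-mono (λ w → bits≤ {3} (λ { (a ∷ b ∷ d ∷ []) → ⟪ a ∧ b ⟫ + ⟪ a ∧ d ⟫ })
      (λ { (a ∷ b ∷ d ∷ []) → ⟪ a ⟫ + ⟪ b ∧ d ⟫ }) refl (adj u w ∷ adj x w ∷ adj y w ∷ [])))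

  indep₃ : ∀ {u x y z} → c u x ≡ B → c u y ≡ B → c u z ≡ B → c x y ≡ D → c x z ≡ D → c y z ≡ D →
    3 * cc B ≤ K + M + M + M
  indep₃ {u} {x} {y} {z} ux uy uz xy xz yz = subst₂ _≤_
    (trans (∑-+₃ (λ w → ⟪ adj u w ∧ adj x w ⟫) _ _) (trans (cong₂ _+_ (cong₂ _+_ (comm-cc ux) (comm-cc uy)) (comm-cc uz))
      (trans (+-assoc (cc B) _ _) (cong (λ q → cc B + (cc B + q)) (sym (+-identityʳ (cc B)))))))
    (trans (∑-+₄ (λ w → ⟪ adj u w ⟫) _ _ _)
      (cong₂ _+_ (cong₂ _+_ (cong₂ _+_ (val-# light u) (comm-cc xy)) (comm-cc xz)) (comm-cc yz)))
    (∑-mono (λ w → bits≤ {4} (λ { (a ∷ b ∷ d ∷ e ∷ []) → ⟪ a ∧ b ⟫ + ⟪ a ∧ d ⟫ + ⟪ a ∧ e ⟫ })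
      (λ { (a ∷ b ∷ d ∷ e ∷ []) → ⟪ a ⟫ + ⟪ b ∧ d ⟫ + ⟪ b ∧ e ⟫ + ⟪ d ∧ e ⟫ }) refl
      (adj u w ∷ adj x w ∷ adj y w ∷ adj z w ∷ [])))

  zero-D : ∀ i j → p i j D ≡ 0 → p j D i ≡ 0
  zero-D i j z = trans (p-sym j D i) (*-cancelˡ-≡ _ _ (k i) {{>-nonZero (k>0 i)}}
    (trans (sym (triangle′ i j D)) (trans (cong (k D *_) z) (trans (*-zeroʳ (k D)) (sym (*-zeroʳ (k i)))))))

  module Two (wide : 2 * K + 1 ≤ 5 * cc B) where

    opaque
      pair : ∀ u → ∃[ x ] ∃[ y ] (c u x ≡ B × c u y ≡ B × c x y ≡ D)
      pair u with #-∃ (isB u) (subst (0 <_) (sym (k-# B u)) (k>0 B))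
      ... | x , ux with escape u (nearby x) (esc-one K M (k A) (k B) (cc B) (# (λ w → isB u w ∧ nearby x w)) K≤ thin (comm≤⅔ B λ ()) (nearby-# (isB⇒ ux)) M-tiny K-big)
      ...   | y , uy , xy = x , y , isB⇒ ux , uy , nearby-false xy

    upper : 2 * cc B ≤ K + M
    upper with pair u₀
    ... | x , y , ux , uy , xy = subst (_≤ K + M) (cong (cc B +_) (sym (+-identityʳ (cc B)))) (indep₂ ux uy xy)

    -- A `B`-neighbour far from both members of the pair would give three nearly disjoint sets of
    -- size `cc B` inside `K` vertices. So the pair dominates the `B`-neighbourhood.
    lower : k B ≤ cc B + cc B + 2
    lower with pair u₀
    ... | x , y , ux , uy , xy with # (λ w → isB u₀ w ∧ (nearby x w ∨ nearby y w)) + 1 ≤? k B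
    ...   | yes lt with escape u₀ (λ w → nearby x w ∨ nearby y w) lt
    ...     | z , uz , e = ⊥-elim (no-three K M (cc B)
                (indep₃ ux uy uz xy (nearby-false (∨-left e)) (nearby-false (∨-right {nearby x z} e))) wide M-tiny K-big)
      where
      ∨-left : ∀ {a b} → a ∨ b ≡ false → a ≡ false
      ∨-left {false} _ = refl
      ∨-right : ∀ {a b} → a ∨ b ≡ false → b ≡ false
      ∨-right {false} e = e
    lower | x , y , ux , uy , xy | no ¬lt = begin
      k B                                                       ≤⟨ s≤s⁻¹ (≤-trans (≰⇒> ¬lt) (≤-reflexive (+-comm _ 1))) ⟩
      # (λ w → isB u₀ w ∧ (nearby x w ∨ nearby y w))            ≤⟨ ∑-mono (λ w → bits≤ {3} (λ { (a ∷ b ∷ d ∷ []) → ⟪ a ∧ (b ∨ d) ⟫ })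
                                                                      (λ { (a ∷ b ∷ d ∷ []) → ⟪ a ∧ b ⟫ + ⟪ a ∧ d ⟫ }) refl (isB u₀ w ∷ nearby x w ∷ nearby y w ∷ [])) ⟩
      ∑ (λ w → ⟪ isB u₀ w ∧ nearby x w ⟫ + ⟪ isB u₀ w ∧ nearby y w ⟫) ≡⟨ ∑-+ (λ w → ⟪ isB u₀ w ∧ nearby x w ⟫) _ ⟩
      # (λ w → isB u₀ w ∧ nearby x w) + # (λ w → isB u₀ w ∧ nearby y w) ≤⟨ +-mono-≤ (nearby-# ux) (nearby-# uy) ⟩
      cc B + 1 + (cc B + 1)                                     ≡⟨ +-interchange (cc B) 1 (cc B) 1 ⟩
      cc B + cc B + 2 ∎
      where open ≤-Reasoning

    β : ℕ
    β = 3 * cc B ∸ (K + 2 * M)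

    β≡ : β + K + 2 * M ≡ 3 * cc B
    β≡ = trans (+-assoc β K (2 * M)) (m∸n+n≡m (thin-n₂ K M (k A) (k B) (cc B) K≤ lower thin M-tiny K-big))

    pBB≤4 : p B B D ≤ 4
    pBB≤4 with occ D
    ... | u , v , uv = subst (_≤ 4) (trans (coh B B u v) (cong (p B B) uv)) (common≤4 u v uv)
      where
      only : ∀ i → (i == B) ≡ true → cc i ≡ cc B
      only i e = cong cc (==⇒≡ i B e)
      -- The threshold `M + k A + 2` absorbs the `A`-neighbours, which the valency of `B` does not
      -- count.
      open Four (_== B) (λ i e → cong light (==⇒≡ i B e)) (cc B) (cc B) (M + k A + 2) β top
        (λ i e → ≤-reflexive (sym (only i e))) (λ i e → ≤-reflexive (only i e)) cc≤top
        (thin-n₁ K M (k A) (k B) (cc B) K≤ upper) (≤-reflexive β≡)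
        (thin-n₃ K M (k A) (k B) (cc B) K≤ lower thin M-tiny K-big)
        (thin-n₄ K M (k A) (k B) (cc B) β K≤ lower thin (≤-reflexive (sym β≡)) M-tiny K-big)
        (thin-n₅ K M (k A) (k B) (cc B) β top K≤ lower thin (≤-reflexive (sym β≡)) top≤⅔ M-tiny K-big)

    -- If `p A B D` vanished, `k B` would be at most `cc A`, about `2 K / 3`. Otherwise
    -- `k D ≤ k A * k B`, and `p B B D ≤ 4` gives `p B D B ≤ 4 * k A`, at most `K / 50`; then `k B`
    -- hardly exceeds `cc B`, about `K / 2`.
    impossible : ⊥
    impossible with p A B D in e
    ... | zero = thin-end-2 K M (k A) (k B) (cc A) K≤ thin
        (≤-trans (≤-reflexive (trans (k-split B A) (trans (cong (p B A A + p B B A +_) (zero-D A B e)) (+-identityʳ _))))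
          (≤-trans (≤-trans (m≤n+m (p B A A + p B B A) (p A A A + p A B A)) (≤-reflexive (sym (+-assoc (p A A A + p A B A) _ _))))
            (≤-reflexive (sym (cc-split A)))))
        (comm≤⅔ A λ ()) M-tiny K-big
    ... | suc _ = thin-end-1 K M (k A) (k B) (cc B) (k D) (p B B D) (p B D B) K≤ thin upper
        (≤-trans (≤-reflexive (k-split B B)) (+-monoˡ-≤ (p B D B) (s≤s (≤-trans (m≤n+m (p B A B + p B B B) (p A A B + p A B B))
          (≤-reflexive (trans (sym (+-assoc (p A A B + p A B B) _ _)) (sym (cc-split B))))))))
        (≤-reflexive (trans (cong (k B *_) (p-sym B D B)) (sym (triangle′ B B D)))) pBB≤4
        (≤-trans (m≤m*n (k D) (p A B D) {{>-nonZero (subst (0 <_) (sym e) (s≤s z≤n))}})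
          (≤-trans (≤-reflexive (triangle′ A B D)) (*-monoʳ-≤ (k A) (≤-trans (≤-reflexive (p-sym D B A))
            (≤-trans (m≤n+m (p B D A) (p B A A + p B B A)) (≤-reflexive (sym (k-split B A))))))))
        M-tiny K-big

-- Planes

blk-big : ∀ K M ka kb b x →
  kb ≤ b + 1 + (b + 1) + (b + 1) →
  K ≤ ka + kb →
  200 * ka ≤ K →
  b ≤ x + ka + M + M →
  100000000 * M ≤ K →
  200000000 ≤ K →
  100 * M + 60 * ka + 100 ≤ 3 * x
blk-big K M ka kb b x h1 h2 h3 h4 h5 h6 = prove (K ∷ M ∷ ka ∷ kb ∷ b ∷ x ∷ []) (λ { (K ∷ M ∷ ka ∷ kb ∷ b ∷ x ∷ []) →
    kb :≤ b :+ con 1 :+ (b :+ con 1) :+ (b :+ con 1) [ con 50000000 ] ∷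
    K :≤ ka :+ kb [ con 50000000 ] ∷
    con 200 :* ka :≤ K [ con 16000000 ] ∷
    b :≤ x :+ ka :+ M :+ M [ con 150000000 ] ∷
    con 100000000 :* M :≤ K [ con 53 ] ∷
    con 200000000 :≤ K [ con 33999947 ] ∷
    [] })
  (λ { (K ∷ M ∷ ka ∷ kb ∷ b ∷ x ∷ []) → con 100 :* M :+ con 60 :* ka :+ con 100 :≤ con 3 :* x [ con 50000000 ] })
  refl (h1 ∷ h2 ∷ h3 ∷ h4 ∷ h5 ∷ h6 ∷ [])

blk-M : ∀ M ka x →
  100 * M + 60 * ka + 100 ≤ 3 * x →
  M + 2 ≤ x
blk-M M ka x h1 = prove (M ∷ ka ∷ x ∷ []) (λ { (M ∷ ka ∷ x ∷ []) →
    con 100 :* M :+ con 60 :* ka :+ con 100 :≤ con 3 :* x [ con 1 ] ∷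
    [] })
  (λ { (M ∷ ka ∷ x ∷ []) → M :+ con 2 :≤ x [ con 3 ] })
  refl (h1 ∷ [])

some-blk : ∀ M ka x y b0 b1 b2 →
  100 * M + 60 * ka + 100 ≤ 3 * x →
  x ≤ y + 1 →
  y ≤ b0 + b1 + b2 + ka + M + M + M →
  b0 ≤ M + 1 →
  b1 ≤ M + 1 →
  b2 ≤ M + 1 →
  ⊥
some-blk M ka x y b0 b1 b2 h1 h2 h3 h4 h5 h6 = refute (M ∷ ka ∷ x ∷ y ∷ b0 ∷ b1 ∷ b2 ∷ []) (λ { (M ∷ ka ∷ x ∷ y ∷ b0 ∷ b1 ∷ b2 ∷ []) →
    con 100 :* M :+ con 60 :* ka :+ con 100 :≤ con 3 :* x [ con 1 ] ∷
    x :≤ y :+ con 1 [ con 3 ] ∷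
    y :≤ b0 :+ b1 :+ b2 :+ ka :+ M :+ M :+ M [ con 3 ] ∷
    b0 :≤ M :+ con 1 [ con 3 ] ∷
    b1 :≤ M :+ con 1 [ con 3 ] ∷
    b2 :≤ M :+ con 1 [ con 3 ] ∷
    [] })
  refl (h1 ∷ h2 ∷ h3 ∷ h4 ∷ h5 ∷ h6 ∷ [])

B-none : ∀ K M ka kb b b0 b1 b2 →
  kb ≤ b + 1 + (b + 1) + (b + 1) →
  K ≤ ka + kb →
  200 * ka ≤ K →
  b ≤ b0 + b1 + b2 + ka + M + M + M →
  b0 ≤ M →
  b1 ≤ M →
  b2 ≤ M →
  100000000 * M ≤ K →
  200000000 ≤ K →
  ⊥
B-none K M ka kb b b0 b1 b2 h1 h2 h3 h4 h5 h6 h7 h8 h9 = refute (K ∷ M ∷ ka ∷ kb ∷ b ∷ b0 ∷ b1 ∷ b2 ∷ []) (λ { (K ∷ M ∷ ka ∷ kb ∷ b ∷ b0 ∷ b1 ∷ b2 ∷ []) →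
    kb :≤ b :+ con 1 :+ (b :+ con 1) :+ (b :+ con 1) [ con 50000000 ] ∷
    K :≤ ka :+ kb [ con 50000000 ] ∷
    con 200 :* ka :≤ K [ con 1000000 ] ∷
    b :≤ b0 :+ b1 :+ b2 :+ ka :+ M :+ M :+ M [ con 150000000 ] ∷
    b0 :≤ M [ con 150000000 ] ∷
    b1 :≤ M [ con 150000000 ] ∷
    b2 :≤ M [ con 150000000 ] ∷
    con 100000000 :* M :≤ K [ con 9 ] ∷
    con 200000000 :≤ K [ con 48999991 ] ∷
    [] })
  refl (h1 ∷ h2 ∷ h3 ∷ h4 ∷ h5 ∷ h6 ∷ h7 ∷ h8 ∷ h9 ∷ [])

B-two : ∀ K M ka kb b b0 b1 b2 x0 x1 →
  kb ≤ b + 1 + (b + 1) + (b + 1) →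
  K ≤ ka + kb →
  200 * ka ≤ K →
  b0 + b1 + b2 ≤ b →
  x0 ≤ b0 + 1 →
  x1 ≤ b1 + 1 →
  b ≤ x0 + ka + M + M →
  b ≤ x1 + ka + M + M →
  100000000 * M ≤ K →
  200000000 ≤ K →
  ⊥
B-two K M ka kb b b0 b1 b2 x0 x1 h1 h2 h3 h4 h5 h6 h7 h8 h9 h10 = refute (K ∷ M ∷ ka ∷ kb ∷ b ∷ b0 ∷ b1 ∷ b2 ∷ x0 ∷ x1 ∷ []) (λ { (K ∷ M ∷ ka ∷ kb ∷ b ∷ b0 ∷ b1 ∷ b2 ∷ x0 ∷ x1 ∷ []) →
    kb :≤ b :+ con 1 :+ (b :+ con 1) :+ (b :+ con 1) [ con 25000000 ] ∷
    K :≤ ka :+ kb [ con 25000000 ] ∷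
    con 200 :* ka :≤ K [ con 875000 ] ∷
    b0 :+ b1 :+ b2 :≤ b [ con 75000000 ] ∷
    x0 :≤ b0 :+ con 1 [ con 75000000 ] ∷
    x1 :≤ b1 :+ con 1 [ con 75000000 ] ∷
    b :≤ x0 :+ ka :+ M :+ M [ con 75000000 ] ∷
    b :≤ x1 :+ ka :+ M :+ M [ con 75000000 ] ∷
    con 100000000 :* M :≤ K [ con 3 ] ∷
    con 200000000 :≤ K [ con 24124997 ] ∷
    [] })
  refl (h1 ∷ h2 ∷ h3 ∷ h4 ∷ h5 ∷ h6 ∷ h7 ∷ h8 ∷ h9 ∷ h10 ∷ [])

A-one : ∀ K M ka a b b0 b1 b2 →
  3 * b ≤ K + M + M + M →
  98 * K ≤ 100 * a + 100 * b →
  200 * ka ≤ K →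
  a ≤ b0 + b1 + b2 + ka + M + M + M →
  b0 ≤ b + 1 →
  b1 ≤ M →
  b2 ≤ M →
  100000000 * M ≤ K →
  200000000 ≤ K →
  ⊥
A-one K M ka a b b0 b1 b2 h1 h2 h3 h4 h5 h6 h7 h8 h9 = refute (K ∷ M ∷ ka ∷ a ∷ b ∷ b0 ∷ b1 ∷ b2 ∷ []) (λ { (K ∷ M ∷ ka ∷ a ∷ b ∷ b0 ∷ b1 ∷ b2 ∷ []) →
    con 3 :* b :≤ K :+ M :+ M :+ M [ con 200000000 ] ∷
    con 98 :* K :≤ con 100 :* a :+ con 100 :* b [ con 3000000 ] ∷
    con 200 :* ka :≤ K [ con 1500000 ] ∷
    a :≤ b0 :+ b1 :+ b2 :+ ka :+ M :+ M :+ M [ con 300000000 ] ∷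
    b0 :≤ b :+ con 1 [ con 300000000 ] ∷
    b1 :≤ M [ con 300000000 ] ∷
    b2 :≤ M [ con 300000000 ] ∷
    con 100000000 :* M :≤ K [ con 21 ] ∷
    con 200000000 :≤ K [ con 92499979 ] ∷
    [] })
  refl (h1 ∷ h2 ∷ h3 ∷ h4 ∷ h5 ∷ h6 ∷ h7 ∷ h8 ∷ h9 ∷ [])

A-three : ∀ K M ka kb a b b0 b1 b2 x0 x1 x2 →
  kb ≤ b + 1 + (b + 1) + (b + 1) →
  K ≤ ka + kb →
  200 * ka ≤ K →
  3 * a ≤ 2 * K + M →
  b0 + b1 + b2 ≤ a →
  x0 ≤ b0 + 1 →
  x1 ≤ b1 + 1 →
  x2 ≤ b2 + 1 →
  b ≤ x0 + ka + M + M →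
  b ≤ x1 + ka + M + M →
  b ≤ x2 + ka + M + M →
  100000000 * M ≤ K →
  200000000 ≤ K →
  ⊥
A-three K M ka kb a b b0 b1 b2 x0 x1 x2 h1 h2 h3 h4 h5 h6 h7 h8 h9 h10 h11 h12 h13 = refute (K ∷ M ∷ ka ∷ kb ∷ a ∷ b ∷ b0 ∷ b1 ∷ b2 ∷ x0 ∷ x1 ∷ x2 ∷ []) (λ { (K ∷ M ∷ ka ∷ kb ∷ a ∷ b ∷ b0 ∷ b1 ∷ b2 ∷ x0 ∷ x1 ∷ x2 ∷ []) →
    kb :≤ b :+ con 1 :+ (b :+ con 1) :+ (b :+ con 1) [ con 300000000 ] ∷
    K :≤ ka :+ kb [ con 300000000 ] ∷
    con 200 :* ka :≤ K [ con 6000000 ] ∷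
    con 3 :* a :≤ con 2 :* K :+ M [ con 100000000 ] ∷
    b0 :+ b1 :+ b2 :≤ a [ con 300000000 ] ∷
    x0 :≤ b0 :+ con 1 [ con 300000000 ] ∷
    x1 :≤ b1 :+ con 1 [ con 300000000 ] ∷
    x2 :≤ b2 :+ con 1 [ con 300000000 ] ∷
    b :≤ x0 :+ ka :+ M :+ M [ con 300000000 ] ∷
    b :≤ x1 :+ ka :+ M :+ M [ con 300000000 ] ∷
    b :≤ x2 :+ ka :+ M :+ M [ con 300000000 ] ∷
    con 100000000 :* M :≤ K [ con 19 ] ∷
    con 200000000 :≤ K [ con 93999981 ] ∷
    [] })
  refl (h1 ∷ h2 ∷ h3 ∷ h4 ∷ h5 ∷ h6 ∷ h7 ∷ h8 ∷ h9 ∷ h10 ∷ h11 ∷ h12 ∷ h13 ∷ [])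

plane-big : ∀ M ka x y →
  100 * M + 60 * ka + 100 ≤ 3 * x →
  x ≤ y →
  20 * ka + 30 ≤ y
plane-big M ka x y h1 h2 = prove (M ∷ ka ∷ x ∷ y ∷ []) (λ { (M ∷ ka ∷ x ∷ y ∷ []) →
    con 100 :* M :+ con 60 :* ka :+ con 100 :≤ con 3 :* x [ con 1 ] ∷
    x :≤ y [ con 3 ] ∷
    [] })
  (λ { (M ∷ ka ∷ x ∷ y ∷ []) → con 20 :* ka :+ con 30 :≤ y [ con 3 ] })
  refl (h1 ∷ h2 ∷ [])

∨-left : ∀ {a b} → a ∨ b ≡ false → a ≡ false
∨-left {false} _ = refl

∨-right : ∀ {a b} → a ∨ b ≡ false → b ≡ false
∨-right {false} e = e

≡-by : ∀ {a b} → (a ≡ true → b ≡ true) → (b ≡ true → a ≡ true) → a ≡ b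
≡-by {true}  {b}     h _ = sym (h refl)
≡-by {false} {true}  _ h = h refl
≡-by {false} {false} _ _ = refl

pattern 𝟎 = zero
pattern 𝟏 = suc zero
pattern 𝟐 = suc (suc zero)

other₁ other₂ : Fin 3 → Fin 3
other₁ 𝟎 = 𝟏
other₁ 𝟏 = 𝟎
other₁ 𝟐 = 𝟎
other₂ 𝟎 = 𝟐
other₂ 𝟏 = 𝟐
other₂ 𝟐 = 𝟏

module Planes {n : ℕ} (E : Setting n) (st-id : ∀ i → Scheme.st (Setting.X E) i ≡ i)
  (thin : 200 * Basic.k (Setting.X E) A ≤ Sparse.K E) (narrow : 5 * Sparse.cc E B ≤ 2 * Sparse.K E) where
  open Thin E st-id thin public

  -- With `cc B` at most `2 K / 5`, neither `cc B` nor `M` is large enough to be `top` in `balance`.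
  balance-A : 98 * K ≤ 100 * cc A + 100 * cc B
  balance-A with top-cases
  ... | inj₁ e        = subst (λ z → 98 * K ≤ 100 * z + 100 * cc B) e balance
  ... | inj₂ (inj₁ e) = ⊥-elim (max-is-A K (cc B) (subst (λ z → 98 * K ≤ 100 * z + 100 * cc B) e balance) narrow K-big)
  ... | inj₂ (inj₂ e) = ⊥-elim (max-not-D K M (cc B) (subst (λ z → 98 * K ≤ 100 * z + 100 * cc B) e balance) narrow M-tiny K-big)

  -- Since `cc A` is at most about `2 K / 3`, `balance-A` keeps `cc B` above `K / 4` by a margin,
  -- and four nearly disjoint sets of that size do not fit among the neighbours of `u`.
  indep₄ : ∀ {u x y z t} → c u x ≡ B → c u y ≡ B → c u z ≡ B → c u t ≡ B →
    c x y ≡ D → c x z ≡ D → c y z ≡ D → c x t ≡ D → c y t ≡ D → c z t ≡ D → ⊥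
  indep₄ {u} {x} {y} {z} {t} ux uy uz ut xy xz yz xt yt zt = no-four K M (cc A) (cc B) balance-A (comm≤⅔ A λ ()) bound M-tiny K-big
    where
    four : ∀ a → a + a + a + a ≡ 4 * a
    four a = trans (+-assoc (a + a) a a) (trans (+-assoc a a (a + a)) (cong (λ q → a + (a + (a + q))) (sym (+-identityʳ a))))
    bound : 4 * cc B ≤ K + M + M + M + M + M + M
    bound = subst₂ _≤_
      (trans (∑-+₄ (λ w → ⟪ adj u w ∧ adj x w ⟫) _ _ _) (trans (cong₂ _+_ (cong₂ _+_ (cong₂ _+_ (comm-cc ux) (comm-cc uy)) (comm-cc uz)) (comm-cc ut)) (four (cc B))))
      (trans (∑-+ (λ w → ⟪ adj u w ⟫ + ⟪ adj x w ∧ adj y w ⟫ + ⟪ adj x w ∧ adj z w ⟫ + ⟪ adj y w ∧ adj z w ⟫ + ⟪ adj x w ∧ adj t w ⟫ + ⟪ adj y w ∧ adj t w ⟫) _)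
        (cong₂ _+_ (trans (∑-+ (λ w → ⟪ adj u w ⟫ + ⟪ adj x w ∧ adj y w ⟫ + ⟪ adj x w ∧ adj z w ⟫ + ⟪ adj y w ∧ adj z w ⟫ + ⟪ adj x w ∧ adj t w ⟫) _)
          (cong₂ _+_ (trans (∑-+₅ (λ w → ⟪ adj u w ⟫) _ _ _ _)
            (cong₂ _+_ (cong₂ _+_ (cong₂ _+_ (cong₂ _+_ (val-# light u) (comm-cc xy)) (comm-cc xz)) (comm-cc yz)) (comm-cc xt))) (comm-cc yt))) (comm-cc zt)))
      (∑-mono (λ w → bits≤ {5} (λ { (a ∷ b ∷ d ∷ e ∷ g ∷ []) → ⟪ a ∧ b ⟫ + ⟪ a ∧ d ⟫ + ⟪ a ∧ e ⟫ + ⟪ a ∧ g ⟫ })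
        (λ { (a ∷ b ∷ d ∷ e ∷ g ∷ []) → ⟪ a ⟫ + ⟪ b ∧ d ⟫ + ⟪ b ∧ e ⟫ + ⟪ d ∧ e ⟫ + ⟪ b ∧ g ⟫ + ⟪ d ∧ g ⟫ + ⟪ e ∧ g ⟫ }) refl
        (adj u w ∷ adj x w ∷ adj y w ∷ adj z w ∷ adj t w ∷ [])))

  record Frame (u : V) : Set where
    field
      x  : Fin 3 → V
      xB : ∀ i → c u (x i) ≡ B
      x₁ : ∀ i → c (x i) (x (other₁ i)) ≡ D
      x₂ : ∀ i → c (x i) (x (other₂ i)) ≡ D
      x₃ : ∀ i → c (x (other₁ i)) (x (other₂ i)) ≡ D

  opaque
    -- Two vertices have at most `2 * cc B + 2` nearby `B`-neighbours of `u`, and `cc B` is at most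
    -- `2 K / 5`, so a third one far from both exists. By `indep₄` there is no fourth.
    frame : ∀ u → Frame u
    frame u with #-∃ (isB u) (subst (0 <_) (sym (k-# B u)) (k>0 B))
    ... | a , ua with escape u (nearby a) (esc-one′ K (k A) (k B) (cc B) (# (λ w → isB u w ∧ nearby a w)) K≤ thin narrow (nearby-# (isB⇒ ua)) K-big)
    ...   | b , ub , ab with escape u (λ w → nearby a w ∨ nearby b w) (esc-two K (k A) (k B) (cc B) (# (λ w → isB u w ∧ (nearby a w ∨ nearby b w)))
              K≤ thin narrow (≤-trans (∑-mono (λ w → bits≤ {3} (λ { (a ∷ b ∷ d ∷ []) → ⟪ a ∧ (b ∨ d) ⟫ })
                  (λ { (a ∷ b ∷ d ∷ []) → ⟪ a ∧ b ⟫ + ⟪ a ∧ d ⟫ }) refl (isB u w ∷ nearby a w ∷ nearby b w ∷ [])))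
                (≤-trans (≤-reflexive (∑-+ (λ w → ⟪ isB u w ∧ nearby a w ⟫) _)) (+-mono-≤ (nearby-# (isB⇒ ua)) (nearby-# ub)))) K-big)
    ...     | d , ud , e = record
      { x  = λ { 𝟎 → a ; 𝟏 → b ; 𝟐 → d }
      ; xB = λ { 𝟎 → isB⇒ ua ; 𝟏 → ub ; 𝟐 → ud }
      ; x₁ = λ { 𝟎 → abD ; 𝟏 → trans (c-sym b a) abD ; 𝟐 → trans (c-sym d a) adD }
      ; x₂ = λ { 𝟎 → adD ; 𝟏 → bdD ; 𝟐 → trans (c-sym d b) bdD }
      ; x₃ = λ { 𝟎 → bdD ; 𝟏 → adD ; 𝟐 → abD } }
      where
      abD : c a b ≡ D
      abD = nearby-false ab
      adD : c a d ≡ D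
      adD = nearby-false (∨-left e)
      bdD : c b d ≡ D
      bdD = nearby-false (∨-right {nearby a d} e)

  x : V → Fin 3 → V
  x u = Frame.x (frame u)

  module _ (u : V) where
    open Frame (frame u) using (xB; x₁; x₂; x₃)

    blk : Fin 3 → V → Bool
    blk i y = isB u y ∧ (nearby (x u i) y ∧ (not (adj (x u (other₁ i)) y) ∧ not (adj (x u (other₂ i)) y)))

    ≢-D : ∀ {a b} → c a b ≡ D → ¬ a ≡ b
    ≢-D {a} e refl = O≢D (trans (sym (loop′ a)) e)

    adj-D : ∀ {a b} → c a b ≡ D → adj a b ≡ false
    adj-D e = cong light e

    blk-B : ∀ {i y} → blk i y ≡ true → c u y ≡ B
    blk-B {i} {y} e = isB⇒ (∧-left e)

    blk-far : ∀ {i y} j → c (x u i) (x u j) ≡ D → adj (x u j) y ≡ false → blk i y ≡ true → c (x u j) y ≡ D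
    blk-far {i} {y} j ij a e = far (x u j) y ne a
      where
      ne : ¬ x u j ≡ y
      ne refl with ∨-cases {y == x u i} (∧-left (∧-right {isB u y} e))
      ... | inj₁ q = ≢-D ij (sym (==⇒≡ y (x u i) q))
      ... | inj₂ q with () ← trans (sym q) (adj-D ij)

    blk-far₁ : ∀ {i y} → blk i y ≡ true → c (x u (other₁ i)) y ≡ D
    blk-far₁ {i} {y} e = blk-far (other₁ i) (x₁ i) (not-true (∧-left (∧-right {nearby (x u i) y} (∧-right {isB u y} e)))) e

    blk-far₂ : ∀ {i y} → blk i y ≡ true → c (x u (other₂ i)) y ≡ D
    blk-far₂ {i} {y} e = blk-far (other₂ i) (x₂ i)
      (not-true (∧-right {not (adj (x u (other₁ i)) y)} (∧-right {nearby (x u i) y} (∧-right {isB u y} e)))) e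

    -- Two non-adjacent members of a block, together with the two other frame vertices, would be
    -- four mutually far `B`-neighbours.
    blk-clique : ∀ {i y y′} → blk i y ≡ true → blk i y′ ≡ true → ¬ y ≡ y′ → adj y y′ ≡ true
    blk-clique {i} {y} {y′} e e′ ne with adj y y′ in a
    ... | true  = refl
    ... | false = ⊥-elim (indep₄ (xB (other₁ i)) (xB (other₂ i)) (blk-B {i} e) (blk-B {i} e′) (x₃ i)
        (blk-far₁ {i} e) (blk-far₂ {i} e) (blk-far₁ {i} e′) (blk-far₂ {i} e′) (far y y′ ne a))

    light-AB : ∀ y → adj u y ≡ (c u y == A) ∨ (c u y == B)
    light-AB y with c u y
    ... | O = refl
    ... | A = refl
    ... | B = refl
    ... | D = refl

    blk-lower : ∀ i → cc B ≤ # (blk i) + k A + M + M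
    blk-lower i = begin
      cc B                                          ≡⟨ sym (comm-cc (xB i)) ⟩
      comm u (x u i)                                ≡⟨ #-cong (λ y → cong (_∧ adj (x u i) y) (light-AB y)) ⟩
      # (λ y → ((c u y == A) ∨ isB u y) ∧ adj (x u i) y)
        ≤⟨ ∑-mono (λ y → bits≤ {6} (λ { (a ∷ b ∷ e ∷ p ∷ q ∷ r ∷ []) → ⟪ (a ∨ b) ∧ p ⟫ })
             (λ { (a ∷ b ∷ e ∷ p ∷ q ∷ r ∷ []) → ⟪ b ∧ ((e ∨ p) ∧ (not q ∧ not r)) ⟫ + ⟪ a ⟫ + ⟪ p ∧ q ⟫ + ⟪ p ∧ r ⟫ }) refl
             ((c u y == A) ∷ isB u y ∷ (y == x u i) ∷ adj (x u i) y ∷ adj (x u (other₁ i)) y ∷ adj (x u (other₂ i)) y ∷ [])) ⟩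
      ∑ (λ y → ⟪ blk i y ⟫ + ⟪ c u y == A ⟫ + ⟪ adj (x u i) y ∧ adj (x u (other₁ i)) y ⟫ + ⟪ adj (x u i) y ∧ adj (x u (other₂ i)) y ⟫)
        ≡⟨ ∑-+₄ (λ y → ⟪ blk i y ⟫) _ _ _ ⟩
      # (blk i) + # (λ y → c u y == A) + comm (x u i) (x u (other₁ i)) + comm (x u i) (x u (other₂ i))
        ≡⟨ cong₂ _+_ (cong₂ _+_ (cong (# (blk i) +_) (k-# A u)) (comm-cc (x₁ i))) (comm-cc (x₂ i)) ⟩
      # (blk i) + k A + M + M ∎
      where open ≤-Reasoning

    blk-upper : ∀ i → # (blk i) ≤ cc B + 1
    blk-upper i = ≤-trans (#-mono (λ y e → ∧-true (∧-left {isB u y} e) (∧-left {nearby (x u i) y} (∧-right {isB u y} e)))) (nearby-# (xB i))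

    covered : ∀ y → c u y ≡ B → (nearby (x u 𝟎) y ∨ (nearby (x u 𝟏) y ∨ nearby (x u 𝟐) y)) ≡ true
    covered y uy with nearby (x u 𝟎) y in a | nearby (x u 𝟏) y in b | nearby (x u 𝟐) y in d
    ... | true  | _     | _     = refl
    ... | false | true  | _     = refl
    ... | false | false | true  = refl
    ... | false | false | false = ⊥-elim (indep₄ (xB 𝟎) (xB 𝟏) (xB 𝟐) uy (x₁ 𝟎) (x₂ 𝟎) (x₂ 𝟏)
        (nearby-false a) (nearby-false b) (nearby-false d))

    x-apart : ∀ i j → c (x u i) (x u j) ≡ D → ∀ y → not ((y == x u i) ∧ adj (x u j) y) ≡ true
    x-apart i j e y with y == x u i in q
    ... | false = refl
    ... | true rewrite ==⇒≡ y (x u i) q = false⇒not (trans (adj-sym (x u j) (x u i)) (adj-D e))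

    cover : ∀ (Z : V → Bool) → # (λ y → adj u y ∧ Z y) ≤
      # (λ y → blk 𝟎 y ∧ Z y) + # (λ y → blk 𝟏 y ∧ Z y) + # (λ y → blk 𝟐 y ∧ Z y) + k A + M + M + M
    cover Z = begin
      # (λ y → adj u y ∧ Z y)
        ≡⟨ #-cong (λ y → cong (_∧ Z y) (light-AB y)) ⟩
      # (λ y → ((c u y == A) ∨ isB u y) ∧ Z y)
        ≤⟨ ∑-mono (λ y → bits≤-if {9}
             (λ { (a ∷ b ∷ z ∷ e ∷ e′ ∷ e″ ∷ p ∷ q ∷ r ∷ []) → (not b ∨ ((e ∨ p) ∨ ((e′ ∨ q) ∨ (e″ ∨ r)))) ∧
                  ((not (e ∧ q) ∧ not (e ∧ r)) ∧ ((not (e′ ∧ p) ∧ not (e′ ∧ r)) ∧ (not (e″ ∧ p) ∧ not (e″ ∧ q)))) })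
             (λ { (a ∷ b ∷ z ∷ e ∷ e′ ∷ e″ ∷ p ∷ q ∷ r ∷ []) → ⟪ (a ∨ b) ∧ z ⟫ })
             (λ { (a ∷ b ∷ z ∷ e ∷ e′ ∷ e″ ∷ p ∷ q ∷ r ∷ []) →
                  ⟪ (b ∧ ((e ∨ p) ∧ (not q ∧ not r))) ∧ z ⟫ + ⟪ (b ∧ ((e′ ∨ q) ∧ (not p ∧ not r))) ∧ z ⟫ + ⟪ (b ∧ ((e″ ∨ r) ∧ (not p ∧ not q))) ∧ z ⟫
                  + ⟪ a ⟫ + ⟪ p ∧ q ⟫ + ⟪ p ∧ r ⟫ + ⟪ q ∧ r ⟫ }) refl
             ((c u y == A) ∷ isB u y ∷ Z y ∷ (y == x u 𝟎) ∷ (y == x u 𝟏) ∷ (y == x u 𝟐) ∷ adj (x u 𝟎) y ∷ adj (x u 𝟏) y ∷ adj (x u 𝟐) y ∷ [])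
             (∧-true (implies (λ e → covered y (isB⇒ e)))
               (∧-true (∧-true (x-apart 𝟎 𝟏 (x₁ 𝟎) y) (x-apart 𝟎 𝟐 (x₂ 𝟎) y))
                 (∧-true (∧-true (x-apart 𝟏 𝟎 (x₁ 𝟏) y) (x-apart 𝟏 𝟐 (x₂ 𝟏) y)) (∧-true (x-apart 𝟐 𝟎 (x₁ 𝟐) y) (x-apart 𝟐 𝟏 (x₂ 𝟐) y)))))) ⟩
      ∑ (λ y → ⟪ blk 𝟎 y ∧ Z y ⟫ + ⟪ blk 𝟏 y ∧ Z y ⟫ + ⟪ blk 𝟐 y ∧ Z y ⟫ + ⟪ c u y == A ⟫ + xx 𝟎 𝟏 y + xx 𝟎 𝟐 y + xx 𝟏 𝟐 y)
        ≡⟨ trans (∑-+₃ (λ y → ⟪ blk 𝟎 y ∧ Z y ⟫ + ⟪ blk 𝟏 y ∧ Z y ⟫ + ⟪ blk 𝟐 y ∧ Z y ⟫ + ⟪ c u y == A ⟫ + xx 𝟎 𝟏 y) (xx 𝟎 𝟐) (xx 𝟏 𝟐))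
             (cong₂ _+_ (cong₂ _+_ (∑-+₅ (λ y → ⟪ blk 𝟎 y ∧ Z y ⟫) (λ y → ⟪ blk 𝟏 y ∧ Z y ⟫) (λ y → ⟪ blk 𝟐 y ∧ Z y ⟫) (λ y → ⟪ c u y == A ⟫) (xx 𝟎 𝟏)) refl) refl) ⟩
      # (λ y → blk 𝟎 y ∧ Z y) + # (λ y → blk 𝟏 y ∧ Z y) + # (λ y → blk 𝟐 y ∧ Z y) + # (λ y → c u y == A) + ∑ (xx 𝟎 𝟏) + ∑ (xx 𝟎 𝟐) + ∑ (xx 𝟏 𝟐)
        ≡⟨ cong₂ _+_ (cong₂ _+_ (cong₂ _+_ (cong (# (λ y → blk 𝟎 y ∧ Z y) + # (λ y → blk 𝟏 y ∧ Z y) + # (λ y → blk 𝟐 y ∧ Z y) +_) (k-# A u))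
             (comm-cc (x₁ 𝟎))) (comm-cc (x₂ 𝟎))) (comm-cc (x₂ 𝟏)) ⟩
      # (λ y → blk 𝟎 y ∧ Z y) + # (λ y → blk 𝟏 y ∧ Z y) + # (λ y → blk 𝟐 y ∧ Z y) + k A + M + M + M ∎
      where
      open ≤-Reasoning
      xx : Fin 3 → Fin 3 → V → ℕ
      xx i j y = ⟪ adj (x u i) y ∧ adj (x u j) y ⟫

    disjoint : ∀ w → # (λ y → blk 𝟎 y ∧ adj w y) + # (λ y → blk 𝟏 y ∧ adj w y) + # (λ y → blk 𝟐 y ∧ adj w y) ≤ comm u w
    disjoint w = subst (_≤ comm u w) (∑-+₃ (λ y → ⟪ blk 𝟎 y ∧ adj w y ⟫) _ _)
      (∑-mono (λ y → bits≤-if {9}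
             (λ { (a ∷ b ∷ z ∷ e ∷ e′ ∷ e″ ∷ p ∷ q ∷ r ∷ []) → (not b ∨ a) ∧
                  (not (e ∧ e′) ∧ (not (e ∧ e″) ∧ not (e′ ∧ e″))) })
             (λ { (a ∷ b ∷ z ∷ e ∷ e′ ∷ e″ ∷ p ∷ q ∷ r ∷ []) →
                  ⟪ (b ∧ ((e ∨ p) ∧ (not q ∧ not r))) ∧ z ⟫ + ⟪ (b ∧ ((e′ ∨ q) ∧ (not p ∧ not r))) ∧ z ⟫ + ⟪ (b ∧ ((e″ ∨ r) ∧ (not p ∧ not q))) ∧ z ⟫ })
             (λ { (a ∷ b ∷ z ∷ e ∷ e′ ∷ e″ ∷ p ∷ q ∷ r ∷ []) → ⟪ a ∧ z ⟫ }) refl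
             (adj u y ∷ isB u y ∷ adj w y ∷ (y == x u 𝟎) ∷ (y == x u 𝟏) ∷ (y == x u 𝟐) ∷ adj (x u 𝟎) y ∷ adj (x u 𝟏) y ∷ adj (x u 𝟐) y ∷ [])
             (∧-true (implies (λ e → cong light (isB⇒ e)))
               (∧-true (distinct (x₁ 𝟎) y) (∧-true (distinct (x₂ 𝟎) y) (distinct (x₂ 𝟏) y))))))
      where
      distinct : ∀ {a b} → c a b ≡ D → ∀ y → not ((y == a) ∧ (y == b)) ≡ true
      distinct {a} {b} e y with y == a in q | y == b in r
      ... | true  | true  = ⊥-elim (≢-D e (trans (sym (==⇒≡ y a q)) (==⇒≡ y b r)))
      ... | true  | false = refl
      ... | false | _     = refl

    kB-upper : k B ≤ cc B + 1 + (cc B + 1) + (cc B + 1)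
    kB-upper = begin
      k B                                     ≡⟨ sym (k-# B u) ⟩
      # (isB u)                               ≤⟨ ∑-mono (λ y → bits≤-if {4} (λ { (b ∷ p ∷ q ∷ r ∷ []) → not b ∨ (p ∨ (q ∨ r)) })
                                                   (λ { (b ∷ p ∷ q ∷ r ∷ []) → ⟪ b ⟫ })
                                                   (λ { (b ∷ p ∷ q ∷ r ∷ []) → ⟪ b ∧ p ⟫ + ⟪ b ∧ q ⟫ + ⟪ b ∧ r ⟫ }) refl
                                                   (isB u y ∷ nearby (x u 𝟎) y ∷ nearby (x u 𝟏) y ∷ nearby (x u 𝟐) y ∷ [])
                                                   (implies (λ e → covered y (isB⇒ e)))) ⟩
      ∑ (λ y → ⟪ isB u y ∧ nearby (x u 𝟎) y ⟫ + ⟪ isB u y ∧ nearby (x u 𝟏) y ⟫ + ⟪ isB u y ∧ nearby (x u 𝟐) y ⟫)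
                                              ≡⟨ ∑-+₃ (λ y → ⟪ isB u y ∧ nearby (x u 𝟎) y ⟫) _ _ ⟩
      _                                       ≤⟨ +-mono-≤ (+-mono-≤ (nearby-# (xB 𝟎)) (nearby-# (xB 𝟏))) (nearby-# (xB 𝟐)) ⟩
      cc B + 1 + (cc B + 1) + (cc B + 1) ∎
      where open ≤-Reasoning

    3ccB≤ : 3 * cc B ≤ K + M + M + M
    3ccB≤ = indep₃ (xB 𝟎) (xB 𝟏) (xB 𝟐) (x₁ 𝟎) (x₂ 𝟎) (x₂ 𝟏)

    blk-large : ∀ i → 100 * M + 60 * k A + 100 ≤ 3 * # (blk i)
    blk-large i = blk-big K M (k A) (k B) (cc B) (# (blk i)) kB-upper K≤ thin (blk-lower i) M-tiny K-big

    blk>M : ∀ i → M + 2 ≤ # (blk i)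
    blk>M i = blk-M M (k A) (# (blk i)) (blk-large i)

  -- The planes through u are the maximal cliques extending its blocks.
  Q : V → Fin 3 → V → Bool
  Q u i y = M <ᵇ # (λ z → blk u i z ∧ adj y z)

  -- `z` is adjacent to the rest of its block, so if `y` and `z` had colour `D` the more than `M`
  -- block members adjacent to `y` would be common neighbours. Thus meeting a block in more than `M`
  -- vertices means being adjacent to all of it.
  Q-adj : ∀ u i y z → Q u i y ≡ true → blk u i z ≡ true → ¬ z ≡ y → adj y z ≡ true
  Q-adj u i y z Qy bz ne with adj y z in a
  ... | true  = refl
  ... | false = ⊥-elim (<⇒≱ (<ᵇ-true Qy) (≤-trans (#-mono h) (≤-reflexive (comm-cc (far y z (ne ∘ sym) a)))))
    where
    h : ∀ w → blk u i w ∧ adj y w ≡ true → adj y w ∧ adj z w ≡ true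
    h w e = ∧-true (∧-right {blk u i w} e) (blk-clique u {i} bz (∧-left e)
      (λ { refl → true≢false (trans (sym (∧-right {blk u i w} e)) a) }))
      where
      true≢false : ¬ true ≡ false
      true≢false ()

  Q-blk : ∀ u i y → Q u i y ≡ true → ∀ (Z : V → Bool) →
    # (λ z → Z z ∧ blk u i z) ≤ # (λ z → Z z ∧ adj y z) + 1
  Q-blk u i y Qy Z = subst (# (λ z → Z z ∧ blk u i z) ≤_)
    (trans (∑-+ (λ z → ⟪ Z z ∧ adj y z ⟫) _) (cong (# (λ z → Z z ∧ adj y z) +_) (#-point y)))
    (∑-mono h)
    where
    h : ∀ z → ⟪ Z z ∧ blk u i z ⟫ ≤ ⟪ Z z ∧ adj y z ⟫ + ⟪ z == y ⟫
    h z with Z z | blk u i z in bz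
    ... | false | _     = z≤n
    ... | true  | false = z≤n
    ... | true  | true with z == y in e
    ...   | true  = m≤n+m 1 ⟪ adj y z ⟫
    ...   | false rewrite Q-adj u i y z Qy bz (==⇒≢ z y e) = ≤-refl

  Q-blk′ : ∀ u i y → Q u i y ≡ true → # (blk u i) ≤ # (λ z → blk u i z ∧ adj y z) + 1
  Q-blk′ u i y Qy = ≤-trans (≤-reflexive (#-cong (λ z → sym (∧-idem (blk u i z))))) (Q-blk u i y Qy (blk u i))

  <ᵇ-intro : ∀ {a b} → a < b → (a <ᵇ b) ≡ true
  <ᵇ-intro {a} {b} lt with a <ᵇ b | <⇒<ᵇ lt
  ... | true | _ = refl

  hits : V → Fin 3 → V → ℕ
  hits u i y = # (λ z → blk u i z ∧ adj y z)

  1+M<M+2 : 1 + M < M + 2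
  1+M<M+2 = ≤-reflexive (+-comm 2 M)

  Q-self : ∀ u i → Q u i u ≡ true
  Q-self u i = <ᵇ-intro {M} {hits u i u} (≤-trans (n≤1+n _) (≤-trans 1+M<M+2 (≤-trans (blk>M u i)
    (#-mono {P = blk u i} {Q = λ z → blk u i z ∧ adj u z} (λ z e → ∧-true e (cong light (blk-B u {i} {z} e)))))))

  Q-x : ∀ u i → Q u i (x u i) ≡ true
  Q-x u i = <ᵇ-intro {M} {hits u i (x u i)} (s≤s⁻¹ (≤-trans 1+M<M+2 (≤-trans (blk>M u i) (≤-trans bound (≤-reflexive (+-comm _ 1))))))
    where
    bound : # (blk u i) ≤ hits u i (x u i) + 1
    bound = subst (# (blk u i) ≤_) (trans (∑-+ (λ z → ⟪ blk u i z ∧ adj (x u i) z ⟫) _) (cong (hits u i (x u i) +_) (#-point (x u i))))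
      (∑-mono (λ z → bits≤ {5} (λ { (b ∷ e ∷ p ∷ q ∷ r ∷ []) → ⟪ b ∧ ((e ∨ p) ∧ (not q ∧ not r)) ⟫ })
        (λ { (b ∷ e ∷ p ∷ q ∷ r ∷ []) → ⟪ (b ∧ ((e ∨ p) ∧ (not q ∧ not r))) ∧ p ⟫ + ⟪ e ⟫ }) refl
        (isB u z ∷ (z == x u i) ∷ adj (x u i) z ∷ adj (x u (other₁ i)) z ∷ adj (x u (other₂ i)) z ∷ [])))

  no-hits : ∀ u i y → hits u i y ≡ 0 → Q u i y ≡ false
  no-hits u i y e with Q u i y in q
  ... | false = refl
  ... | true with () ← subst (M <_) e (<ᵇ-true {M} {hits u i y} q)

  Q-x₁ : ∀ u i → Q u i (x u (other₁ i)) ≡ false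
  Q-x₁ u i = no-hits u i _ (#≡0 (λ z → b₁ (isB u z) (nearby (x u i) z) (adj (x u (other₁ i)) z) (adj (x u (other₂ i)) z)))
    where
    b₁ : ∀ a b d e → (a ∧ (b ∧ (not d ∧ not e))) ∧ d ≡ false
    b₁ true  true  true  e = refl
    b₁ true  true  false true  = refl
    b₁ true  true  false false = refl
    b₁ true  false d e = refl
    b₁ false b d e = refl

  Q-x₂ : ∀ u i → Q u i (x u (other₂ i)) ≡ false
  Q-x₂ u i = no-hits u i _ (#≡0 (λ z → b₂ (isB u z) (nearby (x u i) z) (adj (x u (other₁ i)) z) (adj (x u (other₂ i)) z)))
    where
    b₂ : ∀ a b d e → (a ∧ (b ∧ (not d ∧ not e))) ∧ e ≡ false
    b₂ true  true  true  e = refl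
    b₂ true  true  false true  = refl
    b₂ true  true  false false = refl
    b₂ true  false d e = refl
    b₂ false b d e = refl

  Q-false : ∀ u i y → Q u i y ≡ false → hits u i y ≤ M
  Q-false u i y e = <ᵇ-false {M} {hits u i y} e

  hits≤ : ∀ u i y → hits u i y ≤ cc B + 1
  hits≤ u i y = ≤-trans (#-mono {Q = blk u i} (λ z → ∧-left {blk u i z})) (blk-upper u i)

  hits-cover : ∀ u w → comm u w ≤ hits u 𝟎 w + hits u 𝟏 w + hits u 𝟐 w + k A + M + M + M
  hits-cover u w = cover u (adj w)

  Q-D : ∀ u i w → c u w ≡ D → Q u i w ≡ false
  Q-D u i w e with Q u i w in q
  ... | false = refl
  ... | true = ⊥-elim (<⇒≱ (<ᵇ-true {M} {hits u i w} q) (≤-trans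
      (#-mono {Q = λ z → adj u z ∧ adj w z} (λ z b → ∧-true (cong light (blk-B u {i} {z} (∧-left b))) (∧-right {blk u i z} b)))
      (≤-reflexive (comm-cc e))))

  planes : V → V → ℕ
  planes u w = ⟪ Q u 𝟎 w ⟫ + ⟪ Q u 𝟏 w ⟫ + ⟪ Q u 𝟐 w ⟫

  planes-O : ∀ u → planes u u ≡ 3
  planes-O u = cong₂ _+_ (cong₂ _+_ (cong ⟪_⟫ (Q-self u 𝟎)) (cong ⟪_⟫ (Q-self u 𝟏))) (cong ⟪_⟫ (Q-self u 𝟐))

  planes-D : ∀ u w → c u w ≡ D → planes u w ≡ 0
  planes-D u w e = cong₂ _+_ (cong₂ _+_ (cong ⟪_⟫ (Q-D u 𝟎 w e)) (cong ⟪_⟫ (Q-D u 𝟏 w e))) (cong ⟪_⟫ (Q-D u 𝟐 w e))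

  private
    swap₁ : ∀ a b d → a + b + d ≡ b + a + d
    swap₁ a b d = cong (_+ d) (+-comm a b)

    rot : ∀ a b d → a + b + d ≡ d + a + b
    rot a b d = trans (+-comm (a + b) d) (sym (+-assoc d a b))

    swap₂ : ∀ a b d → a + b + d ≡ a + d + b
    swap₂ a b d = trans (+-assoc a b d) (trans (cong (a +_) (+-comm b d)) (sym (+-assoc a d b)))

  module _ (u w : V) (uw : c u w ≡ B) where
    private
      lo : ∀ {x} → hits u 𝟎 w + hits u 𝟏 w + hits u 𝟐 w ≡ x → x ≤ cc B
      lo e = subst (_≤ cc B) e (≤-trans (disjoint u w) (≤-reflexive (comm-cc uw)))

      two : ∀ i j d → hits u i w + hits u j w + d ≤ cc B → Q u i w ≡ true → Q u j w ≡ true → ⊥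
      two i j d le qi qj = B-two K M (k A) (k B) (cc B) (hits u i w) (hits u j w) d (# (blk u i)) (# (blk u j)) (kB-upper u) K≤ thin
        le (Q-blk′ u i w qi) (Q-blk′ u j w qj) (blk-lower u i) (blk-lower u j) M-tiny K-big

    -- A plane through `u` containing `w` contributes nearly a whole block, about `K / 3`, to the
    -- common neighbours; every other block contributes at most `M`. As `cc B` is itself about
    -- `K / 3`, exactly one plane fits.
    planes-B : planes u w ≡ 1
    planes-B = by-cases (Q u 𝟎 w) (Q u 𝟏 w) (Q u 𝟐 w) refl refl refl
      where
      by-cases : ∀ x y z → Q u 𝟎 w ≡ x → Q u 𝟏 w ≡ y → Q u 𝟐 w ≡ z → ⟪ x ⟫ + ⟪ y ⟫ + ⟪ z ⟫ ≡ 1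
      by-cases true  false false q₀ q₁ q₂ = refl
      by-cases false true  false q₀ q₁ q₂ = refl
      by-cases false false true  q₀ q₁ q₂ = refl
      by-cases true  true  _     q₀ q₁ q₂ = ⊥-elim (two 𝟎 𝟏 (hits u 𝟐 w) (lo refl) q₀ q₁)
      by-cases true  false true  q₀ q₁ q₂ = ⊥-elim (two 𝟎 𝟐 (hits u 𝟏 w) (lo (swap₂ (hits u 𝟎 w) _ _)) q₀ q₂)
      by-cases false true  true  q₀ q₁ q₂ = ⊥-elim (two 𝟏 𝟐 (hits u 𝟎 w) (lo (trans (+-assoc (hits u 𝟎 w) _ _) (+-comm (hits u 𝟎 w) _))) q₁ q₂)
      by-cases false false false q₀ q₁ q₂ = ⊥-elim (B-none K M (k A) (k B) (cc B) (hits u 𝟎 w) (hits u 𝟏 w) (hits u 𝟐 w) (kB-upper u) K≤ thin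
          (≤-trans (≤-reflexive (sym (comm-cc uw))) (hits-cover u w)) (Q-false u 𝟎 w q₀) (Q-false u 𝟏 w q₁) (Q-false u 𝟐 w q₂) M-tiny K-big)

  module _ (u w : V) (uw : c u w ≡ A) where
    private
      up : ∀ {x} → hits u 𝟎 w + hits u 𝟏 w + hits u 𝟐 w ≡ x → cc A ≤ x + k A + M + M + M
      up e = subst (λ z → cc A ≤ z + k A + M + M + M) e (≤-trans (≤-reflexive (sym (comm-cc uw))) (hits-cover u w))

      one : ∀ i j l → cc A ≤ hits u i w + hits u j w + hits u l w + k A + M + M + M → Q u j w ≡ false → Q u l w ≡ false → ⊥
      one i j l le qj ql = A-one K M (k A) (cc A) (cc B) (hits u i w) (hits u j w) (hits u l w) (3ccB≤ u) balance-A thin le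
        (hits≤ u i w) (Q-false u j w qj) (Q-false u l w ql) M-tiny K-big

    -- The same count with `cc A`: by `balance-A` one block is not enough, and by `comm≤⅔` three are
    -- too many.
    planes-A : planes u w ≡ 2
    planes-A = by-cases (Q u 𝟎 w) (Q u 𝟏 w) (Q u 𝟐 w) refl refl refl
      where
      by-cases : ∀ x y z → Q u 𝟎 w ≡ x → Q u 𝟏 w ≡ y → Q u 𝟐 w ≡ z → ⟪ x ⟫ + ⟪ y ⟫ + ⟪ z ⟫ ≡ 2
      by-cases true  true  false q₀ q₁ q₂ = refl
      by-cases true  false true  q₀ q₁ q₂ = refl
      by-cases false true  true  q₀ q₁ q₂ = refl
      by-cases _     false false q₀ q₁ q₂ = ⊥-elim (one 𝟎 𝟏 𝟐 (up refl) q₁ q₂)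
      by-cases false true  false q₀ q₁ q₂ = ⊥-elim (one 𝟏 𝟎 𝟐 (up (swap₁ (hits u 𝟎 w) _ _)) q₀ q₂)
      by-cases false false true  q₀ q₁ q₂ = ⊥-elim (one 𝟐 𝟎 𝟏 (up (rot (hits u 𝟎 w) _ _)) q₀ q₁)
      by-cases true  true  true  q₀ q₁ q₂ = ⊥-elim (A-three K M (k A) (k B) (cc A) (cc B) (hits u 𝟎 w) (hits u 𝟏 w) (hits u 𝟐 w)
          (# (blk u 𝟎)) (# (blk u 𝟏)) (# (blk u 𝟐)) (kB-upper u) K≤ thin (comm≤⅔ A λ ()) (≤-trans (disjoint u w) (≤-reflexive (comm-cc uw)))
          (Q-blk′ u 𝟎 w q₀) (Q-blk′ u 𝟏 w q₁) (Q-blk′ u 𝟐 w q₂) (blk-lower u 𝟎) (blk-lower u 𝟏) (blk-lower u 𝟐) M-tiny K-big)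

  transfer : ∀ u i w l → M + 2 ≤ # (λ z → blk w l z ∧ blk u i z) → ∀ y → Q u i y ≡ true → Q w l y ≡ true
  transfer u i w l big y Qy = <ᵇ-intro {M} {hits w l y} (s≤s⁻¹ (≤-trans 1+M<M+2 (≤-trans big
    (≤-trans (Q-blk u i y Qy (blk w l)) (≤-reflexive (+-comm _ 1))))))

  -- `w` is adjacent to all of block `i` of `u`, which the three blocks of `w` cover up to
  -- `k A + 3 * M` vertices; so one of them meets it in at least `M + 2`. One of these may be `y`
  -- itself, and the remaining `M + 1` let each plane recognise the members of the other.
  same-plane : ∀ u i w → Q u i w ≡ true → ∃[ l ] (∀ y → Q u i y ≡ Q w l y)
  same-plane u i w Qw = choose (M + 2 ≤? ov 𝟎) (M + 2 ≤? ov 𝟏) (M + 2 ≤? ov 𝟐)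
    where
    ov : Fin 3 → ℕ
    ov l = # (λ z → blk w l z ∧ blk u i z)
    agree : ∀ l → M + 2 ≤ ov l → ∀ y → Q u i y ≡ Q w l y
    agree l big y = ≡-by (transfer u i w l big y)
      (transfer w l u i (subst (M + 2 ≤_) (#-cong (λ z → ∧-comm (blk w l z) (blk u i z))) big) y)
    below : ∀ {z} → ¬ M + 2 ≤ z → z ≤ M + 1
    below {z} h = s≤s⁻¹ (subst (suc z ≤_) (+-suc M 1) (≰⇒> h))
    choose : Dec (M + 2 ≤ ov 𝟎) → Dec (M + 2 ≤ ov 𝟏) → Dec (M + 2 ≤ ov 𝟐) → ∃[ l ] (∀ y → Q u i y ≡ Q w l y)
    choose (yes b) _ _ = 𝟎 , agree 𝟎 b
    choose (no _) (yes b) _ = 𝟏 , agree 𝟏 b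
    choose (no _) (no _) (yes b) = 𝟐 , agree 𝟐 b
    choose (no a) (no b) (no d) = ⊥-elim (some-blk M (k A) (# (blk u i)) (hits u i w) (ov 𝟎) (ov 𝟏) (ov 𝟐) (blk-large u i)
      (Q-blk′ u i w Qw) (≤-trans (≤-reflexive (#-cong (λ z → ∧-comm (blk u i z) (adj w z)))) (cover w (blk u i))) (below a) (below b) (below d))

-- Quotient of a finite set by a decidable equivalence

record Quotient {N : ℕ} (_≈_ : Fin N → Fin N → Set) : Set where
  field
    size     : ℕ
    cl       : Fin N → Fin size
    sound    : ∀ x y → x ≈ y → cl x ≡ cl y
    complete : ∀ x y → cl x ≡ cl y → x ≈ y
    onto     : ∀ a → ∃[ x ] cl x ≡ a

quotient : ∀ {N} (_≈_ : Fin N → Fin N → Set) → (∀ x y → Dec (x ≈ y)) → (∀ x → x ≈ x) →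
  (∀ x y → x ≈ y → y ≈ x) → (∀ x y z → x ≈ y → y ≈ z → x ≈ z) → Quotient _≈_
quotient {zero} _ _ _ _ _ = record { size = 0 ; cl = λ () ; sound = λ () ; complete = λ () ; onto = λ () }
quotient {suc N} _≈_ dec rf sy tr
  with quotient (λ x y → suc x ≈ suc y) (λ x y → dec (suc x) (suc y)) (λ x → rf (suc x))
         (λ x y → sy (suc x) (suc y)) (λ x y z → tr (suc x) (suc y) (suc z))
     | FP.any? (λ y → dec zero (suc y))
... | q | yes (y , zy) = record { size = size ; cl = cl′ ; sound = s′ ; complete = c′ ; onto = λ a → suc (proj₁ (onto a)) , proj₂ (onto a) }
  where
  open Quotient q
  cl′ : Fin (suc N) → Fin size
  cl′ zero    = cl y
  cl′ (suc x) = cl x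
  s′ : ∀ a b → a ≈ b → cl′ a ≡ cl′ b
  s′ zero    zero    _ = refl
  s′ zero    (suc b) e = sound y b (tr _ _ _ (sy _ _ zy) e)
  s′ (suc a) zero    e = sound a y (tr _ _ _ e zy)
  s′ (suc a) (suc b) e = sound a b e
  c′ : ∀ a b → cl′ a ≡ cl′ b → a ≈ b
  c′ zero    zero    _ = rf zero
  c′ zero    (suc b) e = tr _ _ _ zy (complete y b e)
  c′ (suc a) zero    e = tr _ _ _ (complete a y e) (sy _ _ zy)
  c′ (suc a) (suc b) e = complete a b e
... | q | no ¬zy = record { size = suc size ; cl = cl′ ; sound = s′ ; complete = c′ ; onto = o′ }
  where
  open Quotient q
  cl′ : Fin (suc N) → Fin (suc size)
  cl′ zero    = zero
  cl′ (suc x) = suc (cl x)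
  s′ : ∀ a b → a ≈ b → cl′ a ≡ cl′ b
  s′ zero    zero    _ = refl
  s′ zero    (suc b) e = ⊥-elim (¬zy (b , e))
  s′ (suc a) zero    e = ⊥-elim (¬zy (a , sy _ _ e))
  s′ (suc a) (suc b) e = cong suc (sound a b e)
  c′ : ∀ a b → cl′ a ≡ cl′ b → a ≈ b
  c′ zero    zero    _ = rf zero
  c′ (suc a) (suc b) e = complete a b (FP.suc-injective e)
  o′ : ∀ a → ∃[ x ] cl′ x ≡ a
  o′ zero    = zero , refl
  o′ (suc a) = suc (proj₁ (onto a)) , cong suc (proj₂ (onto a))

shared : Fin 4 → ℕ
shared O = 3
shared A = 2
shared B = 1
shared D = 0

holds : ∀ {m} → (Fin 3 → Fin m) → Fin m → Bool
holds t a = (t 𝟎 == a) ∨ ((t 𝟏 == a) ∨ (t 𝟐 == a))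

holds-∃ : ∀ {m} (t : Fin 3 → Fin m) a → holds t a ≡ true → ∃[ i ] t i ≡ a
holds-∃ t a e with ∨-cases {t 𝟎 == a} e
... | inj₁ q = 𝟎 , ==⇒≡ _ _ q
... | inj₂ q with ∨-cases {t 𝟏 == a} q
...   | inj₁ r = 𝟏 , ==⇒≡ _ _ r
...   | inj₂ r = 𝟐 , ==⇒≡ _ _ r

∃-holds : ∀ {m} (t : Fin 3 → Fin m) i → holds t (t i) ≡ true
∃-holds t 𝟎 rewrite ==-refl (t 𝟎) = refl
∃-holds t 𝟏 rewrite ==-refl (t 𝟏) with t 𝟎 == t 𝟏
... | true  = refl
... | false = refl
∃-holds t 𝟐 rewrite ==-refl (t 𝟐) with t 𝟎 == t 𝟐 | t 𝟏 == t 𝟐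
... | true  | _     = refl
... | false | true  = refl
... | false | false = refl

-- Vertices as triples of planes, with the colour read off the number of common planes.
record Triples {n : ℕ} (X : Scheme n) : Set where
  field
    m      : ℕ
    π      : Fin n → Fin 3 → Fin m
    π-inj  : ∀ v i j → π v i ≡ π v j → i ≡ j
    π-onto : ∀ a → ∃[ v ] ∃[ i ] π v i ≡ a
    meet   : ∀ u w → ⟪ holds (π w) (π u 𝟎) ⟫ + ⟪ holds (π w) (π u 𝟏) ⟫ + ⟪ holds (π w) (π u 𝟐) ⟫ ≡ shared (Scheme.c X u w)
    full   : ∀ a → 20 * Basic.k X A + 30 ≤ # (λ v → holds (π v) a)

module PlaneTriples {n : ℕ} (E : Setting n) (st-id : ∀ i → Scheme.st (Setting.X E) i ≡ i)
  (thin : 200 * Basic.k (Setting.X E) A ≤ Sparse.K E) (narrow : 5 * Sparse.cc E B ≤ 2 * Sparse.K E) where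
  open Planes E st-id thin narrow

  flag : V → Fin 3 → Fin (n * 3)
  flag u i = F.combine u i

  vtx : Fin (n * 3) → V
  vtx a = proj₁ (F.remQuot 3 a)

  ind : Fin (n * 3) → Fin 3
  ind a = proj₂ (F.remQuot {n} 3 a)

  Qf : Fin (n * 3) → V → Bool
  Qf a = Q (vtx a) (ind a)

  Qf-flag : ∀ u i y → Qf (flag u i) y ≡ Q u i y
  Qf-flag u i y = cong (λ q → Q (proj₁ q) (proj₂ q) y) (FP.remQuot-combine u i)

  -- A plane is a pair of a vertex and a block index, up to having the same members. Numbering the
  -- classes makes planes countable objects.
  q : Quotient (λ a b → ∀ y → Qf a y ≡ Qf b y)
  q = quotient _ (λ a b → FP.all? (λ y → Qf a y ≟ᵇ Qf b y)) (λ a y → refl) (λ a b h y → sym (h y)) (λ a b d h h′ y → trans (h y) (h′ y))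
    where open import Data.Bool.Properties using () renaming (_≟_ to _≟ᵇ_)

  open Quotient q

  π : V → Fin 3 → Fin size
  π u i = cl (flag u i)

  π-sound : ∀ u i w l → (∀ y → Q u i y ≡ Q w l y) → π u i ≡ π w l
  π-sound u i w l h = sound _ _ (λ y → trans (Qf-flag u i y) (trans (h y) (sym (Qf-flag w l y))))

  π-complete : ∀ u i w l → π u i ≡ π w l → ∀ y → Q u i y ≡ Q w l y
  π-complete u i w l e y = trans (sym (Qf-flag u i y)) (trans (complete _ _ e y) (Qf-flag w l y))

  holds-Q : ∀ w u i → holds (π w) (π u i) ≡ Q u i w
  holds-Q w u i = ≡-by
    (λ e → let (l , h) = holds-∃ (π w) (π u i) e in trans (sym (π-complete w l u i h w)) (Q-self w l))
    (λ e → let (l , h) = same-plane u i w e in trans (cong (holds (π w)) (π-sound u i w l h)) (∃-holds (π w) l))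

  -- Each frame vertex lies on the plane of its own block and on neither of the other two.
  π-distinct : ∀ v i j → π v i ≡ π v j → i ≡ j
  π-distinct v i j e = by-cases i j (π-complete v i v j e)
    where
    absurd : ∀ {a b} → a ≡ b → a ≡ true → b ≡ false → ⊥
    absurd refl refl ()
    by-cases : ∀ i j → (∀ y → Q v i y ≡ Q v j y) → i ≡ j
    by-cases 𝟎 𝟎 _ = refl
    by-cases 𝟏 𝟏 _ = refl
    by-cases 𝟐 𝟐 _ = refl
    by-cases 𝟎 𝟏 h = ⊥-elim (absurd (h _) (Q-x v 𝟎) (Q-x₁ v 𝟏))
    by-cases 𝟎 𝟐 h = ⊥-elim (absurd (h _) (Q-x v 𝟎) (Q-x₁ v 𝟐))
    by-cases 𝟏 𝟎 h = ⊥-elim (absurd (h _) (Q-x v 𝟏) (Q-x₁ v 𝟎))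
    by-cases 𝟏 𝟐 h = ⊥-elim (absurd (h _) (Q-x v 𝟏) (Q-x₂ v 𝟐))
    by-cases 𝟐 𝟎 h = ⊥-elim (absurd (h _) (Q-x v 𝟐) (Q-x₂ v 𝟎))
    by-cases 𝟐 𝟏 h = ⊥-elim (absurd (h _) (Q-x v 𝟐) (Q-x₂ v 𝟏))

  planes-shared : ∀ u w → planes u w ≡ shared (c u w)
  planes-shared u w = by-cases (c u w) refl
    where
    by-cases : ∀ i → c u w ≡ i → planes u w ≡ shared i
    by-cases O e = subst (λ v → planes u v ≡ 3) (diag′ u w e) (planes-O u)
    by-cases A e = planes-A u w e
    by-cases B e = planes-B u w e
    by-cases D e = planes-D u w e

  blk⊂Q : ∀ u i z → blk u i z ≡ true → Q u i z ≡ true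
  blk⊂Q u i z bz = <ᵇ-intro {M} {hits u i z} (s≤s⁻¹ (≤-trans 1+M<M+2 (≤-trans (blk>M u i) (≤-trans bound (≤-reflexive (+-comm _ 1))))))
    where
    bound : # (blk u i) ≤ hits u i z + 1
    bound = subst (# (blk u i) ≤_) (trans (∑-+ (λ y → ⟪ blk u i y ∧ adj z y ⟫) _) (cong (hits u i z +_) (#-point z))) (∑-mono h)
      where
      h : ∀ y → ⟪ blk u i y ⟫ ≤ ⟪ blk u i y ∧ adj z y ⟫ + ⟪ y == z ⟫
      h y with blk u i y in by | y == z in e
      ... | false | _ = z≤n
      ... | true  | true = m≤n+m 1 ⟪ adj z y ⟫
      ... | true  | false rewrite blk-clique u {i} {z} {y} bz by (λ q → ==⇒≢ y z e (sym q)) = ≤-refl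

  triples : Triples X
  triples = record
    { m = size ; π = π ; π-inj = π-distinct
    ; π-onto = λ a → vtx (proj₁ (onto a)) , ind (proj₁ (onto a)) , trans (cong cl (FP.combine-remQuot {n} 3 (proj₁ (onto a)))) (proj₂ (onto a))
    ; meet = λ u w → trans (cong₂ _+_ (cong₂ _+_ (cong ⟪_⟫ (holds-Q w u 𝟎)) (cong ⟪_⟫ (holds-Q w u 𝟏))) (cong ⟪_⟫ (holds-Q w u 𝟐))) (planes-shared u w)
    ; full = full′ }
    where
    full′ : ∀ a → 20 * k A + 30 ≤ # (λ v → holds (π v) a)
    full′ a = subst (λ z → 20 * k A + 30 ≤ # (λ v → holds (π v) z)) (proj₂ (onto a)) (in-class (proj₁ (onto a)))
      where
      in-class : ∀ b → 20 * k A + 30 ≤ # (λ v → holds (π v) (cl b))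
      in-class b = plane-big M (k A) (# (blk (vtx b) (ind b))) _ (blk-large (vtx b) (ind b))
        (#-mono {P = blk (vtx b) (ind b)} {Q = λ v → holds (π v) (cl b)} (λ z bz → trans (cong (holds (π z)) (cong cl (sym (FP.combine-remQuot {n} 3 b))))
          (trans (holds-Q z (vtx b) (ind b)) (blk⊂Q (vtx b) (ind b) z bz))))

-- Triples of planes

some-avoid : ∀ ka l x y →
  20 * ka + 30 ≤ x →
  x ≤ l * (ka + 1) + y →
  l ≤ 20 →
  1 ≤ y
some-avoid ka l x y h1 h2 h3 = prove (ka ∷ l ∷ x ∷ y ∷ []) (λ { (ka ∷ l ∷ x ∷ y ∷ []) →
    con 20 :* ka :+ con 30 :≤ x [ con 1 ] ∷
    x :≤ l :* (ka :+ con 1) :+ y [ con 1 ] ∷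
    l :≤ con 20 [ con 1 :+ ka ] ∷
    [] })
  (λ { (ka ∷ l ∷ x ∷ y ∷ []) → con 1 :≤ y [ con 1 ] })
  refl (h1 ∷ h2 ∷ h3 ∷ [])

edges-even₀ : ∀ m xp xq yp yq zp zq →
  m ≤ xp + xq + yp + yq →
  yp + yq + zp + zq ≤ m →
  m ≤ xp + xq + zp + zq →
  xp + xq ≤ 0 →
  1 ≤ m →
  ⊥
edges-even₀ m xp xq yp yq zp zq h1 h2 h3 h4 h5 = refute (m ∷ xp ∷ xq ∷ yp ∷ yq ∷ zp ∷ zq ∷ []) (λ { (m ∷ xp ∷ xq ∷ yp ∷ yq ∷ zp ∷ zq ∷ []) →
    m :≤ xp :+ xq :+ yp :+ yq [ con 1 ] ∷
    yp :+ yq :+ zp :+ zq :≤ m [ con 1 ] ∷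
    m :≤ xp :+ xq :+ zp :+ zq [ con 1 ] ∷
    xp :+ xq :≤ con 0 [ con 2 ] ∷
    con 1 :≤ m [ con 1 ] ∷
    [] })
  refl (h1 ∷ h2 ∷ h3 ∷ h4 ∷ h5 ∷ [])

edges-even₁ : ∀ m xp xq yp yq zp zq →
  xp + xq + yp + yq ≤ m →
  m ≤ yp + yq + zp + zq →
  xp + xq + zp + zq ≤ m →
  1 ≤ xp + xq →
  xp + yp + zp ≤ 1 →
  xq + yq + zq ≤ 1 →
  ⊥
edges-even₁ m xp xq yp yq zp zq h1 h2 h3 h4 h5 h6 = refute (m ∷ xp ∷ xq ∷ yp ∷ yq ∷ zp ∷ zq ∷ []) (λ { (m ∷ xp ∷ xq ∷ yp ∷ yq ∷ zp ∷ zq ∷ []) →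
    xp :+ xq :+ yp :+ yq :≤ m [ con 1 ] ∷
    m :≤ yp :+ yq :+ zp :+ zq [ con 2 ] ∷
    xp :+ xq :+ zp :+ zq :≤ m [ con 1 ] ∷
    con 1 :≤ xp :+ xq [ con 3 ] ∷
    xp :+ yp :+ zp :≤ con 1 [ con 1 ] ∷
    xq :+ yq :+ zq :≤ con 1 [ con 1 ] ∷
    [] })
  refl (h1 ∷ h2 ∷ h3 ∷ h4 ∷ h5 ∷ h6 ∷ [])

edges-three : ∀ m xp xq yp yq zp zq →
  m ≤ xp + xq + yp + yq →
  yp + yq + zp + zq ≤ m →
  m ≤ xp + xq + zp + zq →
  3 ≤ m →
  2 ≤ xp + xq
edges-three m xp xq yp yq zp zq h1 h2 h3 h4 = prove (m ∷ xp ∷ xq ∷ yp ∷ yq ∷ zp ∷ zq ∷ []) (λ { (m ∷ xp ∷ xq ∷ yp ∷ yq ∷ zp ∷ zq ∷ []) →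
    m :≤ xp :+ xq :+ yp :+ yq [ con 1 ] ∷
    yp :+ yq :+ zp :+ zq :≤ m [ con 1 ] ∷
    m :≤ xp :+ xq :+ zp :+ zq [ con 1 ] ∷
    con 3 :≤ m [ con 1 ] ∷
    [] })
  (λ { (m ∷ xp ∷ xq ∷ yp ∷ yq ∷ zp ∷ zq ∷ []) → con 2 :≤ xp :+ xq [ con 2 ] })
  refl (h1 ∷ h2 ∷ h3 ∷ h4 ∷ [])

edges-four : ∀ m xp xq yp yq zp zq →
  xp + xq + yp + yq ≤ m →
  m ≤ yp + yq + zp + zq →
  xp + xq + zp + zq ≤ m →
  2 ≤ xp + xq →
  4 ≤ m
edges-four m xp xq yp yq zp zq h1 h2 h3 h4 = prove (m ∷ xp ∷ xq ∷ yp ∷ yq ∷ zp ∷ zq ∷ []) (λ { (m ∷ xp ∷ xq ∷ yp ∷ yq ∷ zp ∷ zq ∷ []) →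
    xp :+ xq :+ yp :+ yq :≤ m [ con 1 ] ∷
    m :≤ yp :+ yq :+ zp :+ zq [ con 1 ] ∷
    xp :+ xq :+ zp :+ zq :≤ m [ con 1 ] ∷
    con 2 :≤ xp :+ xq [ con 2 ] ∷
    [] })
  (λ { (m ∷ xp ∷ xq ∷ yp ∷ yq ∷ zp ∷ zq ∷ []) → con 4 :≤ m [ con 1 ] })
  refl (h1 ∷ h2 ∷ h3 ∷ h4 ∷ [])

avoids : ∀ {m} → (Fin m → Bool) → List (Fin m) → Bool
avoids P []      = true
avoids P (a ∷ l) = not (P a) ∧ avoids P l

sumOver : ∀ {m} → (Fin m → Bool) → List (Fin m) → ℕ
sumOver P []      = 0
sumOver P (a ∷ l) = ⟪ P a ⟫ + sumOver P l

sumOver≤# : ∀ {m} (P : Fin m → Bool) l → AllPairs (λ a b → ¬ a ≡ b) l → sumOver P l ≤ # P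
sumOver≤# {m} P l uniq = ≤-trans (≤-reflexive (sym (weigh l))) (∑-mono (λ p →
    ≤-trans (*-monoˡ-≤ ⟪ P p ⟫ (freq≤1 p l uniq)) (≤-reflexive (+-identityʳ ⟪ P p ⟫))))
  where
  freq : Fin m → List (Fin m) → ℕ
  freq p []      = 0
  freq p (a ∷ l) = ⟪ p == a ⟫ + freq p l
  weigh : ∀ l → ∑ (λ p → freq p l * ⟪ P p ⟫) ≡ sumOver P l
  weigh []      = ∑-zero m
  weigh (a ∷ l) = trans (∑-cong (λ p → *-distribʳ-+ ⟪ P p ⟫ ⟪ p == a ⟫ (freq p l)))
    (trans (∑-+ (λ p → ⟪ p == a ⟫ * ⟪ P p ⟫) _) (cong₂ _+_ (∑-point a (λ p → ⟪ P p ⟫)) (weigh l)))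
  none : ∀ p l → All (λ b → ¬ p ≡ b) l → freq p l ≡ 0
  none p []      _        = refl
  none p (a ∷ l) (h ∷ hs) rewrite ≢⇒== p a h = none p l hs
  freq≤1 : ∀ p l → AllPairs (λ a b → ¬ a ≡ b) l → freq p l ≤ 1
  freq≤1 p []      _        = z≤n
  freq≤1 p (a ∷ l) (h ∷ hs) with p == a in e
  ... | false = freq≤1 p l hs
  ... | true rewrite ==⇒≡ p a e | none a l h = ≤-refl

perm₃ : ∀ (G : Fin 3 → ℕ) i j l → ¬ i ≡ j → ¬ i ≡ l → ¬ j ≡ l → G i + G j + G l ≡ G 𝟎 + G 𝟏 + G 𝟐
perm₃ G 𝟎 𝟎 _ a _ _ = ⊥-elim (a refl)
perm₃ G 𝟎 𝟏 𝟎 _ b _ = ⊥-elim (b refl)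
perm₃ G 𝟎 𝟏 𝟏 _ _ d = ⊥-elim (d refl)
perm₃ G 𝟎 𝟏 𝟐 _ _ _ = refl
perm₃ G 𝟎 𝟐 𝟎 _ b _ = ⊥-elim (b refl)
perm₃ G 𝟎 𝟐 𝟏 _ _ _ = trans (+-assoc (G 𝟎) _ _) (trans (cong (G 𝟎 +_) (+-comm (G 𝟐) _)) (sym (+-assoc (G 𝟎) _ _)))
perm₃ G 𝟎 𝟐 𝟐 _ _ d = ⊥-elim (d refl)
perm₃ G 𝟏 𝟎 𝟎 _ _ d = ⊥-elim (d refl)
perm₃ G 𝟏 𝟎 𝟏 _ b _ = ⊥-elim (b refl)
perm₃ G 𝟏 𝟎 𝟐 _ _ _ = cong (_+ G 𝟐) (+-comm (G 𝟏) _)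
perm₃ G 𝟏 𝟏 _ a _ _ = ⊥-elim (a refl)
perm₃ G 𝟏 𝟐 𝟎 _ _ _ = trans (+-comm (G 𝟏 + G 𝟐) _) (sym (+-assoc (G 𝟎) _ _))
perm₃ G 𝟏 𝟐 𝟏 _ b _ = ⊥-elim (b refl)
perm₃ G 𝟏 𝟐 𝟐 _ _ d = ⊥-elim (d refl)
perm₃ G 𝟐 𝟎 𝟎 _ _ d = ⊥-elim (d refl)
perm₃ G 𝟐 𝟎 𝟏 _ _ _ = trans (+-assoc (G 𝟐) _ _) (+-comm (G 𝟐) _)
perm₃ G 𝟐 𝟎 𝟐 _ b _ = ⊥-elim (b refl)
perm₃ G 𝟐 𝟏 𝟎 _ _ _ = trans (+-comm (G 𝟐 + G 𝟏) _) (trans (cong (G 𝟎 +_) (+-comm (G 𝟐) _)) (sym (+-assoc (G 𝟎) _ _)))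
perm₃ G 𝟐 𝟏 𝟏 _ _ d = ⊥-elim (d refl)
perm₃ G 𝟐 𝟏 𝟐 _ b _ = ⊥-elim (b refl)
perm₃ G 𝟐 𝟐 _ a _ _ = ⊥-elim (a refl)

third-index : ∀ (i j : Fin 3) → ¬ i ≡ j → ∃[ l ] (¬ i ≡ l × ¬ j ≡ l)
third-index 𝟎 𝟎 a = ⊥-elim (a refl)
third-index 𝟎 𝟏 _ = 𝟐 , (λ ()) , (λ ())
third-index 𝟎 𝟐 _ = 𝟏 , (λ ()) , (λ ())
third-index 𝟏 𝟎 _ = 𝟐 , (λ ()) , (λ ())
third-index 𝟏 𝟏 a = ⊥-elim (a refl)
third-index 𝟏 𝟐 _ = 𝟎 , (λ ()) , (λ ())
third-index 𝟐 𝟎 _ = 𝟏 , (λ ()) , (λ ())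
third-index 𝟐 𝟏 _ = 𝟎 , (λ ()) , (λ ())
third-index 𝟐 𝟐 a = ⊥-elim (a refl)

shared-A : ∀ i → (i == A) ≡ (shared i ≡ᵇ 2)
shared-A O = refl
shared-A A = refl
shared-A B = refl
shared-A D = refl

shared-B : ∀ i → shared i ≡ 1 → i ≡ B
shared-B O ()
shared-B A ()
shared-B B _ = refl
shared-B D ()

shared-O : ∀ i → shared i ≡ 3 → i ≡ O
shared-O O _ = refl
shared-O A ()
shared-O B ()
shared-O D ()

module Links {n : ℕ} (X : Scheme n) (o≡O : Scheme.o X ≡ O) (st-id : ∀ i → Scheme.st X i ≡ i) (T : Triples X) where
  open Basic X
  open Triples T

  private
    c-sym : ∀ u v → c u v ≡ c v u
    c-sym u v = sym (trans (conv u v) (st-id (c u v)))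

    loop′ : ∀ u → c u u ≡ O
    loop′ u = trans (loop u) o≡O

    diag′ : ∀ u v → c u v ≡ O → u ≡ v
    diag′ u v e = diag u v (trans e (sym o≡O))

  has : V → Fin m → Bool
  has v = holds (π v)

  infix 4 _∋_
  _∋_ : V → Fin m → Set
  v ∋ a = has v a ≡ true

  on : V → Fin m → ℕ
  on v a = ⟪ has v a ⟫

  ∌ : ∀ {v a} → ¬ v ∋ a → has v a ≡ false
  ∌ {v} {a} h with has v a
  ... | true  = ⊥-elim (h refl)
  ... | false = refl

  -- A hyperedge on the planes, read as an edge `x y` in the link of `a`. The three operations below
  -- change the plane whose link is considered.
  record Tri (a x y : Fin m) : Set where
    constructor tri
    field
      a≢x : ¬ a ≡ x
      a≢y : ¬ a ≡ y
      x≢y : ¬ x ≡ y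
      v   : V
      v∋a : v ∋ a
      v∋x : v ∋ x
      v∋y : v ∋ y

  tri-swap : ∀ {a x y} → Tri a x y → Tri a y x
  tri-swap (tri p q r v s t u) = tri q p (r ∘ sym) v s u t

  tri-rot : ∀ {a x y} → Tri a x y → Tri x y a
  tri-rot (tri p q r v s t u) = tri r (p ∘ sym) (q ∘ sym) v t u s

  tri-flip : ∀ {a x y} → Tri a x y → Tri x a y
  tri-flip (tri p q r v s t u) = tri (p ∘ sym) r q v t s u

  meet-on : ∀ {a x y} (t : Tri a x y) w → on w a + on w x + on w y ≡ shared (c (Tri.v t) w)
  meet-on {a} {x} {y} (tri p q r v s t u) w with holds-∃ (π v) a s | holds-∃ (π v) x t | holds-∃ (π v) y u
  ... | i , refl | j , refl | l , refl =
    trans (perm₃ (λ i → on w (π v i)) i j l (λ { refl → p refl }) (λ { refl → q refl }) (λ { refl → r refl })) (meet v w)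

  third : ∀ v {a b} → v ∋ a → v ∋ b → ¬ a ≡ b → ∃[ d ] Σ (Tri a b d) (λ t → Tri.v t ≡ v)
  third v {a} {b} va vb ne with holds-∃ (π v) a va | holds-∃ (π v) b vb
  ... | i , refl | j , refl with third-index i j (λ { refl → ne refl })
  ...   | l , il , jl = π v l , tri ne (λ e → il (π-inj v i l e)) (λ e → jl (π-inj v j l e)) v va vb (∃-holds (π v) l) , refl

  others : ∀ v {a} → v ∋ a → ∃[ x ] ∃[ y ] Σ (Tri a x y) (λ t → Tri.v t ≡ v)
  others v {a} va with holds-∃ (π v) a va
  ... | i , refl with second i
    where
    second : ∀ i → ∃[ j ] ¬ i ≡ j
    second 𝟎 = 𝟏 , λ ()
    second 𝟏 = 𝟎 , λ ()
    second 𝟐 = 𝟎 , λ ()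
  ...   | j , ij with third v va (∃-holds (π v) j) (λ e → ij (π-inj v i j e))
  ...     | d , t , e = π v j , d , t , e

  only : ∀ {a x y} (t : Tri a x y) {b} → Tri.v t ∋ b → b ≡ a ⊎ b ≡ x ⊎ b ≡ y
  only {a} {x} {y} (tri p q r v s t u) {b} vb with b FP.≟ a | b FP.≟ x | b FP.≟ y
  ... | yes e | _     | _     = inj₁ e
  ... | no _  | yes e | _     = inj₂ (inj₁ e)
  ... | no _  | no _  | yes e = inj₂ (inj₂ e)
  ... | no d  | no e  | no g with holds-∃ (π v) a s | holds-∃ (π v) x t | holds-∃ (π v) y u | holds-∃ (π v) b vb
  ...   | i , refl | j , refl | l , refl | h , refl = ⊥-elim (absurd i j l h (λ { refl → p refl }) (λ { refl → q refl })
            (λ { refl → r refl }) (λ { refl → d refl }) (λ { refl → e refl }) (λ { refl → g refl }))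
    where
    absurd : ∀ (i j l h : Fin 3) → ¬ i ≡ j → ¬ i ≡ l → ¬ j ≡ l → ¬ h ≡ i → ¬ h ≡ j → ¬ h ≡ l → ⊥
    absurd i j l h a b d e g k with FP.pigeonhole {3} {4} ≤-refl (lookup (h ∷ i ∷ j ∷ l ∷ []))
    ... | zero , suc zero , _ , q = e q
    ... | zero , suc (suc zero) , _ , q = g q
    ... | zero , suc (suc (suc zero)) , _ , q = k q
    ... | suc zero , suc (suc zero) , _ , q = a q
    ... | suc zero , suc (suc (suc zero)) , _ , q = b q
    ... | suc (suc zero) , suc (suc (suc zero)) , _ , q = d q
    ... | suc zero , suc zero , s≤s () , _
    ... | suc (suc _) , suc zero , s≤s () , _
    ... | suc (suc zero) , suc (suc zero) , s≤s (s≤s ()) , _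
    ... | suc (suc (suc zero)) , suc (suc zero) , s≤s (s≤s ()) , _
    ... | suc (suc (suc zero)) , suc (suc (suc zero)) , s≤s (s≤s (s≤s ())) , _

  tri-unique : ∀ {a x y} (t t′ : Tri a x y) → Tri.v t ≡ Tri.v t′
  tri-unique {a} {x} {y} t t′ = diag′ _ _ (shared-O _ (trans (sym (meet-on t (Tri.v t′)))
    (cong₂ _+_ (cong₂ _+_ (cong ⟪_⟫ (Tri.v∋a t′)) (cong ⟪_⟫ (Tri.v∋x t′))) (cong ⟪_⟫ (Tri.v∋y t′)))))

  N₃ : Fin m → Fin m → Fin m → ℕ
  N₃ a x y = # (λ v → has v a ∧ (has v x ∧ has v y))

  N₃-tri : ∀ {a x y} → Tri a x y → N₃ a x y ≡ 1
  N₃-tri {a} {x} {y} t = ≤-antisym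
    (#≤1 _ (λ u w e e′ → trans (tri-unique (mk u e) t) (tri-unique t (mk w e′))))
    (∃-# (λ v → has v a ∧ (has v x ∧ has v y)) (Tri.v t) (∧-true (Tri.v∋a t) (∧-true (Tri.v∋x t) (Tri.v∋y t))))
    where
    mk : ∀ u → has u a ∧ (has u x ∧ has u y) ≡ true → Tri a x y
    mk u e = tri (Tri.a≢x t) (Tri.a≢y t) (Tri.x≢y t) u (∧-left e) (∧-left (∧-right {has u a} e)) (∧-right {has u x} (∧-right {has u a} e))

  tri? : ∀ a x y → ¬ a ≡ x → ¬ a ≡ y → ¬ x ≡ y → Tri a x y ⊎ N₃ a x y ≡ 0
  tri? a x y p q r with N₃ a x y in e
  ... | zero  = inj₂ refl
  ... | suc _ with #-∃ (λ v → has v a ∧ (has v x ∧ has v y)) (subst (0 <_) (sym e) (s≤s z≤n))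
  ...   | v , h = inj₁ (tri p q r v (∧-left h) (∧-left (∧-right {has v a} h)) (∧-right {has v x} (∧-right {has v a} h)))

  N₃-none : ∀ {a x y} → ¬ a ≡ x → ¬ a ≡ y → ¬ x ≡ y → ¬ Tri a x y → N₃ a x y ≡ 0
  N₃-none p q r h with tri? _ _ _ p q r
  ... | inj₁ t = ⊥-elim (h t)
  ... | inj₂ e = e

  μ : ℕ
  μ = p A A B

  has≤3 : ∀ v → # (has v) ≤ 3
  has≤3 v = ≤-trans (∑-mono (λ a → bits≤ {3} (λ { (a ∷ b ∷ d ∷ []) → ⟪ a ∨ (b ∨ d) ⟫ })
      (λ { (a ∷ b ∷ d ∷ []) → ⟪ a ⟫ + ⟪ b ⟫ + ⟪ d ⟫ }) refl ((π v 𝟎 == a) ∷ (π v 𝟏 == a) ∷ (π v 𝟐 == a) ∷ [])))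
    (≤-reflexive (trans (∑-+₃ (λ a → ⟪ π v 𝟎 == a ⟫) _ _) (cong₂ _+_ (cong₂ _+_ (pt 𝟎) (pt 𝟏)) (pt 𝟐))))
    where
    pt : ∀ i → # (λ a → π v i == a) ≡ 1
    pt i = trans (#-cong (λ a → ==-sym (π v i) a)) (#-point (π v i))

  -- Disjoint edges bd and xy of the link of a are joined by exactly μ edges.
  joint : ∀ {a b d x y} → Tri a b d → Tri a x y → ¬ b ≡ x → ¬ b ≡ y → ¬ d ≡ x → ¬ d ≡ y →
    μ ≡ N₃ a b x + N₃ a b y + N₃ a d x + N₃ a d y
  joint {a} {b} {d} {x} {y} t s bx by dx dy = trans (cong (p A A) (sym uwB)) (trans (sym (coh A A u w))
      (trans (≤-antisym (∑-mono le) (∑-mono ge)) (∑-+₄ (λ z → ⟪ has z a ∧ (has z b ∧ has z x) ⟫) _ _ _)))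
    where
    open Tri
    u = Tri.v t
    w = Tri.v s
    w∌ : ∀ {q} → ¬ q ≡ a → ¬ q ≡ x → ¬ q ≡ y → has w q ≡ false
    w∌ p q r = ∌ {w} λ h → not-any (only s h) p q r
      where
      not-any : ∀ {q} → q ≡ a ⊎ q ≡ x ⊎ q ≡ y → ¬ q ≡ a → ¬ q ≡ x → ¬ q ≡ y → ⊥
      not-any (inj₁ e) p _ _ = p e
      not-any (inj₂ (inj₁ e)) _ q _ = q e
      not-any (inj₂ (inj₂ e)) _ _ r = r e
    uwB : c u w ≡ B
    uwB = shared-B _ (trans (sym (meet-on t w)) (cong₂ _+_ (cong₂ _+_ (cong ⟪_⟫ (v∋a s))
      (cong ⟪_⟫ (w∌ {b} (a≢x t ∘ sym) bx by))) (cong ⟪_⟫ (w∌ {d} (a≢y t ∘ sym) dx dy))))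
    isA : ∀ {a x y} (t : Tri a x y) z → (c (Tri.v t) z == A) ≡ (on z a + on z x + on z y ≡ᵇ 2)
    isA t z = trans (shared-A (c (Tri.v t) z)) (cong (_≡ᵇ 2) (sym (meet-on t z)))
    five : ∀ z → on z a + on z b + on z d + on z x + on z y ≤ 3
    five z = ≤-trans (≤-reflexive (reassoc (on z a) (on z b) (on z d) (on z x) (on z y))) (≤-trans
      (sumOver≤# (has z) (a ∷ b ∷ d ∷ x ∷ y ∷ [])
        ((a≢x t ∷ a≢y t ∷ a≢x s ∷ a≢y s ∷ []) ∷ (x≢y t ∷ bx ∷ by ∷ []) ∷ (dx ∷ dy ∷ []) ∷ (x≢y s ∷ []) ∷ [] ∷ []))
      (has≤3 z))
      where
      reassoc : ∀ p q r s t → p + q + r + s + t ≡ p + (q + (r + (s + (t + 0))))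
      reassoc p q r s t rewrite +-identityʳ t | +-assoc (p + q + r) s t | +-assoc (p + q) r (s + t) | +-assoc p q (r + (s + t)) = refl
    L R : Vec Bool 5 → ℕ
    L = λ { (a ∷ b ∷ d ∷ x ∷ y ∷ []) → ⟪ (⟪ a ⟫ + ⟪ b ⟫ + ⟪ d ⟫ ≡ᵇ 2) ∧ (⟪ a ⟫ + ⟪ x ⟫ + ⟪ y ⟫ ≡ᵇ 2) ⟫ }
    R = λ { (a ∷ b ∷ d ∷ x ∷ y ∷ []) → ⟪ a ∧ (b ∧ x) ⟫ + ⟪ a ∧ (b ∧ y) ⟫ + ⟪ a ∧ (d ∧ x) ⟫ + ⟪ a ∧ (d ∧ y) ⟫ }
    H : Vec Bool 5 → Bool
    H = λ { (a ∷ b ∷ d ∷ x ∷ y ∷ []) → ⟪ a ⟫ + ⟪ b ⟫ + ⟪ d ⟫ + ⟪ x ⟫ + ⟪ y ⟫ ≤ᵇ 3 }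
    at : V → Vec Bool 5
    at z = has z a ∷ has z b ∷ has z d ∷ has z x ∷ has z y ∷ []
    ok : ∀ z → H (at z) ≡ true
    ok z with H (at z) | ≤⇒≤ᵇ (five z)
    ... | true | _ = refl
    lhs : ∀ z → ⟪ (c u z == A) ∧ (c w z == A) ⟫ ≡ L (at z)
    lhs z = cong₂ (λ p q → ⟪ p ∧ q ⟫) (isA t z) (isA s z)
    le : ∀ z → ⟪ (c u z == A) ∧ (c w z == A) ⟫ ≤ R (at z)
    le z = ≤-trans (≤-reflexive (lhs z)) (bits≤-if H L R refl (at z) (ok z))
    ge : ∀ z → R (at z) ≤ ⟪ (c u z == A) ∧ (c w z == A) ⟫
    ge z = ≤-trans (bits≤-if H R L refl (at z) (ok z)) (≤-reflexive (sym (lhs z)))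

  -- All other vertices on both planes share exactly two planes with a chosen one, so they have
  -- colour `A` from it.
  two-planes : ∀ {a b} → ¬ a ≡ b → # (λ v → has v a ∧ has v b) ≤ k A + 1
  two-planes {a} {b} ne with 0 <? # (λ v → has v a ∧ has v b)
  ... | no ¬p = ≤-trans (≮⇒≥ ¬p) z≤n
  ... | yes p with #-∃ (λ v → has v a ∧ has v b) p
  ...   | v , e with third v (∧-left e) (∧-right {has v a} e) ne
  ...     | d , t , refl = subst (# (λ v → has v a ∧ has v b) ≤_)
      (trans (∑-+ (λ w → ⟪ c (Tri.v t) w == A ⟫) _) (cong₂ _+_ (k-# A (Tri.v t)) (#-point (Tri.v t)))) (∑-mono h)
    where
    h : ∀ w → ⟪ has w a ∧ has w b ⟫ ≤ ⟪ c (Tri.v t) w == A ⟫ + ⟪ w == Tri.v t ⟫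
    h w with has w a in wa | has w b in wb
    ... | false | _     = z≤n
    ... | true  | false = z≤n
    ... | true  | true with c (Tri.v t) w in e | trans (sym (meet-on t w)) (cong₂ (λ p q → ⟪ p ⟫ + ⟪ q ⟫ + on w d) wa wb)
    ...   | O | _ rewrite sym (diag′ (Tri.v t) w e) | ==-refl (Tri.v t) = ≤-refl
    ...   | A | _ = m≤m+n 1 _
    ...   | B | ()
    ...   | D | ()

  avoiding : ∀ a (l : List (Fin m)) → All (λ b → ¬ a ≡ b) l →
    # (λ v → has v a) ≤ length l * (k A + 1) + # (λ v → has v a ∧ avoids (has v) l)
  avoiding a [] _ = #-mono {P = λ v → has v a} (λ v e → ∧-true e refl)
  avoiding a (b ∷ l) (ab ∷ h) = begin
    # (λ v → has v a)
      ≤⟨ avoiding a l h ⟩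
    length l * (k A + 1) + # (λ v → has v a ∧ avoids (has v) l)
      ≤⟨ +-monoʳ-≤ (length l * (k A + 1)) (≤-trans (∑-mono (λ v → bits≤ {3} (λ { (a ∷ b ∷ d ∷ []) → ⟪ a ∧ d ⟫ })
           (λ { (a ∷ b ∷ d ∷ []) → ⟪ a ∧ b ⟫ + ⟪ a ∧ (not b ∧ d) ⟫ }) refl (has v a ∷ has v b ∷ avoids (has v) l ∷ [])))
           (≤-reflexive (∑-+ (λ v → ⟪ has v a ∧ has v b ⟫) _))) ⟩
    length l * (k A + 1) + (# (λ v → has v a ∧ has v b) + rest)
      ≤⟨ +-monoʳ-≤ (length l * (k A + 1)) (+-monoˡ-≤ rest (two-planes ab)) ⟩
    length l * (k A + 1) + (k A + 1 + rest)
      ≡⟨ trans (sym (+-assoc (length l * (k A + 1)) _ _)) (cong (_+ rest) (+-comm (length l * (k A + 1)) _)) ⟩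
    length (b ∷ l) * (k A + 1) + rest ∎
    where
    open ≤-Reasoning
    rest = # (λ v → has v a ∧ (not (has v b) ∧ avoids (has v) l))

  record Edge (a : Fin m) (l : List (Fin m)) : Set where
    constructor edge
    field
      {x y} : Fin m
      t     : Tri a x y
      x∉l   : All (λ b → ¬ x ≡ b) l
      y∉l   : All (λ b → ¬ y ≡ b) l

  opaque
    -- By `two-planes` each listed plane takes at most `k A + 1` vertices of `a`, so twenty of them
    -- do not exhaust the `20 * k A + 30` vertices there. The two other planes of a remaining vertex
    -- form an edge of the link that avoids the list.
    fresh : ∀ a (l : List (Fin m)) → All (λ b → ¬ a ≡ b) l → length l ≤ 20 → Edge a l
    fresh a l h len with #-∃ (λ v → has v a ∧ avoids (has v) l)
        (some-avoid (k A) (length l) (# (λ v → has v a)) (# (λ v → has v a ∧ avoids (has v) l)) (full a) (avoiding a l h) len)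
    ... | v , e with others v (∧-left e)
    ...   | x , y , t , refl = edge t (off l (∧-right {has v a} e) (Tri.v∋x t)) (off l (∧-right {has v a} e) (Tri.v∋y t))
      where
      off : ∀ l → avoids (has v) l ≡ true → ∀ {z} → v ∋ z → All (λ b → ¬ z ≡ b) l
      off [] _ _ = []
      off (b ∷ l) e vz = (λ { refl → t≢f vz (not-true (∧-left e)) }) ∷ off l (∧-right {not (has v b)} e) vz
        where
        t≢f : ∀ {x : Bool} → x ≡ true → x ≡ false → ⊥
        t≢f refl ()

  common-point : ∀ {u v a} → u ∋ a → v ∋ a → ¬ c u v ≡ D
  common-point {u} {v} {a} ua va e with others u ua
  ... | x , y , t , refl with trans (sym (cong (λ b → ⟪ b ⟫ + on v x + on v y) va)) (trans (meet-on t v) (cong shared e))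
  ...   | ()

  -- Follow an `A`-path from `u` to the first vertex `y` that is neither `u` nor of colour `A` from
  -- it. Its predecessor shares two of its three planes with `u` and two with `y`; so `u` and `y`
  -- share a plane, `c u y` is not `D`, and `B` is all that remains.
  μ>0 : 1 ≤ μ
  μ>0 with occ B
  ... | u , v , uv = walk (conn A (λ e → A≢O (trans e o≡O)) u v) (inj₁ refl)
    where
    found : ∀ x y → c u x ≡ A → c x y ≡ A → c u y ≡ B → 1 ≤ μ
    found x y ux xy uy = subst (1 ≤_) (trans (coh A A u y) (cong (p A A) uy))
      (∃-# (λ w → (c u w == A) ∧ (c y w == A)) x (∧-true (cong (_== A) ux) (cong (_== A) (trans (c-sym y x) xy))))
    disjoint : ∀ x y → c u x ≡ A → c x y ≡ A → c u y ≡ D → ⊥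
    disjoint x y ux xy uy = absurd (has u (π x 𝟎)) (has u (π x 𝟏)) (has u (π x 𝟐)) (has y (π x 𝟎)) (has y (π x 𝟏)) (has y (π x 𝟐))
        (trans (meet x u) (cong shared (trans (c-sym x u) ux))) (trans (meet x y) (cong shared xy)) (apart 𝟎) (apart 𝟏) (apart 𝟐)
      where
      apart : ∀ i → has u (π x i) ≡ true → has y (π x i) ≡ true → ⊥
      apart i a b = common-point {u} {y} a b uy
      absurd : ∀ a b d a′ b′ d′ → ⟪ a ⟫ + ⟪ b ⟫ + ⟪ d ⟫ ≡ 2 → ⟪ a′ ⟫ + ⟪ b′ ⟫ + ⟪ d′ ⟫ ≡ 2 →
        (a ≡ true → a′ ≡ true → ⊥) → (b ≡ true → b′ ≡ true → ⊥) → (d ≡ true → d′ ≡ true → ⊥) → ⊥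
      absurd true  true  false true  _     _     _ _ p _ _ = p refl refl
      absurd true  true  false false true  _     _ _ _ q _ = q refl refl
      absurd true  true  false false false true  _ () _ _ _
      absurd true  false true  true  _     _     _ _ p _ _ = p refl refl
      absurd true  false true  false _     true  _ _ _ _ r = r refl refl
      absurd true  false true  false true  false _ () _ _ _
      absurd false true  true  _     true  _     _ _ _ q _ = q refl refl
      absurd false true  true  _     false true  _ _ _ _ r = r refl refl
      absurd false true  true  true  false false _ () _ _ _
      absurd true  true  true  _ _ _ ()
      absurd true  false false _ _ _ ()
      absurd false true  false _ _ _ ()
      absurd false false true  _ _ _ ()
      absurd false false false _ _ _ ()
    walk : ∀ {x} → Star (λ x y → c x y ≡ A) x v → u ≡ x ⊎ c u x ≡ A → 1 ≤ μ
    walk ε (inj₁ refl) with () ← trans (sym uv) (loop′ u)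
    walk ε (inj₂ e) with () ← trans (sym uv) e
    walk (_◅_ {j = y} xy q) (inj₁ refl) = walk q (inj₂ xy)
    walk {x} (_◅_ {j = y} xy q) (inj₂ ux) with c u y in uy
    ... | O = walk q (inj₁ (diag′ u y uy))
    ... | A = walk q (inj₂ uy)
    ... | B = found x y ux xy uy
    ... | D = ⊥-elim (disjoint x y ux xy uy)

  N₃≤1 : ∀ {a x y} → ¬ a ≡ x → ¬ a ≡ y → ¬ x ≡ y → N₃ a x y ≤ 1
  N₃≤1 p q r with tri? _ _ _ p q r
  ... | inj₁ t = ≤-reflexive (N₃-tri t)
  ... | inj₂ e = ≤-trans (≤-reflexive e) z≤n

  joint≤4 : ∀ {a b d x y} → Tri a b d → Tri a x y → ¬ b ≡ x → ¬ b ≡ y → ¬ d ≡ x → ¬ d ≡ y → μ ≤ 4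
  joint≤4 t s bx by dx dy = ≤-trans (≤-reflexive (joint t s bx by dx dy))
    (+-mono-≤ (+-mono-≤ (+-mono-≤ (N₃≤1 (Tri.a≢x t) (Tri.a≢x s) bx) (N₃≤1 (Tri.a≢x t) (Tri.a≢y s) by))
      (N₃≤1 (Tri.a≢y t) (Tri.a≢x s) dx)) (N₃≤1 (Tri.a≢y t) (Tri.a≢y s) dy))

  -- The disjoint link edges `x p` and `y z` are joined by `x y`, `x z` and `p y`.
  kite : ∀ {a x y z p} → Tri a x y → Tri a y z → Tri a x z → Tri a x p → Tri a y p → ¬ p ≡ z → 3 ≤ μ
  kite {a} {x} {y} {z} {p} xy yz xz xp yp pz = ≤-trans (m≤m+n 3 (N₃ a p z)) (≤-reflexive (sym (trans
    (joint xp yz (Tri.x≢y xy) (Tri.x≢y xz) (Tri.x≢y yp ∘ sym) pz)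
    (cong (_+ N₃ a p z) (cong₂ _+_ (cong₂ _+_ (N₃-tri xy) (N₃-tri xz)) (N₃-tri (tri-swap yp)))))))

  -- Take a link edge `p q` avoiding the triangle and let X, Y, Z count the edges from `x`, `y`, `z`
  -- to it. Applying `joint` to the three sides gives X = Y = Z, so `μ` is 2 X. If `p` and `q` had
  -- at most one neighbour each in the triangle, 3 X ≤ 2 would force `μ` to be 0. Hence `kite`
  -- applies, `μ` is at least 3, and being even it is 4.
  triangle⇒μ≡4 : ∀ {a x y z} → Tri a x y → Tri a y z → Tri a x z → μ ≡ 4
  triangle⇒μ≡4 {a} {x} {y} {z} xy yz xz
    with fresh a (x ∷ y ∷ z ∷ []) (Tri.a≢x xy ∷ Tri.a≢y xy ∷ Tri.a≢y xz ∷ []) (s≤s (s≤s (s≤s z≤n)))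
  ... | edge {p} {q} pq (px ∷ py ∷ pz ∷ []) (qx ∷ qy ∷ qz ∷ []) = ≤-antisym
      (joint≤4 xy pq (px ∘ sym) (qx ∘ sym) (py ∘ sym) (qy ∘ sym)) (four (pairs p (Tri.a≢x pq) px py pz) (pairs q (Tri.a≢y pq) qx qy qz))
    where
    j₁ : μ ≡ N₃ a x p + N₃ a x q + N₃ a y p + N₃ a y q
    j₁ = joint xy pq (px ∘ sym) (qx ∘ sym) (py ∘ sym) (qy ∘ sym)
    j₂ : μ ≡ N₃ a y p + N₃ a y q + N₃ a z p + N₃ a z q
    j₂ = joint yz pq (py ∘ sym) (qy ∘ sym) (pz ∘ sym) (qz ∘ sym)
    j₃ : μ ≡ N₃ a x p + N₃ a x q + N₃ a z p + N₃ a z q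
    j₃ = joint xz pq (px ∘ sym) (qx ∘ sym) (pz ∘ sym) (qz ∘ sym)
    pairs : ∀ p → ¬ a ≡ p → ¬ p ≡ x → ¬ p ≡ y → ¬ p ≡ z → 3 ≤ μ ⊎ N₃ a x p + N₃ a y p + N₃ a z p ≤ 1
    pairs p ap px py pz with tri? a x p (Tri.a≢x xy) ap (px ∘ sym) | tri? a y p (Tri.a≢y xy) ap (py ∘ sym) | tri? a z p (Tri.a≢y xz) ap (pz ∘ sym)
    ... | inj₁ xp | inj₁ yp | _       = inj₁ (kite xy yz xz xp yp pz)
    ... | inj₁ xp | inj₂ _  | inj₁ zp = inj₁ (kite xz (tri-swap yz) xy xp zp py)
    ... | inj₂ _  | inj₁ yp | inj₁ zp = inj₁ (kite yz (tri-swap xz) (tri-swap xy) yp zp px)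
    ... | inj₁ xp | inj₂ e  | inj₂ g  = inj₂ (≤-reflexive (cong₂ _+_ (cong₂ _+_ (N₃-tri xp) e) g))
    ... | inj₂ e  | inj₁ yp | inj₂ g  = inj₂ (≤-reflexive (cong₂ _+_ (cong₂ _+_ e (N₃-tri yp)) g))
    ... | inj₂ e  | inj₂ g  | inj₁ zp = inj₂ (≤-reflexive (cong₂ _+_ (cong₂ _+_ e g) (N₃-tri zp)))
    ... | inj₂ e  | inj₂ g  | inj₂ h  = inj₂ (≤-trans (≤-reflexive (cong₂ _+_ (cong₂ _+_ e g) h)) z≤n)
    from-3 : 3 ≤ μ → 4 ≤ μ
    from-3 h = edges-four μ (N₃ a x p) (N₃ a x q) (N₃ a y p) (N₃ a y q) (N₃ a z p) (N₃ a z q) (≤-reflexive (sym j₁)) (≤-reflexive j₂) (≤-reflexive (sym j₃))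
      (edges-three μ (N₃ a x p) (N₃ a x q) (N₃ a y p) (N₃ a y q) (N₃ a z p) (N₃ a z q) (≤-reflexive j₁) (≤-reflexive (sym j₂)) (≤-reflexive j₃) h)
    four : 3 ≤ μ ⊎ N₃ a x p + N₃ a y p + N₃ a z p ≤ 1 → 3 ≤ μ ⊎ N₃ a x q + N₃ a y q + N₃ a z q ≤ 1 → 4 ≤ μ
    four (inj₁ h) _ = from-3 h
    four (inj₂ _) (inj₁ h) = from-3 h
    four (inj₂ g) (inj₂ h) with 1 ≤? N₃ a x p + N₃ a x q
    ... | yes b = ⊥-elim (edges-even₁ μ (N₃ a x p) (N₃ a x q) (N₃ a y p) (N₃ a y q) (N₃ a z p) (N₃ a z q)
          (≤-reflexive (sym j₁)) (≤-reflexive j₂) (≤-reflexive (sym j₃)) b g h)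
    ... | no ¬b = ⊥-elim (edges-even₀ μ (N₃ a x p) (N₃ a x q) (N₃ a y p) (N₃ a y q) (N₃ a z p) (N₃ a z q)
          (≤-reflexive j₁) (≤-reflexive (sym j₂)) (≤-reflexive j₃) (s≤s⁻¹ (≰⇒> ¬b)) μ>0)

  Near : Fin m → Fin m → Set
  Near a x = ¬ a ≡ x × ∃[ v ] (v ∋ a × v ∋ x)

  near-sym : ∀ {a x} → Near a x → Near x a
  near-sym (ne , v , va , vx) = ne ∘ sym , v , vx , va

  tri-near : ∀ {a x y} → Tri a x y → Near a y
  tri-near (tri p q r v s t u) = q , v , s , u

  second-common : ∀ {y x q} → c y x ≡ A → y ∋ q → ∃[ p ] (y ∋ p × x ∋ p × ¬ p ≡ q)
  second-common {y} {x} {q} yx yq with others y yq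
  ... | r , s , t , refl with has x r in xr | has x s in xs | meet-on t x
  ...   | true  | _     | _ = r , Tri.v∋x t , xr , Tri.a≢x t ∘ sym
  ...   | false | true  | _ = s , Tri.v∋y t , xs , Tri.a≢y t ∘ sym
  ...   | false | false | e with has x q | trans e (cong shared yx)
  ...     | true  | ()
  ...     | false | ()

  module AllTriples (μ≡4 : μ ≡ 4) where

    ones : ∀ {w x y z} → w ≤ 1 → x ≤ 1 → y ≤ 1 → z ≤ 1 → 4 ≡ w + x + y + z → w ≡ 1 × x ≡ 1 × y ≡ 1 × z ≡ 1
    ones {suc zero} {suc zero} {suc zero} {suc zero} _ _ _ _ _ = refl , refl , refl , refl
    ones {zero} {suc zero} {suc zero} {suc zero} _ _ _ _ ()
    ones {zero} {suc zero} {suc zero} {zero} _ _ _ _ ()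
    ones {zero} {suc zero} {zero} {suc zero} _ _ _ _ ()
    ones {zero} {suc zero} {zero} {zero} _ _ _ _ ()
    ones {zero} {zero} {suc zero} {suc zero} _ _ _ _ ()
    ones {zero} {zero} {suc zero} {zero} _ _ _ _ ()
    ones {zero} {zero} {zero} {suc zero} _ _ _ _ ()
    ones {zero} {zero} {zero} {zero} _ _ _ _ ()
    ones {suc zero} {zero} {suc zero} {suc zero} _ _ _ _ ()
    ones {suc zero} {zero} {suc zero} {zero} _ _ _ _ ()
    ones {suc zero} {zero} {zero} {suc zero} _ _ _ _ ()
    ones {suc zero} {zero} {zero} {zero} _ _ _ _ ()
    ones {suc zero} {suc zero} {zero} {suc zero} _ _ _ _ ()
    ones {suc zero} {suc zero} {zero} {zero} _ _ _ _ ()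
    ones {suc zero} {suc zero} {suc zero} {zero} _ _ _ _ ()
    ones {suc (suc _)} (s≤s ())
    ones {_} {suc (suc _)} _ (s≤s ())
    ones {_} {_} {suc (suc _)} _ _ (s≤s ())
    ones {_} {_} {_} {suc (suc _)} _ _ _ (s≤s ())

    joined : ∀ {a b d x y} → Tri a b d → Tri a x y → ¬ b ≡ x → ¬ b ≡ y → ¬ d ≡ x → ¬ d ≡ y → Tri a b x
    joined {a} {b} {d} {x} {y} t s bx by dx dy with tri? a b x (Tri.a≢x t) (Tri.a≢x s) bx
    ... | inj₁ r = r
    ... | inj₂ e with () ← trans (sym e) (proj₁ (ones (N₃≤1 (Tri.a≢x t) (Tri.a≢x s) bx) (N₃≤1 (Tri.a≢x t) (Tri.a≢y s) by)
            (N₃≤1 (Tri.a≢y t) (Tri.a≢x s) dx) (N₃≤1 (Tri.a≢y t) (Tri.a≢y s) dy) (trans (sym μ≡4) (joint t s bx by dx dy))))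

    -- With `μ` equal to 4, disjoint link edges are completely joined. A fresh edge `p q` is joined
    -- to edges at `x` and at `y`; then `x p` and `y q` are disjoint edges, and so `x` and `y` are
    -- joined.
    complete : ∀ {a x y} → Near a x → Near a y → ¬ x ≡ y → Tri a x y
    complete {a} {x} {y} (ax , v , va , vx) (ay , w , wa , wy) xy with third v va vx ax | third w wa wy ay
    ... | x′ , t , _ | y′ , s , _ with fresh a (x ∷ x′ ∷ y ∷ y′ ∷ []) (ax ∷ Tri.a≢y t ∷ ay ∷ Tri.a≢y s ∷ []) (s≤s (s≤s (s≤s (s≤s z≤n))))
    ...   | edge {p} {q} pq (px ∷ px′ ∷ py ∷ py′ ∷ []) (qx ∷ qx′ ∷ qy ∷ qy′ ∷ []) =
      joined (joined t pq (px ∘ sym) (qx ∘ sym) (px′ ∘ sym) (qx′ ∘ sym))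
             (joined s (tri-swap pq) (qy ∘ sym) (py ∘ sym) (qy′ ∘ sym) (py′ ∘ sym)) xy (qx ∘ sym) py (Tri.x≢y pq)

    -- Nearness to `a` spreads along colour `A`: consecutive vertices share a plane `p` other than
    -- the new plane `q`. Since `a` and `q` are both near `p`, `complete` in the link of `p` gives a
    -- vertex on `a` and `q`.
    near-all : ∀ a b → ¬ a ≡ b → Near a b
    near-all a b ne with π-onto a | π-onto b
    ... | u , i , refl | v , j , refl = pick (walk (conn A (λ e → A≢O (trans e o≡O)) u v) start (π v j) (∃-holds (π v) j))
      where
      P : V → Set
      P x = ∀ q → x ∋ q → π u i ≡ q ⊎ Near (π u i) q
      start : P u
      start q uq with π u i FP.≟ q
      ... | yes e = inj₁ e
      ... | no h  = inj₂ (h , u , ∃-holds (π u) i , uq)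
      step : ∀ {x y} → c x y ≡ A → P x → P y
      step {x} {y} xy Px q yq with π u i FP.≟ q
      ... | yes e = inj₁ e
      ... | no aq with has y (π u i) in ya
      ...   | true  = inj₂ (aq , y , ya , yq)
      ...   | false with second-common {y} {x} (trans (c-sym y x) xy) yq
      ...     | p , yp , xp , pq with Px p xp
      ...       | inj₁ refl with () ← trans (sym ya) yp
      step {x} {y} xy Px q yq | no aq | false | p , yp , xp , pq | inj₂ ap =
        inj₂ (tri-near (tri-flip (complete (near-sym ap) (pq , y , yp , yq) aq)))
      walk : ∀ {x y} → Star (λ x y → c x y ≡ A) x y → P x → P y
      walk ε h = h
      walk (xy ◅ r) h = walk r (step xy h)
      pick : π u i ≡ π v j ⊎ Near (π u i) (π v j) → Near (π u i) (π v j)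
      pick (inj₁ e) = ⊥-elim (ne e)
      pick (inj₂ h) = h

    opaque
      all-tri : ∀ a b d → ¬ a ≡ b → ¬ a ≡ d → ¬ b ≡ d → Tri a b d
      all-tri a b d ab ad bd = complete (near-all a b ab) (near-all a d ad) bd

  module TriangleFree (μ≢4 : ¬ μ ≡ 4) where

    no-tri : ∀ {a x y z} → Tri a x y → Tri a y z → Tri a x z → ⊥
    no-tri xy yz xz = μ≢4 (triangle⇒μ≡4 xy yz xz)

    module One (μ≡1 : μ ≡ 1) where

      record Arm (a h x y : Fin m) : Set where
        constructor arm
        field
          hx : Tri a h x
          xy : Tri a x y
          hy : ¬ h ≡ y

      record Sep (x y x′ y′ : Fin m) : Set where
        constructor sep
        field
          xx : ¬ x ≡ x′
          xy : ¬ x ≡ y′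
          yx : ¬ y ≡ x′
          yy : ¬ y ≡ y′

      2≰1 : ¬ 2 ≤ 1
      2≰1 (s≤s ())

      sum-14 : ∀ a b d e → a + e ≤ a + b + d + e
      sum-14 a b d e = +-monoˡ-≤ e (≤-trans (m≤m+n a b) (m≤m+n (a + b) d))

      -- Exactly one edge joins `x y` to `x′ y′`. It is not `x x′`, which would close a triangle
      -- with `h`. If it were `x y′`, then `h x` and `x′ y′` would be joined twice, by `h x′` and
      -- `x y′`; likewise for `y x′`. So it joins the tips, and three arms at one vertex produce a
      -- triangle.
      tips : ∀ {a h x y x′ y′} → Arm a h x y → Arm a h x′ y′ → Sep x y x′ y′ → Tri a y y′
      tips {a} {h} {x} {y} {x′} {y′} (arm hx xy hy) (arm hx′ xy′ hy′) (sep s₁ s₂ s₃ s₄)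
        with tri? a y y′ (Tri.a≢y xy) (Tri.a≢y xy′) s₄ | tri? a x y′ (Tri.a≢x xy) (Tri.a≢y xy′) s₂ | tri? a y x′ (Tri.a≢y xy) (Tri.a≢x xy′) s₃
      ... | inj₁ t | _ | _ = t
      ... | inj₂ _ | inj₁ t | _ = ⊥-elim (2≰1 (≤-trans (+-mono-≤ (≤-reflexive (sym (N₃-tri hx′))) (≤-reflexive (sym (N₃-tri t))))
            (≤-trans (sum-14 (N₃ a h x′) (N₃ a h y′) (N₃ a x x′) (N₃ a x y′)) (≤-reflexive (trans (sym (joint hx xy′ (Tri.x≢y hx′) hy′ s₁ s₂)) μ≡1)))))
      ... | inj₂ _ | inj₂ _ | inj₁ t = ⊥-elim (2≰1 (≤-trans (+-mono-≤ (≤-reflexive (sym (N₃-tri hx))) (≤-reflexive (sym (N₃-tri (tri-swap t)))))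
            (≤-trans (sum-14 (N₃ a h x) (N₃ a h y) (N₃ a x′ x) (N₃ a x′ y)) (≤-reflexive (trans (sym (joint hx′ xy (Tri.x≢y hx) hy (s₁ ∘ sym) (s₃ ∘ sym))) μ≡1)))))
      ... | inj₂ e₁ | inj₂ e₂ | inj₂ e₃ with () ← trans (trans (sym μ≡1) (joint xy xy′ s₁ s₂ s₃ s₄))
              (cong₂ _+_ (cong₂ _+_ (cong₂ _+_ (N₃-none (Tri.a≢x xy) (Tri.a≢x xy′) s₁ (λ t → no-tri hx t hx′)) e₂) e₃) e₁)

      three-arms : ∀ {a h x y x′ y′ x″ y″} → Arm a h x y → Arm a h x′ y′ → Arm a h x″ y″ →
        Sep x y x′ y′ → Sep x y x″ y″ → Sep x′ y′ x″ y″ → ⊥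
      three-arms A₁ A₂ A₃ s₁₂ s₁₃ s₂₃ = no-tri (tips A₁ A₂ s₁₂) (tips A₂ A₃ s₂₃) (tips A₁ A₃ s₁₃)

      record FreshArm (a b d : Fin m) (l : List (Fin m)) : Set where
        field
          side : Bool
          x y  : Fin m
          is   : Arm a (if side then b else d) x y
          x∉l  : All (λ p → ¬ x ≡ p) l
          y∉l  : All (λ p → ¬ y ≡ p) l

      opaque
        -- As `μ` is 1, an edge disjoint from `b d` is joined to `b` or to `d`; `side` records
        -- which, for the later choice of three arms at one end.
        attach : ∀ {a b d} l → Tri a b d → All (λ p → ¬ a ≡ p) l → length l ≤ 18 → FreshArm a b d (b ∷ d ∷ l)
        attach {a} {b} {d} l bd h len with fresh a (b ∷ d ∷ l) (Tri.a≢x bd ∷ Tri.a≢y bd ∷ h) (s≤s (s≤s len))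
        ... | edge {x} {y} xy (xb ∷ xd ∷ xl) (yb ∷ yd ∷ yl)
          with tri? a b x (Tri.a≢x bd) (Tri.a≢x xy) (xb ∘ sym) | tri? a b y (Tri.a≢x bd) (Tri.a≢y xy) (yb ∘ sym)
             | tri? a d x (Tri.a≢y bd) (Tri.a≢x xy) (xd ∘ sym) | tri? a d y (Tri.a≢y bd) (Tri.a≢y xy) (yd ∘ sym)
        ... | inj₁ t | _ | _ | _ = record { side = true ; is = arm t xy (yb ∘ sym) ; x∉l = xb ∷ xd ∷ xl ; y∉l = yb ∷ yd ∷ yl }
        ... | inj₂ _ | inj₁ t | _ | _ = record { side = true ; is = arm t (tri-swap xy) (xb ∘ sym) ; x∉l = yb ∷ yd ∷ yl ; y∉l = xb ∷ xd ∷ xl }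
        ... | inj₂ _ | inj₂ _ | inj₁ t | _ = record { side = false ; is = arm t xy (yd ∘ sym) ; x∉l = xb ∷ xd ∷ xl ; y∉l = yb ∷ yd ∷ yl }
        ... | inj₂ _ | inj₂ _ | inj₂ _ | inj₁ t = record { side = false ; is = arm t (tri-swap xy) (xd ∘ sym) ; x∉l = yb ∷ yd ∷ yl ; y∉l = xb ∷ xd ∷ xl }
        ... | inj₂ e₁ | inj₂ e₂ | inj₂ e₃ | inj₂ e₄ with () ← trans (trans (sym μ≡1) (joint bd xy (xb ∘ sym) (yb ∘ sym) (xd ∘ sym) (yd ∘ sym)))
                (cong₂ _+_ (cong₂ _+_ (cong₂ _+_ e₁ e₂) e₃) e₄)

      -- Among five pairwise disjoint edges attached to the ends of an edge, three are attached to the same end.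
      majority : ∀ {a} (h : Bool → Fin m) {x₁ y₁ x₂ y₂ x₃ y₃ x₄ y₄ x₅ y₅} s₁ s₂ s₃ s₄ s₅ →
        Arm a (h s₁) x₁ y₁ → Arm a (h s₂) x₂ y₂ → Arm a (h s₃) x₃ y₃ → Arm a (h s₄) x₄ y₄ → Arm a (h s₅) x₅ y₅ →
        Sep x₁ y₁ x₂ y₂ → Sep x₁ y₁ x₃ y₃ → Sep x₁ y₁ x₄ y₄ → Sep x₁ y₁ x₅ y₅ → Sep x₂ y₂ x₃ y₃ →
        Sep x₂ y₂ x₄ y₄ → Sep x₂ y₂ x₅ y₅ → Sep x₃ y₃ x₄ y₄ → Sep x₃ y₃ x₅ y₅ → Sep x₄ y₄ x₅ y₅ → ⊥
      majority h true true true _ _ A1 A2 A3 _ _ s0 s1 _ _ s4 _ _ _ _ _ = three-arms A1 A2 A3 s0 s1 s4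
      majority h true true false true _ A1 A2 _ A4 _ s0 _ s2 _ _ s5 _ _ _ _ = three-arms A1 A2 A4 s0 s2 s5
      majority h true true false false true A1 A2 _ _ A5 s0 _ _ s3 _ _ s6 _ _ _ = three-arms A1 A2 A5 s0 s3 s6
      majority h true true false false false _ _ A3 A4 A5 _ _ _ _ _ _ _ s7 s8 s9 = three-arms A3 A4 A5 s7 s8 s9
      majority h true false true true _ A1 _ A3 A4 _ _ s1 s2 _ _ _ _ s7 _ _ = three-arms A1 A3 A4 s1 s2 s7
      majority h true false true false true A1 _ A3 _ A5 _ s1 _ s3 _ _ _ _ s8 _ = three-arms A1 A3 A5 s1 s3 s8
      majority h true false true false false _ A2 _ A4 A5 _ _ _ _ _ s5 s6 _ _ s9 = three-arms A2 A4 A5 s5 s6 s9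
      majority h true false false true true A1 _ _ A4 A5 _ _ s2 s3 _ _ _ _ _ s9 = three-arms A1 A4 A5 s2 s3 s9
      majority h true false false true false _ A2 A3 _ A5 _ _ _ _ s4 _ s6 _ s8 _ = three-arms A2 A3 A5 s4 s6 s8
      majority h true false false false _ _ A2 A3 A4 _ _ _ _ _ s4 s5 _ s7 _ _ = three-arms A2 A3 A4 s4 s5 s7
      majority h false true true true _ _ A2 A3 A4 _ _ _ _ _ s4 s5 _ s7 _ _ = three-arms A2 A3 A4 s4 s5 s7
      majority h false true true false true _ A2 A3 _ A5 _ _ _ _ s4 _ s6 _ s8 _ = three-arms A2 A3 A5 s4 s6 s8
      majority h false true true false false A1 _ _ A4 A5 _ _ s2 s3 _ _ _ _ _ s9 = three-arms A1 A4 A5 s2 s3 s9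
      majority h false true false true true _ A2 _ A4 A5 _ _ _ _ _ s5 s6 _ _ s9 = three-arms A2 A4 A5 s5 s6 s9
      majority h false true false true false A1 _ A3 _ A5 _ s1 _ s3 _ _ _ _ s8 _ = three-arms A1 A3 A5 s1 s3 s8
      majority h false true false false _ A1 _ A3 A4 _ _ s1 s2 _ _ _ _ s7 _ _ = three-arms A1 A3 A4 s1 s2 s7
      majority h false false true true true _ _ A3 A4 A5 _ _ _ _ _ _ _ s7 s8 s9 = three-arms A3 A4 A5 s7 s8 s9
      majority h false false true true false A1 A2 _ _ A5 s0 _ _ s3 _ _ s6 _ _ _ = three-arms A1 A2 A5 s0 s3 s6
      majority h false false true false _ A1 A2 _ A4 _ s0 _ s2 _ _ s5 _ _ _ _ = three-arms A1 A2 A4 s0 s2 s5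
      majority h false false false _ _ A1 A2 A3 _ _ s0 s1 _ _ s4 _ _ _ _ _ = three-arms A1 A2 A3 s0 s1 s4

      impossible : Fin m → ⊥
      impossible a = from (fresh a [] [] z≤n)
        where
        drop₂ : ∀ {P : Fin m → Set} {x y l} → All P (x ∷ y ∷ l) → All P l
        drop₂ (_ ∷ _ ∷ ps) = ps
        mk : ∀ {x y x′ y′ l} → All (λ q → ¬ x′ ≡ q) (x ∷ y ∷ l) → All (λ q → ¬ y′ ≡ q) (x ∷ y ∷ l) → Sep x y x′ y′
        mk (p ∷ q ∷ _) (r ∷ s ∷ _) = sep (p ∘ sym) (r ∘ sym) (q ∘ sym) (s ∘ sym)
        from : Edge a [] → ⊥
        from (edge {b} {d} bd _ _) = majority (λ s → if s then b else d) (side f₁) (side f₂) (side f₃) (side f₄) (side f₅)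
            (is f₁) (is f₂) (is f₃) (is f₄) (is f₅)
            (mk (x₂ f₂) (y₂ f₂)) (mk (x₂ f₃) (y₂ f₃)) (mk (x₂ f₄) (y₂ f₄)) (mk (x₂ f₅) (y₂ f₅))
            (mk (drop₂ (x₂ f₃)) (drop₂ (y₂ f₃))) (mk (drop₂ (x₂ f₄)) (drop₂ (y₂ f₄))) (mk (drop₂ (x₂ f₅)) (drop₂ (y₂ f₅)))
            (mk (drop₂ (drop₂ (x₂ f₄))) (drop₂ (drop₂ (y₂ f₄)))) (mk (drop₂ (drop₂ (x₂ f₅))) (drop₂ (drop₂ (y₂ f₅))))
            (mk (drop₂ (drop₂ (drop₂ (x₂ f₅)))) (drop₂ (drop₂ (drop₂ (y₂ f₅)))))
          where
          open FreshArm
          x₂ : ∀ {l} (g : FreshArm a b d (b ∷ d ∷ l)) → All (λ q → ¬ x g ≡ q) l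
          x₂ g = drop₂ (x∉l g)
          y₂ : ∀ {l} (g : FreshArm a b d (b ∷ d ∷ l)) → All (λ q → ¬ y g ≡ q) l
          y₂ g = drop₂ (y∉l g)
          a≢x : ∀ {l} (g : FreshArm a b d l) → ¬ a ≡ x g
          a≢x g = Tri.a≢x (Arm.xy (is g))
          a≢y : ∀ {l} (g : FreshArm a b d l) → ¬ a ≡ y g
          a≢y g = Tri.a≢y (Arm.xy (is g))
          f₁ : FreshArm a b d (b ∷ d ∷ [])
          f₁ = attach [] bd [] z≤n
          f₂ : FreshArm a b d (b ∷ d ∷ x f₁ ∷ y f₁ ∷ [])
          f₂ = attach _ bd (a≢x f₁ ∷ a≢y f₁ ∷ []) (s≤s (s≤s z≤n))
          f₃ : FreshArm a b d (b ∷ d ∷ x f₁ ∷ y f₁ ∷ x f₂ ∷ y f₂ ∷ [])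
          f₃ = attach _ bd (a≢x f₁ ∷ a≢y f₁ ∷ a≢x f₂ ∷ a≢y f₂ ∷ []) (s≤s (s≤s (s≤s (s≤s z≤n))))
          f₄ : FreshArm a b d (b ∷ d ∷ x f₁ ∷ y f₁ ∷ x f₂ ∷ y f₂ ∷ x f₃ ∷ y f₃ ∷ [])
          f₄ = attach _ bd (a≢x f₁ ∷ a≢y f₁ ∷ a≢x f₂ ∷ a≢y f₂ ∷ a≢x f₃ ∷ a≢y f₃ ∷ []) (s≤s (s≤s (s≤s (s≤s (s≤s (s≤s z≤n))))))
          f₅ : FreshArm a b d (b ∷ d ∷ x f₁ ∷ y f₁ ∷ x f₂ ∷ y f₂ ∷ x f₃ ∷ y f₃ ∷ x f₄ ∷ y f₄ ∷ [])
          f₅ = attach _ bd (a≢x f₁ ∷ a≢y f₁ ∷ a≢x f₂ ∷ a≢y f₂ ∷ a≢x f₃ ∷ a≢y f₃ ∷ a≢x f₄ ∷ a≢y f₄ ∷ [])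
            (s≤s (s≤s (s≤s (s≤s (s≤s (s≤s (s≤s (s≤s z≤n))))))))

    -- Without triangles each end of one edge is adjacent to at most one end of the other.
    μ≤2 : Fin m → μ ≤ 2
    μ≤2 a with fresh a [] [] z≤n
    ... | edge {b} {d} bd _ _ with fresh a (b ∷ d ∷ []) (Tri.a≢x bd ∷ Tri.a≢y bd ∷ []) (s≤s (s≤s z≤n))
    ...   | edge {x} {y} xy (xb ∷ xd ∷ []) (yb ∷ yd ∷ []) = ≤-trans (≤-reflexive (trans (joint bd xy (xb ∘ sym) (yb ∘ sym) (xd ∘ sym) (yd ∘ sym))
          (+-assoc (N₃ a b x + N₃ a b y) _ _))) (+-mono-≤ (at-most-one (Tri.a≢x bd) (xb ∘ sym) (yb ∘ sym)) (at-most-one (Tri.a≢y bd) (xd ∘ sym) (yd ∘ sym)))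
      where
      at-most-one : ∀ {z} → ¬ a ≡ z → ¬ z ≡ x → ¬ z ≡ y → N₃ a z x + N₃ a z y ≤ 1
      at-most-one {z} az zx zy with tri? a z x az (Tri.a≢x xy) zx | tri? a z y az (Tri.a≢y xy) zy
      ... | inj₁ t | inj₁ s = ⊥-elim (no-tri t xy s)
      ... | inj₁ t | inj₂ e = ≤-reflexive (cong₂ _+_ (N₃-tri t) e)
      ... | inj₂ e | inj₁ s = ≤-reflexive (cong₂ _+_ e (N₃-tri s))
      ... | inj₂ e | inj₂ g = ≤-trans (≤-reflexive (cong₂ _+_ e g)) z≤n

    μ≡2 : Fin m → μ ≡ 2
    μ≡2 a with m≤n⇒m<n∨m≡n (μ≤2 a)
    ... | inj₂ e = e
    ... | inj₁ lt = ⊥-elim (One.impossible (≤-antisym (s≤s⁻¹ lt) μ>0) a)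

    -- The link of a is complete bipartite.
    opaque
      bip : ∀ {a b d z y} → Tri a b d → Tri a b z → Tri a d y → Tri a y z
      bip {a} {b} {d} {z} {y} bd bz dy with y FP.≟ b | z FP.≟ d | z FP.≟ y
      ... | yes refl | _ | _ = bz
      ... | no _ | yes refl | _ = tri-swap dy
      ... | no _ | no _ | yes refl = ⊥-elim (no-tri bd dy bz)
      ... | no yb | no zd | no zy with tri? a z y (Tri.a≢y bz) (Tri.a≢y dy) zy
      ...   | inj₁ t = tri-swap t
      ...   | inj₂ e with () ← trans (trans (sym (μ≡2 a)) (joint bz dy (Tri.x≢y bd) (yb ∘ sym) zd zy))
              (cong₂ _+_ (cong₂ _+_ (cong₂ _+_ (N₃-tri bd) (N₃-none (Tri.a≢x bd) (Tri.a≢y dy) (yb ∘ sym) (λ t → no-tri bd dy t)))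
                (N₃-none (Tri.a≢y bz) (Tri.a≢y bd) zd (λ t → no-tri bd (tri-swap t) bz))) e)

    module Base {a b d : Fin m} (abd : Tri a b d) where

      opaque
        -- The replacements in the three positions are independent: `bip` in the links of `b` and
        -- `d` carries two of them over to `x`, and `bip` in the link of `x` combines them.
        grid : ∀ {x y z} → Tri x b d → Tri a y d → Tri a b z → Tri x y z
        grid {x} {y} {z} xbd ayd abz = bip xbd
          (tri-flip (bip (tri-flip abd) (tri-flip abz) (tri-rot xbd)))
          (tri-flip (bip (tri-rot (tri-rot abd)) (tri-rot (tri-rot ayd)) (tri-swap (tri-rot (tri-rot xbd)))))

      opaque
        -- Conversely the third plane of a vertex on `x` and `y` can replace `d` in the base triple.
        -- This lets coordinates propagate along colour `A`.
        next : ∀ {x y z s} → Tri x b d → Tri a y d → Tri a b z → Tri x y s → Tri a b s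
        next {x} {y} {z} {s} xbd ayd abz xys = bip ayz
          (tri-flip (bip (tri-flip (grid xbd ayd abz)) (tri-flip xys) (tri-rot ayz))) (tri-swap abz)
          where
          ayz : Tri a y z
          ayz = grid abd ayd abz

-- Johnson and Hamming schemes

record Enum {n : ℕ} (P : Fin n → Bool) (k : ℕ) : Set where
  field
    at     : Fin k → Fin n
    at-P   : ∀ i → P (at i) ≡ true
    at-inj : ∀ i j → at i ≡ at j → i ≡ j
    rank   : ∀ v → P v ≡ true → Fin k
    at-rank : ∀ v Pv → at (rank v Pv) ≡ v

enum : ∀ {n} (P : Fin n → Bool) → Enum P (# P)
enum {zero}  P = record { at = λ () ; at-P = λ () ; at-inj = λ () ; rank = λ () ; at-rank = λ () }
enum {suc n} P with P zero in e | enum (P ∘ suc)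
... | false | r = record { at = suc ∘ at ; at-P = at-P ; at-inj = λ i j q → at-inj i j (FP.suc-injective q) ; rank = rank′ ; at-rank = at-rank′ }
  where
  open Enum r
  rank′ : ∀ v → P v ≡ true → Fin _
  rank′ zero    Pv with () ← trans (sym e) Pv
  rank′ (suc v) Pv = rank v Pv
  at-rank′ : ∀ v Pv → suc (at (rank′ v Pv)) ≡ v
  at-rank′ zero    Pv with () ← trans (sym e) Pv
  at-rank′ (suc v) Pv = cong suc (at-rank v Pv)
... | true | r = record { at = at′ ; at-P = at-P′ ; at-inj = at-inj′ ; rank = rank′ ; at-rank = at-rank′ }
  where
  open Enum r
  at′ : Fin (suc (# (P ∘ suc))) → Fin (suc n)
  at′ zero    = zero
  at′ (suc i) = suc (at i)
  at-P′ : ∀ i → P (at′ i) ≡ true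
  at-P′ zero    = e
  at-P′ (suc i) = at-P i
  at-inj′ : ∀ i j → at′ i ≡ at′ j → i ≡ j
  at-inj′ zero    zero    _ = refl
  at-inj′ (suc i) (suc j) q = cong suc (at-inj i j (FP.suc-injective q))
  rank′ : ∀ v → P v ≡ true → Fin (suc (# (P ∘ suc)))
  rank′ zero    _  = zero
  rank′ (suc v) Pv = suc (rank v Pv)
  at-rank′ : ∀ v Pv → at′ (rank′ v Pv) ≡ v
  at-rank′ zero    _  = refl
  at-rank′ (suc v) Pv = cong suc (at-rank v Pv)

JohnsonColouring HammingColouring : ∀ {n} → (Fin n → Fin n → Fin 4) → Set
JohnsonColouring {n} c = ∃[ m ] ∃[ d ] (2 ≤ d × 2 * d ≤ m ×
  Σ (Fin n ⤖ JVertex m d) λ f → Σ (Fin 4 → ℕ) λ g → (Injective _≡_ _≡_ g ×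
    (∀ u v → johnsonColour (Bijection.to f u) (Bijection.to f v) ≡ g (c u v))))
HammingColouring {n} c = ∃[ d ] ∃[ m ] (2 ≤ m ×
  Σ (Fin n ⤖ Vec (Fin m) d) λ f → Σ (Fin 4 → ℕ) λ g → (Injective _≡_ _≡_ g ×
    (∀ u v → hammingDist (Bijection.to f u) (Bijection.to f v) ≡ g (c u v))))

dist : Fin 4 → ℕ
dist O = 0
dist A = 1
dist B = 2
dist D = 3

dist+shared : ∀ i → dist i + shared i ≡ 3
dist+shared O = refl
dist+shared A = refl
dist+shared B = refl
dist+shared D = refl

dist-inj : Injective _≡_ _≡_ dist
dist-inj {i} {j} e = FP.toℕ-injective (trans (sym (toℕ≡ i)) (trans e (toℕ≡ j)))
  where
  toℕ≡ : ∀ i → dist i ≡ F.toℕ i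
  toℕ≡ O = refl
  toℕ≡ A = refl
  toℕ≡ B = refl
  toℕ≡ D = refl

∣tabulate∣ : ∀ {m} (P : Fin m → Bool) → ∣ tabulate P ∣ ≡ # P
∣tabulate∣ {zero}  P = refl
∣tabulate∣ {suc m} P with P zero
... | true  = cong suc (∣tabulate∣ (P ∘ suc))
... | false = ∣tabulate∣ (P ∘ suc)

∣tabulate∖∣ : ∀ {m} (P Q : Fin m → Bool) → ∣ tabulate P ∩ ∁ (tabulate Q) ∣ ≡ # (λ a → P a ∧ not (Q a))
∣tabulate∖∣ {zero}  P Q = refl
∣tabulate∖∣ {suc m} P Q with P zero ∧ not (Q zero)
... | true  = cong suc (∣tabulate∖∣ (P ∘ suc) (Q ∘ suc))
... | false = ∣tabulate∖∣ (P ∘ suc) (Q ∘ suc)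

module Isomorphisms {n : ℕ} (X : Scheme n) (o≡O : Scheme.o X ≡ O) (st-id : ∀ i → Scheme.st X i ≡ i) (T : Triples X) where
  open Basic X
  open Triples T
  open Links X o≡O st-id T

  private
    diag′ : ∀ u v → c u v ≡ O → u ≡ v
    diag′ u v e = diag u v (trans e (sym o≡O))

  on-split : ∀ v a → on v a ≡ ⟪ a == π v 𝟎 ⟫ + ⟪ a == π v 𝟏 ⟫ + ⟪ a == π v 𝟐 ⟫
  on-split v a rewrite ==-sym (π v 𝟎) a | ==-sym (π v 𝟏) a | ==-sym (π v 𝟐) a
    with a == π v 𝟎 in p | a == π v 𝟏 in q | a == π v 𝟐 in r
  ... | true  | true  | _     with () ← π-inj v 𝟎 𝟏 (trans (sym (==⇒≡ a _ p)) (==⇒≡ a _ q))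
  ... | true  | false | true  with () ← π-inj v 𝟎 𝟐 (trans (sym (==⇒≡ a _ p)) (==⇒≡ a _ r))
  ... | true  | false | false = refl
  ... | false | true  | true  with () ← π-inj v 𝟏 𝟐 (trans (sym (==⇒≡ a _ q)) (==⇒≡ a _ r))
  ... | false | true  | false = refl
  ... | false | false | true  = refl
  ... | false | false | false = refl

  on-sum : ∀ v (G : Fin m → ℕ) → ∑ (λ a → on v a * G a) ≡ G (π v 𝟎) + G (π v 𝟏) + G (π v 𝟐)
  on-sum v G = trans (∑-cong (λ a → trans (cong (_* G a) (on-split v a))
      (trans (*-distribʳ-+ (G a) (⟪ a == π v 𝟎 ⟫ + ⟪ a == π v 𝟏 ⟫) _) (cong (_+ ⟪ a == π v 𝟐 ⟫ * G a) (*-distribʳ-+ (G a) ⟪ a == π v 𝟎 ⟫ _)))))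
    (trans (∑-+₃ (λ a → ⟪ a == π v 𝟎 ⟫ * G a) (λ a → ⟪ a == π v 𝟏 ⟫ * G a) (λ a → ⟪ a == π v 𝟐 ⟫ * G a))
      (cong₂ _+_ (cong₂ _+_ (∑-point (π v 𝟎) G) (∑-point (π v 𝟏) G)) (∑-point (π v 𝟐) G)))

  #-has : ∀ v → # (has v) ≡ 3
  #-has v = trans (∑-cong (λ a → sym (*-identityʳ (on v a)))) (on-sum v (λ _ → 1))

  #-both : ∀ u w → # (λ a → has u a ∧ has w a) ≡ shared (c u w)
  #-both u w = trans (∑-cong (λ a → ⟪∧⟫ (has u a) (has w a))) (trans (on-sum u (on w)) (meet u w))

  #-diff : ∀ u w → # (λ a → has u a ∧ not (has w a)) ≡ dist (c u w)
  #-diff u w = +-cancelˡ-≡ (shared (c u w)) _ _ (trans (cong (_+ # (λ a → has u a ∧ not (has w a))) (sym (#-both u w)))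
    (trans (sym (#-split (has u) (has w))) (trans (#-has u) (trans (sym (dist+shared (c u w))) (+-comm (dist (c u w)) _)))))

  has-ext : ∀ u w → (∀ a → has u a ≡ has w a) → u ≡ w
  has-ext u w h = diag′ u w (dist-O (c u w) (trans (sym (#-diff u w)) (#≡0 (λ a → trans (cong (λ b → b ∧ not (has w a)) (h a)) (∧-inverseʳ (has w a))))))
    where
    dist-O : ∀ i → dist i ≡ 0 → i ≡ O
    dist-O O _ = refl
    dist-O A ()
    dist-O B ()
    dist-O D ()

  -- Two vertices of colour `D` have no common plane.
  six : 6 ≤ m
  six with occ D
  ... | u , w , uw = subst (6 ≤_) (trans (∑-const m 1) (*-identityʳ m))
      (sumOver≤# (λ _ → true) (π u 𝟎 ∷ π u 𝟏 ∷ π u 𝟐 ∷ π w 𝟎 ∷ π w 𝟏 ∷ π w 𝟐 ∷ [])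
        (((own u λ ()) ∷ (own u λ ()) ∷ x 𝟎 𝟎 ∷ x 𝟎 𝟏 ∷ x 𝟎 𝟐 ∷ [])
       ∷ ((own u λ ()) ∷ x 𝟏 𝟎 ∷ x 𝟏 𝟏 ∷ x 𝟏 𝟐 ∷ [])
       ∷ (x 𝟐 𝟎 ∷ x 𝟐 𝟏 ∷ x 𝟐 𝟐 ∷ [])
       ∷ ((own w λ ()) ∷ (own w λ ()) ∷ [])
       ∷ ((own w λ ()) ∷ []) ∷ [] ∷ []))
    where
    own : ∀ v {i j} → ¬ i ≡ j → ¬ π v i ≡ π v j
    own v ne e = ne (π-inj v _ _ e)
    x : ∀ i j → ¬ π u i ≡ π w j
    x i j e = common-point {u} {w} (∃-holds (π u) i) (trans (cong (has w) e) (∃-holds (π w) j)) uw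

  johnson : μ ≡ 4 → JohnsonColouring c
  johnson μ≡4 = m , 3 , s≤s (s≤s z≤n) , six , mk⤖ (inj , surj) , dist , dist-inj , λ u w → trans (∣tabulate∖∣ (has u) (has w)) (#-diff u w)
    where
    open AllTriples μ≡4
    to : V → JVertex m 3
    to v = tabulate (has v) , trans (∣tabulate∣ (has v)) (#-has v)
    inj : Injective _≡_ _≡_ to
    inj {u} {w} e = has-ext u w (λ a → trans (sym (lookup∘tabulate (has u) a)) (trans (cong (λ q → lookup (proj₁ q) a) e) (lookup∘tabulate (has w) a)))
    JV-≡ : ∀ {U U′ : Subset m} {p : ∣ U ∣ ≡ 3} {p′ : ∣ U′ ∣ ≡ 3} → U ≡ U′ → _≡_ {A = JVertex m 3} (U , p) (U′ , p′)
    JV-≡ {p = p} {p′} refl = cong (_ ,_) (≡-irrelevant p p′)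
    surj : Surjective _≡_ _≡_ to
    surj (U , sz) = v , λ { refl → JV-≡ (trans (tabulate-cong agree) (tabulate∘lookup U)) }
      where
      en : Enum (lookup U) 3
      en = subst (Enum (lookup U)) (trans (sym (∣tabulate∣ (lookup U))) (trans (cong ∣_∣ (tabulate∘lookup U)) sz)) (enum (lookup U))
      open Enum en
      ne : ∀ {i j} → ¬ i ≡ j → ¬ at i ≡ at j
      ne h e = h (at-inj _ _ e)
      t : Tri (at 𝟎) (at 𝟏) (at 𝟐)
      t = all-tri (at 𝟎) (at 𝟏) (at 𝟐) (ne λ ()) (ne λ ()) (ne λ ())
      v = Tri.v t
      on-v : ∀ i → v ∋ at i
      on-v 𝟎 = Tri.v∋a t
      on-v 𝟏 = Tri.v∋x t
      on-v 𝟐 = Tri.v∋y t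
      back : ∀ {a} → a ≡ at 𝟎 ⊎ a ≡ at 𝟏 ⊎ a ≡ at 𝟐 → lookup U a ≡ true
      back (inj₁ refl) = at-P 𝟎
      back (inj₂ (inj₁ refl)) = at-P 𝟏
      back (inj₂ (inj₂ refl)) = at-P 𝟐
      agree : ∀ a → has v a ≡ lookup U a
      agree a with has v a in p | lookup U a in q
      ... | true  | true  = refl
      ... | false | false = refl
      ... | true  | false with () ← trans (sym q) (back (only t p))
      ... | false | true with () ← trans (sym p) (subst (v ∋_) (at-rank a q) (on-v (rank a q)))

  module Grid (μ≢4 : ¬ μ ≡ 4) where
    open TriangleFree μ≢4

    -- A common `A`-neighbour of the two vertices shares two planes with each of them. If it does
    -- not contain both `a` and `b`, it contains one of these together with `d` and `e`, a triangle
    -- in a link. So the line consists of the two vertices and their common `A`-neighbours.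
    line-count : ∀ {a b d e} → Tri a b d → Tri a b e → ¬ d ≡ e → # (λ v → has v a ∧ has v b) ≡ p A A A + 1 + 1
    line-count {a} {b} {d} {e} abd abe de = trans (≤-antisym (∑-mono le) (∑-mono ge))
        (trans (∑-+₃ (λ z → ⟪ (c u z == A) ∧ (c w z == A) ⟫) (λ z → ⟪ z == u ⟫) (λ z → ⟪ z == w ⟫))
          (cong₂ _+_ (cong₂ _+_ (trans (coh A A u w) (cong (p A A) uwA)) (#-point u)) (#-point w)))
      where
      u w : V
      u = Tri.v abd
      w = Tri.v abe
      w∌d : has w d ≡ false
      w∌d = ∌ {w} λ h → none (only abe h)
        where
        none : d ≡ a ⊎ d ≡ b ⊎ d ≡ e → ⊥
        none (inj₁ q) = Tri.a≢y abd (sym q)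
        none (inj₂ (inj₁ q)) = Tri.x≢y abd (sym q)
        none (inj₂ (inj₂ q)) = de q
      shared-2 : ∀ i → shared i ≡ 2 → i ≡ A
      shared-2 O ()
      shared-2 A _ = refl
      shared-2 B ()
      shared-2 D ()
      uwA : c u w ≡ A
      uwA = shared-2 _ (trans (sym (meet-on abd w)) (cong₂ _+_ (cong₂ _+_ (cong ⟪_⟫ (Tri.v∋a abe)) (cong ⟪_⟫ (Tri.v∋x abe))) (cong ⟪_⟫ w∌d)))
      isA : ∀ {a x y} (t : Tri a x y) z → (c (Tri.v t) z == A) ≡ (on z a + on z x + on z y ≡ᵇ 2)
      isA t z = trans (shared-A (c (Tri.v t) z)) (cong (_≡ᵇ 2) (sym (meet-on t z)))
      is-v : ∀ {a x y} (t : Tri a x y) z → (z == Tri.v t) ≡ has z a ∧ (has z x ∧ has z y)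
      is-v {a} {x} {y} t z with z == Tri.v t in q | has z a ∧ (has z x ∧ has z y) in r
      ... | true  | true  = refl
      ... | false | false = refl
      ... | true  | false with () ← trans (sym r) (subst (λ z → has z a ∧ (has z x ∧ has z y) ≡ true) (sym (==⇒≡ z _ q)) (∧-true (Tri.v∋a t) (∧-true (Tri.v∋x t) (Tri.v∋y t))))
      ... | false | true  = ⊥-elim (==⇒≢ z _ q (tri-unique (tri (Tri.a≢x t) (Tri.a≢y t) (Tri.x≢y t) z (∧-left r)
              (∧-left (∧-right {has z a} r)) (∧-right {has z x} (∧-right {has z a} r))) t))
      at : V → Vec Bool 4
      at z = has z a ∷ has z b ∷ has z d ∷ has z e ∷ []
      H : Vec Bool 4 → Bool
      H = λ { (a ∷ b ∷ d ∷ e ∷ []) → not (a ∧ (d ∧ e)) ∧ not (b ∧ (d ∧ e)) }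
      L R : Vec Bool 4 → ℕ
      L = λ { (a ∷ b ∷ d ∷ e ∷ []) → ⟪ a ∧ b ⟫ }
      R = λ { (a ∷ b ∷ d ∷ e ∷ []) → ⟪ (⟪ a ⟫ + ⟪ b ⟫ + ⟪ d ⟫ ≡ᵇ 2) ∧ (⟪ a ⟫ + ⟪ b ⟫ + ⟪ e ⟫ ≡ᵇ 2) ⟫ + ⟪ a ∧ (b ∧ d) ⟫ + ⟪ a ∧ (b ∧ e) ⟫ }
      triangle-bits : ∀ {h k} → Tri h k d → Tri h k e → ∀ z → not (has z h ∧ (has z d ∧ has z e)) ≡ true
      triangle-bits {h} hkd hke z with has z h in p | has z d in q | has z e in r
      ... | true  | true  | true  = ⊥-elim (no-tri hkd (tri (Tri.a≢y hkd) (Tri.a≢y hke) de z p q r) hke)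
      ... | true  | true  | false = refl
      ... | true  | false | _     = refl
      ... | false | _     | _     = refl
      ok : ∀ z → H (at z) ≡ true
      ok z = ∧-true (triangle-bits abd abe z) (triangle-bits (tri-flip abd) (tri-flip abe) z)
      rhs : ∀ z → ⟪ (c u z == A) ∧ (c w z == A) ⟫ + ⟪ z == u ⟫ + ⟪ z == w ⟫ ≡ R (at z)
      rhs z = cong₂ _+_ (cong₂ _+_ (cong₂ (λ p q → ⟪ p ∧ q ⟫) (isA abd z) (isA abe z)) (cong ⟪_⟫ (is-v abd z))) (cong ⟪_⟫ (is-v abe z))
      le : ∀ z → ⟪ has z a ∧ has z b ⟫ ≤ ⟪ (c u z == A) ∧ (c w z == A) ⟫ + ⟪ z == u ⟫ + ⟪ z == w ⟫
      le z = ≤-trans (bits≤-if H L R refl (at z) (ok z)) (≤-reflexive (sym (rhs z)))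
      ge : ∀ z → ⟪ (c u z == A) ∧ (c w z == A) ⟫ + ⟪ z == u ⟫ + ⟪ z == w ⟫ ≤ ⟪ has z a ∧ has z b ⟫
      ge z = ≤-trans (≤-reflexive (rhs z)) (bits≤-if H R L refl (at z) (ok z))

    -- A second vertex on the line comes from a fresh link edge `x y`: it is joined to `b d` by two
    -- edges and `d` cannot take both, so `b` is adjacent to `x` or to `y`.
    line-size : ∀ {a b d} → Tri a b d → # (λ v → has v a ∧ has v b) ≡ p A A A + 1 + 1
    line-size {a} {b} {d} abd with fresh a (b ∷ d ∷ []) (Tri.a≢x abd ∷ Tri.a≢y abd ∷ []) (s≤s (s≤s z≤n))
    ... | edge {x} {y} xy (xb ∷ xd ∷ []) (yb ∷ yd ∷ [])
      with tri? a b x (Tri.a≢x abd) (Tri.a≢x xy) (xb ∘ sym) | tri? a b y (Tri.a≢x abd) (Tri.a≢y xy) (yb ∘ sym)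
    ...   | inj₁ abx | _ = line-count abd abx (xd ∘ sym)
    ...   | inj₂ _ | inj₁ aby = line-count abd aby (yd ∘ sym)
    ...   | inj₂ e₁ | inj₂ e₂ with tri? a d x (Tri.a≢y abd) (Tri.a≢x xy) (xd ∘ sym) | tri? a d y (Tri.a≢y abd) (Tri.a≢y xy) (yd ∘ sym)
                                 | trans (sym (μ≡2 a)) (joint abd xy (xb ∘ sym) (yb ∘ sym) (xd ∘ sym) (yd ∘ sym))
    ...     | inj₁ adx | inj₁ ady | _ = ⊥-elim (no-tri adx xy ady)
    ...     | inj₁ adx | inj₂ e₄ | q with () ← trans q (cong₂ _+_ (cong₂ _+_ (cong₂ _+_ e₁ e₂) (N₃-tri adx)) e₄)
    ...     | inj₂ e₃ | inj₁ ady | q with () ← trans q (cong₂ _+_ (cong₂ _+_ (cong₂ _+_ e₁ e₂) e₃) (N₃-tri ady))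
    ...     | inj₂ e₃ | inj₂ e₄ | q with () ← trans q (cong₂ _+_ (cong₂ _+_ (cong₂ _+_ e₁ e₂) e₃) e₄)

    side : ℕ
    side = p A A A + 1 + 1

    line : ∀ {a b d} → Tri a b d → Enum (λ v → has v a ∧ has v b) side
    line {a} {b} t = subst (Enum (λ v → has v a ∧ has v b)) (line-size t) (enum (λ v → has v a ∧ has v b))

    module Coordinates {a b d : Fin m} (abd : Tri a b d) where
      open Base abd

      record Coords (v : V) : Set where
        constructor coords
        field
          {x y z} : Fin m
          tx : Tri b d x
          ty : Tri a d y
          tz : Tri a b z
          v∋x : v ∋ x
          v∋y : v ∋ y
          v∋z : v ∋ z

        txyz : Tri x y z
        txyz = grid (tri-rot (tri-rot tx)) (tri-swap ty) tz

        tv : Tri x y z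
        tv = tri (Tri.a≢x txyz) (Tri.a≢y txyz) (Tri.x≢y txyz) v v∋x v∋y v∋z

      xy-disjoint : ∀ {q} → Tri b d q → Tri a d q → ⊥
      xy-disjoint s t = Tri.a≢x (grid (tri-rot (tri-rot s)) (tri-swap t) abd) refl

      xz-disjoint : ∀ {q} → Tri b d q → Tri a b q → ⊥
      xz-disjoint s t = Tri.a≢y (grid (tri-rot (tri-rot s)) abd t) refl

      yz-disjoint : ∀ {q} → Tri a d q → Tri a b q → ⊥
      yz-disjoint s t = Tri.x≢y (grid abd (tri-swap s) t) refl

      x-unique : ∀ {v} (k : Coords v) {q} → v ∋ q → Tri b d q → q ≡ Coords.x k
      x-unique k vq t with only (Coords.tv k) vq
      ... | inj₁ e = e
      ... | inj₂ (inj₁ refl) = ⊥-elim (xy-disjoint t (Coords.ty k))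
      ... | inj₂ (inj₂ refl) = ⊥-elim (xz-disjoint t (Coords.tz k))

      y-unique : ∀ {v} (k : Coords v) {q} → v ∋ q → Tri a d q → q ≡ Coords.y k
      y-unique k vq t with only (Coords.tv k) vq
      ... | inj₁ refl = ⊥-elim (xy-disjoint (Coords.tx k) t)
      ... | inj₂ (inj₁ e) = e
      ... | inj₂ (inj₂ refl) = ⊥-elim (yz-disjoint t (Coords.tz k))

      z-unique : ∀ {v} (k : Coords v) {q} → v ∋ q → Tri a b q → q ≡ Coords.z k
      z-unique k vq t with only (Coords.tv k) vq
      ... | inj₁ refl = ⊥-elim (xz-disjoint (Coords.tx k) t)
      ... | inj₂ (inj₁ refl) = ⊥-elim (yz-disjoint (Coords.ty k) t)
      ... | inj₂ (inj₂ e) = e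

      -- An `A`-neighbour keeps two of the three planes; `next`, with the base triple suitably
      -- permuted, puts the new plane into the family of the lost one.
      step : ∀ {v w} → c v w ≡ A → Coords v → Coords w
      step {v} {w} vw k@(coords {x} {y} {z} tx ty tz vx vy vz)
        with has w x in wx | has w y in wy | has w z in wz | trans (meet-on (Coords.tv k) w) (cong shared vw)
      ... | true | true | _ | _ with third w wx wy (Tri.a≢x (Coords.txyz k))
      ...   | s , t , refl = coords tx ty (next (tri-rot (tri-rot tx)) (tri-swap ty) tz t) wx wy (Tri.v∋y t)
      step {v} {w} vw k@(coords {x} {y} {z} tx ty tz vx vy vz) | true | false | true | _ with third w wx wz (Tri.a≢y (Coords.txyz k))
      ...   | s , t , refl = coords tx (Base.next (tri-swap abd) (tri-swap (tri-rot (tri-rot tx))) (tri-swap tz) ty t) tz wx (Tri.v∋y t) wz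
      step {v} {w} vw k@(coords {x} {y} {z} tx ty tz vx vy vz) | false | true | true | _ with third w wy wz (Tri.x≢y (Coords.txyz k))
      ...   | s , t , refl = coords (Base.next (tri-rot abd) (tri-swap (tri-rot (tri-rot ty))) (tri-swap (tri-flip tz)) tx t) ty tz (Tri.v∋y t) wy wz
      step vw k | true | false | false | ()
      step vw k | false | true | false | ()
      step vw k | false | false | true | ()
      step vw k | false | false | false | ()

      walk : ∀ {v w} → Star (λ x y → c x y ≡ A) v w → Coords v → Coords w
      walk ε       k = k
      walk (e ◅ r) k = walk r (step e k)

      opaque
        coordsOf : ∀ v → Coords v
        coordsOf v = walk (conn A (λ e → A≢O (trans e o≡O)) (Tri.v abd) v)
            (coords (tri-rot abd) (tri-swap abd) abd (Tri.v∋a abd) (Tri.v∋x abd) (Tri.v∋y abd))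

      ex : Enum (λ v → has v b ∧ has v d) side
      ex = line (tri-rot abd)
      ey : Enum (λ v → has v a ∧ has v d) side
      ey = line (tri-swap abd)
      ez : Enum (λ v → has v a ∧ has v b) side
      ez = line abd

      on-line : ∀ {a b q} (t : Tri a b q) → has (Tri.v t) a ∧ has (Tri.v t) b ≡ true
      on-line t = ∧-true (Tri.v∋a t) (Tri.v∋x t)

      rk : ∀ {a b q} → Enum (λ v → has v a ∧ has v b) side → Tri a b q → Fin side
      rk en t = Enum.rank en (Tri.v t) (on-line t)

      rk-inj : ∀ {a b q r} (en : Enum (λ v → has v a ∧ has v b) side) (t : Tri a b q) (s : Tri a b r) → rk en t ≡ rk en s → q ≡ r
      rk-inj {a} {b} {q} {r} en t s e = pick (only s (subst (_∋ q) vt≡vs (Tri.v∋y t)))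
        where
        vt≡vs : Tri.v t ≡ Tri.v s
        vt≡vs = trans (sym (Enum.at-rank en (Tri.v t) (on-line t))) (trans (cong (Enum.at en) e) (Enum.at-rank en (Tri.v s) (on-line s)))
        pick : q ≡ a ⊎ q ≡ b ⊎ q ≡ r → q ≡ r
        pick (inj₁ h) = ⊥-elim (Tri.a≢y t (sym h))
        pick (inj₂ (inj₁ h)) = ⊥-elim (Tri.x≢y t (sym h))
        pick (inj₂ (inj₂ h)) = h

      rk-cong : ∀ {a b q r} (en : Enum (λ v → has v a ∧ has v b) side) (t : Tri a b q) (s : Tri a b r) → q ≡ r → rk en t ≡ rk en s
      rk-cong en t s refl = Enum.at-inj en _ _ (trans (Enum.at-rank en _ (on-line t)) (trans (tri-unique t s) (sym (Enum.at-rank en _ (on-line s)))))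

      -- A plane of the first family is determined by the vertex it cuts out on the line of `b` and
      -- `d`, so its coordinate is the rank of that vertex; the other families use the other two
      -- lines of the base triple.
      to : V → Vec (Fin side) 3
      to v = rk ex (Coords.tx (coordsOf v)) ∷ rk ey (Coords.ty (coordsOf v)) ∷ rk ez (Coords.tz (coordsOf v)) ∷ []

      to-inj : Injective _≡_ _≡_ to
      to-inj {u} {w} e = tri-unique (Coords.tv (coordsOf u)) (tri (Tri.a≢x t) (Tri.a≢y t) (Tri.x≢y t) w
          (subst (w ∋_) (rk-inj ex (Coords.tx (coordsOf w)) (Coords.tx (coordsOf u)) (cong (λ q → lookup q 𝟎) (sym e))) (Coords.v∋x (coordsOf w)))
          (subst (w ∋_) (rk-inj ey (Coords.ty (coordsOf w)) (Coords.ty (coordsOf u)) (cong (λ q → lookup q 𝟏) (sym e))) (Coords.v∋y (coordsOf w)))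
          (subst (w ∋_) (rk-inj ez (Coords.tz (coordsOf w)) (Coords.tz (coordsOf u)) (cong (λ q → lookup q 𝟐) (sym e))) (Coords.v∋z (coordsOf w))))
        where
        t = Coords.tv (coordsOf u)

      to-surj : Surjective _≡_ _≡_ to
      to-surj (i ∷ j ∷ l ∷ []) = at-coords (point ex (tri-rot abd) i) (point ey (tri-swap abd) j) (point ez abd l)
        where
        Point : ∀ {a b} → Enum (λ v → has v a ∧ has v b) side → Fin side → Set
        Point {a} {b} en i = ∃[ q ] Σ (Tri a b q) (λ t → rk en t ≡ i)
        point : ∀ {a b d} (en : Enum (λ v → has v a ∧ has v b) side) → Tri a b d → ∀ i → Point en i
        point {a} {b} en t₀ i = via (third (Enum.at en i) (∧-left (Enum.at-P en i)) (∧-right {has (Enum.at en i) a} (Enum.at-P en i)) (Tri.a≢x t₀))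
          where
          via : ∃[ q ] Σ (Tri a b q) (λ t → Tri.v t ≡ Enum.at en i) → Point en i
          via (q , t , e) = q , t , Enum.at-inj en _ _ (trans (Enum.at-rank en _ (on-line t)) e)
        at-coords : Point ex i → Point ey j → Point ez l → ∃[ v ] (∀ {w} → w ≡ v → to w ≡ i ∷ j ∷ l ∷ [])
        at-coords (x , tx , ri) (y , ty , rj) (z , tz , rl) = v , λ e → trans (cong to e) (cong₂ _∷_
            (trans (rk-cong ex (Coords.tx (coordsOf v)) tx (sym (x-unique (coordsOf v) (Tri.v∋a t) tx))) ri) (cong₂ _∷_
            (trans (rk-cong ey (Coords.ty (coordsOf v)) ty (sym (y-unique (coordsOf v) (Tri.v∋x t) ty))) rj) (cong (_∷ [])
            (trans (rk-cong ez (Coords.tz (coordsOf v)) tz (sym (z-unique (coordsOf v) (Tri.v∋y t) tz))) rl))))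
          where
          t : Tri x y z
          t = grid (tri-rot (tri-rot tx)) (tri-swap ty) tz
          v : V
          v = Tri.v t

      to-dist : ∀ u w → hammingDist (to u) (to w) ≡ dist (c u w)
      to-dist u w = +-cancelʳ-≡ (shared (c u w)) _ _ (trans (cong (hammingDist (to u) (to w) +_) (sym (meet-on (Coords.tv ku) w)))
          (trans (regroup (off (rk ex (Coords.tx ku)) (rk ex (Coords.tx kw))) (off (rk ey (Coords.ty ku)) (rk ey (Coords.ty kw))) (off (rk ez (Coords.tz ku)) (rk ez (Coords.tz kw)))
                    (on w (Coords.x ku)) (on w (Coords.y ku)) (on w (Coords.z ku)))
            (trans (cong₂ _+_ (cong₂ _+_
              (one ex (Coords.tx ku) (Coords.tx kw) (λ h → x-unique kw h (Coords.tx ku)) (Coords.v∋x kw))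
              (one ey (Coords.ty ku) (Coords.ty kw) (λ h → y-unique kw h (Coords.ty ku)) (Coords.v∋y kw)))
              (one ez (Coords.tz ku) (Coords.tz kw) (λ h → z-unique kw h (Coords.tz ku)) (Coords.v∋z kw)))
              (sym (dist+shared (c u w))))))
        where
        ku : Coords u
        ku = coordsOf u
        kw : Coords w
        kw = coordsOf w
        off : Fin side → Fin side → ℕ
        off i j = if ⌊ i F.≟ j ⌋ then 0 else 1
        regroup : ∀ a b d x y z → a + (b + (d + 0)) + (x + y + z) ≡ (a + x) + (b + y) + (d + z)
        regroup a b d x y z rewrite +-identityʳ d | sym (+-assoc a b d) | +-interchange (a + b) d (x + y) z | +-interchange a b x y = refl
        one : ∀ {a b q r} (en : Enum (λ v → has v a ∧ has v b) side) (t : Tri a b q) (s : Tri a b r) →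
          (w ∋ q → q ≡ r) → w ∋ r → off (rk en t) (rk en s) + on w q ≡ 1
        one {q = q} en t s uniq wr with rk en t F.≟ rk en s | has w q in e
        ... | yes h | true  = refl
        ... | no  h | false = refl
        ... | yes h | false with () ← trans (sym e) (trans (cong (has w) (rk-inj en t s h)) wr)
        ... | no  h | true  = ⊥-elim (h (rk-cong en t s (uniq refl)))

    hamming : HammingColouring c
    hamming with occ O
    ... | v , _ with others v (∃-holds (π v) 𝟎)
    ...   | _ , _ , t , _ = 3 , side , m≤n+m′ , mk⤖ (to-inj , to-surj) , dist , dist-inj , to-dist
      where
      open Coordinates t
      m≤n+m′ : 2 ≤ side
      m≤n+m′ = ≤-trans (m≤n+m 2 (p A A A)) (≤-reflexive (sym (+-assoc (p A A A) 1 1)))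

  classify : JohnsonColouring c ⊎ HammingColouring c
  classify with μ ≟ 4
  ... | yes e = inj₁ (johnson e)
  ... | no ne = inj₂ (Grid.hamming ne)

-- Reduction to the heavy colour

exchange : Fin 4 → Fin 4 → Fin 4 → Fin 4
exchange i j l = if l == i then j else if l == j then i else l

exchange-left : ∀ i j → exchange i j i ≡ j
exchange-left i j rewrite ==-refl i = refl

exchange-fix : ∀ i j l → ¬ l ≡ i → ¬ l ≡ j → exchange i j l ≡ l
exchange-fix i j l a b rewrite ≢⇒== l i a | ≢⇒== l j b = refl

exchange-invol : ∀ i j l → exchange i j (exchange i j l) ≡ l
exchange-invol i j l with l == i in p
... | true with j == i in q
...   | true  = trans (==⇒≡ j i q) (sym (==⇒≡ l i p))
...   | false rewrite ==-refl j = sym (==⇒≡ l i p)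
exchange-invol i j l | false with l == j in q
...   | true rewrite ==-refl i = sym (==⇒≡ l j q)
...   | false rewrite p | q = refl

module Relabel {n : ℕ} (X : Scheme n) (ρ σ : Fin 4 → Fin 4) (ρσ : ∀ i → ρ (σ i) ≡ i) (σρ : ∀ i → σ (ρ i) ≡ i) where
  open Scheme X

  ==-ρ : ∀ x i → (ρ x == i) ≡ (x == σ i)
  ==-ρ x i with ρ x == i in p | x == σ i in q
  ... | true  | true  = refl
  ... | false | false = refl
  ... | true  | false = ⊥-elim (==⇒≢ x (σ i) q (trans (sym (σρ x)) (cong σ (==⇒≡ (ρ x) i p))))
  ... | false | true  = ⊥-elim (==⇒≢ (ρ x) i p (trans (cong ρ (==⇒≡ x (σ i) q)) (ρσ i)))

  ρ-inj : ∀ {x y} → ρ x ≡ ρ y → x ≡ y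
  ρ-inj {x} {y} e = trans (sym (σρ x)) (trans (cong σ e) (σρ y))

  relabelled : Scheme n
  relabelled = record
    { c    = λ u v → ρ (c u v)
    ; o    = ρ o
    ; st   = λ i → ρ (st (σ i))
    ; p    = λ i j t → p (σ i) (σ j) (σ t)
    ; occ  = λ i → let (u , v , e) = occ (σ i) in u , v , trans (cong ρ e) (ρσ i)
    ; loop = λ u → cong ρ (loop u)
    ; diag = λ u v e → diag u v (ρ-inj e)
    ; conv = λ u v → cong ρ (trans (conv u v) (cong st (sym (σρ (c u v)))))
    ; coh  = λ i j u v → trans (#-cong (λ w → cong₂ _∧_ (==-ρ (c u w) i) (==-ρ (c v w) j)))
                          (trans (coh (σ i) (σ j) u v) (cong (p (σ i) (σ j)) (sym (σρ (c u v)))))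
    ; conn = λ i i≢o u v → Star.map (λ e → trans (cong ρ e) (ρσ i))
                             (conn (σ i) (λ e → i≢o (trans (sym (ρσ i)) (cong ρ e))) u v)
    }

  k-relabelled : ∀ i → Basic.k relabelled i ≡ Basic.k X (σ i)
  k-relabelled i with occ o
  ... | u , _ = trans (sym (Basic.k-# relabelled i u)) (trans (#-cong (λ w → ==-ρ (c u w) i)) (Basic.k-# X (σ i) u))

  johnson-back : JohnsonColouring (Scheme.c relabelled) → JohnsonColouring c
  johnson-back (m , d , a , b , f , g , inj , h) = m , d , a , b , f , g ∘ ρ , (λ e → ρ-inj (inj e)) , h

  hamming-back : HammingColouring (Scheme.c relabelled) → HammingColouring c
  hamming-back (d , m , a , f , g , inj , h) = d , m , a , f , g ∘ ρ , (λ e → ρ-inj (inj e)) , h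

JohnsonOrHamming : ∀ {n} → Scheme n → Set
JohnsonOrHamming X = JohnsonColouring (Scheme.c X) ⊎ HammingColouring (Scheme.c X)

st-identity : ∀ {n} (E : Setting n) → Scheme.st (Setting.X E) A ≡ A → ∀ i → Scheme.st (Setting.X E) i ≡ i
st-identity E stA = go
  where
  open Sparse E
  go : ∀ i → st i ≡ i
  go O = st-O
  go A = stA
  go D = st-D
  go B with st B in e | light-st B
  ... | B | _ = refl
  ... | A | _ with () ← trans (sym (st-st B)) (trans (cong st e) stA)
  go B | O | ()
  go B | D | ()

thin-case : ∀ {n} (E : Setting n) → (∀ i → Scheme.st (Setting.X E) i ≡ i) →
  200 * Basic.k (Setting.X E) A ≤ Sparse.K E → JohnsonOrHamming (Setting.X E)
thin-case E st-id thin with 5 * Sparse.cc E B ≤? 2 * Sparse.K E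
... | yes narrow = Isomorphisms.classify (Setting.X E) (Setting.o≡O E) st-id (PlaneTriples.triples E st-id thin narrow)
... | no wide = ⊥-elim (Thin.Two.impossible E st-id thin (subst (_≤ 5 * Sparse.cc E B) (+-comm 1 (2 * Sparse.K E)) (≰⇒> wide)))

module SwapAB {n : ℕ} (E : Setting n) where
  open Relabel (Setting.X E) (exchange A B) (exchange A B) (exchange-invol A B) (exchange-invol A B) public

  swapped : Setting n
  swapped = record
    { X = relabelled ; o≡O = cong (exchange A B) (Setting.o≡O E) ; f = Setting.f E
    ; f-col = λ u v → cong (exchange A B) (Setting.f-col E u v)
    ; u₀ = Setting.u₀ E ; u₀-moved = Setting.u₀-moved E ; N = Setting.N E ; N-big = Setting.N-big E ; few = Setting.few E
    ; heavy-D = subst (λ z → n ≤ z + 6 * Moving.s (Setting.X E) (Setting.f E) (Setting.f-col E)) (sym (k-relabelled D)) (Setting.heavy-D E) }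

  K-swapped : Sparse.K swapped ≡ Sparse.K E
  K-swapped = trans (Sparse.K≡ swapped) (trans (cong₂ _+_ (k-relabelled A) (k-relabelled B))
    (trans (+-comm (Basic.k (Setting.X E) B) _) (sym (Sparse.K≡ E))))

symmetric-case : ∀ {n} (E : Setting n) → (∀ i → Scheme.st (Setting.X E) i ≡ i) → JohnsonOrHamming (Setting.X E)
symmetric-case E st-id with 200 * Basic.k (Setting.X E) A ≤? Sparse.K E | 200 * Basic.k (Setting.X E) B ≤? Sparse.K E
... | yes a | _ = thin-case E st-id a
... | no _ | yes b = back (thin-case swapped st-id′ (subst₂ (λ x y → 200 * x ≤ y) (sym (k-relabelled A)) (sym K-swapped) b))
  where
  open SwapAB E
  st-id′ : ∀ i → exchange A B (Scheme.st (Setting.X E) (exchange A B i)) ≡ i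
  st-id′ i = trans (cong (exchange A B) (st-id (exchange A B i))) (exchange-invol A B i)
  back : JohnsonOrHamming relabelled → JohnsonOrHamming (Setting.X E)
  back (inj₁ j) = inj₁ (johnson-back j)
  back (inj₂ h) = inj₂ (hamming-back h)
... | no a | no b = ⊥-elim (Balanced.impossible E st-id (above (Basic.k (Setting.X E) A) a) (above (Basic.k (Setting.X E) B) b))
  where
  above : ∀ x → ¬ 200 * x ≤ Sparse.K E → Sparse.K E + 1 ≤ 200 * x
  above x h = subst (_≤ 200 * x) (+-comm 1 (Sparse.K E)) (≰⇒> h)

setting-case : ∀ {n} (E : Setting n) → JohnsonOrHamming (Setting.X E)
setting-case E = by-cases (Scheme.st (Setting.X E) A) refl
  where
  open Sparse E using (light-st)
  by-cases : ∀ i → Scheme.st (Setting.X E) A ≡ i → JohnsonOrHamming (Setting.X E)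
  by-cases A e = symmetric-case E (st-identity E e)
  by-cases B e = ⊥-elim (Directed.impossible E e)
  by-cases O e with () ← trans (sym (light-st A)) (cong light e)
  by-cases D e with () ← trans (sym (light-st A)) (cong light e)

few-moved : ∀ {n} (X : Scheme n) (f : Fin n → Fin n) (f-col : ∀ u v → Scheme.c X (f u) (f v) ≡ Scheme.c X u v) →
  ∀ u₀ → ¬ f u₀ ≡ u₀ → ∀ N → 100000000000000000 ≤ N → N * # (λ u → not (f u == u)) + 1 ≤ n → JohnsonOrHamming X
few-moved {n} X f f-col u₀ u₀-moved N N-big few = dispatch heavy
  where
  open Scheme X using (o)
  open Moving X f f-col
  open Few u₀ u₀-moved N N-big few using (heavy)
  dispatch : ∃[ d ] (¬ d ≡ o × n ≤ Basic.k X d + 6 * s) → JohnsonOrHamming X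
  dispatch (d , d≢o , heavy-d) = back (setting-case E)
    where
    -- The heavy colour after the diagonal has been moved to `O`. It differs from `O`, so the second
    -- exchange brings it to `D` and leaves the diagonal in place.
    d′ : Fin 4
    d′ = exchange o O d
    O≢d′ : ¬ O ≡ d′
    O≢d′ e = d≢o (trans (sym (exchange-invol o O d)) (trans (cong (exchange o O) (sym e)) (trans (cong (exchange o O) (sym (exchange-left o O))) (exchange-invol o O o))))
    ρ σ : Fin 4 → Fin 4
    ρ i = exchange d′ D (exchange o O i)
    σ i = exchange o O (exchange d′ D i)
    open Relabel X ρ σ
      (λ i → trans (cong (exchange d′ D) (exchange-invol o O (exchange d′ D i))) (exchange-invol d′ D i))
      (λ i → trans (cong (exchange o O) (exchange-invol d′ D (exchange o O i))) (exchange-invol o O i))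
    ρo≡O : ρ o ≡ O
    ρo≡O = trans (cong (exchange d′ D) (exchange-left o O)) (exchange-fix d′ D O O≢d′ O≢D)
    σD≡d : σ D ≡ d
    σD≡d = trans (cong (exchange o O) (trans (cong (exchange d′ D) (sym (exchange-left d′ D))) (exchange-invol d′ D d′))) (exchange-invol o O d)
    E : Setting n
    E = record
      { X = relabelled ; o≡O = ρo≡O ; f = f ; f-col = λ u v → cong ρ (f-col u v) ; u₀ = u₀ ; u₀-moved = u₀-moved
      ; N = N ; N-big = N-big ; few = few
      ; heavy-D = subst (λ z → n ≤ z + 6 * s) (sym (trans (k-relabelled D) (cong (Basic.k X) σD≡d))) heavy-d }
    back : JohnsonOrHamming relabelled → JohnsonOrHamming X
    back (inj₁ j) = inj₁ (johnson-back j)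
    back (inj₂ h) = inj₂ (hamming-back h)

-- From primitive coherent configurations to the dichotomy

⌊≟⌋ : ∀ {n} (i j : Fin n) → ⌊ i F.≟ j ⌋ ≡ (i == j)
⌊≟⌋ i j with i F.≟ j
... | yes refl = sym (==-refl i)
... | no ne    = sym (≢⇒== i j ne)

module FromConfiguration {n : ℕ} (Y : Configuration n 4) (prim : IsPrimitive Y) where
  open Configuration Y

  private
    star : Fin 4 → Fin 4
    star i = proj₁ (converse i)

    conv′ : ∀ u v → c v u ≡ star (c u v)
    conv′ u v = proj₂ (converse (c u v)) u v refl

    star-star : ∀ i → star (star i) ≡ i
    star-star i with surj i
    ... | u , v , refl = trans (cong star (sym (conv′ u v))) (sym (conv′ v u))

    base : Fin n
    base = proj₁ (surj zero)

    ==-star : ∀ v w j → (c v w == j) ≡ (c w v == star j)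
    ==-star v w j with c v w == j in e | c w v == star j in e′
    ... | true  | true  = refl
    ... | false | false = refl
    ... | true  | false = ⊥-elim (==⇒≢ _ _ e′ (trans (conv′ v w) (cong star (==⇒≡ _ _ e))))
    ... | false | true  = ⊥-elim (==⇒≢ _ _ e (trans (conv′ w v) (trans (cong star (==⇒≡ _ _ e′)) (star-star j))))

    diag′ : ∀ u v → c u v ≡ c base base → u ≡ v
    diag′ u v e with u F.≟ v
    ... | yes q = q
    ... | no ne = ⊥-elim (diagSep base u v ne (sym e))

  scheme : Scheme n
  scheme = record
    { c = c ; o = c base base ; st = star ; p = λ i j t → proj₁ (proj₁ prim) i (star j) t
    ; occ = surj ; loop = λ u → proj₁ (proj₂ prim) u base ; diag = diag′ ; conv = conv′
    -- Coherence counts by `c w v` while the scheme reads the second colour from `v`, hence the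
    -- converse of `j`.
    ; coh = λ i j u v → trans (#-cong (λ w → cong₂ _∧_ (sym (⌊≟⌋ (c u w) i)) (trans (==-star v w j) (sym (⌊≟⌋ (c w v) (star j))))))
        (trans (sym (count≡# (λ w → ⌊ c u w F.≟ i ⌋ ∧ ⌊ c w v F.≟ star j ⌋))) (proj₂ (proj₁ prim) i (star j) u v))
    ; conn = λ i i≢o → proj₂ (proj₂ prim) i (λ u e → i≢o (trans (sym e) (proj₁ (proj₂ prim) u base))) }

  -- Stated for plain maps, which are finitely many and can be searched, so the alternative is
  -- decidable. Preserving colours already makes such a map injective.
  Fixes : ℕ → (Fin n → Fin n) → Set
  Fixes N f = (∀ u v → c (f u) (f v) ≡ c u v) × (∃[ u ] ¬ f u ≡ u) × N * # (λ u → not (f u == u)) + 1 ≤ n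

  fixes? : ∀ N f → Dec (Fixes N f)
  fixes? N f = FP.all? (λ u → FP.all? (λ v → c (f u) (f v) F.≟ c u v)) ×-dec
    (FP.any? (λ u → ¬? (f u F.≟ u)) ×-dec (N * # (λ u → not (f u == u)) + 1 ≤? n))

  fixes-cong : ∀ {N f g} → (∀ u → f u ≡ g u) → Fixes N f → Fixes N g
  fixes-cong {N} {f} {g} h (a , (u , b) , d) =
    (λ u v → trans (cong₂ c (sym (h u)) (sym (h v))) (a u v)) , (u , λ e → b (trans (h u) e)) ,
    subst (λ z → N * z + 1 ≤ n) (#-cong (λ u → cong (λ x → not (x == u)) (h u))) d

  dichotomy : ∀ N → 100000000000000000 ≤ N →
    (∀ mot → IsMotion Y mot → 1 * n ≤ N * mot) ⊎ (IsJohnson Y ⊎ IsHamming Y)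
  dichotomy N N-big with FP.any? (λ i → fixes? N (F.finToFun {n} {n} i))
  ... | yes (i , a , (u , b) , d) = inj₂ (few-moved scheme (F.finToFun {n} {n} i) a u b N N-big d)
  ... | no none = inj₁ bound
    where
    bound : ∀ mot → IsMotion Y mot → 1 * n ≤ N * mot
    bound mot (inj₁ (_ , refl)) = *-monoˡ-≤ n (≤-trans (s≤s z≤n) N-big)
    bound mot (inj₂ ((σ , aut , (u , b) , refl) , _)) with 1 * n ≤? N * moved Y σ
    ... | yes h = h
    ... | no ¬h = ⊥-elim (none (F.funToFin (σ ⟨$⟩ʳ_) , fixes-cong {N} (λ u → sym (FP.finToFun-funToFin (σ ⟨$⟩ʳ_) u))
        (aut , (u , b) , subst₂ (λ x y → N * x + 1 ≤ y)
          (trans (count≡# (λ u → not ⌊ σ ⟨$⟩ʳ u F.≟ u ⌋)) (#-cong (λ u → cong not (⌊≟⌋ (σ ⟨$⟩ʳ u) u)))) (+-identityʳ n)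
          (subst (_≤ 1 * n) (+-comm 1 _) (≰⇒> ¬h)))))

theorem1p4 : ∃[ a ] ∃[ b ] (0 < a × 0 < b ×
    (∀ (n : ℕ) (X : Configuration n 4) → IsPrimitive X →
    (∀ (mot : ℕ) → IsMotion X mot → a * n ≤ b * mot)
    ⊎ IsJohnson X ⊎ IsHamming X))
theorem1p4 = 1 , 100000000000000000 , s≤s z≤n , s≤s z≤n ,
  λ n X prim → FromConfiguration.dichotomy X prim 100000000000000000 ≤-refl
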